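{- Let $\mathcal{P}=(\mathcal{P}_1,\mathcal{P}_2,\dots)$ be an index-invariant distribution property. Suppose that for every $\epsilon'\in(0,1)$ there are integers $s(\epsilon'),q(\epsilon')$ (not depending on $n$) such that $\mathcal{P}$ admits an $\epsilon'$-tester in the Huge Object model using $s(\epsilon')$ samples and $q(\epsilon')$ queries. Then there exist an absolute constant $c>0$ and a polynomial $p$ such that for every $\epsilon\in(0,1)$, writing $s=s(c\epsilon)$ and $q=q(c\epsilon)$, and for every $n\ge 2^{p(2^{q},s,1/\epsilon)}$, there is a randomized algorithm that, given Huge Object oracle access to an unknown distribution $\mu$ over $\{0,1\}^n$, makes at most $\exp\left(\exp\left(2^{q}\cdot p(s,q,1/\epsilon)\right)\right)$ queries and outputs a value $\widetilde{d}$ such that with probability at least $2/3$, $|\widetilde{d}-d_{EM}(\mu,\mathcal{P})|\le\epsilon$.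
   Context: For $x,y\in\{0,1\}^n$, $d_H(x,y)=\frac1n|\{i:x_i\ne y_i\}|$ is the normalized Hamming distance. A transfer distribution between distributions $\mu,\tau$ is a distribution $T$ on pairs whose first marginal is $\mu$ and second marginal is $\tau$. The Earth Mover distance is $d_{EM}(\mu,\tau)=\min_T \mathbb{E}_{(x,y)\sim T}[d_H(x,y)]$ over transfer distributions $T$. A distribution property is a sequence $\mathcal{P}_1,\mathcal{P}_2,\dots$ where $\mathcal{P}_n$ is a compact set of distributions over $\{0,1\}^n$; $d_{EM}(\mu,\mathcal{P})=\min_{\tau\in\mathcal{P}_n}d_{EM}(\mu,\tau)$. $\mathcal P$ is index-invariant if for every permutation $\pi$ of $[n]$, $\{\mu_\pi:\mu\in\mathcal{P}_n\}=\mathcal{P}_n$, where $\mu_\pi(x_{\pi(1)},\dots,x_{\pi(n)})=\mu(x_1,\dots,x_n)$. Huge Object oracle: the algorithm may at any time request a fresh independent sample $x\sim\mu$ (receiving no bits of it), or query a coordinate $j\in[n]$ of a previously obtained sample, receiving its bit; complexity counts the queries. An $\epsilon'$-tester accepts with probability at least $2/3$ every $\mu\in\mathcal{P}_n$ and rejects with probability at least $2/3$ every $\mu$ with $d_{EM}(\mu,\mathcal{P})>\epsilon'$. -}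

module Defs where

open import Algebra.Bundles using (CommutativeRing; Semiring)
open import Data.Bool.Base using (Bool; true; false; not; if_then_else_)
open import Data.Bool.Properties using () renaming (_≟_ to _≟ᵇ_)
open import Data.Fin.Base using (Fin)
open import Data.Fin.Permutation using (Permutation′; _⟨$⟩ʳ_)
open import Data.List.Base as List using (List; []; _∷_; _++_; upTo; cartesianProduct)
open import Data.List.Relation.Unary.Any using (Any)
open import Data.Nat.Base as ℕ using (ℕ; zero; suc; NonZero; _!)
open import Data.Product.Base using (Σ; ∃; _×_; _,_)
open import Data.Vec.Base as Vec using (Vec; []; _∷_; lookup; tabulate; zipWith)
open import Function.Base using (id)
open import Function.Bundles using (_⇔_)
open import Level using (0ℓ)
open import Relation.Binary.Bundles using (DecTotalOrder)
open import Relation.Binary.Core using (Rel)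
open import Relation.Binary.Structures using (IsDecTotalOrder)
open import Relation.Nullary using (¬_)
open import Relation.Nullary.Decidable using (does)
open import Relation.Unary using (Pred; _∈_)

-- The axioms characterising ℝ classically (up to unique isomorphism).
-- As usual for setoids, equality of reals is _≈_. The value of x ⁻¹ is
-- unconstrained when x ≈ 0#.
record CompleteOrderedField : Set₁ where
  field
    commutativeRing : CommutativeRing 0ℓ 0ℓ

  open CommutativeRing commutativeRing public

  infix 4 _≤_
  infix 8 _⁻¹

  field
    _≤_             : Rel Carrier 0ℓ
    isDecTotalOrder : IsDecTotalOrder _≈_ _≤_
    _⁻¹             : Carrier → Carrier
    0≉1             : ¬ 0# ≈ 1#
    *-inverseʳ      : ∀ x → ¬ x ≈ 0# → x * x ⁻¹ ≈ 1#
    +-monoʳ-≤       : ∀ x {y z} → y ≤ z → x + y ≤ x + z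
    *-nonNeg        : ∀ {x y} → 0# ≤ x → 0# ≤ y → 0# ≤ x * y
    leastUpperBound : (S : Pred Carrier 0ℓ) → ∃ S →
                      ∃ (λ b → ∀ x → x ∈ S → x ≤ b) →
                      ∃ λ u → (∀ x → x ∈ S → x ≤ u) ×
                              (∀ b → (∀ x → x ∈ S → x ≤ b) → u ≤ b)

  decTotalOrder : DecTotalOrder 0ℓ 0ℓ 0ℓ
  decTotalOrder = record { isDecTotalOrder = isDecTotalOrder }

  open DecTotalOrder decTotalOrder public using (totalOrder; _≤?_)

Str : ℕ → Set
Str = Vec Bool

strings : ∀ n → List (Str n)
strings zero    = [] ∷ []
strings (suc n) = List.map (false ∷_) (strings n) ++ List.map (true ∷_) (strings n)

mismatches : ∀ {n} → Str n → Str n → ℕ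
mismatches []       []       = 0
mismatches (a ∷ x) (b ∷ y) = (if does (a ≟ᵇ b) then 0 else 1) ℕ.+ mismatches x y

permute : ∀ {n} → Permutation′ n → Str n → Str n
permute π x = tabulate λ i → lookup x (π ⟨$⟩ʳ i)

module HugeObject (R : CompleteOrderedField) where

  open CompleteOrderedField R public using
    (_≈_; _≤_; _≤?_; _+_; _*_; _-_; -_; 0#; 1#; _⁻¹; totalOrder)
    renaming (Carrier to ℝ)
  open import Algebra.Definitions.RawSemiring
    (Semiring.rawSemiring (CompleteOrderedField.semiring R)) public using (_^_)
    renaming (_×_ to _·_)
  open import Algebra.Construct.NaturalChoice.Max totalOrder public using (_⊔_)
  open import Relation.Binary.Construct.NonStrictToStrict _≈_ _≤_ public using (_<_)

  fromℕ : ℕ → ℝ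
  fromℕ n = n · 1#

  2/3 : ℝ
  2/3 = fromℕ 2 * fromℕ 3 ⁻¹

  ∣_∣ : ℝ → ℝ
  ∣ x ∣ = x ⊔ (- x)

  ∑ : {A : Set} → List A → (A → ℝ) → ℝ
  ∑ xs f = List.foldr (λ x acc → f x + acc) 0# xs

  IsLeast : Pred ℝ 0ℓ → ℝ → Set
  IsLeast S m = m ∈ S × (∀ x → x ∈ S → m ≤ x)

  IsLimit : (ℕ → ℝ) → ℝ → Set
  IsLimit a l = ∀ δ → 0# < δ → ∃ λ N → ∀ m → N ℕ.≤ m → ∣ a m - l ∣ < δ

  -- y = exp x, via the power series.
  IsExp : ℝ → ℝ → Set
  IsExp x y = IsLimit (λ m → ∑ (upTo m) λ k → x ^ k * fromℕ (k !) ⁻¹) y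

  -- y = 2 ^ x for a real exponent x, that is, y = exp (x * ln 2).
  IsExp₂ : ℝ → ℝ → Set
  IsExp₂ x y = ∃ λ ln2 → IsExp ln2 (fromℕ 2) × IsExp (x * ln2) y

  -- Polynomials in m variables as lists of monomials
  -- (coefficient , exponents).
  Polynomial : ℕ → Set
  Polynomial m = List (ℝ × Vec ℕ m)

  eval : ∀ {m} → Polynomial m → Vec ℝ m → ℝ
  eval p xs = ∑ p λ (a , es) → a * Vec.foldr _ _*_ 1# (zipWith _^_ xs es)

  -- Distributions on a finite type, given by an enumeration xs of all of its
  -- elements without repetition.
  record Distribution {A : Set} (xs : List A) : Set where
    field
      mass   : A → ℝ
      nonNeg : ∀ x → 0# ≤ mass x
      total  : ∑ xs mass ≈ 1#

  open Distribution public

  Dist : ℕ → Set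
  Dist n = Distribution (strings n)

  hamming : ∀ {n} → Str n → Str n → ℝ
  hamming {n} x y = fromℕ (mismatches x y) * fromℕ n ⁻¹

  record Transfer {n} (μ τ : Dist n) : Set where
    field
      joint     : Distribution (cartesianProduct (strings n) (strings n))
      marginal₁ : ∀ x → ∑ (strings n) (λ y → mass joint (x , y)) ≈ mass μ x
      marginal₂ : ∀ y → ∑ (strings n) (λ x → mass joint (x , y)) ≈ mass τ y

  open Transfer public

  cost : ∀ {n} {μ τ : Dist n} → Transfer μ τ → ℝ
  cost {n} T = ∑ (cartesianProduct (strings n) (strings n)) λ (x , y) →
    mass (joint T) (x , y) * hamming x y

  -- d = d_EM(μ, τ).
  IsEMDistance : ∀ {n} → Dist n → Dist n → ℝ → Set
  IsEMDistance μ τ = IsLeast λ e → Σ (Transfer μ τ) λ T → cost T ≈ e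

  -- d = d_EM(μ, K); no d qualifies when K is empty.
  IsEMDistanceTo : ∀ {n} → Pred (Dist n) 0ℓ → Dist n → ℝ → Set
  IsEMDistanceTo K μ = IsLeast λ e → ∃ λ τ → τ ∈ K × IsEMDistance μ τ e

  -- The Euclidean topology on the simplex of distributions, through
  -- sup-norm balls.
  IsOpen : ∀ {n} → Pred (Dist n) 0ℓ → Set
  IsOpen U = ∀ μ → μ ∈ U → ∃ λ δ → 0# < δ ×
    (∀ ν → (∀ x → ∣ mass ν x - mass μ x ∣ < δ) → ν ∈ U)

  IsCompact : ∀ {n} → Pred (Dist n) 0ℓ → Set₁
  IsCompact {n} K = (I : Set) (U : I → Pred (Dist n) 0ℓ) →
    (∀ i → IsOpen (U i)) →
    (∀ μ → μ ∈ K → ∃ λ i → μ ∈ U i) →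
    ∃ λ (is : List I) → ∀ μ → μ ∈ K → Any (λ i → μ ∈ U i) is

  record Property : Set₁ where
    field
      member   : ∀ n → .{{NonZero n}} → Pred (Dist n) 0ℓ
      compact  : ∀ n → .{{_ : NonZero n}} → IsCompact (member n)
      -- Membership only depends on the masses, as real numbers.
      respects : ∀ n → .{{_ : NonZero n}} → ∀ μ ν →
                 (∀ x → mass μ x ≈ mass ν x) → μ ∈ member n → ν ∈ member n

  open Property public

  -- ν = μ_π; as x ↦ (x_π(1) , … , x_π(n)) is a bijection, this determines ν.
  IsPermuted : ∀ {n} → Permutation′ n → Dist n → Dist n → Set
  IsPermuted π μ ν = ∀ x → mass ν (permute π x) ≈ mass μ x

  IndexInvariant : Property → Set
  IndexInvariant 𝒫 = ∀ n → .{{_ : NonZero n}} → (π : Permutation′ n) → ∀ ν →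
    (∃ λ μ → μ ∈ member 𝒫 n × IsPermuted π μ ν) ⇔ ν ∈ member 𝒫 n

  -- Randomised adaptive algorithms with Huge Object oracle access and outputs
  -- in A, holding k samples so far; sample 0 is the most recent one.
  -- Internal randomness is by independent coins of arbitrary real bias, which
  -- realise every finite mixture of deterministic decision trees.
  data Algorithm (n : ℕ) (A : Set) (k : ℕ) : Set where
    output : A → Algorithm n A k
    coin   : (r : ℝ) → 0# ≤ r → r ≤ 1# →
             Algorithm n A k → Algorithm n A k → Algorithm n A k
    sample : Algorithm n A (suc k) → Algorithm n A k
    query  : (i : Fin k) (j : Fin n) → (Bool → Algorithm n A k) → Algorithm n A k

  -- Worst-case numbers of samples and of queries.
  samples : ∀ {n A k} → Algorithm n A k → ℕ
  samples (output a)       = 0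
  samples (coin r _ _ t u) = samples t ℕ.⊔ samples u
  samples (sample t)       = suc (samples t)
  samples (query i j t)    = samples (t false) ℕ.⊔ samples (t true)

  queries : ∀ {n A k} → Algorithm n A k → ℕ
  queries (output a)       = 0
  queries (coin r _ _ t u) = queries t ℕ.⊔ queries u
  queries (sample t)       = queries t
  queries (query i j t)    = suc (queries (t false) ℕ.⊔ queries (t true))

  -- The probability that the output satisfies E, when the samples obtained
  -- so far are ρ and all further ones are drawn independently from μ.
  probFrom : ∀ {n A k} → Dist n → (A → Bool) → Vec (Str n) k → Algorithm n A k → ℝ
  probFrom μ E ρ (output a)       = if E a then 1# else 0#
  probFrom μ E ρ (coin r _ _ t u) = r * probFrom μ E ρ t + (1# - r) * probFrom μ E ρ u
  probFrom μ E ρ (sample t)       = ∑ (strings _) λ x → mass μ x * probFrom μ E (x ∷ ρ) t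
  probFrom μ E ρ (query i j t)    = probFrom μ E ρ (t (lookup (lookup ρ i) j))

  prob : ∀ {n A} → Dist n → (A → Bool) → Algorithm n A 0 → ℝ
  prob μ E t = probFrom μ E [] t

  -- Output true means accept.
  record IsTester (𝒫 : Property) (ε : ℝ) (n : ℕ) .{{_ : NonZero n}}
                  (t : Algorithm n Bool 0) : Set where
    field
      completeness : ∀ μ → μ ∈ member 𝒫 n → 2/3 ≤ prob μ id t
      soundness    : ∀ μ d → IsEMDistanceTo (member 𝒫 n) μ d → ε < d →
                     2/3 ≤ prob μ not t

  Testable : Property → (s q : ℝ → ℕ) → Set
  Testable 𝒫 s q = ∀ ε → 0# < ε → ε < 1# → ∀ n → .{{_ : NonZero n}} →
    ∃ λ t → IsTester 𝒫 ε n t × samples t ℕ.≤ s ε × queries t ℕ.≤ q ε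

  IsEstimator : Property → ℝ → (n : ℕ) → .{{NonZero n}} → Algorithm n ℝ 0 → Set
  IsEstimator 𝒫 ε n t = ∀ μ d → IsEMDistanceTo (member 𝒫 n) μ d →
    2/3 ≤ prob μ (λ d̃ → does (∣ d̃ - d ∣ ≤? ε)) t

{-# OPTIONS --safe #-}

-- An estimator draws k random anchor rows and columns and records, for m random entries of the sample-by-index bit
-- matrix, the entry together with the anchor values in its row and column. It outputs the distance to the property of
-- any distribution for which this data is typical, so one has to see that two distributions μ and μ′ sharing typical
-- data have distances differing by at most ε.
--
-- Random anchors are weakly regular: by an energy argument (Anchors) the matrix is close in cut norm to its averages
-- over blocks of row and column types, and the data determines the block densities up to a small error. Let T be an
-- optimal transfer from μ to the property. A greedy potential argument (Greedy) approximates the second component of T,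
-- given the first, by a kernel η of complexity about 2^q, with the weight ζ (θ + 𝔼 F 𝔼 G), θ = 2^-q, that a tree with q
-- queries needs (Counting). Since η is much simpler than the anchors are fine, it can be transplanted to μ′ by matching
-- types at random: the lifted distribution is at distance at most d(μ) + ε/4 from μ′ on average, and by Chebyshev's
-- inequality usually. The ε/2-tester, which for an index-invariant property sees essentially independent uniform columns
-- (WithoutReplacement), cannot tell it from the target of T; so it is ε/2-close to the property.
module Submission where

open import Defs
open import Algebra.Bundles using (CommutativeRing; Semiring)
import Algebra.Construct.NaturalChoice.Max as NaturalMax
import Algebra.Construct.NaturalChoice.MaxOp as MaxOp
import Algebra.Properties.CommutativeMonoid.Sum as MonoidSum
import Algebra.Properties.Ring as RingProperties
import Algebra.Properties.Semiring.Mult as MultProperties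
import Algebra.Solver.Ring as RingSolver
open import Algebra.Solver.Ring.AlmostCommutativeRing
  using (AlmostCommutativeRing; fromCommutativeRing; _-Raw-AlmostCommutative⟶_; -raw-almostCommutative⟶)
open import Axiom.ExcludedMiddle using (ExcludedMiddle)
open import Data.Bool.Base using (Bool; true; false; not; if_then_else_; _∧_)
open import Data.Bool.Properties using () renaming (_≟_ to _≟ᵇ_)
open import Data.Empty using (⊥; ⊥-elim)
open import Data.Fin.Base using (Fin; zero; suc; punchOut)
open import Data.Fin.Permutation as Perm using (Permutation′; _⟨$⟩ʳ_; _⟨$⟩ˡ_; permutation; transpose; flip)
open import Data.Fin.Properties using (injective⇒≤; punchOut-injective) renaming (_≟_ to _≟ᶠ_)
open import Data.Integer.Base as ℤ using (ℤ; +_; -[1+_])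
import Data.Integer.Properties as ℤₚ
open import Data.List.Base as List using (List; []; _∷_; _++_; upTo; cartesianProduct)
open import Data.List.Membership.Propositional using () renaming (_∈_ to _∈ˡ_)
open import Data.List.Membership.Propositional.Properties using (∈-map⁺; ∈-++⁺ˡ; ∈-++⁺ʳ; ∈-cartesianProduct⁺)
open import Data.List.Relation.Unary.All as All using (All)
open import Data.List.Relation.Unary.Any using (Any; here; there)
open import Data.Maybe.Base using (Maybe; just; nothing)
open import Data.Nat.Base as ℕ using (ℕ; NonZero; zero; suc; _!; s≤s; z≤n)
import Data.Nat.Properties as ℕₚ
import Data.Nat.Solver
open import Data.Product.Base using (Σ; ∃; _×_; _,_; proj₁; proj₂)
open import Data.Sum.Base using (_⊎_; inj₁; inj₂)
open import Data.Unit.Base using (⊤; tt)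
open import Data.Vec.Base as Vec using (Vec; []; _∷_; lookup; tabulate; _[_]≔_; replicate)
open import Data.Vec.Properties using
  (lookup∘update; lookup∘update′; []≔-idempotent; lookup-replicate; lookup∘tabulate; tabulate∘lookup; tabulate-cong;
   lookup-map; lookup-zip; map-∘; map-proj₁-zip)
open import Function.Base using (id; _∘_)
open import Function.Bundles using (Equivalence)
open import Level using (0ℓ)
open import Relation.Binary.Bundles using (DecTotalOrder)
open import Relation.Binary.PropositionalEquality as ≡ using (_≡_; refl)
import Relation.Binary.Reasoning.PartialOrder as PosetReasoning
import Relation.Binary.Reasoning.Setoid as SetoidReasoning
open import Relation.Nullary using (¬_; Dec; yes; no)
open import Relation.Nullary.Decidable using (does)
open import Relation.Unary using (Pred)

-- The bound on the queries gets its form from a chain of parameters. A tree with q queries has 2^q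
-- leaves, so one uniform cut-norm error would have to be about 2^-q, and a greedy argument would
-- take about 4^q steps. Charging ζ times (θ + mass of the weight) is cheaper: the masses at the
-- leaves add up, and only the 2^q terms ζθ pile up. A greedy step then lowers the squared error by
-- 2ζ²θ, so that K of order 2^q times a polynomial suffices. Each step multiplies by at most four
-- the factor by which `η` can amplify a cut norm. The regularity error must therefore be below
-- 4^-K, the number k of anchors is its inverse to the fourth power, and learning the law of the
-- types takes about 4^k observations. Hence two exponentials above K. The obstacle is that
-- regularity says nothing about single bits. The kernel therefore takes the true bit of the first
-- string as an argument, and this bit is replaced by a block density only inside averages against
-- product weights. No optimal transfer is ever estimated: it exists only in the analysis.

module Proof (em : ExcludedMiddle 0ℓ) (R : CompleteOrderedField) where

  open HugeObject R
  open CompleteOrderedField R using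
    (commutativeRing; semiring; 0≉1; *-inverseʳ; +-monoʳ-≤; *-nonNeg; leastUpperBound;
     +-cong; +-congˡ; +-congʳ; *-cong; *-congˡ; *-congʳ; -‿cong; +-assoc; +-comm; *-assoc; *-comm;
     +-identityˡ; +-identityʳ; *-identityˡ; *-identityʳ; zeroˡ; zeroʳ; distribˡ; distribʳ;
     -‿inverseˡ; -‿inverseʳ; decTotalOrder)
    renaming (refl to ≈-refl; sym to ≈-sym; trans to ≈-trans; reflexive to ≈-reflexive; setoid to ℝ-setoid)
  open RingProperties (CommutativeRing.ring commutativeRing) using
    (-0#≈0#; -‿distribˡ-*; -‿distribʳ-*; -‿+-comm; -‿involutive)
  open MultProperties semiring using (×-homo-+; ×1-homo-*)
  open DecTotalOrder decTotalOrder using (≤-respˡ-≈; ≤-respʳ-≈)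
    renaming (refl to ≤-refl; trans to ≤-trans; reflexive to ≤-reflexive; antisym to ≤-antisym; total to ≤-total)

  -- Integer coefficients for the ring solver

  fromℤ : ℤ → ℝ
  fromℤ (+ 0)            = 0#
  -- `fromℕ 1` unfolds to `1# + 0#`; the separate clause makes the solver's literal 1 definitionally
  -- `1#`.
  fromℤ (+ 1)            = 1#
  fromℤ (+ (suc (suc n))) = fromℕ (suc (suc n))
  fromℤ -[1+ n ]         = - fromℕ (suc n)

  fromℤ-+ : ∀ n → fromℤ (+ n) ≈ fromℕ n
  fromℤ-+ 0             = ≈-refl
  fromℤ-+ 1             = ≈-sym (+-identityʳ 1#)
  fromℤ-+ (suc (suc n)) = ≈-refl

  module ≈R = SetoidReasoning ℝ-setoid

  private
    almost : AlmostCommutativeRing 0ℓ 0ℓ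
    almost = fromCommutativeRing commutativeRing

    -- Without a zero test the solver still proves identities that need no cancellation of constants;
    -- this suffices to set up the solver with integer coefficients.
    module Weak = RingSolver (AlmostCommutativeRing.rawRing almost) almost (-raw-almostCommutative⟶ almost) (λ _ _ → nothing)

    fromℤ-neg : ∀ n → fromℤ (ℤ.- (+ n)) ≈ - fromℕ n
    fromℤ-neg 0       = ≈-sym -0#≈0#
    fromℤ-neg (suc n) = ≈-refl

    cancel : ∀ a b c → (c + a) - (c + b) ≈ a - b
    cancel a b c = begin
      (c + a) + - (c + b)     ≈⟨ +-congˡ (-‿+-comm c b) ⟨
      (c + a) + (- c + - b)   ≈⟨ Weak.solve 4 (λ a b c d → (c Weak.:+ a) Weak.:+ (d Weak.:+ b) Weak.:= (c Weak.:+ d) Weak.:+ (a Weak.:+ b)) ≈-refl a (- b) c (- c) ⟩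
      (c + - c) + (a + - b)   ≈⟨ +-congʳ (-‿inverseʳ c) ⟩
      0# + (a + - b)          ≈⟨ +-identityˡ _ ⟩
      a + - b                 ∎ where open ≈R

    fromℤ-⊖ : ∀ m n → fromℤ (m ℤ.⊖ n) ≈ fromℕ m - fromℕ n
    fromℤ-⊖ m 0 = ≈-trans (fromℤ-+ m) (≈-sym (≈-trans (+-congˡ -0#≈0#) (+-identityʳ _)))
    fromℤ-⊖ 0 (suc n) = ≈-sym (+-identityˡ _)
    fromℤ-⊖ (suc m) (suc n) rewrite ℤₚ.[1+m]⊖[1+n]≡m⊖n m n =
      ≈-trans (fromℤ-⊖ m n) (≈-sym (cancel _ _ 1#))

    fromℤ-homo-+ : ∀ i j → fromℤ (i ℤ.+ j) ≈ fromℤ i + fromℤ j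
    fromℤ-homo-+ (+ m) (+ n) = ≈-trans (fromℤ-+ (m ℕ.+ n)) (≈-trans (×-homo-+ 1# m n) (≈-sym (+-cong (fromℤ-+ m) (fromℤ-+ n))))
    fromℤ-homo-+ (+ m) -[1+ n ] = ≈-trans (fromℤ-⊖ m (suc n)) (+-congʳ (≈-sym (fromℤ-+ m)))
    fromℤ-homo-+ -[1+ m ] (+ n) = ≈-trans (fromℤ-⊖ n (suc m)) (≈-trans (+-congʳ (≈-sym (fromℤ-+ n))) (+-comm _ _))
    fromℤ-homo-+ -[1+ m ] -[1+ n ] =
      ≈-trans (-‿cong (≈-trans (≈-reflexive (≡.cong (λ k → fromℕ (suc k)) (≡.sym (ℕₚ.+-suc m n)))) (×-homo-+ 1# (suc m) (suc n))))
              (≈-sym (-‿+-comm _ _))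

    fromℤ-homo-* : ∀ i j → fromℤ (i ℤ.* j) ≈ fromℤ i * fromℤ j
    fromℤ-homo-* (+ m) (+ n) rewrite ℤₚ.+◃n≡+n (m ℕ.* n) =
      ≈-trans (fromℤ-+ (m ℕ.* n)) (≈-trans (×1-homo-* m n) (≈-sym (*-cong (fromℤ-+ m) (fromℤ-+ n))))
    fromℤ-homo-* (+ m) -[1+ n ] rewrite ℤₚ.-◃n≡-n (m ℕ.* suc n) =
      ≈-trans (fromℤ-neg (m ℕ.* suc n)) (≈-trans (-‿cong (×1-homo-* m (suc n)))
        (≈-trans (-‿distribʳ-* _ _) (*-congʳ (≈-sym (fromℤ-+ m)))))
    fromℤ-homo-* -[1+ m ] (+ n) rewrite ℤₚ.-◃n≡-n (suc m ℕ.* n) =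
      ≈-trans (fromℤ-neg (suc m ℕ.* n)) (≈-trans (-‿cong (×1-homo-* (suc m) n))
        (≈-trans (-‿distribˡ-* _ _) (*-congˡ (≈-sym (fromℤ-+ n)))))
    fromℤ-homo-* -[1+ m ] -[1+ n ] rewrite ℤₚ.+◃n≡+n (suc m ℕ.* suc n) =
      ≈-trans (fromℤ-+ (suc m ℕ.* suc n)) (≈-trans (×1-homo-* (suc m) (suc n))
        (≈-trans (≈-sym (-‿involutive _)) (≈-trans (-‿cong (-‿distribˡ-* _ _)) (-‿distribʳ-* _ _))))

    fromℤ-homo-neg : ∀ i → fromℤ (ℤ.- i) ≈ - fromℤ i
    fromℤ-homo-neg (+ n) = ≈-trans (fromℤ-neg n) (-‿cong (≈-sym (fromℤ-+ n)))
    fromℤ-homo-neg -[1+ n ] = ≈-trans (fromℤ-+ (suc n)) (≈-sym (-‿involutive _))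

    morphism : CommutativeRing.rawRing ℤₚ.+-*-commutativeRing -Raw-AlmostCommutative⟶ almost
    morphism = record
      { ⟦_⟧ = fromℤ ; +-homo = fromℤ-homo-+ ; *-homo = fromℤ-homo-* ; -‿homo = fromℤ-homo-neg
      ; 0-homo = ≈-refl ; 1-homo = ≈-refl }

    coeff≟ : ∀ i j → Maybe (fromℤ i ≈ fromℤ j)
    coeff≟ i j with i ℤₚ.≟ j
    ... | yes ≡.refl = just ≈-refl
    ... | no _       = nothing

  module Solver = RingSolver (CommutativeRing.rawRing ℤₚ.+-*-commutativeRing) almost morphism coeff≟
  open Solver public using (solve; _:=_; _:+_; _:*_; _:-_; :-_; con)

  open MaxOp (NaturalMax.maxOperator totalOrder) using (x≤x⊔y; x≤y⊔x; ⊔-lub)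

  module ≤R = PosetReasoning (DecTotalOrder.poset decTotalOrder)

  -- Inequalities, absolute values and the unit interval

  infixl 6 _⊕_
  infixl 7 _⊛_

  ≤⇒0≤ : ∀ {a b} → a ≤ b → 0# ≤ b - a
  ≤⇒0≤ {a} {b} p = ≤-respˡ-≈ (-‿inverseˡ a) (≤-respʳ-≈ (+-comm _ _) (+-monoʳ-≤ (- a) p))

  -- Linear arithmetic is done this way throughout: `_⊕_` and `_⊛_` build a certificate `x ≤ y`, and
  -- the ring solver checks that it has the same slack as the goal.
  lin : ∀ {a b x y} → x ≤ y → y - x ≈ b - a → a ≤ b
  lin {a} {b} p e = ≤-respˡ-≈ (+-identityʳ a) (≤-respʳ-≈ (solve 2 (λ a b → a :+ (b :- a) := b) ≈-refl a b)
    (+-monoʳ-≤ a (≤-respʳ-≈ e (≤⇒0≤ p))))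

  _⊕_ : ∀ {a b c d} → a ≤ b → c ≤ d → a + c ≤ b + d
  _⊕_ {a} {b} {c} {d} p q = ≤-trans (+-monoʳ-≤ a q) (≤-respˡ-≈ (+-comm _ _) (≤-respʳ-≈ (+-comm _ _) (+-monoʳ-≤ d p)))

  _⊛_ : ∀ {k a b} → 0# ≤ k → a ≤ b → k * a ≤ k * b
  _⊛_ {k} {a} {b} p q = lin (*-nonNeg p (≤⇒0≤ q))
    (solve 3 (λ k a b → k :* (b :- a) :- con (+ 0) := k :* b :- k :* a) ≈-refl k a b)

  0≤⇒≤ : ∀ {a b} → 0# ≤ b - a → a ≤ b
  0≤⇒≤ {a} {b} p = lin p (solve 2 (λ a b → (b :- a) :- con (+ 0) := b :- a) ≈-refl a b)

  neg-mono : ∀ {a b} → a ≤ b → - b ≤ - a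
  neg-mono {a} {b} p = lin p (solve 2 (λ a b → b :- a := :- a :- :- b) ≈-refl a b)

  mul-mono : ∀ {a b c d} → 0# ≤ a → a ≤ b → 0# ≤ d → c ≤ d → a * c ≤ b * d
  mul-mono 0≤a p 0≤d q = ≤-trans (0≤a ⊛ q) (≤-respˡ-≈ (*-comm _ _) (≤-respʳ-≈ (*-comm _ _) (0≤d ⊛ p)))

  0≤-+ : ∀ {a b} → 0# ≤ a → 0# ≤ b → 0# ≤ a + b
  0≤-+ p q = ≤-respˡ-≈ (+-identityˡ 0#) (p ⊕ q)

  0≤-neg : ∀ {a} → a ≤ 0# → 0# ≤ - a
  0≤-neg p = ≤-respˡ-≈ -0#≈0# (neg-mono p)

  0≤x² : ∀ x → 0# ≤ x * x
  0≤x² x with ≤-total 0# x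
  ... | inj₁ p = *-nonNeg p p
  ... | inj₂ p = ≤-respʳ-≈ (solve 1 (λ x → :- x :* :- x := x :* x) ≈-refl x) (*-nonNeg (0≤-neg p) (0≤-neg p))

  0≤1 : 0# ≤ 1#
  0≤1 = ≤-respʳ-≈ (*-identityˡ 1#) (0≤x² 1#)

  0<1 : 0# < 1#
  0<1 = 0≤1 , 0≉1

  ≰⇒< : ∀ {a b} → ¬ a ≤ b → b < a
  ≰⇒< {a} {b} n with ≤-total a b
  ... | inj₁ p = ⊥-elim (n p)
  ... | inj₂ p = p , λ e → n (≤-reflexive (≈-sym e))

  <⇒≰ : ∀ {a b} → a < b → ¬ b ≤ a
  <⇒≰ (p , n) q = n (≤-antisym p q)

  <⇒≤ : ∀ {a b} → a < b → a ≤ b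
  <⇒≤ = proj₁

  ≤-<-trans : ∀ {a b c} → a ≤ b → b < c → a < c
  ≤-<-trans p q = ≰⇒< λ r → <⇒≰ q (≤-trans r p)

  <-≤-trans : ∀ {a b c} → a < b → b ≤ c → a < c
  <-≤-trans p q = ≰⇒< λ r → <⇒≰ p (≤-trans q r)

  ≤-or-< : ∀ a b → a ≤ b ⊎ b < a
  ≤-or-< a b with a ≤? b
  ... | yes p = inj₁ p
  ... | no  n = inj₂ (≰⇒< n)

  fromℕ-+ : ∀ m n → fromℕ (m ℕ.+ n) ≈ fromℕ m + fromℕ n
  fromℕ-+ = ×-homo-+ 1#

  fromℕ-* : ∀ m n → fromℕ (m ℕ.* n) ≈ fromℕ m * fromℕ n
  fromℕ-* = ×1-homo-*

  fromℕ-1 : fromℕ 1 ≈ 1#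
  fromℕ-1 = +-identityʳ 1#

  0≤fromℕ : ∀ n → 0# ≤ fromℕ n
  0≤fromℕ zero    = ≤-refl
  0≤fromℕ (suc n) = 0≤-+ 0≤1 (0≤fromℕ n)

  fromℕ-mono : ∀ {m n} → m ℕ.≤ n → fromℕ m ≤ fromℕ n
  fromℕ-mono {n = n} z≤n = 0≤fromℕ n
  fromℕ-mono (s≤s p)     = ≤-refl ⊕ fromℕ-mono p

  1≤fromℕ : ∀ n → .{{NonZero n}} → 1# ≤ fromℕ n
  1≤fromℕ (suc n) = ≤-respˡ-≈ fromℕ-1 (fromℕ-mono {1} {suc n} (s≤s z≤n))

  0<fromℕ : ∀ n → .{{NonZero n}} → 0# < fromℕ n
  0<fromℕ n = <-≤-trans 0<1 (1≤fromℕ n)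

  <⇒≉0 : ∀ {x} → 0# < x → ¬ x ≈ 0#
  <⇒≉0 (_ , n) e = n (≈-sym e)

  *-inv : ∀ {x} → 0# < x → x * x ⁻¹ ≈ 1#
  *-inv p = *-inverseʳ _ (<⇒≉0 p)

  0<⁻¹ : ∀ {x} → 0# < x → 0# < x ⁻¹
  0<⁻¹ {x} p = ≰⇒< λ q → <⇒≰ 0<1 (≤-respˡ-≈ (*-inv p) (≤-respʳ-≈ (zeroʳ x) (<⇒≤ p ⊛ q)))

  0<-* : ∀ {a b} → 0# < a → 0# < b → 0# < a * b
  0<-* {a} {b} p q = *-nonNeg (<⇒≤ p) (<⇒≤ q) , λ e → <⇒≉0 q (begin
    b              ≈⟨ solve 1 (λ b → b := b :* con (+ 1)) ≈-refl b ⟩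
    b * 1#         ≈⟨ *-congˡ (*-inv p) ⟨
    b * (a * a ⁻¹) ≈⟨ solve 3 (λ a b i → b :* (a :* i) := (a :* b) :* i) ≈-refl a b (a ⁻¹) ⟩
    a * b * a ⁻¹   ≈⟨ *-congʳ e ⟨
    0# * a ⁻¹      ≈⟨ zeroˡ _ ⟩
    0#             ∎)
    where open ≈R

  *-cancelˡ-≤ : ∀ {c a b} → 0# < c → c * a ≤ c * b → a ≤ b
  *-cancelˡ-≤ {c} {a} {b} p q = ≤-respˡ-≈ (e a) (≤-respʳ-≈ (e b) (<⇒≤ (0<⁻¹ p) ⊛ q))
    where
    e : ∀ a → c ⁻¹ * (c * a) ≈ a
    e a = ≈-trans (solve 3 (λ i c a → i :* (c :* a) := (c :* i) :* a) ≈-refl (c ⁻¹) c a)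
            (≈-trans (*-congʳ (*-inv p)) (*-identityˡ a))

  x²≤y²⇒x≤y : ∀ {x y} → 0# ≤ y → x * x ≤ y * y → x ≤ y
  x²≤y²⇒x≤y {x} {y} 0≤y q with ≤-or-< x y
  ... | inj₁ p = p
  ... | inj₂ p = ⊥-elim (<⇒≰ (0<-* 0<x-y 0<x+y) (lin q
      (solve 2 (λ x y → y :* y :- x :* x := con (+ 0) :- (x :- y) :* (x :+ y)) ≈-refl x y)))
    where
    0<x-y : 0# < x - y
    0<x-y = ≰⇒< λ r → <⇒≰ p (lin r (solve 2 (λ x y → con (+ 0) :- (x :- y) := y :- x) ≈-refl x y))
    0<x+y : 0# < x + y
    0<x+y = <-≤-trans (≤-<-trans 0≤y p) (lin 0≤y (solve 2 (λ x y → y :- con (+ 0) := (x :+ y) :- x) ≈-refl x y))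

  -- Otherwise the naturals have a least upper bound u. Since k + 1 is also a natural number, u - 1
  -- is again an upper bound, against the minimality of u.
  archimedean : ∀ x → ∃ λ n → x ≤ fromℕ n
  archimedean x with em {∃ λ n → x ≤ fromℕ n}
  ... | yes p = p
  ... | no  n = ⊥-elim (<⇒≰ {u - 1#} {u}
      (≰⇒< λ r → <⇒≰ 0<1 (lin r (solve 1 (λ u → (u :- con (+ 1)) :- u := con (+ 0) :- con (+ 1)) ≈-refl u)))
      (u-least (u - 1#) λ y (k , e) → lin (u-upper (fromℕ (suc k)) (suc k , ≈-refl))
        (≈-trans (solve 2 (λ u k → u :- (con (+ 1) :+ k) := (u :- con (+ 1)) :- k) ≈-refl u (fromℕ k))
                 (+-congˡ (-‿cong (≈-sym e))))))
    where
    S : Pred ℝ 0ℓ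
    S y = ∃ λ k → y ≈ fromℕ k
    sup = leastUpperBound S (0# , 0 , ≈-refl)
      (x , λ y (k , e) → ≤-respˡ-≈ (≈-sym e) (<⇒≤ (≰⇒< λ p → n (k , p))))
    u = proj₁ sup
    u-upper = proj₁ (proj₂ sup)
    u-least = proj₂ (proj₂ sup)

  infix 4 _⊴_
  -- The absolute value as a pair of linear inequalities: in this form a bound passes through sums,
  -- integrals and scaling by monotonicity alone.
  _⊴_ : ℝ → ℝ → Set
  a ⊴ b = a ≤ b × - a ≤ b

  abs⇒⊴ : ∀ {a b} → ∣ a ∣ ≤ b → a ⊴ b
  abs⇒⊴ {a} p = ≤-trans (x≤x⊔y a (- a)) p , ≤-trans (x≤y⊔x a (- a)) p

  ⊴⇒abs : ∀ {a b} → a ⊴ b → ∣ a ∣ ≤ b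
  ⊴⇒abs (p , q) = ⊔-lub p q

  ⊴-cong : ∀ {a a′ b} → a ≈ a′ → a ⊴ b → a′ ⊴ b
  ⊴-cong e (p , q) = ≤-respˡ-≈ e p , ≤-respˡ-≈ (-‿cong e) q

  ⊴-≤ : ∀ {a b b′} → a ⊴ b → b ≤ b′ → a ⊴ b′
  ⊴-≤ (p , q) r = ≤-trans p r , ≤-trans q r

  ⊴-+ : ∀ {a b c d} → a ⊴ b → c ⊴ d → a + c ⊴ b + d
  ⊴-+ {a} {b} {c} {d} (p , q) (r , s) = p ⊕ r , ≤-respˡ-≈ (-‿+-comm a c) (q ⊕ s)

  ⊴-neg : ∀ {a b} → a ⊴ b → - a ⊴ b
  ⊴-neg {a} (p , q) = q , ≤-respˡ-≈ (≈-sym (-‿involutive a)) p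

  ⊴-0 : ∀ {a b} → a ≈ 0# → 0# ≤ b → a ⊴ b
  ⊴-0 e p = ≤-respˡ-≈ (≈-sym e) p , ≤-respˡ-≈ (≈-trans (≈-sym -0#≈0#) (-‿cong (≈-sym e))) p

  ⊴-scale : ∀ {k a b} → 0# ≤ k → a ⊴ b → k * a ⊴ k * b
  ⊴-scale {k} {a} p (q , r) = p ⊛ q , ≤-respˡ-≈ (≈-sym (-‿distribʳ-* k a)) (p ⊛ r)

  ⊴⇒0≤ : ∀ {a b} → a ⊴ b → 0# ≤ b
  ⊴⇒0≤ {a} {b} (p , q) = *-cancelˡ-≤ (0<fromℕ 2)
    (lin (p ⊕ q) (solve 2 (λ a b → b :+ b :- (a :+ :- a) := con (+ 2) :* b :- con (+ 2) :* con (+ 0)) ≈-refl a b))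

  ²≤⇒⊴ : ∀ {a b} → 0# ≤ b → a * a ≤ b * b → a ⊴ b
  ²≤⇒⊴ {a} 0≤b p = x²≤y²⇒x≤y 0≤b p , x²≤y²⇒x≤y 0≤b (≤-respˡ-≈ (solve 1 (λ x → x :* x := :- x :* :- x) ≈-refl a) p)

  𝕀 : ℝ → Set
  𝕀 x = 0# ≤ x × x ≤ 1#

  𝕀-0 : 𝕀 0#
  𝕀-0 = ≤-refl , 0≤1

  𝕀-1 : 𝕀 1#
  𝕀-1 = 0≤1 , ≤-refl

  𝕀-* : ∀ {x y} → 𝕀 x → 𝕀 y → 𝕀 (x * y)
  𝕀-* (p , q) (r , s) = *-nonNeg p r , ≤-respʳ-≈ (*-identityˡ 1#) (mul-mono p q 0≤1 s)

  𝕀-not : ∀ {x} → 𝕀 x → 𝕀 (1# - x)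
  𝕀-not {x} (p , q) = ≤⇒0≤ q , lin p (solve 1 (λ x → x :- con (+ 0) := con (+ 1) :- (con (+ 1) :- x)) ≈-refl x)

  mix-≤ : ∀ {r a b c} → 𝕀 r → a ≤ c → b ≤ c → r * a + (1# - r) * b ≤ c
  mix-≤ {r} {a} {b} {c} i p q = ≤-trans (proj₁ i ⊛ p ⊕ proj₁ (𝕀-not i) ⊛ q)
    (≤-reflexive (solve 2 (λ r c → r :* c :+ (con (+ 1) :- r) :* c := c) ≈-refl r c))

  mix-≥ : ∀ {r a b c} → 𝕀 r → c ≤ a → c ≤ b → c ≤ r * a + (1# - r) * b
  mix-≥ {r} {a} {b} {c} i p q = ≤-trans
    (≤-reflexive (solve 2 (λ r c → c := r :* c :+ (con (+ 1) :- r) :* c) ≈-refl r c))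
    (proj₁ i ⊛ p ⊕ proj₁ (𝕀-not i) ⊛ q)

  𝕀-mix : ∀ {r a b} → 𝕀 r → 𝕀 a → 𝕀 b → 𝕀 (r * a + (1# - r) * b)
  𝕀-mix i (p , q) (r , s) = mix-≥ i p r , mix-≤ i q s

  ind : Bool → ℝ
  ind b = if b then 1# else 0#

  𝕀-ind : ∀ b → 𝕀 (ind b)
  𝕀-ind true  = 𝕀-1
  𝕀-ind false = 𝕀-0

  -- Finite probability

  -- A finite measure is represented by the functional f ↦ ∫ f; finite support enters only through
  -- commutation with every linear functional (Fubini).
  record Lin (A : Set) : Set where
    field
      ap      : (A → ℝ) → ℝ
      ap-cong : ∀ {f g} → (∀ a → f a ≈ g a) → ap f ≈ ap g
      ap-+    : ∀ f g → ap (λ a → f a + g a) ≈ ap f + ap g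
      ap-*    : ∀ c f → ap (λ a → c * f a) ≈ c * ap f

  record Meas (A : Set) : Set₁ where
    field
      functional : Lin A
    open Lin functional
    field
      ap-pos  : ∀ {f} → (∀ a → 0# ≤ f a) → 0# ≤ ap f
      ap-swap : ∀ {B} (Q : Lin B) (f : A → B → ℝ) →
                ap (λ a → Lin.ap Q (f a)) ≈ Lin.ap Q (λ b → ap λ a → f a b)

  record Prob (A : Set) : Set₁ where
    field
      meas  : Meas A
      total-1 : Lin.ap (Meas.functional meas) (λ _ → 1#) ≈ 1#

  open Prob public using (meas)
  open Meas public using (functional)

  variable
    A B U : Set

  ∫ : Meas A → (A → ℝ) → ℝ
  ∫ M = Lin.ap (functional M)

  𝔼 : Prob A → (A → ℝ) → ℝ
  𝔼 P = ∫ (meas P)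

  module _ (M : Meas A) where
    open Lin (functional M)

    ∫-cong : ∀ {f g} → (∀ a → f a ≈ g a) → ∫ M f ≈ ∫ M g
    ∫-cong = ap-cong

    ∫-+ : ∀ f g → ∫ M (λ a → f a + g a) ≈ ∫ M f + ∫ M g
    ∫-+ = ap-+

    ∫-* : ∀ c f → ∫ M (λ a → c * f a) ≈ c * ∫ M f
    ∫-* = ap-*

    ∫-*ʳ : ∀ c f → ∫ M (λ a → f a * c) ≈ ∫ M f * c
    ∫-*ʳ c f = ≈-trans (ap-cong λ a → *-comm _ _) (≈-trans (ap-* c f) (*-comm _ _))

    ∫-neg : ∀ f → ∫ M (λ a → - f a) ≈ - ∫ M f
    ∫-neg f = ≈-trans (ap-cong λ a → m (f a)) (≈-trans (ap-* (- 1#) f) (≈-sym (m _)))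
      where m : ∀ x → - x ≈ - 1# * x
            m = solve 1 (λ x → :- x := :- con (+ 1) :* x) ≈-refl

    ∫-- : ∀ f g → ∫ M (λ a → f a - g a) ≈ ∫ M f - ∫ M g
    ∫-- f g = ≈-trans (ap-+ f (λ a → - g a)) (+-congˡ (∫-neg g))

    ∫-pos : ∀ {f} → (∀ a → 0# ≤ f a) → 0# ≤ ∫ M f
    ∫-pos = Meas.ap-pos M

    ∫-mono : ∀ {f g} → (∀ a → f a ≤ g a) → ∫ M f ≤ ∫ M g
    ∫-mono {f} {g} p = 0≤⇒≤ (≤-respʳ-≈ (∫-- g f) (∫-pos λ a → ≤⇒0≤ (p a)))

    ∫-⊴ : ∀ {f g} → (∀ a → f a ⊴ g a) → ∫ M f ⊴ ∫ M g
    ∫-⊴ {f} {g} p = ∫-mono (proj₁ ∘ p) , ≤-respˡ-≈ (∫-neg f) (∫-mono (proj₂ ∘ p))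

    ∫-swap : (N : Meas B) (f : A → B → ℝ) → ∫ M (λ a → ∫ N (f a)) ≈ ∫ N (λ b → ∫ M λ a → f a b)
    ∫-swap N = Meas.ap-swap M (functional N)

    ∫-0 : ∀ {f} → (∀ a → f a ≈ 0#) → ∫ M f ≈ 0#
    ∫-0 {f} p = ≈-trans (ap-cong λ a → ≈-trans (p a) (≈-sym (zeroˡ 0#))) (≈-trans (ap-* 0# λ _ → 0#) (zeroˡ _))

    -- The discriminant argument; for b ≈ 0# the witness t = (a + 1) / 2c makes the quadratic equal to -1.
    ∫-cauchySchwarz : ∀ (f g : A → ℝ) → ∫ M (λ a → f a * g a) * ∫ M (λ a → f a * g a) ≤ ∫ M (λ a → f a * f a) * ∫ M (λ a → g a * g a)
    ∫-cauchySchwarz f g = go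
      where
      a = ∫ M (λ x → f x * f x)
      b = ∫ M (λ x → g x * g x)
      c = ∫ M (λ x → f x * g x)
      quadratic : ∀ t → 0# ≤ a + (t * t * b - (t + t) * c)
      quadratic t = ≤-respʳ-≈ e (∫-pos λ x → 0≤x² (f x - t * g x))
        where
        e : ∫ M (λ x → (f x - t * g x) * (f x - t * g x)) ≈ a + (t * t * b - (t + t) * c)
        e = ≈-trans (ap-cong λ x → solve 3 (λ f g t → (f :- t :* g) :* (f :- t :* g) :=
                  f :* f :+ (t :* t :* (g :* g) :- (t :+ t) :* (f :* g))) ≈-refl (f x) (g x) t)
            (≈-trans (ap-+ _ _) (+-congˡ (≈-trans (∫-- _ _) (+-cong (ap-* _ _) (-‿cong (ap-* _ _))))))
      0≤b : 0# ≤ b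
      0≤b = ∫-pos λ x → 0≤x² (g x)
      go : c * c ≤ a * b
      go with em {0# < b} | em {c ≈ 0#}
      ... | yes p | _ = *-cancelˡ-≤ (0<⁻¹ p) (lin (quadratic (b ⁻¹ * c)) (≈-trans
            (solve 4 (λ i a b c → a :+ ((i :* c) :* (i :* c) :* b :- (i :* c :+ i :* c) :* c) :- con (+ 0)
               := con (+ 1) :* a :+ (b :* i) :* (i :* (c :* c)) :- con (+ 2) :* (i :* (c :* c))) ≈-refl (b ⁻¹) a b c)
            (≈-trans (+-congʳ (+-cong (*-congʳ (≈-sym (*-inv p))) (*-congʳ (*-inv p))))
            (solve 4 (λ i a b c → (b :* i) :* a :+ con (+ 1) :* (i :* (c :* c)) :- con (+ 2) :* (i :* (c :* c))
               := i :* (a :* b) :- i :* (c :* c)) ≈-refl (b ⁻¹) a b c))))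
      ... | no  _ | yes q = ≤-respˡ-≈ (≈-sym (≈-trans (*-congʳ q) (zeroˡ c))) (*-nonNeg (∫-pos λ x → 0≤x² (f x)) 0≤b)
      ... | no  p | no  q = ⊥-elim (<⇒≰ 0<1 (lin (quadratic t) (begin
          a + (t * t * b - (t + t) * c) - 0#   ≈⟨ +-congʳ (+-congˡ (+-congʳ (≈-trans (*-congˡ b≈0) (zeroʳ _)))) ⟩
          a + (0# - (t + t) * c) - 0#
            ≈⟨ solve 4 (λ a h i c → a :+ (con (+ 0) :- ((a :+ con (+ 1)) :* h :* i :+ (a :+ con (+ 1)) :* h :* i) :* c) :- con (+ 0)
                 := a :- (a :+ con (+ 1)) :* (con (+ 2) :* h) :* (c :* i)) ≈-refl a (fromℕ 2 ⁻¹) (c ⁻¹) c ⟩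
          a - (a + 1#) * (fromℕ 2 * fromℕ 2 ⁻¹) * (c * c ⁻¹)
            ≈⟨ +-congˡ (-‿cong (*-cong (*-congˡ (*-inv (0<fromℕ 2))) (*-inverseʳ c q))) ⟩
          a - (a + 1#) * 1# * 1#   ≈⟨ solve 1 (λ a → a :- (a :+ con (+ 1)) :* con (+ 1) :* con (+ 1) := con (+ 0) :- con (+ 1)) ≈-refl a ⟩
          0# - 1#                  ∎)))
        where
        open ≈R
        t = (a + 1#) * fromℕ 2 ⁻¹ * c ⁻¹
        b≈0 : b ≈ 0#
        b≈0 with ≤-or-< b 0#
        ... | inj₁ r = ≤-antisym r 0≤b
        ... | inj₂ r = ⊥-elim (p r)

  module _ (P : Prob A) where

    𝔼-const : ∀ c → 𝔼 P (λ _ → c) ≈ c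
    𝔼-const c = ≈-trans (∫-cong (meas P) λ _ → ≈-sym (*-identityʳ c))
      (≈-trans (∫-* (meas P) c (λ _ → 1#)) (≈-trans (*-congˡ (Prob.total-1 P)) (*-identityʳ c)))

    𝔼-≤ : ∀ {f c} → (∀ a → f a ≤ c) → 𝔼 P f ≤ c
    𝔼-≤ p = ≤-respʳ-≈ (𝔼-const _) (∫-mono (meas P) p)

    𝔼-≥ : ∀ {f c} → (∀ a → c ≤ f a) → c ≤ 𝔼 P f
    𝔼-≥ p = ≤-respˡ-≈ (𝔼-const _) (∫-mono (meas P) p)

    𝔼-⊴ : ∀ {f c} → (∀ a → f a ⊴ c) → 𝔼 P f ⊴ c
    𝔼-⊴ p = ⊴-≤ (∫-⊴ (meas P) p) (≤-reflexive (𝔼-const _))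

    𝔼-𝕀 : ∀ {f} → (∀ a → 𝕀 (f a)) → 𝕀 (𝔼 P f)
    𝔼-𝕀 p = 𝔼-≥ (proj₁ ∘ p) , 𝔼-≤ (proj₂ ∘ p)

    𝔼-jensen : ∀ (f : A → ℝ) → 𝔼 P f * 𝔼 P f ≤ 𝔼 P (λ a → f a * f a)
    𝔼-jensen f = ≤-respˡ-≈ (*-cong e e) (≤-respʳ-≈
      (≈-trans (*-congˡ (≈-trans (∫-cong (meas P) λ _ → *-identityˡ 1#) (Prob.total-1 P))) (*-identityʳ _))
      (∫-cauchySchwarz (meas P) f (λ _ → 1#)))
      where e = ∫-cong (meas P) λ a → *-identityʳ (f a)

  dirac : A → Prob A
  dirac a = record
    { meas = record
      { functional = record { ap = λ f → f a ; ap-cong = λ p → p a ; ap-+ = λ _ _ → ≈-refl ; ap-* = λ _ _ → ≈-refl }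
      ; ap-pos = λ p → p a ; ap-swap = λ Q f → ≈-refl }
    ; total-1 = ≈-refl }

  bind : Prob A → (A → Prob B) → Prob B
  bind P K = record
    { meas = record
      { functional = record
        { ap = λ f → 𝔼 P λ a → 𝔼 (K a) f
        ; ap-cong = λ p → ∫-cong (meas P) λ a → ∫-cong (meas (K a)) p
        ; ap-+ = λ f g → ≈-trans (∫-cong (meas P) λ a → ∫-+ (meas (K a)) f g) (∫-+ (meas P) _ _)
        ; ap-* = λ c f → ≈-trans (∫-cong (meas P) λ a → ∫-* (meas (K a)) c f) (∫-* (meas P) c _) }
      ; ap-pos = λ p → ∫-pos (meas P) λ a → ∫-pos (meas (K a)) p
      ; ap-swap = λ Q f → ≈-trans (∫-cong (meas P) λ a → Meas.ap-swap (meas (K a)) Q f) (Meas.ap-swap (meas P) Q _) }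
    ; total-1 = ≈-trans (∫-cong (meas P) λ a → Prob.total-1 (K a)) (Prob.total-1 P) }

  mapP : (A → B) → Prob A → Prob B
  mapP f P = bind P (dirac ∘ f)

  weighted : ∀ M (w : A → ℝ) → (∀ a → 0# ≤ w a) → Meas A
  weighted M w 0≤w = record
    { functional = record
      { ap = λ f → ∫ M λ a → w a * f a
      ; ap-cong = λ p → ∫-cong M λ a → *-congˡ (p a)
      ; ap-+ = λ f g → ≈-trans (∫-cong M λ a → distribˡ _ _ _) (∫-+ M _ _)
      ; ap-* = λ c f → ≈-trans (∫-cong M λ a → solve 3 (λ w c f → w :* (c :* f) := c :* (w :* f)) ≈-refl (w a) c (f a)) (∫-* M c _) }
    ; ap-pos = λ p → ∫-pos M λ a → *-nonNeg (0≤w a) (p a)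
    ; ap-swap = λ Q f → ≈-trans (∫-cong M λ a → ≈-sym (Lin.ap-* Q _ _)) (Meas.ap-swap M Q λ a b → w a * f a b) }

  bernoulli : (r : ℝ) → 𝕀 r → Prob Bool
  bernoulli r i = record
    { meas = record
      { functional = record
        { ap = λ f → r * f true + (1# - r) * f false
        ; ap-cong = λ p → +-cong (*-congˡ (p true)) (*-congˡ (p false))
        ; ap-+ = λ f g → solve 6 (λ r s a b c d → r :* (a :+ c) :+ s :* (b :+ d) := (r :* a :+ s :* b) :+ (r :* c :+ s :* d))
                   ≈-refl r (1# - r) (f true) (f false) (g true) (g false)
        ; ap-* = λ c f → solve 5 (λ r s c a b → r :* (c :* a) :+ s :* (c :* b) := c :* (r :* a :+ s :* b))
                   ≈-refl r (1# - r) c (f true) (f false) }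
      ; ap-pos = λ p → 0≤-+ (*-nonNeg (proj₁ i) (p true)) (*-nonNeg (proj₁ (𝕀-not i)) (p false))
      ; ap-swap = λ Q f → ≈-trans (+-cong (≈-sym (Lin.ap-* Q _ _)) (≈-sym (Lin.ap-* Q _ _))) (≈-sym (Lin.ap-+ Q _ _)) }
    ; total-1 = solve 1 (λ r → r :* con (+ 1) :+ (con (+ 1) :- r) :* con (+ 1) := con (+ 1)) ≈-refl r }

  ap-zero : (Q : Lin A) → Lin.ap Q (λ _ → 0#) ≈ 0#
  ap-zero Q = ≈-trans (Lin.ap-cong Q λ _ → ≈-sym (zeroˡ 0#)) (≈-trans (Lin.ap-* Q 0# _) (zeroˡ _))

  ∑M : List A → Meas A
  ∑M xs = record
    { functional = record
      { ap = ∑ xs ; ap-cong = λ p → cg xs p ; ap-+ = pl xs ; ap-* = ml xs }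
    ; ap-pos = ps xs ; ap-swap = sw xs }
    where
    cg : ∀ xs {f g} → (∀ a → f a ≈ g a) → ∑ xs f ≈ ∑ xs g
    cg [] p       = ≈-refl
    cg (x ∷ xs) p = +-cong (p x) (cg xs p)
    pl : ∀ xs f g → ∑ xs (λ a → f a + g a) ≈ ∑ xs f + ∑ xs g
    pl [] f g       = ≈-sym (+-identityˡ 0#)
    pl (x ∷ xs) f g = ≈-trans (+-congˡ (pl xs f g))
      (solve 4 (λ a b c d → (a :+ b) :+ (c :+ d) := (a :+ c) :+ (b :+ d)) ≈-refl (f x) (g x) (∑ xs f) (∑ xs g))
    ml : ∀ xs c f → ∑ xs (λ a → c * f a) ≈ c * ∑ xs f
    ml [] c f       = ≈-sym (zeroʳ c)
    ml (x ∷ xs) c f = ≈-trans (+-congˡ (ml xs c f)) (≈-sym (distribˡ c _ _))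
    ps : ∀ xs {f} → (∀ a → 0# ≤ f a) → 0# ≤ ∑ xs f
    ps [] p       = ≤-refl
    ps (x ∷ xs) p = 0≤-+ (p x) (ps xs p)
    sw : ∀ xs {B} (Q : Lin B) (f : A → B → ℝ) → ∑ xs (λ a → Lin.ap Q (f a)) ≈ Lin.ap Q (λ b → ∑ xs λ a → f a b)
    sw [] Q f       = ≈-sym (ap-zero Q)
    sw (x ∷ xs) Q f = ≈-trans (+-congˡ (sw xs Q f)) (≈-sym (Lin.ap-+ Q _ _))

  ⟦_⟧ : {xs : List A} → Distribution xs → Prob A
  ⟦_⟧ {xs = xs} μ = record
    { meas = weighted (∑M xs) (mass μ) (nonNeg μ)
    ; total-1 = ≈-trans (∫-cong (∑M xs) λ a → *-identityʳ _) (total μ) }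

  open MonoidSum (Semiring.+-commutativeMonoid semiring) using (sum; sum-permute)

  -- `pick`, summation against a delta function, encodes that `elems` lists every element exactly
  -- once. In this form it passes to products directly.
  record Enum (U : Set) : Set where
    field
      elems : List U
      _==_  : U → U → Bool
      pick  : ∀ a (f : U → ℝ) → ∑ elems (λ x → ind (a == x) * f x) ≈ f a

  ∑-map : (g : A → B) (xs : List A) (f : B → ℝ) → ∑ (List.map g xs) f ≈ ∑ xs (f ∘ g)
  ∑-map g [] f       = ≈-refl
  ∑-map g (x ∷ xs) f = +-congˡ (∑-map g xs f)

  ∑-++ : (xs ys : List A) (f : A → ℝ) → ∑ (xs ++ ys) f ≈ ∑ xs f + ∑ ys f
  ∑-++ [] ys f       = ≈-sym (+-identityˡ _)
  ∑-++ (x ∷ xs) ys f = ≈-trans (+-congˡ (∑-++ xs ys f)) (≈-sym (+-assoc _ _ _))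

  ∑-× : (xs : List A) (ys : List B) (f : A × B → ℝ) → ∑ (cartesianProduct xs ys) f ≈ ∑ xs (λ x → ∑ ys λ y → f (x , y))
  ∑-× [] ys f       = ≈-refl
  ∑-× (x ∷ xs) ys f = ≈-trans (∑-++ (List.map (x ,_) ys) _ f) (+-cong (∑-map _ ys f) (∑-× xs ys f))

  ind-∧ : ∀ a b → ind (a ∧ b) ≈ ind a * ind b
  ind-∧ true  b = ≈-sym (*-identityˡ _)
  ind-∧ false b = ≈-sym (zeroˡ _)

  enumBool : Enum Bool
  enumBool = record
    { elems = false ∷ true ∷ []
    ; _==_ = λ a b → does (a ≟ᵇ b)
    ; pick = λ { false f → solve 2 (λ a b → con (+ 1) :* a :+ (con (+ 0) :* b :+ con (+ 0)) := a) ≈-refl (f false) (f true)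
               ; true f → solve 2 (λ a b → con (+ 0) :* a :+ (con (+ 1) :* b :+ con (+ 0)) := b) ≈-refl (f false) (f true) } }

  enum× : Enum A → Enum B → Enum (A × B)
  enum× EA EB = record
    { elems = cartesianProduct (Enum.elems EA) (Enum.elems EB)
    ; _==_ = λ (a , b) (c , d) → Enum._==_ EA a c ∧ Enum._==_ EB b d
    ; pick = λ (a , b) f → ≈-trans (∑-× (Enum.elems EA) (Enum.elems EB) _) (≈-trans
        (∫-cong (∑M (Enum.elems EA)) λ x → ≈-trans
          (∫-cong (∑M (Enum.elems EB)) λ y → ≈-trans (*-congʳ (ind-∧ _ _)) (*-assoc _ _ _))
          (≈-trans (∫-* (∑M (Enum.elems EB)) _ _) (*-congˡ (Enum.pick EB b (λ y → f (x , y))))))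
        (Enum.pick EA a (λ x → f (x , b)))) }

  _==ᵛ_ : ∀ {n} → Str n → Str n → Bool
  [] ==ᵛ []             = true
  (a ∷ x) ==ᵛ (b ∷ y) = does (a ≟ᵇ b) ∧ (x ==ᵛ y)

  ==ᵛ-refl : ∀ {n} (x : Str n) → (x ==ᵛ x) ≡ true
  ==ᵛ-refl []          = refl
  ==ᵛ-refl (true ∷ x)  = ==ᵛ-refl x
  ==ᵛ-refl (false ∷ x) = ==ᵛ-refl x

  ==ᵛ-sound : ∀ {n} (x y : Str n) → (x ==ᵛ y) ≡ true → x ≡ y
  ==ᵛ-sound [] [] _ = refl
  ==ᵛ-sound (true ∷ x) (true ∷ y) e   = ≡.cong (true ∷_) (==ᵛ-sound x y e)
  ==ᵛ-sound (false ∷ x) (false ∷ y) e = ≡.cong (false ∷_) (==ᵛ-sound x y e)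

  enumVec : ∀ n → Enum (Str n)
  enumVec n = record { elems = strings n ; _==_ = _==ᵛ_ ; pick = pk n }
    where
    pk : ∀ n (a : Str n) f → ∑ (strings n) (λ x → ind (a ==ᵛ x) * f x) ≈ f a
    pk zero [] f = solve 1 (λ a → con (+ 1) :* a :+ con (+ 0) := a) ≈-refl (f [])
    pk (suc n) (a ∷ x) f = ≈-trans (∑-++ (List.map (false ∷_) (strings n)) _ _) (≈-trans (+-cong (half false) (half true))
        (≈-trans (+-congˡ (≈-sym (+-identityʳ _))) (Enum.pick enumBool a (λ b → f (b ∷ x)))))
      where
      half : ∀ b → ∑ (List.map (b ∷_) (strings n)) (λ y → ind (((a ∷ x) ==ᵛ y)) * f y) ≈ ind (does (a ≟ᵇ b)) * f (b ∷ x)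
      half b = ≈-trans (∑-map (b ∷_) (strings n) _) (≈-trans
        (∫-cong (∑M (strings n)) λ y → ≈-trans (*-congʳ (ind-∧ (does (a ≟ᵇ b)) (x ==ᵛ y))) (*-assoc _ _ _))
        (≈-trans (∫-* (∑M (strings n)) _ _) (*-congˡ (pk n x (λ y → f (b ∷ y))))))

  module _ (EU : Enum U) where
    open Enum EU

    module _ (P : Prob A) (u : A → U) where

      fibre : U → A → ℝ
      fibre u₀ a = ind (u a == u₀)

      0≤fibre : ∀ u₀ a → 0# ≤ fibre u₀ a
      0≤fibre u₀ a = proj₁ (𝕀-ind (u a == u₀))

      -- On a null fibre the conditional law is, arbitrarily, P itself.
      cond : U → Prob A
      cond u₀ with ≤-or-< (𝔼 P (fibre u₀)) 0#
      ... | inj₁ _ = P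
      ... | inj₂ p = record
        { meas = weighted (meas P) (λ a → 𝔼 P (fibre u₀) ⁻¹ * fibre u₀ a)
            (λ a → *-nonNeg (<⇒≤ (0<⁻¹ p)) (0≤fibre u₀ a))
        ; total-1 = ≈-trans (∫-cong (meas P) λ a → *-identityʳ _)
            (≈-trans (∫-* (meas P) _ _) (≈-trans (*-comm _ _) (*-inv p))) }

      -- Both sides vanish on a null fibre: by Cauchy-Schwarz the square of the right-hand side is
      -- at most the mass of the fibre times the second moment of `h`, whatever `h` is. So no
      -- statement about conditional laws has to exclude null types.
      cond-fibre : ∀ u₀ (h : A → ℝ) → 𝔼 P (fibre u₀) * 𝔼 (cond u₀) h ≈ 𝔼 P (λ a → fibre u₀ a * h a)
      cond-fibre u₀ h with ≤-or-< (𝔼 P (fibre u₀)) 0#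
      ... | inj₂ p = ≈-trans (*-congˡ (≈-trans (∫-cong (meas P) λ a → *-assoc _ _ _) (∫-* (meas P) _ _)))
          (≈-trans (≈-sym (*-assoc _ _ _)) (≈-trans (*-congʳ (*-inv p)) (*-identityˡ _)))
      ... | inj₁ p = ≈-trans (≈-trans (*-congʳ null) (zeroˡ _)) (≈-sym (≤-antisym (proj₁ small) (≤-respʳ-≈ (-‿involutive _) (≤-respˡ-≈ -0#≈0# (neg-mono (proj₂ small))))))
        where
        null : 𝔼 P (fibre u₀) ≈ 0#
        null = ≤-antisym p (∫-pos (meas P) (0≤fibre u₀))
        idem : ∀ b → ind b * ind b ≈ ind b
        idem true  = *-identityˡ 1#
        idem false = zeroˡ 0#
        small : 𝔼 P (λ a → fibre u₀ a * h a) ⊴ 0#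
        small = ²≤⇒⊴ ≤-refl (≤-trans (∫-cauchySchwarz (meas P) (fibre u₀) h) (≤-reflexive
          (≈-trans (*-congʳ (≈-trans (∫-cong (meas P) λ a → idem (u a == u₀)) null)) (≈-trans (zeroˡ _) (≈-sym (zeroˡ 0#))))))

      ∑-fibres : (H : U → ℝ) → 𝔼 P (H ∘ u) ≈ ∑ elems (λ u₀ → 𝔼 P (fibre u₀) * H u₀)
      ∑-fibres H = ≈-trans (∫-cong (meas P) λ a → ≈-sym (pick (u a) H))
        (≈-trans (∫-swap (meas P) (∑M elems) _) (∫-cong (∑M elems) λ u₀ → ∫-*ʳ (meas P) (H u₀) _))

      -- The tower property. `g` may see the value of `u` as a parameter, since this value is
      -- constant on each fibre; `∑-fibres` reduces the claim to `cond-fibre`.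
      disintegrate : (g : U → A → ℝ) → 𝔼 P (λ a → 𝔼 (cond (u a)) (g (u a))) ≈ 𝔼 P (λ a → g (u a) a)
      disintegrate g = ≈-trans (∑-fibres (λ u₀ → 𝔼 (cond u₀) (g u₀))) (≈-trans
        (∫-cong (∑M elems) λ u₀ → cond-fibre u₀ (g u₀))
        (≈-trans (≈-sym (∫-swap (meas P) (∑M elems) _)) (∫-cong (meas P) λ a → pick (u a) (λ u₀ → g u₀ a))))

  sumM : ∀ n → Meas (Fin n)
  sumM n = record
    { functional = record { ap = sum ; ap-cong = cg n ; ap-+ = pl n ; ap-* = ml n }
    ; ap-pos = ps n ; ap-swap = sw n }
    where
    cg : ∀ n {f g : Fin n → ℝ} → (∀ a → f a ≈ g a) → sum f ≈ sum g
    cg zero p    = ≈-refl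
    cg (suc n) p = +-cong (p zero) (cg n (p ∘ suc))
    pl : ∀ n (f g : Fin n → ℝ) → sum (λ a → f a + g a) ≈ sum f + sum g
    pl zero f g    = ≈-sym (+-identityˡ 0#)
    pl (suc n) f g = ≈-trans (+-congˡ (pl n _ _))
      (solve 4 (λ a b c d → (a :+ b) :+ (c :+ d) := (a :+ c) :+ (b :+ d)) ≈-refl (f zero) (g zero) (sum (f ∘ suc)) (sum (g ∘ suc)))
    ml : ∀ n c (f : Fin n → ℝ) → sum (λ a → c * f a) ≈ c * sum f
    ml zero c f    = ≈-sym (zeroʳ c)
    ml (suc n) c f = ≈-trans (+-congˡ (ml n c _)) (≈-sym (distribˡ c _ _))
    ps : ∀ n {f : Fin n → ℝ} → (∀ a → 0# ≤ f a) → 0# ≤ sum f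
    ps zero p    = ≤-refl
    ps (suc n) p = 0≤-+ (p zero) (ps n (p ∘ suc))
    sw : ∀ n {B} (Q : Lin B) (f : Fin n → B → ℝ) → sum {n} (λ a → Lin.ap Q (f a)) ≈ Lin.ap Q (λ b → sum λ a → f a b)
    sw zero Q f    = ≈-sym (ap-zero Q)
    sw (suc n) Q f = ≈-trans (+-congˡ (sw n Q _)) (≈-sym (Lin.ap-+ Q _ _))

  sum-const : ∀ n c → sum {n} (λ _ → c) ≈ fromℕ n * c
  sum-const zero c    = ≈-sym (zeroˡ c)
  sum-const (suc n) c = ≈-trans (+-congˡ (sum-const n c)) (≈-trans (+-congʳ (≈-sym (*-identityˡ c))) (≈-sym (distribʳ c _ _)))

  uniform : ∀ n → .{{NonZero n}} → Prob (Fin n)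
  uniform n = record
    { meas = weighted (sumM n) (λ _ → fromℕ n ⁻¹) (λ _ → <⇒≤ (0<⁻¹ (0<fromℕ n)))
    ; total-1 = ≈-trans (sum-const n _) (≈-trans (*-congˡ (*-identityʳ _)) (*-inv (0<fromℕ n))) }

  uniform-permute : ∀ {n} .{{_ : NonZero n}} (π : Permutation′ n) (f : Fin n → ℝ) → 𝔼 (uniform n) (λ x → f (π ⟨$⟩ʳ x)) ≈ 𝔼 (uniform n) f
  uniform-permute {n} π f = ≈-trans (∫-* (sumM n) _ _) (≈-trans (*-congˡ (≈-sym (sum-permute f π))) (≈-sym (∫-* (sumM n) _ _)))

  indep : ∀ {n} → (Fin n → Prob A) → Prob (Vec A n)
  indep {n = zero}  P = dirac []
  indep {n = suc n} P = bind (P zero) λ a → bind (indep (P ∘ suc)) λ v → dirac (a ∷ v)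

  infix 4 _∼_
  _∼_ : Prob A → Prob A → Set
  P ∼ Q = ∀ f → 𝔼 P f ≈ 𝔼 Q f

  indep-cong : ∀ {n} {P Q : Fin n → Prob A} → (∀ i → P i ∼ Q i) → indep P ∼ indep Q
  indep-cong {n = zero}  p f = ≈-refl
  indep-cong {n = suc n} {P} {Q} p f = ≈-trans (∫-cong (meas (P zero)) λ a → indep-cong (p ∘ suc) _) (p zero _)

  -- Independence in the form needed by a tree that looks at one coordinate: the old value at `i` is
  -- overwritten, so the rest may still be averaged over the full product.
  indep-resample : ∀ {n} (P : Fin n → Prob A) i (f : Vec A n → ℝ) → 𝔼 (indep P) f ≈ 𝔼 (P i) λ a → 𝔼 (indep P) λ v → f (v [ i ]≔ a)
  indep-resample {n = suc n} P zero f = ∫-cong (meas (P zero)) λ a → ≈-sym (𝔼-const (P zero) _)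
  indep-resample {n = suc n} P (suc i) f = ≈-trans
    (∫-cong (meas (P zero)) λ a → indep-resample (P ∘ suc) i (f ∘ (a ∷_)))
    (∫-swap (meas (P zero)) (meas (P (suc i))) _)

  indep-update : ∀ {n} (P Q : Fin n → Prob A) i b → (∀ j → ¬ j ≡ i → P j ∼ Q j) → ∀ (f : Vec A n → ℝ) →
                 𝔼 (indep P) (λ v → f (v [ i ]≔ b)) ≈ 𝔼 (indep Q) (λ v → f (v [ i ]≔ b))
  indep-update {n = suc n} P Q zero b p f = ≈-trans (𝔼-const (P zero) _) (≈-trans
    (indep-cong (λ j → p (suc j) λ ()) _) (≈-sym (𝔼-const (Q zero) _)))
  indep-update {n = suc n} P Q (suc i) b p f = ≈-trans
    (∫-cong (meas (P zero)) λ a → indep-update (P ∘ suc) (Q ∘ suc) i b (λ j n → p (suc j) λ { refl → n refl }) (f ∘ (a ∷_)))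
    (p zero (λ ()) _)

  -- Conditioning a product measure on one coordinate gives a product measure again, with a point
  -- mass there. Hence inductions over decision trees stay within families of independent laws.
  fix : ∀ {n} → (Fin n → Prob A) → Fin n → A → Fin n → Prob A
  fix P i a j with j ≟ᶠ i
  ... | yes _ = dirac a
  ... | no  _ = P j

  fix-≡ : ∀ {n} (P : Fin n → Prob A) i a (f : A → ℝ) → 𝔼 (fix P i a i) f ≈ f a
  fix-≡ P i a f with i ≟ᶠ i
  ... | yes _ = ≈-refl
  ... | no  n = ⊥-elim (n refl)

  fix-≢ : ∀ {n} (P : Fin n → Prob A) i a j → ¬ j ≡ i → P j ∼ fix P i a j
  fix-≢ P i a j n f with j ≟ᶠ i
  ... | yes p = ⊥-elim (n p)
  ... | no  _ = ≈-refl

  indep-fix : ∀ {n} (P : Fin n → Prob A) i a (f : Vec A n → ℝ) → 𝔼 (indep P) (λ v → f (v [ i ]≔ a)) ≈ 𝔼 (indep (fix P i a)) f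
  indep-fix P i a f = ≈-trans (indep-update P (fix P i a) i a (fix-≢ P i a) f)
    (≈-sym (≈-trans (indep-resample (fix P i a) i f) (fix-≡ P i a _)))

  indep-reveal : ∀ {n} (P : Fin n → Prob A) i (f : Vec A n → ℝ) → 𝔼 (indep P) f ≈ 𝔼 (P i) λ a → 𝔼 (indep (fix P i a)) f
  indep-reveal P i f = ≈-trans (indep-resample P i f) (∫-cong (meas (P i)) λ a → indep-fix P i a f)

  indep-marginal : ∀ {n} (P : Fin n → Prob A) i (f : A → ℝ) → 𝔼 (indep P) (λ v → f (lookup v i)) ≈ 𝔼 (P i) f
  indep-marginal {n = suc n} P zero f = ∫-cong (meas (P zero)) λ a → 𝔼-const (indep (P ∘ suc)) _
  indep-marginal {n = suc n} P (suc i) f = ≈-trans (𝔼-const (P zero) _) (indep-marginal (P ∘ suc) i f)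

  indep-bind : ∀ {n} (P : Fin n → Prob A) (K : A → Prob B) →
               indep (λ j → bind (P j) K) ∼ bind (indep P) (λ v → indep (K ∘ lookup v))
  indep-bind {n = zero} P K f  = ≈-refl
  indep-bind {n = suc n} P K f = ∫-cong (meas (P zero)) λ a → ≈-trans
    (∫-cong (meas (K a)) λ b → indep-bind (P ∘ suc) K _)
    (∫-swap (meas (K a)) (meas (indep (P ∘ suc))) _)

  -- After centring, the cross terms integrate to zero by independence, and the variance of one
  -- summand is at most its second moment. With indicators for `h` this controls empirical
  -- frequencies, with column costs it gives Chebyshev's inequality.
  variance-≤ : ∀ {n} (P : Fin n → Prob A) (h : Fin n → A → ℝ) → let d = λ v → sum (λ j → h j (lookup v j) - 𝔼 (P j) (h j)) in
               𝔼 (indep P) (λ v → d v * d v) ≤ sum (λ j → 𝔼 (P j) (λ a → h j a * h j a))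
  variance-≤ {n = zero} P h  = ≤-reflexive (zeroˡ 0#)
  variance-≤ {n = suc n} P h = ≤-trans (≤-reflexive expand) (single ⊕ variance-≤ (P ∘ suc) (h ∘ suc))
    where
    open ≈R
    P₀ = meas (P zero)
    Q = indep (P ∘ suc)
    m = 𝔼 (P zero) (h zero)
    Δ₀ = λ a → h zero a - m
    Δ = λ v → sum (λ j → h (suc j) (lookup v j) - 𝔼 (P (suc j)) (h (suc j)))
    square : ∀ x y → (x + y) * (x + y) ≈ x * x + (x * (y + y) + y * y)
    square = solve 2 (λ x y → (x :+ y) :* (x :+ y) := x :* x :+ (x :* (y :+ y) :+ y :* y)) ≈-refl
    X-0 : 𝔼 (P zero) Δ₀ ≈ 0#
    X-0 = ≈-trans (∫-- P₀ _ _) (≈-trans (+-congˡ (-‿cong (𝔼-const (P zero) m))) (-‿inverseʳ m))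
    expand = begin
      𝔼 (P zero) (λ a → 𝔼 Q λ v → (Δ₀ a + Δ v) * (Δ₀ a + Δ v))
        ≈⟨ ∫-cong P₀ (λ a → ≈-trans (∫-cong (meas Q) λ v → square (Δ₀ a) (Δ v)) (≈-trans (∫-+ (meas Q) _ _)
             (+-cong (𝔼-const Q _) (≈-trans (∫-+ (meas Q) _ _) (+-congʳ (∫-* (meas Q) (Δ₀ a) _)))))) ⟩
      𝔼 (P zero) (λ a → Δ₀ a * Δ₀ a + (Δ₀ a * 𝔼 Q (λ v → Δ v + Δ v) + 𝔼 Q (λ v → Δ v * Δ v)))
        ≈⟨ ≈-trans (∫-+ P₀ _ _) (+-congˡ (≈-trans (∫-+ P₀ _ _) (+-cong (≈-trans (∫-*ʳ P₀ _ Δ₀) (≈-trans (*-congʳ X-0) (zeroˡ _))) (𝔼-const (P zero) _)))) ⟩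
      𝔼 (P zero) (λ a → Δ₀ a * Δ₀ a) + (0# + 𝔼 Q (λ v → Δ v * Δ v))
        ≈⟨ +-congˡ (+-identityˡ _) ⟩
      𝔼 (P zero) (λ a → Δ₀ a * Δ₀ a) + 𝔼 Q (λ v → Δ v * Δ v) ∎
    single : 𝔼 (P zero) (λ a → Δ₀ a * Δ₀ a) ≤ 𝔼 (P zero) (λ a → h zero a * h zero a)
    single = lin (0≤x² m) (≈-trans (solve 2 (λ m s → m :* m :- con (+ 0) := s :- (s :- (m :+ m) :* m :+ m :* m)) ≈-refl m (𝔼 (P zero) (λ a → h zero a * h zero a)))
      (+-congˡ (-‿cong (≈-sym (begin
        𝔼 (P zero) (λ a → Δ₀ a * Δ₀ a)
          ≈⟨ ∫-cong P₀ (λ a → solve 2 (λ x m → (x :- m) :* (x :- m) := (x :* x :- (m :+ m) :* x) :+ m :* m) ≈-refl (h zero a) m) ⟩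
        𝔼 (P zero) (λ a → h zero a * h zero a - (m + m) * h zero a + m * m)
          ≈⟨ ≈-trans (∫-+ P₀ _ _) (+-cong (≈-trans (∫-- P₀ _ _) (+-congˡ (-‿cong (∫-* P₀ _ _)))) (𝔼-const (P zero) _)) ⟩
        𝔼 (P zero) (λ a → h zero a * h zero a) - (m + m) * m + m * m ∎)))))

  markov : (P : Prob A) (Z : A → ℝ) → (∀ a → 0# ≤ Z a) → ∀ t → 𝔼 P (λ a → ind (does (t ≤? Z a))) * t ≤ 𝔼 P Z
  markov P Z 0≤Z t = ≤-respˡ-≈ (∫-*ʳ (meas P) t _) (∫-mono (meas P) step)
    where
    step : ∀ a → ind (does (t ≤? Z a)) * t ≤ Z a
    step a with t ≤? Z a
    ... | yes p = ≤-respˡ-≈ (≈-sym (*-identityˡ t)) p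
    ... | no  _ = ≤-respˡ-≈ (≈-sym (zeroˡ t)) (0≤Z a)

  -- The way back from functionals to the mass functions in which the theorem is stated.
  lawOn : (EA : Enum A) → Prob A → Distribution (Enum.elems EA)
  lawOn EA P = record
    { mass = λ x → 𝔼 P (λ a → ind (a == x))
    ; nonNeg = λ x → ∫-pos (meas P) λ a → proj₁ (𝕀-ind _)
    ; total = ≈-trans (≈-sym (∫-swap (meas P) (∑M elems) _)) (≈-trans
        (∫-cong (meas P) λ a → ≈-trans (∫-cong (∑M elems) λ x → ≈-sym (*-identityʳ _)) (pick a (λ _ → 1#)))
        (Prob.total-1 P)) }
    where open Enum EA

  lawOn-∼ : (EA : Enum A) (P : Prob A) → ⟦ lawOn EA P ⟧ ∼ P
  lawOn-∼ EA P f = ≈-sym (∑-fibres EA P id f)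

  law : ∀ {n} → Prob (Str n) → Dist n
  law {n} = lawOn (enumVec n)

  law-∼ : ∀ {n} (P : Prob (Str n)) → ⟦ law P ⟧ ∼ P
  law-∼ {n} = lawOn-∼ (enumVec n)

  -- Decision trees on random bit matrices

  module _ {n : ℕ} where

    -- nothing marks an entry that has not been queried.
    Knowledge : ℕ → Set
    Knowledge k = Vec (Vec (Maybe Bool) n) k

    known : ∀ {k} → Knowledge k → Fin k → Fin n → Maybe Bool
    known kn i j = lookup (lookup kn i) j

    record-answer : ∀ {k} → Knowledge k → Fin k → Fin n → Bool → Knowledge k
    record-answer kn i j b = kn [ i ]≔ (lookup kn i [ j ]≔ just b)

    known-recorded : ∀ {k} (kn : Knowledge k) i j b → known (record-answer kn i j b) i j ≡ just b
    known-recorded kn i j b rewrite lookup∘update i kn (lookup kn i [ j ]≔ just b) = lookup∘update j (lookup kn i) (just b)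

    known-other : ∀ {k} (kn : Knowledge k) i j b i′ j′ → ¬ (i ≡ i′ × j ≡ j′) →
                  known (record-answer kn i j b) i′ j′ ≡ known kn i′ j′
    known-other kn i j b i′ j′ ne with i′ ≟ᶠ i
    ... | no p rewrite lookup∘update′ p kn (lookup kn i [ j ]≔ just b) = refl
    ... | yes refl rewrite lookup∘update i kn (lookup kn i [ j ]≔ just b) =
      lookup∘update′ (λ { refl → ne (refl , refl) }) (lookup kn i) (just b)

    blank : Vec (Maybe Bool) n
    blank = replicate n nothing

  module Interpretation {n : ℕ} {O : Set} (acc : O → Bool)
                        {X Y : Set} (Rows : Prob X) (κ : X → Y → ℝ) where

    -- The acceptance probability when entry (x , y) of the bit matrix is 1 with probability κ x y,
    -- independently, given the kinds φ of the columns and ρ of the rows drawn so far.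
    val : Vec Y n → ∀ {k} → Vec X k → Knowledge {n} k → Algorithm n O k → ℝ
    val φ ρ kn (output a)       = ind (acc a)
    val φ ρ kn (coin r _ _ t u) = r * val φ ρ kn t + (1# - r) * val φ ρ kn u
    val φ ρ kn (sample t)       = 𝔼 Rows λ x → val φ (x ∷ ρ) (blank ∷ kn) t
    val φ ρ kn (query i j t) with known kn i j
    ... | just b  = val φ ρ kn (t b)
    ... | nothing = κ (lookup ρ i) (lookup φ j) * val φ ρ (record-answer kn i j true) (t true)
                  + (1# - κ (lookup ρ i) (lookup φ j)) * val φ ρ (record-answer kn i j false) (t false)

    module _ (κ𝕀 : ∀ x y → 𝕀 (κ x y)) where

      val-𝕀 : ∀ φ {k} (ρ : Vec X k) kn t → 𝕀 (val φ ρ kn t)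
      val-𝕀 φ ρ kn (output a)       = 𝕀-ind (acc a)
      val-𝕀 φ ρ kn (coin r p q t u) = 𝕀-mix (p , q) (val-𝕀 φ ρ kn t) (val-𝕀 φ ρ kn u)
      val-𝕀 φ ρ kn (sample t)       = 𝔼-𝕀 Rows λ x → val-𝕀 φ (x ∷ ρ) (blank ∷ kn) t
      val-𝕀 φ ρ kn (query i j t) with known kn i j
      ... | just b  = val-𝕀 φ ρ kn (t b)
      ... | nothing = 𝕀-mix (κ𝕀 _ _) (val-𝕀 φ ρ _ (t true)) (val-𝕀 φ ρ _ (t false))

      bit : Maybe Bool → X → Y → Prob Bool
      bit (just b) x y = dirac b
      bit nothing  x y = bernoulli (κ x y) (κ𝕀 x y)

      rowLaw : Vec Y n → X → Vec (Maybe Bool) n → Prob (Str n)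
      rowLaw φ x kn = indep λ j → bit (lookup kn j) x (lookup φ j)

      rowDist : Vec Y n → Dist n
      rowDist φ = law (bind Rows λ x → rowLaw φ x blank)

      rowLaws : Vec Y n → ∀ {k} → Vec X k → Knowledge k → Prob (Vec (Str n) k)
      rowLaws φ ρ kn = indep λ i → rowLaw φ (lookup ρ i) (lookup kn i)

      set : ∀ {k} → Fin k → Fin n → Bool → Vec (Str n) k → Vec (Str n) k
      set i j b ys = ys [ i ]≔ (lookup ys i [ j ]≔ b)

      lookup-set : ∀ {k} i j b (ys : Vec (Str n) k) → lookup (lookup (set i j b ys) i) j ≡ b
      lookup-set i j b ys = ≡.trans (≡.cong (λ z → lookup z j) (lookup∘update i ys _)) (lookup∘update j (lookup ys i) b)

      module _ (φ : Vec Y n) {k} (ρ : Vec X k) where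

        set-row : ∀ kn i j b (G : Vec (Str n) k → ℝ) → 𝔼 (rowLaws φ ρ kn) (G ∘ set i j b) ≈
                   𝔼 (rowLaw φ (lookup ρ i) (lookup kn i)) λ y → 𝔼 (rowLaws φ ρ kn) λ ys → G (ys [ i ]≔ (y [ j ]≔ b))
        set-row kn i j b G = ≈-trans (indep-resample _ i _) (∫-cong (meas (rowLaw φ (lookup ρ i) (lookup kn i))) λ y →
          ∫-cong (meas (rowLaws φ ρ kn)) λ ys → ≈-reflexive (≡.cong G (≡.trans
            ([]≔-idempotent ys i) (≡.cong (λ z → ys [ i ]≔ (z [ j ]≔ b)) (lookup∘update i ys y)))))

        reveal-bit : ∀ kn i j (G : Vec (Str n) k → ℝ) → 𝔼 (rowLaws φ ρ kn) G ≈
                     𝔼 (bit (known kn i j) (lookup ρ i) (lookup φ j)) λ b → 𝔼 (rowLaws φ ρ kn) (G ∘ set i j b)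
        reveal-bit kn i j G = ≈-trans (indep-resample _ i G) (≈-trans (indep-resample _ j _)
          (∫-cong (meas (bit (known kn i j) _ _)) λ b → ≈-sym (set-row kn i j b G)))

        -- The laws for `kn` and for `record-answer kn i j b` differ only at entry (i, j), which
        -- `set` overwrites. Under the latter this entry already is the point mass at `b`, so
        -- overwriting it changes nothing.
        set-recorded : ∀ kn i j b (G : Vec (Str n) k → ℝ) →
                        𝔼 (rowLaws φ ρ kn) (G ∘ set i j b) ≈ 𝔼 (rowLaws φ ρ (record-answer kn i j b)) G
        set-recorded kn i j b G = ≈-trans (set-row kn i j b G) (≈-trans middle (≈-trans (≈-sym (set-row kn′ i j b G)) fixed))
          where
          kn′ = record-answer kn i j b
          fixed : 𝔼 (rowLaws φ ρ kn′) (G ∘ set i j b) ≈ 𝔼 (rowLaws φ ρ kn′) G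
          fixed with reveal-bit kn′ i j G
          ... | e rewrite known-recorded kn i j b = ≈-sym e
          same : ∀ {a a′ x y} → a ≡ a′ → bit a x y ∼ bit a′ x y
          same refl f = ≈-refl
          middle : 𝔼 (rowLaw φ (lookup ρ i) (lookup kn i)) (λ y → 𝔼 (rowLaws φ ρ kn) λ ys → G (ys [ i ]≔ (y [ j ]≔ b))) ≈
                   𝔼 (rowLaw φ (lookup ρ i) (lookup kn′ i)) (λ y → 𝔼 (rowLaws φ ρ kn′) λ ys → G (ys [ i ]≔ (y [ j ]≔ b)))
          middle = ≈-trans
            (indep-update (λ j → bit (known kn i j) (lookup ρ i) (lookup φ j)) (λ j → bit (known kn′ i j) (lookup ρ i) (lookup φ j)) j b
              (λ j′ ne → same (≡.sym (known-other kn i j b i j′ λ (_ , p) → ne (≡.sym p))))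
              (λ y → 𝔼 (rowLaws φ ρ kn) λ ys → G (ys [ i ]≔ y)))
            (∫-cong (meas (rowLaw φ (lookup ρ i) (lookup kn′ i))) λ y → indep-update (λ i → rowLaw φ (lookup ρ i) (lookup kn i)) (λ i → rowLaw φ (lookup ρ i) (lookup kn′ i)) i (y [ j ]≔ b)
              (λ i′ ne → indep-cong λ j′ → same (≡.sym (known-other kn i j b i′ j′ λ (p , _) → ne (≡.sym p)))) G)

      -- Deferred decisions: tossing the bit of an entry at its first query is the same as drawing
      -- the whole row when it is sampled. The induction needs arbitrary knowledge `kn`, on which
      -- the rows `ys` are conditioned.
      val≈prob : ∀ φ {k} (ρ : Vec X k) kn t → val φ ρ kn t ≈ 𝔼 (rowLaws φ ρ kn) λ ys → probFrom (rowDist φ) acc ys t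
      val≈prob φ ρ kn (output a) = ≈-sym (𝔼-const (rowLaws φ ρ kn) _)
      val≈prob φ ρ kn (coin r p q t u) = ≈-trans (+-cong (*-congˡ (val≈prob φ ρ kn t)) (*-congˡ (val≈prob φ ρ kn u)))
        (≈-sym (≈-trans (∫-+ L _ _) (+-cong (∫-* L r _) (∫-* L (1# - r) _))))
        where L = meas (rowLaws φ ρ kn)
      val≈prob φ ρ kn (sample t) = ≈-trans (∫-cong (meas Rows) λ x → val≈prob φ (x ∷ ρ) (blank ∷ kn) t) (≈-sym (≈-trans
        (∫-cong (meas (rowLaws φ ρ kn)) λ ys → law-∼ (bind Rows λ x → rowLaw φ x blank) (λ y → probFrom (rowDist φ) acc (y ∷ ys) t))
        (≈-trans (∫-swap (meas (rowLaws φ ρ kn)) (meas Rows) _)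
          (∫-cong (meas Rows) λ x → ∫-swap (meas (rowLaws φ ρ kn)) (meas (rowLaw φ x blank)) _))))
      val≈prob φ {k} ρ kn (query i j t) = go
        where
        L = meas (rowLaws φ ρ kn)
        pr : Vec (Str n) k → Algorithm n O k → ℝ
        pr ys u = probFrom (rowDist φ) acc ys u
        G : Vec (Str n) k → ℝ
        G ys = pr ys (t (lookup (lookup ys i) j))
        answered : ∀ b → ∫ L (G ∘ set i j b) ≈ ∫ L (λ ys → pr (set i j b ys) (t b))
        answered b = ∫-cong L λ ys → ≈-reflexive (≡.cong (λ c → pr (set i j b ys) (t c)) (lookup-set i j b ys))
        go : val φ ρ kn (query i j t) ≈ ∫ L G
        go with known kn i j in eq
        ... | just b  = ≈-trans (val≈prob φ ρ kn (t b)) (≈-trans (reveal λ ys → pr ys (t b)) (≈-sym (≈-trans (reveal G) (answered b))))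
          where
          reveal : (H : Vec (Str n) k → ℝ) → ∫ L H ≈ ∫ L (H ∘ set i j b)
          reveal H with reveal-bit φ ρ kn i j H
          ... | e rewrite eq = e
        ... | nothing = ≈-sym (≈-trans reveal (+-cong (*-congˡ (half true)) (*-congˡ (half false))))
          where
          reveal : ∫ L G ≈ κ (lookup ρ i) (lookup φ j) * ∫ L (G ∘ set i j true)
                           + (1# - κ (lookup ρ i) (lookup φ j)) * ∫ L (G ∘ set i j false)
          reveal with reveal-bit φ ρ kn i j G
          ... | e rewrite eq = e
          half : ∀ b → ∫ L (G ∘ set i j b) ≈ val φ ρ (record-answer kn i j b) (t b)
          half b = ≈-trans (answered b) (≈-trans (set-recorded φ ρ kn i j b λ ys → pr ys (t b)) (≈-sym (val≈prob φ ρ _ (t b))))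

  ⊴-mix : ∀ {r a b c} → 𝕀 r → a ⊴ c → b ⊴ c → r * a + (1# - r) * b ⊴ c
  ⊴-mix {r} {a} {b} i (p , q) (p′ , q′) = mix-≤ i p p′ , ≤-respˡ-≈
    (solve 3 (λ r a b → r :* :- a :+ (con (+ 1) :- r) :* :- b := :- (r :* a :+ (con (+ 1) :- r) :* b)) ≈-refl r a b)
    (mix-≤ i q q′)

  ∫-mix : (M : Meas A) → ∀ r (f g : A → ℝ) → ∫ M (λ a → r * f a + (1# - r) * g a) ≈ r * ∫ M f + (1# - r) * ∫ M g
  ∫-mix M r f g = ≈-trans (∫-+ M _ _) (+-cong (∫-* M r f) (∫-* M (1# - r) g))

  infixr 3 _⊗_
  _⊗_ : Prob A → Prob B → Prob (A × B)
  P ⊗ Q = bind P λ a → bind Q λ b → dirac (a , b)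

  2^_ : ℕ → ℝ
  2^ n = fromℕ 2 ^ n

  1≤2^ : ∀ n → 1# ≤ 2^ n
  1≤2^ zero    = ≤-refl
  1≤2^ (suc n) = ≤-respˡ-≈ (*-identityˡ 1#) (mul-mono 0≤1 (1≤fromℕ 2) (≤-trans 0≤1 (1≤2^ n)) (1≤2^ n))

  0≤2^ : ∀ n → 0# ≤ 2^ n
  0≤2^ n = ≤-trans 0≤1 (1≤2^ n)

  -- These are the test functions of the cut norm, with factors in [0,1] instead of sets.
  Rank1 : (A → B → ℝ) → Set
  Rank1 {A} {B} w = ∃ λ (F : A → ℝ) → ∃ λ (G : B → ℝ) → (∀ a → 𝕀 (F a)) × (∀ b → 𝕀 (G b)) × (∀ a b → w a b ≈ F a * G b)

  rank1-*ˡ : {w : A → B → ℝ} → Rank1 w → (e : A → B → ℝ) (α : A → ℝ) → (∀ a → 𝕀 (α a)) → (∀ a b → e a b ≈ α a) → Rank1 (λ a b → w a b * e a b)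
  rank1-*ˡ (F , G , iF , iG , eq) e α iα p = (λ a → F a * α a) , G , (λ a → 𝕀-* (iF a) (iα a)) , iG , λ a b → ≈-trans (*-cong (eq a b) (p a b))
    (solve 3 (λ f g a → f :* g :* a := f :* a :* g) ≈-refl (F a) (G b) (α a))

  rank1-*ʳ : {w : A → B → ℝ} → Rank1 w → (e : A → B → ℝ) (β : B → ℝ) → (∀ b → 𝕀 (β b)) → (∀ a b → e a b ≈ β b) → Rank1 (λ a b → w a b * e a b)
  rank1-*ʳ (F , G , iF , iG , eq) e β iβ p = F , (λ b → G b * β b) , iF , (λ b → 𝕀-* (iG b) (iβ b)) , λ a b → ≈-trans (*-cong (eq a b) (p a b)) (*-assoc _ _ _)

  -- An entry other than (i, j) lies in another column or in another row. It thus depends on at most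
  -- one of `r` and `c`, and its factor can be absorbed into `F` or into `G`.
  rank1-entry : ∀ {X Y : Set} {n k} (K : X → Y → ℝ) → (∀ x y → 𝕀 (K x y)) → (φ : Vec Y n) (ρ : Vec X k) →
                ∀ i j i′ j′ → ¬ (i ≡ i′ × j ≡ j′) → {w : X → Y → ℝ} → Rank1 w →
                Rank1 (λ r c → w r c * K (lookup (ρ [ i ]≔ r) i′) (lookup (φ [ j ]≔ c) j′))
  rank1-entry K iK φ ρ i j i′ j′ ne rw with j′ ≟ᶠ j
  ... | no p = rank1-*ˡ rw _ (λ r → K (lookup (ρ [ i ]≔ r) i′) (lookup φ j′)) (λ _ → iK _ _)
        (λ r c → ≈-reflexive (≡.cong (K _) (lookup∘update′ p φ c)))
  ... | yes refl = rank1-*ʳ rw _ (λ c → K (lookup ρ i′) (lookup (φ [ j ]≔ c) j)) (λ _ → iK _ _)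
        (λ r c → ≈-reflexive (≡.cong (λ x → K x _) (lookup∘update′ (λ e → ne (≡.sym e , refl)) ρ r)))

  module Counting {n : ℕ} {O : Set} (acc : O → Bool) {X Y : Set} (Rows : Prob X) (Cols : Prob Y)
    (κ κ₀ : X → Y → ℝ) (κ𝕀 : ∀ x y → 𝕀 (κ x y)) (κ₀𝕀 : ∀ x y → 𝕀 (κ₀ x y))
    (ζ θ : ℝ) (0≤ζ : 0# ≤ ζ) (0≤θ : 0# ≤ θ)
    (close : ∀ w → Rank1 w → 𝔼 (Rows ⊗ Cols) (λ (x , y) → w x y * (κ x y - κ₀ x y)) ⊴ ζ * (θ + 𝔼 (Rows ⊗ Cols) (λ (x , y) → w x y)))
    where

    private
      module I = Interpretation {n} acc Rows κ
      module I₀ = Interpretation {n} acc Rows κ₀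
      RC = Rows ⊗ Cols
      D = λ x y → κ x y - κ₀ x y

    bound : ℕ → ℝ → ℝ
    bound Q m = ζ * (2^ Q * θ + m)

    -- The remaining tree still depends on the resampled row and column, so it is expanded down to
    -- its leaves. A query splits `w` into two product weights whose masses add up to that of `w`,
    -- and only the term ζθ doubles. As (i, j) is already known, its own factor never enters a
    -- weight.
    entry-bound : ∀ Q φ {k} (ρ : Vec X k) kn i j b → known kn i j ≡ just b → ∀ t → queries t ℕ.≤ Q → ∀ w → Rank1 w →
      𝔼 RC (λ (r , c) → w r c * D r c * I.val (φ [ j ]≔ c) (ρ [ i ]≔ r) kn t) ⊴ bound Q (𝔼 RC λ (r , c) → w r c)
    entry-bound Q φ ρ kn i j b kb (output a) _ w rw with acc a
    ... | true  = ⊴-cong (∫-cong (meas RC) λ _ → ≈-sym (*-identityʳ _)) (⊴-≤ (close w rw)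
          (0≤ζ ⊛ (≤-respˡ-≈ (*-identityˡ θ) (mul-mono 0≤1 (1≤2^ Q) 0≤θ ≤-refl) ⊕ ≤-refl)))
    ... | false = ⊴-0 (∫-0 (meas RC) λ _ → zeroʳ _) (*-nonNeg 0≤ζ (0≤-+ (*-nonNeg (0≤2^ Q) 0≤θ)
          (∫-pos (meas RC) λ (r , c) → ≤-respʳ-≈ (≈-sym (proj₂ (proj₂ (proj₂ (proj₂ rw))) r c))
            (*-nonNeg (proj₁ (proj₁ (proj₂ (proj₂ rw)) r)) (proj₁ (proj₁ (proj₂ (proj₂ (proj₂ rw))) c))))))
    entry-bound Q φ ρ kn i j b kb (coin r p q t u) le w rw = ⊴-cong
      (≈-sym (≈-trans (∫-cong (meas RC) λ (x , y) → solve 5 (λ a r s x y → a :* (r :* x :+ s :* y) := r :* (a :* x) :+ s :* (a :* y)) ≈-refl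
         (w x y * D x y) r (1# - r) (I.val (φ [ j ]≔ y) (ρ [ i ]≔ x) kn t) (I.val (φ [ j ]≔ y) (ρ [ i ]≔ x) kn u)) (∫-mix (meas RC) r _ _)))
      (⊴-mix (p , q) (entry-bound Q φ ρ kn i j b kb t (ℕₚ.m⊔n≤o⇒m≤o (queries t) _ le) w rw)
                     (entry-bound Q φ ρ kn i j b kb u (ℕₚ.m⊔n≤o⇒n≤o (queries t) _ le) w rw))
    entry-bound Q φ ρ kn i j b kb (sample t) le w rw = ⊴-cong
      (≈-sym (≈-trans (∫-cong (meas RC) λ (r , c) → ≈-sym (∫-* (meas Rows) _ _)) (∫-swap (meas RC) (meas Rows) _)))
      (𝔼-⊴ Rows λ x → entry-bound Q φ (x ∷ ρ) (blank ∷ kn) (suc i) j b kb t le w rw)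
    entry-bound Q φ {k} ρ kn i j b kb (query i′ j′ t) le w rw with known kn i′ j′ in eq
    ... | just b′ = entry-bound Q φ ρ kn i j b kb (t b′) (≤t b′) w rw
      where
      ≤t : ∀ b′ → queries (t b′) ℕ.≤ Q
      ≤t false = ℕₚ.≤-trans (ℕₚ.m≤n⇒m≤1+n (ℕₚ.m≤m⊔n _ _)) le
      ≤t true  = ℕₚ.≤-trans (ℕₚ.m≤n⇒m≤1+n (ℕₚ.m≤n⊔m (queries (t false)) _)) le
    entry-bound (suc Q) φ {k} ρ kn i j b kb (query i′ j′ t) (s≤s le) w rw | nothing =
      ⊴-cong (≈-sym split) (⊴-≤ (⊴-+
        (entry-bound Q φ ρ (rec true) i j b (kb′ true) (t true) (ℕₚ.m⊔n≤o⇒n≤o (queries (t false)) _ le) w₁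
          (rank1-entry κ κ𝕀 φ ρ i j i′ j′ ne rw))
        (entry-bound Q φ ρ (rec false) i j b (kb′ false) (t false) (ℕₚ.m⊔n≤o⇒m≤o (queries (t false)) _ le) w₀
          (rank1-entry (λ x y → 1# - κ x y) (λ x y → 𝕀-not (κ𝕀 x y)) φ ρ i j i′ j′ ne rw)))
        (≤-reflexive (≈-trans
          (solve 5 (λ z p θ m₁ m₀ → z :* (p :* θ :+ m₁) :+ z :* (p :* θ :+ m₀) := z :* (con (+ 2) :* p :* θ :+ (m₁ :+ m₀))) ≈-refl ζ (2^ Q) θ _ _)
          (*-congˡ (+-congˡ mass-split)))))
      where
      rec = record-answer kn i′ j′
      ne : ¬ (i ≡ i′ × j ≡ j′)
      ne (refl , refl) with ≡.trans (≡.sym kb) eq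
      ... | ()
      kb′ : ∀ b′ → known (rec b′) i j ≡ just b
      kb′ b′ = ≡.trans (known-other kn i′ j′ b′ i j λ (p , q) → ne (≡.sym p , ≡.sym q)) kb
      e = λ r c → κ (lookup (ρ [ i ]≔ r) i′) (lookup (φ [ j ]≔ c) j′)
      w₁ = λ r c → w r c * e r c
      w₀ = λ r c → w r c * (1# - e r c)
      v = λ b′ r c → I.val (φ [ j ]≔ c) (ρ [ i ]≔ r) (rec b′) (t b′)
      split : 𝔼 RC (λ (r , c) → w r c * D r c * (e r c * v true r c + (1# - e r c) * v false r c)) ≈
              𝔼 RC (λ (r , c) → w₁ r c * D r c * v true r c) + 𝔼 RC (λ (r , c) → w₀ r c * D r c * v false r c)
      split = ≈-trans (∫-cong (meas RC) λ (r , c) → solve 6 (λ w d e f x y → w :* d :* (e :* x :+ f :* y) := w :* e :* d :* x :+ w :* f :* d :* y)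
        ≈-refl (w r c) (D r c) (e r c) (1# - e r c) (v true r c) (v false r c)) (∫-+ (meas RC) _ _)
      mass-split : 𝔼 RC (λ (r , c) → w₁ r c) + 𝔼 RC (λ (r , c) → w₀ r c) ≈ 𝔼 RC (λ (r , c) → w r c)
      mass-split = ≈-trans (≈-sym (∫-+ (meas RC) _ _)) (∫-cong (meas RC) λ (r , c) →
        solve 2 (λ w e → w :* e :+ w :* (con (+ 1) :- e) := w) ≈-refl (w r c) (e r c))

    private
      FR : ∀ k → Prob (Vec Y n × Vec X k)
      FR k = indep (λ _ → Cols) ⊗ indep (λ _ → Rows)

    resample-entry : ∀ {k} i j (h : Vec Y n → Vec X k → ℝ) → 𝔼 (FR k) (λ (φ , ρ) → h φ ρ) ≈
                     𝔼 (FR k) λ (φ , ρ) → 𝔼 RC λ (r , c) → h (φ [ j ]≔ c) (ρ [ i ]≔ r)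
    resample-entry {k} i j h = ≈-trans (indep-resample (λ _ → Cols) j _) (≈-trans
      (∫-swap (meas Cols) (meas Φ) _) (∫-cong (meas Φ) λ φ → ≈-trans
        (∫-cong (meas Cols) λ c → indep-resample (λ _ → Rows) i (h (φ [ j ]≔ c)))
        (≈-trans (∫-swap (meas Cols) (meas Rows) _) (≈-trans
          (∫-cong (meas Rows) λ r → ∫-swap (meas Cols) (meas P) _)
          (∫-swap (meas Rows) (meas P) _)))))
      where
      Φ = indep {n = n} (λ _ → Cols)
      P = indep {n = k} (λ _ → Rows)

    -- A factor from entry (i, j) itself would spoil the product form in row i and column j, but
    -- once it is there the entry is known. Every entry that can still be queried afresh thus meets
    -- a product weight.
    Separable : ∀ {k} → Knowledge k → (Vec Y n → Vec X k → ℝ) → Set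
    Separable kn ω = ∀ i j → known kn i j ≡ nothing → ∀ φ ρ → Rank1 (λ r c → ω (φ [ j ]≔ c) (ρ [ i ]≔ r))

    total-bound : ℕ → ℝ → ℝ
    total-bound Q m = fromℕ Q * (ζ * (2^ Q * θ + (m + m)))

    -- `ω` stands for the probability under `κ₀` of the path so far. At a fresh entry the difference
    -- splits into the change of this entry, followed by the rest of the tree under `κ`, and the
    -- differences for the two subtrees, weighted by their paths. Each of the `Q` levels pays at
    -- most ζ (2^Q θ + 2 mass).
    path-bound : ∀ Q {k} kn (t : Algorithm n O k) → queries t ℕ.≤ Q → ∀ (ω : Vec Y n → Vec X k → ℝ) → (∀ φ ρ → 𝕀 (ω φ ρ)) → Separable kn ω →
      𝔼 (FR k) (λ (φ , ρ) → ω φ ρ * (I.val φ ρ kn t - I₀.val φ ρ kn t)) ⊴ total-bound Q (𝔼 (FR k) λ (φ , ρ) → ω φ ρ)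
    path-bound Q {k} kn (output a) le ω iω sp = ⊴-0 (∫-0 (meas (FR k)) λ _ → ≈-trans (*-congˡ (-‿inverseʳ _)) (zeroʳ _))
      (*-nonNeg (0≤fromℕ Q) (*-nonNeg 0≤ζ (0≤-+ (*-nonNeg (0≤2^ Q) 0≤θ) (0≤-+ 0≤m 0≤m))))
      where 0≤m = ∫-pos (meas (FR k)) λ (φ , ρ) → proj₁ (iω φ ρ)
    path-bound Q {k} kn (coin r p q t u) le ω iω sp = ⊴-cong
      (≈-sym (≈-trans (∫-cong (meas (FR k)) λ (φ , ρ) → solve 7 (λ w r s x y x′ y′ → w :* ((r :* x :+ s :* y) :- (r :* x′ :+ s :* y′)) := r :* (w :* (x :- x′)) :+ s :* (w :* (y :- y′)))
         ≈-refl (ω φ ρ) r (1# - r) (I.val φ ρ kn t) (I.val φ ρ kn u) (I₀.val φ ρ kn t) (I₀.val φ ρ kn u)) (∫-mix (meas (FR k)) r _ _)))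
      (⊴-mix (p , q) (path-bound Q kn t (ℕₚ.m⊔n≤o⇒m≤o (queries t) _ le) ω iω sp) (path-bound Q kn u (ℕₚ.m⊔n≤o⇒n≤o (queries t) _ le) ω iω sp))
    path-bound Q {k} kn (sample t) le ω iω sp = ⊴-cong
      (≈-sym (∫-cong (meas (indep {n = n} λ _ → Cols)) λ φ → ≈-trans
        (∫-cong (meas (indep {n = k} λ _ → Rows)) λ ρ → ≈-trans (*-congˡ (≈-sym (∫-- (meas Rows) _ _))) (≈-sym (∫-* (meas Rows) _ _)))
        (∫-swap (meas (indep {n = k} λ _ → Rows)) (meas Rows) _)))
      (⊴-≤ (path-bound Q (blank ∷ kn) t le ω′ (λ { φ (x ∷ ρ) → iω φ ρ }) sp′)
        (≤-reflexive (*-congˡ (*-congˡ (+-congˡ (+-cong same same))))))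
      where
      ω′ : Vec Y n → Vec X (suc k) → ℝ
      ω′ φ (x ∷ ρ) = ω φ ρ
      sp′ : Separable (blank ∷ kn) ω′
      -- A row just sampled does not occur in the weight yet, so its factor is constant.
      sp′ zero j _ φ (x ∷ ρ) = (λ _ → 1#) , (λ c → ω (φ [ j ]≔ c) ρ) , (λ _ → 𝕀-1) , (λ c → iω _ ρ) , λ _ _ → ≈-sym (*-identityˡ _)
      sp′ (suc i) j e φ (x ∷ ρ) = sp i j e φ ρ
      same : 𝔼 (FR (suc k)) (λ (φ , ρ) → ω′ φ ρ) ≈ 𝔼 (FR k) (λ (φ , ρ) → ω φ ρ)
      same = ∫-cong (meas (indep {n = n} λ _ → Cols)) λ φ → 𝔼-const Rows _
    path-bound Q {k} kn (query i j t) le ω iω sp with known kn i j in eq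
    ... | just b = path-bound Q kn (t b) (≤t b) ω iω sp
      where
      ≤t : ∀ b′ → queries (t b′) ℕ.≤ Q
      ≤t false = ℕₚ.≤-trans (ℕₚ.m≤n⇒m≤1+n (ℕₚ.m≤m⊔n _ _)) le
      ≤t true  = ℕₚ.≤-trans (ℕₚ.m≤n⇒m≤1+n (ℕₚ.m≤n⊔m (queries (t false)) _)) le
    path-bound (suc Q) {k} kn (query i j t) (s≤s le) ω iω sp | nothing = ⊴-cong (≈-sym split) (⊴-≤
        (⊴-+ (⊴-+ (focused true le₁) (⊴-neg (focused false le₀)))
             (⊴-+ (path-bound Q (rec true) (t true) le₁ ω₁ (λ φ ρ → 𝕀-* (iω φ ρ) (κ₀𝕀 _ _)) (separable true κ₀ κ₀𝕀))
                  (path-bound Q (rec false) (t false) le₀ ω₀ (λ φ ρ → 𝕀-* (iω φ ρ) (𝕀-not (κ₀𝕀 _ _)))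
                     (separable false (λ x y → 1# - κ₀ x y) (λ x y → 𝕀-not (κ₀𝕀 x y))))))
        (≤-reflexive (≈-trans
          (+-congʳ (+-cong (*-congˡ (+-congˡ (≈-sym mass-split))) (*-congˡ (+-congˡ (≈-sym mass-split)))))
          (≈-trans (solve 6 (λ z p θ m₁ m₀ Q →
              z :* (p :* θ :+ (m₁ :+ m₀)) :+ z :* (p :* θ :+ (m₁ :+ m₀)) :+ (Q :* (z :* (p :* θ :+ (m₁ :+ m₁))) :+ Q :* (z :* (p :* θ :+ (m₀ :+ m₀))))
              := (con (+ 1) :+ Q) :* (z :* (con (+ 2) :* p :* θ :+ (m₁ :+ m₀ :+ (m₁ :+ m₀))))) ≈-refl ζ (2^ Q) θ _ _ (fromℕ Q))
            (*-congˡ (*-congˡ (+-congˡ (+-cong mass-split mass-split))))))))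
      where
      M = meas (FR k)
      rec = record-answer kn i j
      le₁ = ℕₚ.m⊔n≤o⇒n≤o (queries (t false)) _ le
      le₀ = ℕₚ.m⊔n≤o⇒m≤o (queries (t false)) _ le
      v = λ b φ ρ → I.val φ ρ (rec b) (t b)
      v₀ = λ b φ ρ → I₀.val φ ρ (rec b) (t b)
      at : (X → Y → ℝ) → Vec Y n → Vec X k → ℝ
      at K φ ρ = K (lookup ρ i) (lookup φ j)
      ω₁ = λ φ ρ → ω φ ρ * at κ₀ φ ρ
      ω₀ = λ φ ρ → ω φ ρ * (1# - at κ₀ φ ρ)
      m = ∫ M λ (φ , ρ) → ω φ ρ
      mass-split : ∫ M (λ (φ , ρ) → ω₁ φ ρ) + ∫ M (λ (φ , ρ) → ω₀ φ ρ) ≈ m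
      mass-split = ≈-trans (≈-sym (∫-+ M _ _)) (∫-cong M λ (φ , ρ) →
        solve 2 (λ w e → w :* e :+ w :* (con (+ 1) :- e) := w) ≈-refl (ω φ ρ) (at κ₀ φ ρ))
      separable : ∀ b K → (∀ x y → 𝕀 (K x y)) → Separable (rec b) (λ φ ρ → ω φ ρ * at K φ ρ)
      separable b K iK i′ j′ e φ ρ = rank1-entry K iK φ ρ i′ j′ i j ne (sp i′ j′ (≡.trans (≡.sym (known-other kn i j b i′ j′ (λ (p , q) → ne (≡.sym p , ≡.sym q)))) e) φ ρ)
        where
        ne : ¬ (i′ ≡ i × j′ ≡ j)
        ne (refl , refl) with ≡.trans (≡.sym e) (known-recorded kn i j b)
        ... | ()
      focused : ∀ b → queries (t b) ℕ.≤ Q → ∫ M (λ (φ , ρ) → ω φ ρ * at D φ ρ * v b φ ρ) ⊴ bound Q m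
      focused b leb = ⊴-cong (≈-sym (≈-trans (resample-entry i j λ φ ρ → ω φ ρ * at D φ ρ * v b φ ρ) (∫-cong M λ (φ , ρ) → ∫-cong (meas RC) λ (r , c) →
          *-congʳ (*-congˡ (≈-reflexive (≡.cong₂ D (lookup∘update i ρ r) (lookup∘update j φ c)))))))
        (⊴-≤ (∫-⊴ M λ (φ , ρ) → entry-bound Q φ ρ (rec b) i j b (known-recorded kn i j b) (t b) leb _ (sp i j eq φ ρ))
          (≤-reflexive (≈-trans (∫-* M ζ _) (*-congˡ (≈-trans (∫-+ M _ _) (+-cong (𝔼-const (FR k) _) (≈-sym (resample-entry i j ω))))))))
      split : ∫ M (λ (φ , ρ) → ω φ ρ * ((at κ φ ρ * v true φ ρ + (1# - at κ φ ρ) * v false φ ρ) - (at κ₀ φ ρ * v₀ true φ ρ + (1# - at κ₀ φ ρ) * v₀ false φ ρ)))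
        ≈ ∫ M (λ (φ , ρ) → ω φ ρ * at D φ ρ * v true φ ρ) + - ∫ M (λ (φ , ρ) → ω φ ρ * at D φ ρ * v false φ ρ)
          + (∫ M (λ (φ , ρ) → ω₁ φ ρ * (v true φ ρ - v₀ true φ ρ)) + ∫ M (λ (φ , ρ) → ω₀ φ ρ * (v false φ ρ - v₀ false φ ρ)))
      split = ≈-trans (∫-cong M λ (φ , ρ) → solve 7 (λ w a a′ x y x′ y′ →
          w :* ((a :* x :+ (con (+ 1) :- a) :* y) :- (a′ :* x′ :+ (con (+ 1) :- a′) :* y′))
          := (w :* (a :- a′) :* x :- w :* (a :- a′) :* y) :+ (w :* a′ :* (x :- x′) :+ w :* (con (+ 1) :- a′) :* (y :- y′))) ≈-refl
          (ω φ ρ) (at κ φ ρ) (at κ₀ φ ρ) (v true φ ρ) (v false φ ρ) (v₀ true φ ρ) (v₀ false φ ρ))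
        (≈-trans (∫-+ M _ _) (+-cong (∫-- M _ _) (∫-+ M _ _)))

    counting : ∀ Q t → queries t ℕ.≤ Q →
      𝔼 (indep λ _ → Cols) (λ φ → I.val φ [] [] t) - 𝔼 (indep λ _ → Cols) (λ φ → I₀.val φ [] [] t) ⊴ total-bound Q 1#
    counting Q t le = ⊴-cong
      (≈-trans (∫-cong M λ φ → *-identityˡ _) (∫-- M _ _))
      (⊴-≤ (path-bound Q [] t le (λ _ _ → 1#) (λ _ _ → 𝕀-1) λ ()) (≤-reflexive (*-congˡ (*-congˡ (+-congˡ (+-cong one one))))))
      where
      M = meas (indep {n = n} λ _ → Cols)
      one : 𝔼 (FR 0) (λ _ → 1#) ≈ 1#
      one = 𝔼-const (FR 0) 1#

  -- Changing the laws of rows and columns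

  Close : ℝ → Prob A → Prob A → Set
  Close {A} γ P Q = ∀ (f : A → ℝ) → (∀ a → 𝕀 (f a)) → 𝔼 P f - 𝔼 Q f ⊴ γ

  close-step : ∀ {γ δ} {P Q : Prob A} → Close γ P Q → (h h′ : A → ℝ) → (∀ a → h a - h′ a ⊴ δ) → (∀ a → 𝕀 (h′ a)) →
               𝔼 P h - 𝔼 Q h′ ⊴ γ + δ
  close-step {P = P} {Q} cl h h′ p i = ⊴-cong
    (≈-trans (+-congˡ (∫-- (meas P) h h′)) (solve 3 (λ a b c → (b :- c) :+ (a :- b) := a :- c) ≈-refl (𝔼 P h) (𝔼 P h′) (𝔼 Q h′)))
    (⊴-+ (cl h′ i) (𝔼-⊴ P p))

  indep-fixed : ∀ {n} (P : Fin n → Prob A) j c (F : A → Vec A n → ℝ) →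
                𝔼 (indep (fix P j c)) (λ v → F (lookup v j) v) ≈ 𝔼 (indep (fix P j c)) (F c)
  indep-fixed P j c F = ≈-trans (≈-sym (indep-fix P j c _)) (≈-trans
    (∫-cong (meas (indep P)) λ v → ≈-reflexive (≡.cong (λ x → F x (v [ j ]≔ c)) (lookup∘update j v c)))
    (indep-fix P j c (F c)))

  module ChangeOfMeasure {n : ℕ} {O : Set} (acc : O → Bool) {X Y : Set} (Rows Rows′ : Prob X)
    (κ : X → Y → ℝ) (κ𝕀 : ∀ x y → 𝕀 (κ x y)) (γr γc : ℝ) (0≤γr : 0# ≤ γr) (0≤γc : 0# ≤ γc) (closeR : Close γr Rows Rows′) where

    private
      module I = Interpretation {n} acc Rows κ
      module I′ = Interpretation {n} acc Rows′ κ

    -- A hybrid argument in which the kind of a column is revealed only when one of its entries is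
    -- queried; afterwards the two laws agree there. So the cost is counted per query and not over
    -- all n columns.
    changeOfMeasure : ∀ S Q {k} (t : Algorithm n O k) → samples t ℕ.≤ S → queries t ℕ.≤ Q →
      ∀ (P P′ : Fin n → Prob Y) → (∀ j → Close γc (P j) (P′ j)) → ∀ ρ kn →
      𝔼 (indep P) (λ φ → I.val φ ρ kn t) - 𝔼 (indep P′) (λ φ → I′.val φ ρ kn t) ⊴ fromℕ S * γr + fromℕ Q * γc
    changeOfMeasure S Q (output a) ls lq P P′ cl ρ kn = ⊴-0
      (≈-trans (+-cong (𝔼-const (indep P) _) (-‿cong (𝔼-const (indep P′) _))) (-‿inverseʳ _))
      (0≤-+ (*-nonNeg (0≤fromℕ S) 0≤γr) (*-nonNeg (0≤fromℕ Q) 0≤γc))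
    changeOfMeasure S Q (coin r p q t u) ls lq P P′ cl ρ kn = ⊴-cong
      (≈-trans (solve 6 (λ r s x y x′ y′ → r :* (x :- x′) :+ s :* (y :- y′) := (r :* x :+ s :* y) :- (r :* x′ :+ s :* y′)) ≈-refl r (1# - r) _ _ _ _)
        (≈-sym (+-cong (∫-mix (meas (indep P)) r _ _) (-‿cong (∫-mix (meas (indep P′)) r _ _)))))
      (⊴-mix (p , q) (changeOfMeasure S Q t (ℕₚ.m⊔n≤o⇒m≤o (samples t) _ ls) (ℕₚ.m⊔n≤o⇒m≤o (queries t) _ lq) P P′ cl ρ kn)
                     (changeOfMeasure S Q u (ℕₚ.m⊔n≤o⇒n≤o (samples t) _ ls) (ℕₚ.m⊔n≤o⇒n≤o (queries t) _ lq) P P′ cl ρ kn))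
    changeOfMeasure (suc S) Q (sample t) (s≤s ls) lq P P′ cl ρ kn = ⊴-cong
      (≈-sym (+-cong (∫-swap (meas (indep P)) (meas Rows) _) (-‿cong (∫-swap (meas (indep P′)) (meas Rows′) _))))
      (⊴-≤ (close-step {P = Rows} {Rows′} closeR _ _ (λ x → changeOfMeasure S Q t ls lq P P′ cl (x ∷ ρ) (blank ∷ kn))
              (λ x → 𝔼-𝕀 (indep P′) λ φ → I′.val-𝕀 κ𝕀 φ (x ∷ ρ) (blank ∷ kn) t))
        (≤-reflexive (solve 4 (λ s r q c → r :+ (s :* r :+ q :* c) := (con (+ 1) :+ s) :* r :+ q :* c) ≈-refl (fromℕ S) γr (fromℕ Q) γc)))
    changeOfMeasure S Q (query i j t) ls lq P P′ cl ρ kn with known kn i j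
    ... | just b = changeOfMeasure S Q (t b) (≤s b) (≤q b) P P′ cl ρ kn
      where
      ≤s : ∀ b → samples (t b) ℕ.≤ S
      ≤s false = ℕₚ.m⊔n≤o⇒m≤o (samples (t false)) _ ls
      ≤s true  = ℕₚ.m⊔n≤o⇒n≤o (samples (t false)) _ ls
      ≤q : ∀ b → queries (t b) ℕ.≤ Q
      ≤q false = ℕₚ.≤-trans (ℕₚ.m≤n⇒m≤1+n (ℕₚ.m≤m⊔n _ _)) lq
      ≤q true  = ℕₚ.≤-trans (ℕₚ.m≤n⇒m≤1+n (ℕₚ.m≤n⊔m (queries (t false)) _)) lq
    changeOfMeasure S (suc Q) (query i j t) ls (s≤s lq) P P′ cl ρ kn | nothing = ⊴-cong
      (≈-sym (+-cong (indep-reveal P j _) (-‿cong (indep-reveal P′ j _))))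
      (⊴-≤ (close-step {P = P j} {P′ j} (cl j) _ _ inner (λ c → 𝔼-𝕀 (indep (fix P′ j c)) λ φ → 𝕀-mix (κ𝕀 _ _)
              (I′.val-𝕀 κ𝕀 φ ρ _ (t true)) (I′.val-𝕀 κ𝕀 φ ρ _ (t false))))
        (≤-reflexive (solve 4 (λ s r q c → c :+ (s :* r :+ q :* c) := s :* r :+ (con (+ 1) :+ q) :* c) ≈-refl (fromℕ S) γr (fromℕ Q) γc)))
      where
      rec = record-answer kn i j
      still : ∀ c j′ → Close γc (fix P j c j′) (fix P′ j c j′)
      still c j′ with j′ ≟ᶠ j
      ... | yes _ = λ f _ → ⊴-0 (-‿inverseʳ _) 0≤γc
      ... | no  _ = cl j′
      pull : ∀ (R : Fin n → Prob Y) c (f g : Vec Y n → ℝ) →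
        𝔼 (indep (fix R j c)) (λ φ → κ (lookup ρ i) (lookup φ j) * f φ + (1# - κ (lookup ρ i) (lookup φ j)) * g φ)
        ≈ κ (lookup ρ i) c * 𝔼 (indep (fix R j c)) f + (1# - κ (lookup ρ i) c) * 𝔼 (indep (fix R j c)) g
      pull R c f g = ≈-trans (indep-fixed R j c λ y φ → κ (lookup ρ i) y * f φ + (1# - κ (lookup ρ i) y) * g φ)
        (∫-mix (meas (indep (fix R j c))) _ f g)
      inner : ∀ c → 𝔼 (indep (fix P j c)) (λ φ → κ (lookup ρ i) (lookup φ j) * I.val φ ρ (rec true) (t true) + (1# - κ (lookup ρ i) (lookup φ j)) * I.val φ ρ (rec false) (t false))
            - 𝔼 (indep (fix P′ j c)) (λ φ → κ (lookup ρ i) (lookup φ j) * I′.val φ ρ (rec true) (t true) + (1# - κ (lookup ρ i) (lookup φ j)) * I′.val φ ρ (rec false) (t false))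
            ⊴ fromℕ S * γr + fromℕ Q * γc
      inner c = ⊴-cong
        (≈-trans (solve 6 (λ r s x y x′ y′ → r :* (x :- x′) :+ s :* (y :- y′) := (r :* x :+ s :* y) :- (r :* x′ :+ s :* y′)) ≈-refl (κ (lookup ρ i) c) _ _ _ _ _)
          (≈-sym (+-cong (pull P c _ _) (-‿cong (pull P′ c _ _)))))
        (⊴-mix (κ𝕀 _ _)
          (changeOfMeasure S Q (t true) (ℕₚ.m⊔n≤o⇒n≤o (samples (t false)) _ ls) (ℕₚ.m⊔n≤o⇒n≤o (queries (t false)) _ lq) (fix P j c) (fix P′ j c) (still c) ρ _)
          (changeOfMeasure S Q (t false) (ℕₚ.m⊔n≤o⇒m≤o (samples (t false)) _ ls) (ℕₚ.m⊔n≤o⇒m≤o (queries (t false)) _ lq) (fix P j c) (fix P′ j c) (still c) ρ _))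

  does-⇔ : {P Q : Set} → (P → Q) → (Q → P) → does (em {P}) ≡ does (em {Q})
  does-⇔ {P} {Q} f g with em {P} | em {Q}
  ... | yes _ | yes _ = refl
  ... | no  _ | no  _ = refl
  ... | yes p | no  n = ⊥-elim (n (f p))
  ... | no  n | yes q = ⊥-elim (n (g q))

  ind-yes : {P : Set} → P → ind (does (em {P})) ≈ 1#
  ind-yes {P} p with em {P}
  ... | yes _ = ≈-refl
  ... | no  n = ⊥-elim (n p)

  ind-no : {P : Set} → ¬ P → ind (does (em {P})) ≈ 0#
  ind-no {P} n with em {P}
  ... | yes p = ⊥-elim (n p)
  ... | no  _ = ≈-refl

  sum-pick : ∀ {n} (z : Fin n) (f : Fin n → ℝ) → sum (λ x → ind (does (x ≟ᶠ z)) * f x) ≈ f z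
  sum-pick {suc n} zero f = ≈-trans (+-cong (*-identityˡ _) (∫-0 (sumM n) λ x → zeroˡ _)) (+-identityʳ _)
  sum-pick {suc n} (suc z) f = ≈-trans (+-congʳ (zeroˡ _)) (≈-trans (+-identityˡ _) (sum-pick z (f ∘ suc)))

  indep-map : ∀ {n} (g : A → B) (P : Fin n → Prob A) (f : Vec B n → ℝ) →
              𝔼 (indep P) (f ∘ Vec.map g) ≈ 𝔼 (indep (λ j → mapP g (P j))) f
  indep-map {n = zero} g P f  = ≈-refl
  indep-map {n = suc n} g P f = ∫-cong (meas (P zero)) λ a → indep-map g (P ∘ suc) (f ∘ (g a ∷_))

  indep-zip : ∀ {n} (π : Vec A n) (β : A → Prob B) (f : Vec (A × B) n → ℝ) →
              𝔼 (indep (λ j → mapP (lookup π j ,_) (β (lookup π j)))) f ≈ 𝔼 (indep (β ∘ lookup π)) (f ∘ Vec.zip π)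
  indep-zip [] β f      = ≈-refl
  indep-zip (a ∷ π) β f = ∫-cong (meas (β a)) λ b → indep-zip π β (f ∘ ((a , b) ∷_))

  indep-positive : ∀ {n} (P : Fin n → Prob A) (v : Vec A n) (f : Vec A n → ℝ) →
                   (∀ j (g : A → ℝ) → (∀ a → 0# ≤ g a) → 0# < g (lookup v j) → 0# < 𝔼 (P j) g) →
                   (∀ w → 0# ≤ f w) → 0# < f v → 0# < 𝔼 (indep P) f
  indep-positive P [] f atoms f≥0 fv      = fv
  indep-positive P (a ∷ v) f atoms f≥0 fv = atoms zero _ (λ b → ∫-pos (meas (indep (P ∘ suc))) λ w → f≥0 (b ∷ w))
    (indep-positive (P ∘ suc) v (f ∘ (a ∷_)) (λ j → atoms (suc j)) (λ w → f≥0 (a ∷ w)) fv)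

  -- Bernoulli's inequality for the base 1 - x with x = 1 - a, together with the range of the power.
  bernoulli-≤ : ∀ Q a → 𝕀 a → 1# - fromℕ Q * (1# - a) ≤ a ^ Q × 𝕀 (a ^ Q)
  bernoulli-≤ zero a i = ≤-reflexive (solve 1 (λ a → con (+ 1) :- con (+ 0) :* (con (+ 1) :- a) := con (+ 1)) ≈-refl a) , 𝕀-1
  bernoulli-≤ (suc Q) a i with bernoulli-≤ Q a i
  ... | p , j = lin (p ⊕ *-nonNeg (proj₁ (𝕀-not i)) (proj₁ (𝕀-not j)))
        (solve 3 (λ a q x → (x :+ (con (+ 1) :- a) :* (con (+ 1) :- x)) :- (con (+ 1) :- q :* (con (+ 1) :- a) :+ con (+ 0))
          := a :* x :- (con (+ 1) :- (con (+ 1) :+ q) :* (con (+ 1) :- a))) ≈-refl a (fromℕ Q) (a ^ Q))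
      , 𝕀-* i j

  -- Independent columns and random permutations

  Distinct : ∀ {m n} → Vec (Fin n) m → Set
  Distinct v = ∀ i j → lookup v i ≡ lookup v j → i ≡ j

  module WithoutReplacement {n : ℕ} .{{_ : NonZero n}} {O : Set} (acc : O → Bool) {X J : Set} (Rows : Prob X)
    (κ : X → Fin n × J → ℝ) (κ𝕀 : ∀ x y → 𝕀 (κ x y)) (β : Fin n → Prob J) where

    private
      module I = Interpretation {n} acc Rows κ
      Y = Fin n × J
      𝒰 = uniform n

    Cols : Prob Y
    Cols = bind 𝒰 λ c → mapP (c ,_) (β c)

    distinct : Vec (Fin n) n → ℝ
    distinct v = ind (does (em {Distinct v}))

    weight : Vec Y n → ℝ
    weight φ = distinct (Vec.map proj₁ φ)

    -- The probability that all n columns have different indices. For independent uniform indices it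
    -- is n!/n^n, too small to condition on directly; only its change when one more column is
    -- revealed is estimated.
    Z : (Fin n → Prob Y) → ℝ
    Z P = 𝔼 (indep P) weight

    private
      0≤weight : ∀ φ → 0# ≤ weight φ
      0≤weight φ = proj₁ (𝕀-ind (does (em {Distinct (Vec.map proj₁ φ)})))

      0≤Z : ∀ P → 0# ≤ Z P
      0≤Z P = ∫-pos (meas (indep P)) 0≤weight

    -- w dominates the indicator of the columns revealed so far.
    Revealed : (Fin n → ℝ) → (Fin n → Prob Y) → Set
    Revealed w P = ∀ j → (P j ∼ Cols) ⊎ (∃ λ z → (P j ∼ dirac z) × 1# ≤ w (proj₁ z))

    Clash : (Fin n → ℝ) → (Fin n → Prob Y) → Fin n → Y → Set
    Clash w P j z = ∃ λ j′ → ¬ j′ ≡ j × ∃ λ z′ → (P j′ ∼ dirac z′) × 1# ≤ w (proj₁ z′) × proj₁ z′ ≡ proj₁ z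

    Z-clash : ∀ w P j z → Clash w P j z → Z (fix P j z) ≈ 0#
    Z-clash w P j z (j′ , ne , z′ , e , _ , same) = ≈-trans (indep-resample P₂ j′ weight) (≈-trans
      (≈-trans (≈-sym (fix-≢ P j z j′ ne _)) (e _))
      (≈-trans (≈-sym (indep-fix P j z _)) (∫-0 (meas (indep P)) λ v → ind-no λ d → ne (d j′ j (≡.trans (at′ v) (≡.trans same (≡.sym (at v))))))))
      where
      P₂ = fix P j z
      vec = λ (v : Vec Y n) → (v [ j ]≔ z) [ j′ ]≔ z′
      at′ : ∀ v → lookup (Vec.map proj₁ (vec v)) j′ ≡ proj₁ z′
      at′ v = ≡.trans (lookup-map j′ proj₁ (vec v)) (≡.cong proj₁ (lookup∘update j′ (v [ j ]≔ z) z′))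
      at : ∀ v → lookup (Vec.map proj₁ (vec v)) j ≡ proj₁ z
      at v = ≡.trans (lookup-map j proj₁ (vec v)) (≡.cong proj₁ (≡.trans (lookup∘update′ (λ e → ne (≡.sym e)) (v [ j ]≔ z) z′) (lookup∘update j v z)))

    -- Transposing the indices of `z` and `z′` preserves distinctness and the law of the index of
    -- every fresh column. It fixes the other revealed columns, because none of them carries either
    -- index.
    Z-symmetric : ∀ w P → Revealed w P → ∀ j z z′ → ¬ Clash w P j z → ¬ Clash w P j z′ → Z (fix P j z) ≈ Z (fix P j z′)
    Z-symmetric w P rv j z z′ nc nc′ = ≈-trans (indep-map proj₁ (fix P j z) distinct) (≈-trans
      (∫-cong (meas (indep (λ i → mapP proj₁ (fix P j z i)))) λ v → ≈-reflexive (≡.cong ind (does-⇔ (fwd v) (bwd v))))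
      (≈-trans (indep-map s _ distinct) (≈-trans (indep-cong same distinct) (≈-sym (indep-map proj₁ (fix P j z′) distinct)))))
      where
      π = transpose (proj₁ z) (proj₁ z′)
      s : Fin n → Fin n
      s = π ⟨$⟩ʳ_
      s-z : s (proj₁ z) ≡ proj₁ z′
      s-z with proj₁ z ≟ᶠ proj₁ z
      ... | yes _ = refl
      ... | no  n = ⊥-elim (n refl)
      s-other : ∀ y → ¬ y ≡ proj₁ z → ¬ y ≡ proj₁ z′ → s y ≡ y
      s-other y a b with y ≟ᶠ proj₁ z
      ... | yes e = ⊥-elim (a e)
      ... | no  _ with y ≟ᶠ proj₁ z′
      ...   | yes e = ⊥-elim (b e)
      ...   | no  _ = refl
      s-injective : ∀ x y → s x ≡ s y → x ≡ y
      s-injective x y e = ≡.trans (≡.sym (Perm.inverseˡ π)) (≡.trans (≡.cong (π ⟨$⟩ˡ_) e) (Perm.inverseˡ π))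
      fwd : ∀ v → Distinct v → Distinct (Vec.map s v)
      fwd v d a b e = d a b (s-injective _ _ (≡.trans (≡.sym (lookup-map a s v)) (≡.trans e (lookup-map b s v))))
      bwd : ∀ v → Distinct (Vec.map s v) → Distinct v
      bwd v d a b e = d a b (≡.trans (lookup-map a s v) (≡.trans (≡.cong s e) (≡.sym (lookup-map b s v))))
      same : ∀ i → mapP s (mapP proj₁ (fix P j z i)) ∼ mapP proj₁ (fix P j z′ i)
      same i f with i ≟ᶠ j
      ... | yes _ = ≈-reflexive (≡.cong f s-z)
      ... | no ne with rv i
      ...   | inj₁ e = ≈-trans (e _) (≈-trans (∫-cong (meas 𝒰) λ c → 𝔼-const (β c) _) (≈-trans (uniform-permute π f)
                (≈-sym (≈-trans (e _) (∫-cong (meas 𝒰) λ c → 𝔼-const (β c) _)))))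
      ...   | inj₂ (y , e , l) = ≈-trans (e _) (≈-trans (≈-reflexive (≡.cong f (s-other (proj₁ y)
                (λ p → nc (i , ne , y , e , l , p)) (λ p → nc′ (i , ne , y , e , l , p))))) (≈-sym (e _)))

    Z-average : ∀ P j → Z P ≈ 𝔼 (P j) (λ z → Z (fix P j z))
    Z-average P j = indep-reveal P j weight

    -- The values of column j that avoid the revealed indices all give the same `Z`, by symmetry,
    -- and the others give zero. So `Z P` is this common value times the probability of avoiding
    -- them, which is at least 1 - 𝔼 w.
    Z-fresh : ∀ w P → (∀ x → 0# ≤ w x) → Revealed w P → ∀ j → P j ∼ Cols → ∀ z → (1# - 𝔼 𝒰 w) * Z (fix P j z) ≤ Z P
    Z-fresh w P 0≤w rv j e z with em {Clash w P j z}
    ... | yes c = ≤-trans (≤-reflexive (≈-trans (*-congˡ (Z-clash w P j z c)) (zeroʳ _))) (0≤Z P)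
    ... | no nc = ≤-trans (≤-reflexive mean) (≤-trans (∫-mono (meas (P j)) pointwise) (≤-reflexive (≈-sym (Z-average P j))))
      where
      z₀ = Z (fix P j z)
      mean : (1# - 𝔼 𝒰 w) * z₀ ≈ 𝔼 (P j) (λ z′ → (1# - w (proj₁ z′)) * z₀)
      mean = ≈-sym (≈-trans (e _) (≈-trans (∫-cong (meas 𝒰) λ c → 𝔼-const (β c) _) (≈-trans (∫-*ʳ (meas 𝒰) z₀ _)
        (*-congʳ (≈-trans (∫-- (meas 𝒰) _ _) (+-congʳ (𝔼-const 𝒰 1#)))))))
      pointwise : ∀ z′ → (1# - w (proj₁ z′)) * z₀ ≤ Z (fix P j z′)
      pointwise z′ with em {Clash w P j z′}
      ... | no nc′ = ≤-trans (lin (*-nonNeg (0≤w (proj₁ z′)) (0≤Z (fix P j z)))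
            (solve 2 (λ w z → w :* z :- con (+ 0) := z :- (con (+ 1) :- w) :* z) ≈-refl (w (proj₁ z′)) z₀)) (≤-reflexive (Z-symmetric w P rv j z z′ nc nc′))
      ... | yes (_ , _ , y , _ , l , q) = ≤-trans (lin (*-nonNeg (≤⇒0≤ (≤-respʳ-≈ (≈-reflexive (≡.cong w q)) l)) (0≤Z (fix P j z)))
            (solve 2 (λ w z → (w :- con (+ 1)) :* z :- con (+ 0) := con (+ 0) :- (con (+ 1) :- w) :* z) ≈-refl (w (proj₁ z′)) z₀)) (0≤Z (fix P j z′))

    reveal : (Fin n → ℝ) → Y → Fin n → ℝ
    reveal w z x = w x + ind (does (x ≟ᶠ proj₁ z))

    revealed-fix : ∀ w P → (∀ x → 0# ≤ w x) → Revealed w P → ∀ j z → Revealed (reveal w z) (fix P j z)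
    revealed-fix w P 0≤w rv j z j′ with j′ ≟ᶠ j
    ... | yes _ = inj₂ (z , (λ _ → ≈-refl) , now)
      where
      now : 1# ≤ w (proj₁ z) + ind (does (proj₁ z ≟ᶠ proj₁ z))
      now with proj₁ z ≟ᶠ proj₁ z
      ... | yes _ = ≤-respˡ-≈ (+-identityˡ 1#) (0≤w _ ⊕ ≤-refl)
      ... | no  n = ⊥-elim (n refl)
    ... | no _ with rv j′
    ...   | inj₁ e = inj₁ e
    ...   | inj₂ (y , e , p) = inj₂ (y , e , ≤-respˡ-≈ (+-identityʳ 1#) (p ⊕ proj₁ (𝕀-ind _)))

    reveal-mass : ∀ w z → 𝔼 𝒰 (reveal w z) ≈ 𝔼 𝒰 w + fromℕ n ⁻¹
    reveal-mass w z = ≈-trans (∫-+ (meas 𝒰) _ _) (+-congˡ (≈-trans (∫-cong (sumM n) λ x → *-comm _ _)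
      (sum-pick (proj₁ z) (λ _ → fromℕ n ⁻¹))))

    Z-reveal : ∀ w P a → (∀ x → 0# ≤ w x) → 𝕀 a → a ≤ 1# - 𝔼 𝒰 w → Revealed w P → ∀ j (g : Y → ℝ) → (∀ z → 0# ≤ g z) →
               a * 𝔼 (P j) (λ z → Z (fix P j z) * g z) ≤ Z P * 𝔼 (P j) g
    Z-reveal w P a 0≤w i le rv j g 0≤g with rv j
    ... | inj₁ e = ≤-respˡ-≈ (∫-* (meas (P j)) a _) (≤-respʳ-≈ (∫-* (meas (P j)) (Z P) g) (∫-mono (meas (P j)) λ z →
          ≤-respˡ-≈ (*-assoc _ _ _) (mul-mono (*-nonNeg (proj₁ i) (0≤Z (fix P j z)))
            (≤-trans (mul-mono (proj₁ i) le (0≤Z (fix P j z)) ≤-refl) (Z-fresh w P 0≤w rv j e z)) (0≤g z) ≤-refl)))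
    ... | inj₂ (z , e , _) = ≤-trans (mul-mono (proj₁ i) (proj₂ i) (≤-respʳ-≈ (≈-sym (e _)) (*-nonNeg (0≤Z (fix P j z)) (0≤g z))) ≤-refl)
          (≤-reflexive (≈-trans (*-identityˡ _) (≈-trans (e _) (*-cong (≈-sym (≈-trans (Z-average P j) (e _))) (≈-sym (e g))))))

    -- Conditioning on distinct columns multiplies the value by at most a power of 1 / a.
    weighted-bound : ∀ Q {k} (t : Algorithm n O k) → queries t ℕ.≤ Q → ∀ a → 𝕀 a → ∀ w P → (∀ x → 0# ≤ w x) →
      𝔼 𝒰 w + fromℕ Q * fromℕ n ⁻¹ ≤ 1# - a → Revealed w P → ∀ ρ kn →
      a ^ Q * 𝔼 (indep P) (λ φ → weight φ * I.val φ ρ kn t) ≤ Z P * 𝔼 (indep P) (λ φ → I.val φ ρ kn t)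
    weighted-bound Q (output o) le a i w P 0≤w lw rv ρ kn = ≤-trans
      (mul-mono (proj₁ (proj₂ (bernoulli-≤ Q a i))) (proj₂ (proj₂ (bernoulli-≤ Q a i)))
        (∫-pos (meas (indep P)) λ φ → *-nonNeg (0≤weight φ) (proj₁ (𝕀-ind (acc o)))) ≤-refl)
      (≤-reflexive (≈-trans (*-identityˡ _) (≈-trans (∫-*ʳ (meas (indep P)) _ _) (*-congˡ (≈-sym (𝔼-const (indep P) _))))))
    weighted-bound Q (coin r p q t u) le a i w P 0≤w lw rv ρ kn = ≤-trans
      (≤-reflexive (≈-trans (*-congˡ (≈-trans (∫-cong M λ φ → solve 5 (λ w r s x y → w :* (r :* x :+ s :* y) := r :* (w :* x) :+ s :* (w :* y)) ≈-refl (weight φ) r (1# - r) _ _)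
          (∫-mix M r _ _))) (solve 5 (λ a r s x y → a :* (r :* x :+ s :* y) := r :* (a :* x) :+ s :* (a :* y)) ≈-refl (a ^ Q) r (1# - r) _ _)))
      (≤-trans (p ⊛ weighted-bound Q t (ℕₚ.m⊔n≤o⇒m≤o (queries t) _ le) a i w P 0≤w lw rv ρ kn
                ⊕ proj₁ (𝕀-not (p , q)) ⊛ weighted-bound Q u (ℕₚ.m⊔n≤o⇒n≤o (queries t) _ le) a i w P 0≤w lw rv ρ kn)
        (≤-reflexive (≈-trans (solve 5 (λ z r s x y → r :* (z :* x) :+ s :* (z :* y) := z :* (r :* x :+ s :* y)) ≈-refl (Z P) r (1# - r) _ _)
          (*-congˡ (≈-sym (∫-mix M r _ _))))))
      where M = meas (indep P)
    weighted-bound Q (sample t) le a i w P 0≤w lw rv ρ kn = ≤-trans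
      (≤-reflexive (≈-trans (*-congˡ (≈-trans (∫-cong M λ φ → ≈-sym (∫-* (meas Rows) _ _)) (∫-swap M (meas Rows) _))) (≈-sym (∫-* (meas Rows) _ _))))
      (≤-trans (∫-mono (meas Rows) λ x → weighted-bound Q t le a i w P 0≤w lw rv (x ∷ ρ) (blank ∷ kn))
        (≤-reflexive (≈-trans (∫-* (meas Rows) _ _) (*-congˡ (≈-sym (∫-swap M (meas Rows) _))))))
      where M = meas (indep P)
    weighted-bound Q (query i′ j t) le a i w P 0≤w lw rv ρ kn with known kn i′ j
    ... | just b = weighted-bound Q (t b) (≤q b) a i w P 0≤w lw rv ρ kn
      where
      ≤q : ∀ b → queries (t b) ℕ.≤ Q
      ≤q false = ℕₚ.≤-trans (ℕₚ.m≤n⇒m≤1+n (ℕₚ.m≤m⊔n _ _)) le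
      ≤q true  = ℕₚ.≤-trans (ℕₚ.m≤n⇒m≤1+n (ℕₚ.m≤n⊔m (queries (t false)) _)) le
    weighted-bound (suc Q) (query i′ j t) (s≤s le) a i w P 0≤w lw rv ρ kn | nothing = begin
      a * a ^ Q * 𝔼 (indep P) (λ φ → weight φ * step φ)
        ≈⟨ *-congˡ (≈-trans (indep-reveal P j _) (∫-cong (meas (P j)) λ z → ≈-trans (pull z weight) (+-cong (*-congˡ ≈-refl) (*-congˡ ≈-refl)))) ⟩
      a * a ^ Q * 𝔼 (P j) (λ z → k z * Iv true z + (1# - k z) * Iv false z)
        ≈⟨ ≈-trans (*-assoc _ _ _) (*-congˡ (≈-trans (≈-sym (∫-* (meas (P j)) _ _)) (∫-cong (meas (P j)) λ z →
            solve 5 (λ p k l x y → p :* (k :* x :+ l :* y) := k :* (p :* x) :+ l :* (p :* y)) ≈-refl (a ^ Q) (k z) (1# - k z) (Iv true z) (Iv false z)))) ⟩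
      a * 𝔼 (P j) (λ z → k z * (a ^ Q * Iv true z) + (1# - k z) * (a ^ Q * Iv false z))
        ≤⟨ proj₁ i ⊛ ∫-mono (meas (P j)) (λ z → proj₁ (κ𝕀 _ _) ⊛ ih true (ℕₚ.m⊔n≤o⇒n≤o (queries (t false)) _ le) z
             ⊕ proj₁ (𝕀-not (κ𝕀 _ _)) ⊛ ih false (ℕₚ.m⊔n≤o⇒m≤o (queries (t false)) _ le) z) ⟩
      a * 𝔼 (P j) (λ z → k z * (Z (fix P j z) * Ev true z) + (1# - k z) * (Z (fix P j z) * Ev false z))
        ≈⟨ *-congˡ (∫-cong (meas (P j)) λ z → solve 5 (λ p k l x y → k :* (p :* x) :+ l :* (p :* y) := p :* (k :* x :+ l :* y)) ≈-refl (Z (fix P j z)) (k z) (1# - k z) (Ev true z) (Ev false z)) ⟩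
      a * 𝔼 (P j) (λ z → Z (fix P j z) * (k z * Ev true z + (1# - k z) * Ev false z))
        ≤⟨ Z-reveal w P a 0≤w i a≤ rv j _ (λ z → 0≤-+ (*-nonNeg (proj₁ (κ𝕀 _ _)) (0≤Ev true z)) (*-nonNeg (proj₁ (𝕀-not (κ𝕀 _ _))) (0≤Ev false z))) ⟩
      Z P * 𝔼 (P j) (λ z → k z * Ev true z + (1# - k z) * Ev false z)
        ≈⟨ *-congˡ (≈-sym (≈-trans (indep-reveal P j step) (∫-cong (meas (P j)) λ z → ≈-trans
             (indep-fixed P j z λ y φ → κ (lookup ρ i′) y * v true φ + (1# - κ (lookup ρ i′) y) * v false φ) (∫-mix (meas (indep (fix P j z))) _ _ _)))) ⟩
      Z P * 𝔼 (indep P) step ∎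
      where
      open ≤R
      rec = record-answer kn i′ j
      v : Bool → Vec Y n → ℝ
      v b φ = I.val φ ρ (rec b) (t b)
      step : Vec Y n → ℝ
      step φ = κ (lookup ρ i′) (lookup φ j) * v true φ + (1# - κ (lookup ρ i′) (lookup φ j)) * v false φ
      k : Y → ℝ
      k z = κ (lookup ρ i′) z
      Iv Ev : Bool → Y → ℝ
      Iv b z = 𝔼 (indep (fix P j z)) (λ φ → weight φ * v b φ)
      Ev b z = 𝔼 (indep (fix P j z)) (v b)
      0≤Ev : ∀ b z → 0# ≤ Ev b z
      0≤Ev b z = ∫-pos (meas (indep (fix P j z))) λ φ → proj₁ (I.val-𝕀 κ𝕀 φ ρ (rec b) (t b))
      0≤n⁻¹ = <⇒≤ (0<⁻¹ (0<fromℕ n))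
      a≤ : a ≤ 1# - 𝔼 𝒰 w
      a≤ = lin (lw ⊕ *-nonNeg (0≤fromℕ (suc Q)) 0≤n⁻¹)
        (solve 3 (λ a w q → (con (+ 1) :- a :+ q) :- (w :+ q :+ con (+ 0)) := (con (+ 1) :- w) :- a) ≈-refl a (𝔼 𝒰 w) (fromℕ (suc Q) * fromℕ n ⁻¹))
      ih : ∀ b → queries (t b) ℕ.≤ Q → ∀ z → a ^ Q * Iv b z ≤ Z (fix P j z) * Ev b z
      ih b leb z = weighted-bound Q (t b) leb a i (reveal w z) (fix P j z) (λ x → 0≤-+ (0≤w x) (proj₁ (𝕀-ind _)))
        (≤-respˡ-≈ (≈-trans (solve 3 (λ w q m → w :+ (con (+ 1) :+ q) :* m := (w :+ m) :+ q :* m) ≈-refl (𝔼 𝒰 w) (fromℕ Q) (fromℕ n ⁻¹))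
          (+-congʳ (≈-sym (reveal-mass w z)))) lw)
        (revealed-fix w P 0≤w rv j z) ρ (rec b)
      pull : ∀ z (u : Vec Y n → ℝ) → 𝔼 (indep (fix P j z)) (λ φ → u φ * step φ) ≈
             k z * 𝔼 (indep (fix P j z)) (λ φ → u φ * v true φ) + (1# - k z) * 𝔼 (indep (fix P j z)) (λ φ → u φ * v false φ)
      pull z u = ≈-trans (indep-fixed P j z λ y φ → u φ * (κ (lookup ρ i′) y * v true φ + (1# - κ (lookup ρ i′) y) * v false φ))
        (≈-trans (∫-cong (meas (indep (fix P j z))) λ φ → solve 5 (λ w r s x y → w :* (r :* x :+ s :* y) := r :* (w :* x) :+ s :* (w :* y)) ≈-refl (u φ) (k z) (1# - k z) (v true φ) (v false φ))
          (∫-mix (meas (indep (fix P j z))) _ _ _))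

    -- Weighting by distinctness turns independent columns into a random permutation, for which `τ`
    -- bounds the value from below. With a = 1 - Q/n the loss is a^Q, at least 1 - Q²/n. A lower
    -- bound suffices, as rejection is treated as acceptance with `not`.
    withReplacement : ∀ Q (t : Algorithm n O 0) → queries t ℕ.≤ Q → fromℕ Q ≤ fromℕ n → ∀ τ → 0# ≤ τ →
      (∀ π → Distinct π → τ ≤ 𝔼 (indep (β ∘ lookup π)) (λ l → I.val (Vec.zip π l) [] [] t)) →
      (1# - fromℕ Q * (fromℕ Q * fromℕ n ⁻¹)) * τ ≤ 𝔼 (indep (λ _ → Cols)) (λ φ → I.val φ [] [] t)
    withReplacement Q t le Q≤n τ 0≤τ low = ≤-trans (mul-mono′ (proj₁ (bernoulli-≤ Q a a𝕀))) (*-cancelˡ-≤ 0<Z₀ (≤-trans (≤-reflexive (solve 3 (λ z p τ → z :* (p :* τ) := p :* (z :* τ)) ≈-refl Z₀ (a ^ Q) τ))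
        (≤-trans (proj₁ (proj₂ (bernoulli-≤ Q a a𝕀)) ⊛ low′) main)))
      where
      P : Fin n → Prob Y
      P _ = Cols
      Z₀ = Z P
      m = fromℕ Q * fromℕ n ⁻¹
      a = 1# - m
      0≤n⁻¹ = <⇒≤ (0<⁻¹ (0<fromℕ n))
      m𝕀 : 𝕀 m
      m𝕀 = *-nonNeg (0≤fromℕ Q) 0≤n⁻¹ , ≤-respʳ-≈ (*-inv (0<fromℕ n)) (mul-mono (0≤fromℕ Q) Q≤n 0≤n⁻¹ ≤-refl)
      a𝕀 = 𝕀-not m𝕀
      mul-mono′ : ∀ {p} → 1# - fromℕ Q * (1# - a) ≤ p → (1# - fromℕ Q * m) * τ ≤ p * τ
      mul-mono′ {p} h = lin (0≤τ ⊛ h) (solve 4 (λ t q m p → t :* p :- t :* (con (+ 1) :- q :* (con (+ 1) :- (con (+ 1) :- m))) := p :* t :- (con (+ 1) :- q :* m) :* t) ≈-refl τ (fromℕ Q) m p)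
      main : a ^ Q * 𝔼 (indep P) (λ φ → weight φ * I.val φ [] [] t) ≤ Z₀ * 𝔼 (indep P) (λ φ → I.val φ [] [] t)
      main = weighted-bound Q t le a a𝕀 (λ _ → 0#) P (λ _ → ≤-refl)
        (≤-reflexive (≈-trans (+-congʳ (𝔼-const 𝒰 0#)) (solve 1 (λ m → con (+ 0) :+ m := con (+ 1) :- (con (+ 1) :- m)) ≈-refl m)))
        (λ j → inj₁ λ _ → ≈-refl) [] []
      split : ∀ (f : Vec Y n → ℝ) → 𝔼 (indep P) f ≈ 𝔼 (indep (λ _ → 𝒰)) λ π → 𝔼 (indep (β ∘ lookup π)) (f ∘ Vec.zip π)
      split f = ≈-trans (indep-bind (λ _ → 𝒰) (λ c → mapP (c ,_) (β c)) f) (∫-cong (meas (indep (λ _ → 𝒰))) λ π → indep-zip π β f)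
      split-weighted : ∀ (f : Vec Y n → ℝ) → 𝔼 (indep P) (λ φ → weight φ * f φ) ≈ 𝔼 (indep (λ _ → 𝒰)) λ π → distinct π * 𝔼 (indep (β ∘ lookup π)) (f ∘ Vec.zip π)
      split-weighted f = ≈-trans (split _) (∫-cong (meas (indep (λ _ → 𝒰))) λ π → ≈-trans
        (∫-cong (meas (indep (β ∘ lookup π))) λ l → *-congʳ (≈-reflexive (≡.cong distinct (map-proj₁-zip π l)))) (∫-* (meas (indep (β ∘ lookup π))) _ _))
      Z₀≈ : Z₀ ≈ 𝔼 (indep (λ _ → 𝒰)) distinct
      Z₀≈ = ≈-trans (split weight) (∫-cong (meas (indep (λ _ → 𝒰))) λ π → ≈-trans
        (∫-cong (meas (indep (β ∘ lookup π))) λ l → ≈-reflexive (≡.cong distinct (map-proj₁-zip π l))) (𝔼-const (indep (β ∘ lookup π)) _))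
      low′ : Z₀ * τ ≤ 𝔼 (indep P) (λ φ → weight φ * I.val φ [] [] t)
      low′ = ≤-respʳ-≈ (≈-sym (split-weighted λ φ → I.val φ [] [] t)) (≤-respˡ-≈ (≈-trans (∫-*ʳ (meas (indep (λ _ → 𝒰))) τ distinct) (*-congʳ (≈-sym Z₀≈)))
        (∫-mono (meas (indep (λ _ → 𝒰))) pointwise))
        where
        pointwise : ∀ π → distinct π * τ ≤ distinct π * 𝔼 (indep (β ∘ lookup π)) (λ l → I.val (Vec.zip π l) [] [] t)
        pointwise π with em {Distinct π}
        ... | yes d = 0≤1 ⊛ low π d
        ... | no  _ = ≤-reflexive (≈-trans (zeroˡ _) (≈-sym (zeroˡ _)))
      -- The identity arrangement occurs with positive probability, so the common factor can be
      -- cancelled.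
      0<Z₀ : 0# < Z₀
      0<Z₀ = <-≤-trans (indep-positive (λ _ → 𝒰) (tabulate id) distinct atoms (λ v → proj₁ (𝕀-ind _)) one) (≤-reflexive (≈-sym Z₀≈))
        where
        one : 0# < distinct (tabulate id)
        one = <-≤-trans 0<1 (≤-reflexive (≈-sym (ind-yes λ i j e → ≡.trans (≡.sym (lookup∘tabulate id i)) (≡.trans e (lookup∘tabulate id j)))))
        atoms : ∀ j (g : Fin n → ℝ) → (∀ x → 0# ≤ g x) → 0# < g (lookup (tabulate id) j) → 0# < 𝔼 𝒰 g
        atoms j g 0≤g pos = <-≤-trans (0<-* (0<⁻¹ (0<fromℕ n)) pos) (≤-respʳ-≈ (≈-sym (∫-* (sumM n) _ _))
          (0≤n⁻¹ ⊛ ≤-respˡ-≈ (sum-pick _ g) (∫-mono (sumM n) λ x → ≤-respʳ-≈ (*-identityˡ _)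
            (mul-mono (proj₁ (𝕀-ind _)) (proj₂ (𝕀-ind (does (x ≟ᶠ lookup (tabulate id) j)))) (0≤g x) ≤-refl))))

  -- Regularity

  clip : ℝ → ℝ
  clip x with ≤-or-< 0# x | ≤-or-< x 1#
  ... | inj₂ _ | _      = 0#
  ... | inj₁ _ | inj₂ _ = 1#
  ... | inj₁ _ | inj₁ _ = x

  clip-𝕀 : ∀ x → 𝕀 (clip x)
  clip-𝕀 x with ≤-or-< 0# x | ≤-or-< x 1#
  ... | inj₂ _ | _      = 𝕀-0
  ... | inj₁ _ | inj₂ _ = 𝕀-1
  ... | inj₁ p | inj₁ q = p , q

  clip-closer : ∀ {u} x → 𝕀 u → (u - clip x) * (u - clip x) ≤ (u - x) * (u - x)
  clip-closer {u} x (p , q) with ≤-or-< 0# x | ≤-or-< x 1#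
  ... | inj₁ _ | inj₁ _ = ≤-refl
  ... | inj₂ n | _ = lin (*-nonNeg (0≤-neg (<⇒≤ n)) (0≤-+ (0≤-+ p p) (0≤-neg (<⇒≤ n))))
    (solve 2 (λ u x → :- x :* (u :+ u :+ :- x) :- con (+ 0) := (u :- x) :* (u :- x) :- (u :- con (+ 0)) :* (u :- con (+ 0))) ≈-refl u x)
  ... | inj₁ _ | inj₂ n = lin (*-nonNeg (≤⇒0≤ (<⇒≤ n)) (0≤-+ (0≤-+ (≤⇒0≤ q) (≤⇒0≤ q)) (≤⇒0≤ (<⇒≤ n))))
    (solve 2 (λ u x → (x :- con (+ 1)) :* ((con (+ 1) :- u) :+ (con (+ 1) :- u) :+ (x :- con (+ 1))) :- con (+ 0)
      := (u :- x) :* (u :- x) :- (u :- con (+ 1)) :* (u :- con (+ 1))) ≈-refl u x)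

  sgn : Bool → ℝ
  sgn b = if b then 1# else - 1#

  sgn² : ∀ b → sgn b * sgn b ≈ 1#
  sgn² true  = *-identityˡ 1#
  sgn² false = solve 0 (:- con (+ 1) :* :- con (+ 1) := con (+ 1)) ≈-refl

  4^_ : ℕ → ℝ
  4^ n = fromℕ 4 ^ n

  -- η has low complexity: multiplying by a function of η blows up cut norms by at most 4^ K.
  Simple : ℕ → (Bool → A → B → ℝ) → Set₁
  Simple {A} {B} K η = ∀ {A′ B′ : Set} (P : Prob A′) (Q : Prob B′) (r : A′ → A) (c : B′ → B) (D : A′ → B′ → ℝ) z →
    (∀ w → Rank1 w → 𝔼 (P ⊗ Q) (λ (a , b) → w a b * D a b) ⊴ z) →
    ∀ (f : ℝ → ℝ → ℝ) → (∀ {x y} → 𝕀 x → 𝕀 y → 𝕀 (f x y)) →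
    ∀ w → Rank1 w → 𝔼 (P ⊗ Q) (λ (a , b) → w a b * D a b * f (η true (r a) (c b)) (η false (r a) (c b))) ⊴ 4^ K * z

  simple-constant : Simple {A} {B} 0 (λ _ _ _ → 0#)
  simple-constant P Q r c D z h f f𝕀 w rw = ⊴-cong (≈-sym (≈-trans (∫-*ʳ (meas (P ⊗ Q)) _ _) (*-comm _ _)))
    (⊴-≤ (⊴-scale (proj₁ v) (h w rw)) (mul-mono (proj₁ v) (proj₂ v) (⊴⇒0≤ (h w rw)) ≤-refl))
    where v = f𝕀 𝕀-0 𝕀-0

  simple-suc : ∀ {K η} → Simple {A} {B} K η → Simple (suc K) η
  simple-suc {K = K} s P Q r c D z h f f𝕀 w rw = ⊴-≤ (s P Q r c D z h f f𝕀 w rw)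
    (≤-respˡ-≈ (*-identityˡ _) (≤-respʳ-≈ (≈-sym (*-assoc _ _ _))
      (mul-mono 0≤1 (1≤fromℕ 4) (⊴⇒0≤ (s P Q r c D z h f f𝕀 w rw)) ≤-refl)))

  update : (A → Bool) → (B → Bool) → (Bool → ℝ) → (Bool → A → B → ℝ) → Bool → A → B → ℝ
  update a b δ η s x y = if a x ∧ b y then clip (η s x y + δ s) else η s x y

  update-𝕀 : ∀ (a : A → Bool) (b : B → Bool) δ η → (∀ s x y → 𝕀 (η s x y)) → ∀ s x y → 𝕀 (update a b δ η s x y)
  update-𝕀 a b δ η i s x y with a x ∧ b y
  ... | true  = clip-𝕀 _
  ... | false = i s x y

  -- Outside the rectangle of `a` and `b` nothing changes, and the complement of a rectangle is the
  -- union of two disjoint rectangles. So one test against the new function is three tests against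
  -- the old one, with `f` shifted and clipped inside the rectangle. Rounding 3 up to 4 gives a
  -- power of two.
  simple-update : ∀ {K η} (a : A → Bool) (b : B → Bool) δ → Simple K η → Simple (suc K) (update a b δ η)
  simple-update {K = K} {η} a b δ s P Q r c D z h f f𝕀 w rw = ⊴-cong (≈-sym split) (⊴-≤
    (⊴-+ (⊴-+ (s P Q r c D z h f₁ (λ _ _ → f𝕀 (clip-𝕀 _) (clip-𝕀 _)) _ w₁) (s P Q r c D z h f f𝕀 _ w₂)) (s P Q r c D z h f f𝕀 _ w₃))
    (lin (⊴⇒0≤ (s P Q r c D z h f f𝕀 _ w₂)) (solve 2 (λ p z → p :* z :- con (+ 0) := con (+ 4) :* p :* z :- (p :* z :+ p :* z :+ p :* z)) ≈-refl (4^ K) z)))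
    where
    f₁ = λ x y → f (clip (x + δ true)) (clip (y + δ false))
    α = λ x → ind (a (r x))
    β = λ y → ind (b (c y))
    w₁ = rank1-*ʳ (rank1-*ˡ rw (λ x y → α x) α (λ _ → 𝕀-ind _) (λ _ _ → ≈-refl)) (λ x y → β y) β (λ _ → 𝕀-ind _) (λ _ _ → ≈-refl)
    w₂ = rank1-*ˡ rw (λ x y → 1# - α x) _ (λ _ → 𝕀-not (𝕀-ind _)) (λ _ _ → ≈-refl)
    w₃ = rank1-*ʳ (rank1-*ˡ rw (λ x y → α x) α (λ _ → 𝕀-ind _) (λ _ _ → ≈-refl)) (λ x y → 1# - β y) _ (λ _ → 𝕀-not (𝕀-ind _)) (λ _ _ → ≈-refl)
    e = λ x y → f (η true (r x) (c y)) (η false (r x) (c y))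
    e₁ = λ x y → f₁ (η true (r x) (c y)) (η false (r x) (c y))
    η′ = update a b δ η
    cases : ∀ x y → w x y * D x y * f (η′ true (r x) (c y)) (η′ false (r x) (c y)) ≈
            w x y * α x * β y * D x y * e₁ x y + w x y * (1# - α x) * D x y * e x y + w x y * α x * (1# - β y) * D x y * e x y
    cases x y with a (r x) | b (c y)
    ... | true | true = solve 4 (λ w d p q → w :* d :* p := w :* con (+ 1) :* con (+ 1) :* d :* p :+ w :* (con (+ 1) :- con (+ 1)) :* d :* q
        :+ w :* con (+ 1) :* (con (+ 1) :- con (+ 1)) :* d :* q) ≈-refl (w x y) (D x y) (e₁ x y) (e x y)
    ... | true | false = solve 4 (λ w d p q → w :* d :* q := w :* con (+ 1) :* con (+ 0) :* d :* p :+ w :* (con (+ 1) :- con (+ 1)) :* d :* q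
        :+ w :* con (+ 1) :* (con (+ 1) :- con (+ 0)) :* d :* q) ≈-refl (w x y) (D x y) (e₁ x y) (e x y)
    ... | false | β = solve 5 (λ w d p q b → w :* d :* q := w :* con (+ 0) :* b :* d :* p :+ w :* (con (+ 1) :- con (+ 0)) :* d :* q
        :+ w :* con (+ 0) :* (con (+ 1) :- b) :* d :* q) ≈-refl (w x y) (D x y) (e₁ x y) (e x y) (ind β)
    split = ≈-trans (∫-cong (meas (P ⊗ Q)) λ (x , y) → cases x y) (≈-trans (∫-+ (meas (P ⊗ Q)) _ _) (+-congʳ (∫-+ (meas (P ⊗ Q)) _ _)))

  positive : ℝ → Bool
  positive x = does (em {0# ≤ x})

  positive-max : ∀ {c} x → 𝕀 c → c * x ≤ ind (positive x) * x
  positive-max {c} x (p , q) with em {0# ≤ x}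
  ... | yes r = mul-mono p q r ≤-refl
  ... | no  r = ≤-respʳ-≈ (≈-sym (zeroˡ x)) (≤-respʳ-≈ (zeroʳ c) (p ⊛ <⇒≤ (≰⇒< r)))

  -- A bilinear form in F, G ∈ [0,1] is maximal at indicator functions.
  extremal : (P : Prob A) (Q : Prob B) (s : A → B → ℝ) → ∀ w → Rank1 w → ∃ λ (a : A → Bool) → ∃ λ (b : B → Bool) →
             𝔼 (P ⊗ Q) (λ (x , y) → w x y * s x y) ≤ 𝔼 (P ⊗ Q) (λ (x , y) → ind (a x) * ind (b y) * s x y)
  extremal P Q s w (F , G , F𝕀 , G𝕀 , eq) = a , b , (begin
    𝔼 P (λ x → 𝔼 Q λ y → w x y * s x y)
      ≈⟨ ∫-cong (meas P) (λ x → ≈-trans (∫-cong (meas Q) λ y → ≈-trans (*-congʳ (eq x y)) (*-assoc _ _ _)) (∫-* (meas Q) _ _)) ⟩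
    𝔼 P (λ x → F x * h x)
      ≤⟨ ∫-mono (meas P) (λ x → positive-max (h x) (F𝕀 x)) ⟩
    𝔼 P (λ x → ind (a x) * h x)
      ≈⟨ ∫-cong (meas P) (λ x → ≈-trans (≈-sym (∫-* (meas Q) _ _)) (∫-cong (meas Q) λ y →
           solve 3 (λ a g s → a :* (g :* s) := g :* (a :* s)) ≈-refl (ind (a x)) (G y) (s x y))) ⟩
    𝔼 P (λ x → 𝔼 Q λ y → G y * (ind (a x) * s x y))
      ≈⟨ ≈-trans (∫-swap (meas P) (meas Q) _) (∫-cong (meas Q) λ y → ∫-* (meas P) _ _) ⟩
    𝔼 Q (λ y → G y * g y)
      ≤⟨ ∫-mono (meas Q) (λ y → positive-max (g y) (G𝕀 y)) ⟩
    𝔼 Q (λ y → ind (b y) * g y)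
      ≈⟨ ≈-trans (∫-cong (meas Q) λ y → ≈-sym (∫-* (meas P) _ _)) (≈-sym (∫-swap (meas P) (meas Q) _)) ⟩
    𝔼 P (λ x → 𝔼 Q λ y → ind (b y) * (ind (a x) * s x y))
      ≈⟨ ∫-cong (meas (P ⊗ Q)) (λ (x , y) → solve 3 (λ a b s → b :* (a :* s) := a :* b :* s) ≈-refl (ind (a x)) (ind (b y)) (s x y)) ⟩
    𝔼 (P ⊗ Q) (λ (x , y) → ind (a x) * ind (b y) * s x y) ∎)
    where
    open ≤R
    h = λ x → 𝔼 Q λ y → G y * s x y
    a = λ x → positive (h x)
    g = λ y → 𝔼 P λ x → ind (a x) * s x y
    b = λ y → positive (g y)

  -- `W` and `V` are the bits of the two strings of a transferred pair, and `η b` models the bit `V`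
  -- where `W` is `b`. The matrix `W` itself need not be simple; only the dependence of `η` on row
  -- and column has to be, and the true bit is kept as an argument.
  module Greedy (P : Prob A) (Q : Prob B) (W V : A → B → Bool) (ζ θ : ℝ) (0≤ζ : 0# ≤ ζ) (0≤θ : 0# ≤ θ) where

    private
      PQ = meas (P ⊗ Q)
      State = Bool → A → B → ℝ

    error : State → A → B → ℝ
    error η x y = ind (V x y) - η (W x y) x y

    -- The signs `M` test the entries with W = 1 and W = 0 against each other. Constant signs
    -- control the values of trees, `M = id` controls the transfer cost, to which the two kinds of
    -- entries contribute with opposite signs.
    Approximates : State → Set
    Approximates η = ∀ (M : Bool → Bool) w → Rank1 w →
      ∫ PQ (λ (x , y) → w x y * (sgn (M (W x y)) * error η x y)) ≤ ζ * (θ + ∫ PQ (λ (x , y) → w x y))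

    loss : State → ℝ
    loss η = ∫ PQ (λ (x , y) → error η x y * error η x y)

    Violation : State → Set
    Violation η = ∃ λ (a : A → Bool) → ∃ λ (b : B → Bool) → ∃ λ (M : Bool → Bool) →
      ζ * (θ + ∫ PQ (λ (x , y) → ind (a x) * ind (b y))) ≤ ∫ PQ (λ (x , y) → ind (a x) * ind (b y) * (sgn (M (W x y)) * error η x y))

    approximates : ∀ η → ¬ Violation η → Approximates η
    -- Subtracting ζ moves the mass of the weight into the bilinear form, so that a violating
    -- product yields a violating rectangle.
    approximates η nv M w rw = conclude (extremal P Q (λ x y → sg x y - ζ) w rw)
      where
      sg : A → B → ℝ
      sg x y = sgn (M (W x y)) * error η x y
      mean mass′ : (A → B → ℝ) → ℝ
      mean u = ∫ PQ (λ (x , y) → u x y * sg x y)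
      mass′ u = ∫ PQ (λ (x , y) → u x y)
      expand : ∀ (u : A → B → ℝ) → ∫ PQ (λ (x , y) → u x y * (sg x y - ζ)) ≈ mean u - mass′ u * ζ
      expand u = ≈-trans (∫-cong PQ λ (x , y) → solve 3 (λ u s z → u :* (s :- z) := u :* s :- u :* z) ≈-refl (u x y) (sg x y) ζ)
        (≈-trans (∫-- PQ _ _) (+-congˡ (-‿cong (∫-*ʳ PQ ζ _))))
      arith : ∀ s t e d {x y} → x ≈ s - e * ζ → y ≈ t - d * ζ → y ≤ x → s ≤ ζ * (θ + e) → t ≤ ζ * (θ + d)
      arith s t e d p q y≤x le = lin (≤-respˡ-≈ q (≤-respʳ-≈ p y≤x) ⊕ le)
        (solve 6 (λ s t e d z θ → (s :- e :* z) :+ z :* (θ :+ e) :- ((t :- d :* z) :+ s) := z :* (θ :+ d) :- t) ≈-refl s t e d ζ θ)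
      conclude : (∃ λ (a : A → Bool) → ∃ λ (b : B → Bool) → ∫ PQ (λ (x , y) → w x y * (sg x y - ζ)) ≤ ∫ PQ (λ (x , y) → ind (a x) * ind (b y) * (sg x y - ζ))) →
                 mean w ≤ ζ * (θ + mass′ w)
      conclude (a , b , le) = arith (mean ab) (mean w) (mass′ ab) (mass′ w) (expand ab) (expand w) le (<⇒≤ (≰⇒< λ v → nv (a , b , M , v)))
        where
        ab : A → B → ℝ
        ab x y = ind (a x) * ind (b y)

    -- Moving `η` by ζ in the direction of the violation changes the squared error by ζ² mass - 2ζ
    -- correlation. As the correlation is at least ζ (θ + mass), the error falls by 2ζ²θ or more.
    -- Clipping only helps, because the target bits lie in [0,1].
    step : ∀ η ((a , b , M , _) : Violation η) → loss (update a b (λ s → sgn (M s) * ζ) η) ≤ loss η - fromℕ 2 * (ζ * ζ * θ)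
    step η (a , b , M , v) = ≤-trans (∫-mono PQ λ (x , y) → pointwise x y) (≤-trans (≤-reflexive expand)
      (lin (fromζ ⊛ v ⊕ *-nonNeg (*-nonNeg 0≤ζ 0≤ζ) (∫-pos PQ λ (x , y) → *-nonNeg (proj₁ (𝕀-ind (a x))) (proj₁ (𝕀-ind (b y)))))
        (solve 5 (λ z θ e s l → (con (+ 2) :* z :* s :+ z :* z :* e) :- (con (+ 2) :* z :* (z :* (θ :+ e)) :+ con (+ 0))
          := (l :- con (+ 2) :* (z :* z :* θ)) :- (l :+ (z :* z :* e :- con (+ 2) :* z :* s))) ≈-refl ζ θ _ _ (loss η))))
      where
      η′ = update a b (λ s → sgn (M s) * ζ) η
      ab = λ x y → ind (a x) * ind (b y)
      sg = λ x y → sgn (M (W x y)) * error η x y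
      fromζ : 0# ≤ fromℕ 2 * ζ
      fromζ = *-nonNeg (0≤fromℕ 2) 0≤ζ
      moved : ∀ u e σ → σ * σ ≈ 1# → (u - (e + σ * ζ)) * (u - (e + σ * ζ)) ≈ (u - e) * (u - e) + 1# * 1# * (ζ * ζ - fromℕ 2 * ζ * (σ * (u - e)))
      moved u e σ p = ≈-trans (solve 4 (λ u e s z → (u :- (e :+ s :* z)) :* (u :- (e :+ s :* z))
          := (u :- e) :* (u :- e) :+ con (+ 1) :* con (+ 1) :* ((s :* s) :* (z :* z) :- con (+ 2) :* z :* (s :* (u :- e)))) ≈-refl u e σ ζ)
        (+-congˡ (*-congˡ (+-congʳ (≈-trans (*-congʳ p) (*-identityˡ _)))))
      pointwise : ∀ x y → error η′ x y * error η′ x y ≤ error η x y * error η x y + ab x y * (ζ * ζ - fromℕ 2 * ζ * sg x y)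
      pointwise x y with a x | b y
      ... | true | true = ≤-trans (clip-closer _ (𝕀-ind (V x y))) (≤-reflexive (moved _ _ _ (sgn² (M (W x y)))))
      ... | true | false = ≤-reflexive (solve 2 (λ e t → e := e :+ con (+ 1) :* con (+ 0) :* t) ≈-refl _ _)
      ... | false | β = ≤-reflexive (solve 3 (λ e t b → e := e :+ con (+ 0) :* b :* t) ≈-refl _ _ (ind β))
      expand : ∫ PQ (λ (x , y) → error η x y * error η x y + ab x y * (ζ * ζ - fromℕ 2 * ζ * sg x y)) ≈
               loss η + (ζ * ζ * ∫ PQ (λ (x , y) → ab x y) - fromℕ 2 * ζ * ∫ PQ (λ (x , y) → ab x y * sg x y))
      expand = ≈-trans (∫-+ PQ _ _) (+-congˡ (≈-trans (∫-cong PQ λ (x , y) → solve 4 (λ a p q s → a :* (p :- q :* s) := p :* a :- q :* (a :* s)) ≈-refl (ab x y) (ζ * ζ) (fromℕ 2 * ζ) (sg x y))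
        (≈-trans (∫-- PQ _ _) (+-cong (∫-* PQ _ _) (-‿cong (∫-* PQ _ _))))))

    run : ∀ K → ∃ λ (η : State) → (∀ s x y → 𝕀 (η s x y)) × Σ (Simple K η) λ _ → (Approximates η ⊎ loss η ≤ 1# - fromℕ K * (fromℕ 2 * (ζ * ζ * θ)))
    run zero = (λ _ _ _ → 0#) , (λ _ _ _ → 𝕀-0) , simple-constant , inj₂ (≤-trans (𝔼-≤ (P ⊗ Q) λ (x , y) → small (V x y))
        (≤-reflexive (solve 1 (λ z → con (+ 1) := con (+ 1) :- con (+ 0) :* z) ≈-refl _)))
      where
      small : ∀ b → (ind b - 0#) * (ind b - 0#) ≤ 1#
      small true  = ≤-reflexive (solve 0 ((con (+ 1) :- con (+ 0)) :* (con (+ 1) :- con (+ 0)) := con (+ 1)) ≈-refl)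
      small false = ≤-trans (≤-reflexive (solve 0 ((con (+ 0) :- con (+ 0)) :* (con (+ 0) :- con (+ 0)) := con (+ 0)) ≈-refl)) 0≤1
    run (suc K) with run K
    ... | η , i , s , inj₁ ap = η , i , simple-suc {K = K} {η} s , inj₁ ap
    ... | η , i , s , inj₂ le with em {Violation η}
    ...   | no nv = η , i , simple-suc {K = K} {η} s , inj₁ (approximates η nv)
    ...   | yes v@(a , b , M , _) = update a b (λ s → sgn (M s) * ζ) η , update-𝕀 a b (λ s → sgn (M s) * ζ) η i , simple-update {K = K} {η} a b (λ s → sgn (M s) * ζ) s ,
            inj₂ (≤-trans (step η v) (lin le (solve 3 (λ l k d → (con (+ 1) :- k :* d) :- l := (con (+ 1) :- (con (+ 1) :+ k) :* d) :- (l :- d)) ≈-refl (loss η) (fromℕ K) _)))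

    -- The squared error starts at no more than 1 and is never negative, so `K` steps that each gain
    -- 2ζ²θ cannot all take place.
    greedy : ∀ K → 1# < fromℕ K * (fromℕ 2 * (ζ * ζ * θ)) →
             ∃ λ (η : State) → (∀ s x y → 𝕀 (η s x y)) × Σ (Simple K η) λ _ → Approximates η
    greedy K big with run K
    ... | η , i , s , inj₁ ap = η , i , s , ap
    ... | η , i , s , inj₂ le = ⊥-elim (<⇒≰ big (lin (≤-trans (∫-pos PQ λ (x , y) → 0≤x² (error η x y)) le)
          (solve 1 (λ d → con (+ 1) :- d :- con (+ 0) := con (+ 1) :- d) ≈-refl _)))

  difference² : ∀ {x y} → 𝕀 x → 𝕀 y → (x - y) * (x - y) ≤ 1#
  difference² {x} {y} (p , q) (r , s) = lin (*-nonNeg (0≤-+ (≤⇒0≤ q) r) (0≤-+ p (≤⇒0≤ s)))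
    (solve 2 (λ x y → ((con (+ 1) :- x) :+ y) :* (x :+ (con (+ 1) :- y)) :- con (+ 0) := con (+ 1) :- (x :- y) :* (x :- y)) ≈-refl x y)

  -- Rows are classified by their values on k random anchor columns.
  module Anchors (P : Prob A) (Q : Prob B) (W : A → B → Bool) where

    private
      MP = meas P
      MQ = meas Q

    type : ∀ {k} → Vec B k → A → Vec Bool k
    type bs a = Vec.map (W a) bs

    average : ∀ {k} → Vec B k → B → Vec Bool k → ℝ
    average {k} bs b u = 𝔼 (cond (enumVec k) P (type bs) u) λ a → ind (W a b)

    dev : ∀ {k} → Vec B k → B → A → ℝ
    dev bs b a = ind (W a b) - average bs b (type bs a)

    unexplained : ∀ {k} → Vec B k → ℝ
    unexplained bs = 𝔼 Q λ b → 𝔼 P λ a → dev bs b a * dev bs b a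

    cov : ∀ {k} → Vec B k → B → B → ℝ
    cov bs b b′ = 𝔼 P λ a → dev bs b a * dev bs b′ a

    -- Expanding the square averages the product of the deviations at the four corners of a random
    -- rectangle of rows and columns: this is the fourth power of their box norm.
    box : ∀ {k} → Vec B k → ℝ
    box bs = 𝔼 Q λ b → 𝔼 Q λ b′ → cov bs b b′ * cov bs b b′

    -- Adds up the box norms as they were before each anchor was added. No single partition need be
    -- regular, but this sum has mean at most 1, and by `tot-norm` all its k terms dominate the same
    -- correlation.
    tot : ∀ {k} → Vec B k → ℝ
    tot []       = 0#
    tot (b ∷ bs) = box bs + tot bs

    0≤box : ∀ {k} (bs : Vec B k) → 0# ≤ box bs
    0≤box bs = ∫-pos MQ λ b → ∫-pos MQ λ b′ → 0≤x² _

    0≤tot : ∀ {k} (bs : Vec B k) → 0# ≤ tot bs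
    0≤tot []       = ≤-refl
    0≤tot (b ∷ bs) = 0≤-+ (0≤box bs) (0≤tot bs)

    average-𝕀 : ∀ {k} (bs : Vec B k) b u → 𝕀 (average bs b u)
    average-𝕀 {k} bs b u = 𝔼-𝕀 (cond (enumVec k) P (type bs) u) λ a → 𝕀-ind (W a b)

    dev² : ∀ {k} (bs : Vec B k) b a → dev bs b a * dev bs b a ≤ 1#
    dev² bs b a = difference² (𝕀-ind (W a b)) (average-𝕀 bs b (type bs a))

    orthogonal : ∀ {k} (bs : Vec B k) b (g : Vec Bool k → ℝ) → 𝔼 P (λ a → dev bs b a * g (type bs a)) ≈ 0#
    orthogonal {k} bs b g = ≈-trans (∫-cong MP λ a → solve 3 (λ x y g → (x :- y) :* g := x :* g :- y :* g) ≈-refl (ind (W a b)) (average bs b (type bs a)) (g (type bs a)))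
      (≈-trans (∫-- MP _ _) (≈-trans (+-congˡ (-‿cong (≈-trans
        (∫-cong MP λ a → ≈-sym (∫-*ʳ (meas (cond (enumVec k) P (type bs) (type bs a))) (g (type bs a)) _))
        (disintegrate (enumVec k) P (type bs) (λ u a → ind (W a b) * g u))))) (-‿inverseʳ _)))

    -- The block average is the orthogonal projection onto the functions of the type, so by
    -- Pythagoras no other `h` has a smaller error.
    best : ∀ {k} (bs : Vec B k) b (h : Vec Bool k → ℝ) →
           cov bs b b ≤ 𝔼 P (λ a → (ind (W a b) - h (type bs a)) * (ind (W a b) - h (type bs a)))
    best bs b h = lin (∫-pos MP λ a → 0≤x² (average bs b (type bs a) - h (type bs a))) (≈-trans
      (arith _ _ _ _ (orthogonal bs b (λ u → average bs b u - h u)) (≈-trans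
        (∫-cong MP λ a → solve 3 (λ w v h → (w :- h) :* (w :- h) := (w :- v) :* (w :- v) :+ (con (+ 2) :* ((w :- v) :* (v :- h)) :+ (v :- h) :* (v :- h))) ≈-refl (ind (W a b)) (average bs b (type bs a)) (h (type bs a)))
        (≈-trans (∫-+ MP _ _) (+-congˡ (≈-trans (∫-+ MP _ _) (+-congʳ (∫-* MP (fromℕ 2) _))))))) ≈-refl)
      where
      arith : ∀ x c o y → o ≈ 0# → y ≈ c + (fromℕ 2 * o + x) → x - 0# ≈ y - c
      arith x c o y p q = ≈-trans (solve 2 (λ x c → x :- con (+ 0) := (c :+ (con (+ 2) :* con (+ 0) :+ x)) :- c) ≈-refl x c)
        (+-congʳ (≈-trans (+-congˡ (+-congʳ (*-congˡ (≈-sym p)))) (≈-sym q)))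

    -- A new anchor explains the part of every column that is correlated with it.
    improve : ∀ {k} (bs : Vec B k) b b′ → cov (b ∷ bs) b′ b′ + cov bs b b′ * cov bs b b′ ≤ cov bs b′ b′
    improve {k} bs b b′ = arith (cov bs b b) c (cov bs b′ b′) (cov (b ∷ bs) b′ b′) (𝔼-≤ P (dev² bs b)) (≤-trans (best (b ∷ bs) b′ h) (≤-reflexive expand))
      where
      c = cov bs b b′
      h : Vec Bool (suc k) → ℝ
      h (v ∷ u) = average bs b′ u + c * (ind v - average bs b u)
      expand : 𝔼 P (λ a → (ind (W a b′) - h (type (b ∷ bs) a)) * (ind (W a b′) - h (type (b ∷ bs) a))) ≈ cov bs b′ b′ + (c * c * cov bs b b - (c + c) * c)
      expand = ≈-trans (∫-cong MP λ a → solve 5 (λ w v x y c → (w :- (v :+ c :* (x :- y))) :* (w :- (v :+ c :* (x :- y)))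
          := (w :- v) :* (w :- v) :+ (c :* c :* ((x :- y) :* (x :- y)) :- (c :+ c) :* ((x :- y) :* (w :- v)))) ≈-refl
            (ind (W a b′)) (average bs b′ (type bs a)) (ind (W a b)) (average bs b (type bs a)) c)
        (≈-trans (∫-+ MP _ _) (+-congˡ (≈-trans (∫-- MP _ _) (+-cong (∫-* MP _ _) (-‿cong (∫-* MP _ _))))))
      arith : ∀ v c x y → v ≤ 1# → y ≤ x + (c * c * v - (c + c) * c) → y + c * c ≤ x
      arith v c x y p q = lin (0≤x² c ⊛ p ⊕ q) (solve 4 (λ v c x y → (c :* c :* con (+ 1) :+ (x :+ (c :* c :* v :- (c :+ c) :* c))) :- (c :* c :* v :+ y) := x :- (y :+ c :* c)) ≈-refl v c x y)

    -- By `improve` a random new anchor lowers the unexplained energy on average by at least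
    -- `box bs`, which is exactly what `tot` gains; so the sum does not increase in the mean.
    energy : ∀ k → 𝔼 (indep {n = k} (λ _ → Q)) (λ bs → unexplained bs + tot bs) ≤ 1#
    energy zero = ≤-trans (≤-reflexive (+-identityʳ _)) (𝔼-≤ Q λ b → 𝔼-≤ P λ a → dev² [] b a)
    energy (suc k) = ≤-trans (≤-reflexive (∫-swap MQ (meas Qs) _)) (≤-trans (∫-mono (meas Qs) drop) (energy k))
      where
      Qs = indep {n = k} (λ _ → Q)
      drop : ∀ bs → 𝔼 Q (λ b → unexplained (b ∷ bs) + tot (b ∷ bs)) ≤ unexplained bs + tot bs
      drop bs = ≤-trans (≤-reflexive (≈-trans (∫-+ MQ _ _) (≈-trans (+-congˡ (𝔼-const Q _)) (≈-sym (+-assoc _ _ _)))))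
        (≤-trans (≤-reflexive (≈-sym (∫-+ MQ (λ b → unexplained (b ∷ bs)) (λ b → 𝔼 Q λ b′ → cov bs b b′ * cov bs b b′)))) less ⊕ ≤-refl)
        where
        less : 𝔼 Q (λ b → unexplained (b ∷ bs) + 𝔼 Q (λ b′ → cov bs b b′ * cov bs b b′)) ≤ unexplained bs
        less = 𝔼-≤ Q λ b → ≤-respˡ-≈ (∫-+ MQ _ _) (∫-mono MQ λ b′ → improve bs b b′)

    𝔼-tot : ∀ k → 𝔼 (indep {n = k} (λ _ → Q)) tot ≤ 1#
    𝔼-tot k = ≤-trans (∫-mono (meas (indep {n = k} (λ _ → Q))) λ bs → lin {a = tot bs} (∫-pos MQ λ b → ∫-pos MP λ a → 0≤x² (dev bs b a))
      (solve 2 (λ u t → u :- con (+ 0) := (u :+ t) :- t) ≈-refl (unexplained bs) (tot bs))) (energy k)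

    -- Test functions may see more than the row and the column themselves: the other string of a
    -- pair, or the partner to which a row is matched. So correlations are bounded over spaces that
    -- project to the given ones.
    module Extension {A′ B′ : Set} (P′ : Prob A′) (Q′ : Prob B′) (α : A′ → A) (β : B′ → B)
                     (P′∼ : mapP α P′ ∼ P) (Q′∼ : mapP β Q′ ∼ Q) where

      private
        MP′ = meas P′
        MQ′ = meas Q′
        M = meas (P′ ⊗ Q′)

      correlation : (A′ → ℝ) → (B′ → ℝ) → ℝ
      correlation F G = 𝔼 P′ λ a → 𝔼 Q′ λ b → F a * (G b * ind (W (α a) (β b)))

      Perp : ∀ {k} → Vec B k → (A′ → ℝ) → Set
      Perp {k} bs F = ∀ (h : Vec Bool k → ℝ) → 𝔼 P′ (λ a → F a * h (type bs (α a))) ≈ 0#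

      module _ (F : A′ → ℝ) (G : B′ → ℝ) (F² : ∀ a → F a * F a ≤ 1#) (G² : ∀ b → G b * G b ≤ 1#) where

        private x = correlation F G

        -- Two applications of the Cauchy–Schwarz inequality.
        box-norm : ∀ {k} (bs : Vec B k) → Perp bs F → (x * x) * (x * x) ≤ box bs
        box-norm bs perp = ≤-trans (mul-mono (0≤x² x) x²≤ (≤-trans (0≤x² x) x²≤) x²≤) (≤-trans (𝔼-jensen (Q′ ⊗ Q′) _)
          (≤-trans (∫-mono (meas (Q′ ⊗ Q′)) λ (b , b′) → drop b b′) (≤-reflexive push)))
          where
          d : A′ → B′ → ℝ
          d a b = dev bs (β b) (α a)
          y : A′ → ℝ
          y a = 𝔼 Q′ λ b → G b * d a b
          x≈ : x ≈ 𝔼 P′ λ a → F a * y a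
          x≈ = begin
            x ≈⟨ ∫-cong M (λ (a , b) → solve 4 (λ f g w v → f :* (g :* w) := f :* (g :* (w :- v)) :+ g :* (f :* v)) ≈-refl
                   (F a) (G b) (ind (W (α a) (β b))) (average bs (β b) (type bs (α a)))) ⟩
            ∫ M (λ (a , b) → F a * (G b * d a b) + G b * (F a * average bs (β b) (type bs (α a))))
              ≈⟨ ∫-+ M _ _ ⟩
            ∫ M (λ (a , b) → F a * (G b * d a b)) + ∫ M (λ (a , b) → G b * (F a * average bs (β b) (type bs (α a))))
              ≈⟨ +-cong (∫-cong MP′ λ a → ∫-* MQ′ (F a) _) (≈-trans (∫-swap MP′ MQ′ _) (∫-0 MQ′ λ b →
                   ≈-trans (∫-* MP′ (G b) _) (≈-trans (*-congˡ (perp (average bs (β b)))) (zeroʳ _)))) ⟩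
            𝔼 P′ (λ a → F a * y a) + 0#
              ≈⟨ +-identityʳ _ ⟩
            𝔼 P′ (λ a → F a * y a) ∎ where open ≈R
          c : B′ → B′ → ℝ
          c b b′ = cov bs (β b) (β b′)
          y²≈ : 𝔼 P′ (λ a → y a * y a) ≈ 𝔼 (Q′ ⊗ Q′) λ (b , b′) → G b * G b′ * c b b′
          y²≈ = begin
            𝔼 P′ (λ a → y a * y a)
              ≈⟨ ∫-cong MP′ (λ a → ≈-trans (≈-sym (∫-*ʳ MQ′ _ _)) (∫-cong MQ′ λ b → ≈-sym (∫-* MQ′ _ _))) ⟩
            𝔼 P′ (λ a → 𝔼 (Q′ ⊗ Q′) λ (b , b′) → G b * d a b * (G b′ * d a b′))
              ≈⟨ ∫-swap MP′ (meas (Q′ ⊗ Q′)) _ ⟩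
            𝔼 (Q′ ⊗ Q′) (λ (b , b′) → 𝔼 P′ λ a → G b * d a b * (G b′ * d a b′))
              ≈⟨ ∫-cong (meas (Q′ ⊗ Q′)) (λ (b , b′) → ≈-trans (∫-cong MP′ λ a → solve 4 (λ g x h y → g :* x :* (h :* y) := g :* h :* (x :* y)) ≈-refl (G b) (d a b) (G b′) (d a b′))
                   (≈-trans (∫-* MP′ _ _) (*-congˡ (P′∼ (λ a → dev bs (β b) a * dev bs (β b′) a))))) ⟩
            𝔼 (Q′ ⊗ Q′) (λ (b , b′) → G b * G b′ * c b b′) ∎ where open ≈R
          x²≤ : x * x ≤ 𝔼 (Q′ ⊗ Q′) λ (b , b′) → G b * G b′ * c b b′
          x²≤ = ≤-trans (≤-reflexive (*-cong x≈ x≈)) (≤-trans (𝔼-jensen P′ _) (≤-trans (∫-mono MP′ λ a →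
            ≤-respˡ-≈ (solve 2 (λ f y → f :* f :* (y :* y) := f :* y :* (f :* y)) ≈-refl (F a) (y a))
              (≤-respʳ-≈ (*-identityˡ _) (mul-mono (0≤x² (F a)) (F² a) (0≤x² (y a)) ≤-refl))) (≤-reflexive y²≈)))
          drop : ∀ b b′ → G b * G b′ * c b b′ * (G b * G b′ * c b b′) ≤ c b b′ * c b b′
          drop b b′ = ≤-respˡ-≈ (solve 3 (λ g h c → g :* g :* (h :* h) :* (c :* c) := g :* h :* c :* (g :* h :* c)) ≈-refl (G b) (G b′) (c b b′))
            (≤-respʳ-≈ (*-identityˡ _) (mul-mono (*-nonNeg (0≤x² (G b)) (0≤x² (G b′)))
              (≤-respʳ-≈ (*-identityˡ 1#) (mul-mono (0≤x² (G b)) (G² b) 0≤1 (G² b′))) (0≤x² (c b b′)) ≤-refl))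
          push : 𝔼 (Q′ ⊗ Q′) (λ (b , b′) → c b b′ * c b b′) ≈ box bs
          push = ≈-trans (∫-cong MQ′ λ b → Q′∼ (λ b′ → cov bs (β b) b′ * cov bs (β b) b′))
                         (Q′∼ (λ b → 𝔼 Q λ b′ → cov bs b b′ * cov bs b b′))

        -- A function orthogonal to all functions of the type is orthogonal to those of the coarser
        -- types obtained by dropping anchors. Hence every term of `tot` bounds the same fourth
        -- power.
        tot-norm : ∀ {k} (bs : Vec B k) → Perp bs F → fromℕ k * ((x * x) * (x * x)) ≤ tot bs
        tot-norm [] perp = ≤-reflexive (zeroˡ _)
        tot-norm {suc k} (b ∷ bs) perp = ≤-trans (≤-reflexive (solve 2 (λ k x → (con (+ 1) :+ k) :* x := x :+ k :* x) ≈-refl (fromℕ k) ((x * x) * (x * x))))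
          (box-norm bs perp′ ⊕ tot-norm bs perp′)
          where
          perp′ : Perp bs F
          perp′ h = perp (λ { (v ∷ u) → h u })

      perp-⊴ : ∀ {k} (bs : Vec B k) ν → 0# ≤ ν → 0# < fromℕ k → tot bs ≤ fromℕ k * ((ν * ν) * (ν * ν)) → ∀ F G →
               (∀ a → F a * F a ≤ 1#) → (∀ b → G b * G b ≤ 1#) → Perp bs F → correlation F G ⊴ ν
      perp-⊴ bs ν 0≤ν 0<k le F G F² G² perp = ²≤⇒⊴ 0≤ν (x²≤y²⇒x≤y (0≤x² ν) (*-cancelˡ-≤ 0<k (≤-trans (tot-norm F G F² G² bs perp) le)))

      residual : ∀ {k} → Vec B k → (A′ → ℝ) → A′ → ℝ
      residual {k} bs F a = F a - 𝔼 (cond (enumVec k) P′ (type bs ∘ α) (type bs (α a))) F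

      residual-perp : ∀ {k} (bs : Vec B k) F → Perp bs (residual bs F)
      residual-perp {k} bs F h = ≈-trans (∫-cong MP′ λ a → solve 3 (λ x y g → (x :- y) :* g := x :* g :- y :* g) ≈-refl (F a) (𝔼 (cond (enumVec k) P′ (type bs ∘ α) (type bs (α a))) F) (h (type bs (α a))))
        (≈-trans (∫-- MP′ _ _) (≈-trans (+-congˡ (-‿cong (≈-trans
          (∫-cong MP′ λ a → ≈-sym (∫-*ʳ (meas (cond (enumVec k) P′ (type bs ∘ α) (type bs (α a)))) (h (type bs (α a))) F))
          (disintegrate (enumVec k) P′ (type bs ∘ α) (λ u a → F a * h u))))) (-‿inverseʳ _)))

      residual² : ∀ {k} (bs : Vec B k) F → (∀ a → 𝕀 (F a)) → ∀ a → residual bs F a * residual bs F a ≤ 1#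
      residual² {k} bs F i a = difference² (i a) (𝔼-𝕀 (cond (enumVec k) P′ (type bs ∘ α) (type bs (α a))) i)

  module Regularity (P : Prob A) (Q : Prob B) (W : A → B → Bool) {k} (bs : Vec B k) (as : Vec A k) where

    private
      module Rᵣ = Anchors P Q W
      module R꜀ = Anchors Q P (λ b a → W a b)

    rowType : A → Vec Bool k
    rowType = Rᵣ.type bs

    colType : B → Vec Bool k
    colType = R꜀.type as

    density : Vec Bool k → Vec Bool k → ℝ
    density u v = 𝔼 (cond (enumVec k) P rowType u) λ a → 𝔼 (cond (enumVec k) Q colType v) λ b → ind (W a b)

    density-𝕀 : ∀ u v → 𝕀 (density u v)
    density-𝕀 u v = 𝔼-𝕀 (cond (enumVec k) P rowType u) λ a → 𝔼-𝕀 (cond (enumVec k) Q colType v) λ b → 𝕀-ind (W a b)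

    density-average : ∀ (h : Vec Bool k → Vec Bool k → ℝ) →
      𝔼 P (λ a → 𝔼 Q λ b → h (rowType a) (colType b) * density (rowType a) (colType b)) ≈
      𝔼 P (λ a → 𝔼 Q λ b → h (rowType a) (colType b) * ind (W a b))
    density-average h = ≈-trans (≈-trans (∫-cong (meas P) λ a → ∫-cong (meas Q) λ b → expand (rowType a) (colType b))
        (≈-trans (∫-cong (meas P) λ a → ∫-swap (meas Q) (meas (cond (enumVec k) P rowType (rowType a))) _)
          (disintegrate (enumVec k) P rowType (λ u a → 𝔼 Q λ b → 𝔼 (cond (enumVec k) Q colType (colType b)) λ b′ → h u (colType b) * ind (W a b′)))))
      (∫-cong (meas P) λ a → disintegrate (enumVec k) Q colType (λ v b → h (rowType a) v * ind (W a b)))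
      where
      expand : ∀ u v → h u v * density u v ≈ 𝔼 (cond (enumVec k) P rowType u) λ a → 𝔼 (cond (enumVec k) Q colType v) λ b → h u v * ind (W a b)
      expand u v = ≈-trans (≈-sym (∫-* (meas (cond (enumVec k) P rowType u)) (h u v) _)) (∫-cong (meas (cond (enumVec k) P rowType u)) λ a →
        ≈-sym (∫-* (meas (cond (enumVec k) Q colType v)) (h u v) _))

    module _ (ν : ℝ) (0≤ν : 0# ≤ ν) (0<k : 0# < fromℕ k)
             (row-tot : Rᵣ.tot bs ≤ fromℕ k * ((ν * ν) * (ν * ν))) (col-tot : R꜀.tot as ≤ fromℕ k * ((ν * ν) * (ν * ν)))
             {A′ B′ : Set} (P′ : Prob A′) (Q′ : Prob B′) (α : A′ → A) (β : B′ → B)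
             (P′∼ : mapP α P′ ∼ P) (Q′∼ : mapP β Q′ ∼ Q) where

      private
        module Eᵣ = Rᵣ.Extension P′ Q′ α β P′∼ Q′∼
        module E꜀ = R꜀.Extension Q′ P′ β α Q′∼ P′∼
        MP = meas P′
        MQ = meas Q′
        M = meas (P′ ⊗ Q′)

      -- `F` is replaced by its average over row types and then `G` by its average over column
      -- types; each replacement costs ν, by the anchors of its own side. Against weights that
      -- depend on types only, the matrix and its block densities have equal integrals.
      cut : ∀ w → Rank1 w →
        𝔼 (P′ ⊗ Q′) (λ (a , b) → w a b * (ind (W (α a) (β b)) - density (rowType (α a)) (colType (β b)))) ⊴ ν + ν
      cut w (F , G , F𝕀 , G𝕀 , eq) = ⊴-cong (≈-sym main) (⊴-+
        (Eᵣ.perp-⊴ bs ν 0≤ν 0<k row-tot (Eᵣ.residual bs F) G (Eᵣ.residual² bs F F𝕀) (λ b → square (G𝕀 b)) (Eᵣ.residual-perp bs F))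
        (E꜀.perp-⊴ as ν 0≤ν 0<k col-tot (E꜀.residual as G) (F̄ ∘ rowType ∘ α) (E꜀.residual² as G G𝕀)
          (λ a → square (𝔼-𝕀 (cond (enumVec k) P′ (rowType ∘ α) (rowType (α a))) F𝕀)) (E꜀.residual-perp as G)))
        where
        square : ∀ {x} → 𝕀 x → x * x ≤ 1#
        square i = proj₂ (𝕀-* i i)
        F̄ Ḡ : Vec Bool k → ℝ
        F̄ u = 𝔼 (cond (enumVec k) P′ (rowType ∘ α) u) F
        Ḡ v = 𝔼 (cond (enumVec k) Q′ (colType ∘ β) v) G
        W′ : A′ → B′ → ℝ
        W′ a b = ind (W (α a) (β b))
        F̄′ : A′ → ℝ
        F̄′ a = F̄ (rowType (α a))
        Ḡ′ : B′ → ℝ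
        Ḡ′ b = Ḡ (colType (β b))
        ρ : A′ → B′ → ℝ
        ρ a b = density (rowType (α a)) (colType (β b))
        -- Averaging over types replaces F and G by their conditional expectations.
        averaged : 𝔼 P′ (λ a → 𝔼 Q′ λ b → F a * (G b * ρ a b)) ≈ 𝔼 P′ λ a → 𝔼 Q′ λ b → F̄′ a * (Ḡ′ b * W′ a b)
        averaged = begin
          𝔼 P′ (λ a → 𝔼 Q′ λ b → F a * (G b * ρ a b))
            ≈⟨ ∫-cong MP (λ a → ≈-trans (≈-sym (disintegrate (enumVec k) Q′ (colType ∘ β) (λ v b → F a * (G b * density (rowType (α a)) v))))
                 (∫-cong MQ λ b → ≈-trans (∫-* (meas (cond (enumVec k) Q′ (colType ∘ β) (colType (β b)))) (F a) _) (*-congˡ (∫-*ʳ (meas (cond (enumVec k) Q′ (colType ∘ β) (colType (β b)))) (ρ a b) G)))) ⟩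
          𝔼 P′ (λ a → 𝔼 Q′ λ b → F a * (Ḡ′ b * ρ a b))
            ≈⟨ ∫-swap MP MQ _ ⟩
          𝔼 Q′ (λ b → 𝔼 P′ λ a → F a * (Ḡ′ b * ρ a b))
            ≈⟨ ∫-cong MQ (λ b → ≈-trans (≈-sym (disintegrate (enumVec k) P′ (rowType ∘ α) (λ u a → F a * (Ḡ′ b * density u (colType (β b))))))
                 (∫-cong MP λ a → ∫-*ʳ (meas (cond (enumVec k) P′ (rowType ∘ α) (rowType (α a)))) (Ḡ′ b * ρ a b) F)) ⟩
          𝔼 Q′ (λ b → 𝔼 P′ λ a → F̄′ a * (Ḡ′ b * ρ a b))
            ≈⟨ ≈-sym (∫-swap MP MQ _) ⟩
          𝔼 P′ (λ a → 𝔼 Q′ λ b → F̄′ a * (Ḡ′ b * ρ a b))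
            ≈⟨ push (λ a b → F̄ (rowType a) * (Ḡ (colType b) * density (rowType a) (colType b))) ⟩
          𝔼 P (λ a → 𝔼 Q λ b → F̄ (rowType a) * (Ḡ (colType b) * density (rowType a) (colType b)))
            ≈⟨ ≈-trans (∫-cong (meas (P ⊗ Q)) λ _ → ≈-sym (*-assoc _ _ _)) (≈-trans (density-average λ u v → F̄ u * Ḡ v) (∫-cong (meas (P ⊗ Q)) λ _ → *-assoc _ _ _)) ⟩
          𝔼 P (λ a → 𝔼 Q λ b → F̄ (rowType a) * (Ḡ (colType b) * ind (W a b)))
            ≈⟨ ≈-sym (push (λ a b → F̄ (rowType a) * (Ḡ (colType b) * ind (W a b)))) ⟩
          𝔼 P′ (λ a → 𝔼 Q′ λ b → F̄′ a * (Ḡ′ b * W′ a b)) ∎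
          where
          open ≈R
          push : (h : A → B → ℝ) → 𝔼 P′ (λ a → 𝔼 Q′ λ b → h (α a) (β b)) ≈ 𝔼 P λ a → 𝔼 Q λ b → h a b
          push h = ≈-trans (∫-cong MP λ a → Q′∼ (h (α a))) (P′∼ λ a → 𝔼 Q (h a))
        main : 𝔼 (P′ ⊗ Q′) (λ (a , b) → w a b * (W′ a b - ρ a b)) ≈
               Eᵣ.correlation (Eᵣ.residual bs F) G + E꜀.correlation (E꜀.residual as G) F̄′
        main = begin
          ∫ M (λ (a , b) → w a b * (W′ a b - ρ a b))
            ≈⟨ ∫-cong M (λ (a , b) → ≈-trans (*-congʳ (eq a b)) (solve 6 (λ f g w r f′ g′ → f :* g :* (w :- r)
                 := ((f :- f′) :* (g :* w) :+ (g :- g′) :* (f′ :* w)) :+ (f′ :* (g′ :* w) :- f :* (g :* r))) ≈-refl (F a) (G b) (W′ a b) (ρ a b) (F̄′ a) (Ḡ′ b))) ⟩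
          ∫ M (λ (a , b) → (Eᵣ.residual bs F a * (G b * W′ a b) + E꜀.residual as G b * (F̄′ a * W′ a b)) + (F̄′ a * (Ḡ′ b * W′ a b) - F a * (G b * ρ a b)))
            ≈⟨ ≈-trans (∫-+ M _ _) (+-cong (∫-+ M _ _) (∫-- M _ _)) ⟩
          (Eᵣ.correlation (Eᵣ.residual bs F) G + ∫ M (λ (a , b) → E꜀.residual as G b * (F̄′ a * W′ a b)))
            + (∫ M (λ (a , b) → F̄′ a * (Ḡ′ b * W′ a b)) - ∫ M (λ (a , b) → F a * (G b * ρ a b)))
            ≈⟨ +-cong (+-congˡ (∫-swap MP MQ _)) (≈-trans (+-congˡ (-‿cong averaged)) (-‿inverseʳ _)) ⟩
          (Eᵣ.correlation (Eᵣ.residual bs F) G + E꜀.correlation (E꜀.residual as G) F̄′) + 0#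
            ≈⟨ +-identityʳ _ ⟩
          Eᵣ.correlation (Eᵣ.residual bs F) G + E꜀.correlation (E꜀.residual as G) F̄′ ∎
          where open ≈R

  module _ {n : ℕ} {O : Set} (acc : O → Bool) where

    value : ∀ {X Y : Set} → Prob X → Prob Y → (X → Y → ℝ) → Algorithm n O 0 → ℝ
    value Rows Cols κ t = 𝔼 (indep {n = n} λ _ → Cols) λ φ → Interpretation.val {n} acc Rows κ φ [] [] t

    val-natural : ∀ {X X′ Y Y′ : Set} (Rows : Prob X) (g : X → X′) (h : Y → Y′) (κ : X′ → Y′ → ℝ) φ {k} (ρ : Vec X k) kn t →
      Interpretation.val {n} acc Rows (λ x y → κ (g x) (h y)) φ ρ kn t ≈ Interpretation.val {n} acc (mapP g Rows) κ (Vec.map h φ) (Vec.map g ρ) kn t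
    val-natural Rows g h κ φ ρ kn (output a)       = ≈-refl
    val-natural Rows g h κ φ ρ kn (coin r _ _ t u) = +-cong (*-congˡ (val-natural Rows g h κ φ ρ kn t)) (*-congˡ (val-natural Rows g h κ φ ρ kn u))
    val-natural Rows g h κ φ ρ kn (sample t)       = ∫-cong (meas Rows) λ x → val-natural Rows g h κ φ (x ∷ ρ) (blank ∷ kn) t
    val-natural Rows g h κ φ ρ kn (query i j t) with known kn i j
    ... | just b  = val-natural Rows g h κ φ ρ kn (t b)
    ... | nothing = +-cong (*-cong e (val-natural Rows g h κ φ ρ _ (t true))) (*-cong (+-congˡ (-‿cong e)) (val-natural Rows g h κ φ ρ _ (t false)))
      where e = ≈-reflexive (≡.sym (≡.cong₂ κ (lookup-map i g ρ) (lookup-map j h φ)))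

    value-natural : ∀ {X X′ Y Y′ : Set} (Rows : Prob X) (Cols : Prob Y) (g : X → X′) (h : Y → Y′) (κ : X′ → Y′ → ℝ) (t : Algorithm n O 0) →
      value Rows Cols (λ x y → κ (g x) (h y)) t ≈ value (mapP g Rows) (mapP h Cols) κ t
    value-natural Rows Cols g h κ t = ≈-trans (∫-cong (meas (indep {n = n} λ _ → Cols)) λ φ → val-natural Rows g h κ φ [] [] t)
      (indep-map {n = n} h (λ _ → Cols) λ φ → Interpretation.val {n} acc (mapP g Rows) κ φ [] [] t)

    value-change : ∀ {X Y : Set} (Rows Rows′ : Prob X) (Cols Cols′ : Prob Y) (κ : X → Y → ℝ) → (∀ x y → 𝕀 (κ x y)) → ∀ γ → 0# ≤ γ →
      Close γ Rows Rows′ → Close γ Cols Cols′ → ∀ s q (t : Algorithm n O 0) → samples t ℕ.≤ s → queries t ℕ.≤ q →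
      value Rows Cols κ t - value Rows′ Cols′ κ t ⊴ fromℕ s * γ + fromℕ q * γ
    value-change Rows Rows′ Cols Cols′ κ κ𝕀 γ 0≤γ close-rows close-cols s q t ls lq =
      ChangeOfMeasure.changeOfMeasure acc Rows Rows′ κ κ𝕀 γ γ 0≤γ 0≤γ close-rows s q t ls lq (λ _ → Cols) (λ _ → Cols′) (λ _ → close-cols) [] []

    value-lower : .{{_ : NonZero n}} → ∀ {X J : Set} (Rows : Prob X) (κ : X → Fin n × J → ℝ) → (∀ x y → 𝕀 (κ x y)) → (β : Fin n → Prob J) →
      ∀ q (t : Algorithm n O 0) → queries t ℕ.≤ q → fromℕ q ≤ fromℕ n → ∀ τ → 0# ≤ τ →
      (∀ π → Distinct π → τ ≤ 𝔼 (indep (β ∘ lookup π)) (λ l → Interpretation.val {n} acc Rows κ (Vec.zip π l) [] [] t)) →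
      (1# - fromℕ q * (fromℕ q * fromℕ n ⁻¹)) * τ ≤ value Rows (bind (uniform n) λ c → mapP (c ,_) (β c)) κ t
    value-lower Rows κ κ𝕀 β = WithoutReplacement.withReplacement acc Rows κ κ𝕀 β

  rank1-𝕀 : {w : A → B → ℝ} → Rank1 w → ∀ a b → 𝕀 (w a b)
  rank1-𝕀 (F , G , iF , iG , eq) a b = ≤-respʳ-≈ (≈-sym (eq a b)) (proj₁ i) , ≤-respˡ-≈ (≈-sym (eq a b)) (proj₂ i)
    where i = 𝕀-* (iF a) (iG b)

  -- The probability that a bit with mean e differs from b.
  disagree : Bool → ℝ → ℝ
  disagree b e = if b then 1# - e else e

  disagree-𝕀 : ∀ b {e} → 𝕀 e → 𝕀 (disagree b e)
  disagree-𝕀 true  i = 𝕀-not i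
  disagree-𝕀 false i = i

  -- Transplanting a transfer from μ to μ′

  module Lifting {n : ℕ} .{{_ : NonZero n}} (μ μ′ : Dist n) (T : Prob (Str n × Str n)) (T∼ : mapP proj₁ T ∼ ⟦ μ ⟧)
    {k : ℕ} (bs bs′ : Vec (Fin n) k) (as as′ : Vec (Str n) k) where

    Pairs : Set
    Pairs = Str n × Str n

    𝒰 : Prob (Fin n)
    𝒰 = uniform n

    module S  = Regularity ⟦ μ ⟧ 𝒰 lookup bs as
    module S′ = Regularity ⟦ μ′ ⟧ 𝒰 lookup bs′ as′
    module Aᵣ  = Anchors ⟦ μ ⟧ 𝒰 lookup
    module A꜀  = Anchors 𝒰 ⟦ μ ⟧ (λ c x → lookup x c)
    module Aᵣ′ = Anchors ⟦ μ′ ⟧ 𝒰 lookup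
    module A꜀′ = Anchors 𝒰 ⟦ μ′ ⟧ (λ c x → lookup x c)
    module G (ζ θ : ℝ) (0≤ζ : 0# ≤ ζ) (0≤θ : 0# ≤ θ) = Greedy T 𝒰 (λ r c → lookup (proj₁ r) c) (λ r c → lookup (proj₂ r) c) ζ θ 0≤ζ 0≤θ

    Type : Set
    Type = Vec Bool k

    -- A row of μ′ is matched with a random pair of the transfer whose first string has the same
    -- type, the one type taken with the anchors of μ′ and the other with those of μ. Types are all
    -- that the two sides have in common.
    rowPartner : Str n → Prob Pairs
    rowPartner x = cond (enumVec k) T (S.rowType ∘ proj₁) (S′.rowType x)

    colPartner : Fin n → Prob (Fin n)
    colPartner c = cond (enumVec k) 𝒰 S.colType (S′.colType c)

    Rows′ : Prob (Str n × Pairs)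
    Rows′ = bind ⟦ μ′ ⟧ λ x → mapP (x ,_) (rowPartner x)

    Cols′ : Prob (Fin n × Fin n)
    Cols′ = bind 𝒰 λ c → mapP (c ,_) (colPartner c)

    -- The trivial label gives this side the same form as `Cols′`, an index with a random label, so
    -- that both are instances of `value-lower`.
    Cols : Prob (Fin n × ⊤)
    Cols = bind 𝒰 λ c → mapP (c ,_) (dirac tt)

    -- All that common data say about the two distributions: the joint laws of row type, column type
    -- and entry nearly agree.
    TypeClose : ℝ → Set
    TypeClose γ = ∀ (f : Type → Type → Bool → ℝ) → (∀ u v b → f u v b ⊴ 1#) →
      𝔼 ⟦ μ ⟧ (λ x → 𝔼 𝒰 λ c → f (S.rowType x) (S.colType c) (lookup x c)) -
      𝔼 ⟦ μ′ ⟧ (λ x → 𝔼 𝒰 λ c → f (S′.rowType x) (S′.colType c) (lookup x c)) ⊴ γ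

    Rows′∼ : mapP proj₁ Rows′ ∼ ⟦ μ′ ⟧
    Rows′∼ f = ∫-cong (meas ⟦ μ′ ⟧) λ x → 𝔼-const (rowPartner x) (f x)

    Cols′∼ : mapP proj₁ Cols′ ∼ 𝒰
    Cols′∼ f = ∫-cong (meas 𝒰) λ c → 𝔼-const (colPartner c) (f c)

    record Parameters : Set₁ where
      field
        ν γ ζ θ : ℝ
        K       : ℕ
        0≤ν     : 0# ≤ ν
        0≤γ     : 0# ≤ γ
        0≤ζ     : 0# ≤ ζ
        0≤θ     : 0# ≤ θ
        0<k     : 0# < fromℕ k
      Anchored : ℝ → Set
      Anchored t = t ≤ fromℕ k * ((ν * ν) * (ν * ν))
      -- The cut-norm error on either side: 2ν from regularity and, for μ′, 2γ for using the block
      -- densities of μ. By `small` it stays below ζθ after the amplification by 4^K.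
      z : ℝ
      z = (ν + ν) + (γ + γ)
      field
        rowTot  : Anchored (Aᵣ.tot bs)
        colTot  : Anchored (A꜀.tot as)
        rowTot′ : Anchored (Aᵣ′.tot bs′)
        colTot′ : Anchored (A꜀′.tot as′)
        typeClose : TypeClose γ
        small   : 4^ K * z + 4^ K * z ≤ ζ * θ
        η       : Bool → Pairs → Fin n → ℝ
        η𝕀      : ∀ s r c → 𝕀 (η s r c)
        simple  : Simple K η
        approximates : G.Approximates ζ θ 0≤ζ 0≤θ η

    module _ (params : Parameters) where
      open Parameters params

      0≤γ+γ : 0# ≤ γ + γ
      0≤γ+γ = 0≤-+ 0≤γ 0≤γ

      gap : ∀ (w : Pairs → Fin n × ⊤ → ℝ) → Rank1 w → 𝔼 (T ⊗ Cols) (λ (r , c) → w r c * (ind (lookup (proj₁ r) (proj₁ c)) - S.density (S.rowType (proj₁ r)) (S.colType (proj₁ c)))) ⊴ z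
      gap w rw = ⊴-≤ (S.cut ν 0≤ν 0<k rowTot colTot T Cols proj₁ proj₁ T∼ (λ f → ≈-refl) w rw)
        (lin 0≤γ+γ (solve 2 (λ n g → g :- con (+ 0) := (n :+ g) :- n) ≈-refl (ν + ν) (γ + γ)))

      -- The worst test function is the sign of the difference of the block densities.
      density-gap : ∀ (w : Str n × Pairs → Fin n × Fin n → ℝ) → (∀ r c → 𝕀 (w r c)) →
        𝔼 (Rows′ ⊗ Cols′) (λ (r , c) → w r c * (S′.density (S′.rowType (proj₁ r)) (S′.colType (proj₁ c)) - S.density (S′.rowType (proj₁ r)) (S′.colType (proj₁ c)))) ⊴ γ + γ
      density-gap w iw = ⊴-≤ (∫-⊴ (meas (Rows′ ⊗ Cols′)) λ (r , c) → below (S′.density (S′.rowType (proj₁ r)) (S′.colType (proj₁ c)) - S.density (S′.rowType (proj₁ r)) (S′.colType (proj₁ c))) (w r c) (iw r c)) (≤-trans (≤-reflexive push) (proj₁ bound))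
        where
        σ : Type → Type → ℝ
        σ u v = sgn (positive (S′.density u v - S.density u v))
        σ⊴ : ∀ b → sgn b ⊴ 1#
        σ⊴ true  = ≤-refl , ≤-trans (≤-respʳ-≈ -0#≈0# (neg-mono 0≤1)) 0≤1
        σ⊴ false = ≤-trans (≤-respʳ-≈ -0#≈0# (neg-mono 0≤1)) 0≤1 , ≤-reflexive (-‿involutive 1#)
        ind⊴ : ∀ b c → sgn b * ind c ⊴ 1#
        ind⊴ b true  = ⊴-cong (≈-sym (*-identityʳ _)) (σ⊴ b)
        ind⊴ b false = ⊴-0 (zeroʳ _) 0≤1
        𝕀⊴ : ∀ b {x} → 𝕀 x → sgn b * x ⊴ 1#
        𝕀⊴ b {x} i = ⊴-cong (*-comm _ _) (⊴-≤ (⊴-scale (proj₁ i) (σ⊴ b)) (≤-respˡ-≈ (≈-sym (*-identityʳ _)) (proj₂ i)))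
        below : ∀ x w → 𝕀 w → w * x ⊴ sgn (positive x) * x
        below x w (p , q) with em {0# ≤ x}
        ... | yes r = mul-mono p q r ≤-refl , lin (0≤-+ (*-nonNeg p r) r) (solve 2 (λ w x → w :* x :+ x :- con (+ 0) := con (+ 1) :* x :- :- (w :* x)) ≈-refl w x)
        ... | no  r = lin (0≤-+ (*-nonNeg p 0≤-x) 0≤-x) (solve 2 (λ w x → w :* :- x :+ :- x :- con (+ 0) := :- con (+ 1) :* x :- w :* x) ≈-refl w x)
                    , lin (*-nonNeg (≤⇒0≤ q) 0≤-x) (solve 2 (λ w x → (con (+ 1) :- w) :* :- x :- con (+ 0) := :- con (+ 1) :* x :- :- (w :* x)) ≈-refl w x)
          where 0≤-x = 0≤-neg (<⇒≤ (≰⇒< r))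
        E E′ : (Str n → Fin n → ℝ) → ℝ
        E f  = 𝔼 ⟦ μ ⟧ λ x → 𝔼 𝒰 λ c → f x c
        E′ f = 𝔼 ⟦ μ′ ⟧ λ x → 𝔼 𝒰 λ c → f x c
        σ′ = λ x c → σ (S′.rowType x) (S′.colType c)
        ρ′ = λ x c → S′.density (S′.rowType x) (S′.colType c)
        ρ  = λ x c → S.density (S′.rowType x) (S′.colType c)
        push : 𝔼 (Rows′ ⊗ Cols′) (λ (r , c) → σ′ (proj₁ r) (proj₁ c) * (ρ′ (proj₁ r) (proj₁ c) - ρ (proj₁ r) (proj₁ c))) ≈ E′ (λ x c → σ′ x c * ρ′ x c) - E′ (λ x c → σ′ x c * ρ x c)
        push = ≈-trans (∫-cong (meas Rows′) λ r → Cols′∼ (λ c → σ′ (proj₁ r) c * (ρ′ (proj₁ r) c - ρ (proj₁ r) c)))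
          (≈-trans (Rows′∼ λ x → 𝔼 𝒰 λ c → σ′ x c * (ρ′ x c - ρ x c)) (≈-trans
            (∫-cong (meas (⟦ μ′ ⟧ ⊗ 𝒰)) λ (x , c) → solve 3 (λ s p q → s :* (p :- q) := s :* p :- s :* q) ≈-refl (σ′ x c) (ρ′ x c) (ρ x c))
            (∫-- (meas (⟦ μ′ ⟧ ⊗ 𝒰)) _ _)))
        bound : E′ (λ x c → σ′ x c * ρ′ x c) - E′ (λ x c → σ′ x c * ρ x c) ⊴ γ + γ
        bound = ⊴-cong (≈-trans (+-congˡ (+-congʳ (S.density-average σ))) (≈-trans
            (solve 3 (λ a b c → :- (a :- b) :+ (a :- c) := b :- c) ≈-refl
              (E λ x c → σ (S.rowType x) (S.colType c) * ind (lookup x c)) (E′ λ x c → σ′ x c * ind (lookup x c)) (E′ λ x c → σ′ x c * ρ x c))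
            (+-congʳ (≈-sym (S′.density-average σ)))))
          (⊴-+ (⊴-neg (typeClose (λ u v b → σ u v * ind b) λ u v b → ind⊴ (positive (S′.density u v - S.density u v)) b))
               (typeClose (λ u v b → σ u v * S.density u v) λ u v b → 𝕀⊴ (positive (S′.density u v - S.density u v)) (S.density-𝕀 u v)))

      -- The bits of μ′ are compared with the block densities of μ rather than with their own, so
      -- that afterwards both sides refer to the same kernel on labels.
      gap′ : ∀ (w : Str n × Pairs → Fin n × Fin n → ℝ) → Rank1 w → 𝔼 (Rows′ ⊗ Cols′) (λ (r , c) → w r c * (ind (lookup (proj₁ r) (proj₁ c)) - S.density (S′.rowType (proj₁ r)) (S′.colType (proj₁ c)))) ⊴ z
      gap′ w rw = ⊴-cong (≈-sym (≈-trans (∫-cong (meas (Rows′ ⊗ Cols′)) λ (r , c) →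
          solve 4 (λ w x y z → w :* (x :- z) := w :* (x :- y) :+ w :* (y :- z)) ≈-refl (w r c) (ind (lookup (proj₁ r) (proj₁ c)))
            (S′.density (S′.rowType (proj₁ r)) (S′.colType (proj₁ c))) (S.density (S′.rowType (proj₁ r)) (S′.colType (proj₁ c)))) (∫-+ (meas (Rows′ ⊗ Cols′)) _ _)))
        (⊴-+ (S′.cut ν 0≤ν 0<k rowTot′ colTot′ Rows′ Cols′ proj₁ proj₁ Rows′∼ Cols′∼ w rw) (density-gap w (rank1-𝕀 rw)))

      -- Both sides are compared through types together with the partner's row and column.
      rowLabel : Pairs → Type × Pairs
      rowLabel r = S.rowType (proj₁ r) , r

      rowLabel′ : Str n × Pairs → Type × Pairs
      rowLabel′ (x , r) = S′.rowType x , r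

      colLabel : Fin n × ⊤ → Type × Fin n
      colLabel (c , _) = S.colType c , c

      colLabel′ : Fin n × Fin n → Type × Fin n
      colLabel′ (c′ , c) = S′.colType c′ , c

      -- Within a type, `rowPartner` follows the conditional law of the transfer, so the two laws of
      -- labelled rows differ only in the law of the type itself.
      rows-close : Close γ (mapP rowLabel T) (mapP rowLabel′ Rows′)
      rows-close f i = ⊴-cong (+-congʳ (≈-sym (≈-trans (≈-sym (disintegrate (enumVec k) T (S.rowType ∘ proj₁) (λ u r → f (u , r)))) (≈-trans (T∼ (g ∘ S.rowType)) (≈-sym (∫-cong (meas ⟦ μ ⟧) λ x → 𝔼-const 𝒰 _))))))
        (⊴-cong (+-congˡ (-‿cong (∫-cong (meas ⟦ μ′ ⟧) λ x → 𝔼-const 𝒰 _))) (typeClose (λ u _ _ → g u) λ u _ _ → g⊴ u))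
        where
        g : Type → ℝ
        g u = 𝔼 (cond (enumVec k) T (S.rowType ∘ proj₁) u) λ r → f (u , r)
        g⊴ : ∀ u → g u ⊴ 1#
        g⊴ u = proj₂ h , ≤-trans (≤-respʳ-≈ -0#≈0# (neg-mono (proj₁ h))) 0≤1
          where h = 𝔼-𝕀 (cond (enumVec k) T (S.rowType ∘ proj₁) u) λ r → i (u , r)

      cols-close : Close γ (mapP colLabel Cols) (mapP colLabel′ Cols′)
      cols-close f i = ⊴-cong (+-cong (≈-trans (𝔼-const ⟦ μ ⟧ _) (disintegrate (enumVec k) 𝒰 S.colType (λ v c → f (v , c)))) (-‿cong (𝔼-const ⟦ μ′ ⟧ _)))
        (typeClose (λ _ v _ → g v) λ _ v _ → g⊴ v)
        where
        g : Type → ℝ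
        g v = 𝔼 (cond (enumVec k) 𝒰 S.colType v) λ c → f (v , c)
        g⊴ : ∀ v → g v ⊴ 1#
        g⊴ v = proj₂ h , ≤-trans (≤-respʳ-≈ -0#≈0# (neg-mono (proj₁ h))) 0≤1
          where h = 𝔼-𝕀 (cond (enumVec k) 𝒰 S.colType v) λ c → i (v , c)

  blend : ℝ → ℝ → ℝ → ℝ
  blend w x y = w * x + (1# - w) * y

  blend-ind : (η : Bool → ℝ) (b : Bool) → η b ≈ blend (ind b) (η true) (η false)
  blend-ind η true  = solve 2 (λ x y → x := con (+ 1) :* x :+ (con (+ 1) :- con (+ 1)) :* y) ≈-refl (η true) (η false)
  blend-ind η false = solve 2 (λ x y → y := con (+ 0) :* x :+ (con (+ 1) :- con (+ 0)) :* y) ≈-refl (η true) (η false)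

  module LiftedValues {n : ℕ} .{{_ : NonZero n}} (μ μ′ : Dist n) (T : Prob (Str n × Str n)) (T∼ : mapP proj₁ T ∼ ⟦ μ ⟧)
    {k : ℕ} (bs bs′ : Vec (Fin n) k) (as as′ : Vec (Str n) k) (params : Lifting.Parameters μ μ′ T T∼ bs bs′ as as′) where

    open Lifting μ μ′ T T∼ bs bs′ as as′ public
    open Parameters params public

    -- The kernels of the second components under μ, of its label-determined approximation, and of the lifted distribution.
    κ : Pairs → Fin n × ⊤ → ℝ
    κ (x , y) (c , _) = ind (lookup y c)

    κ₁ : Type × Pairs → Type × Fin n → ℝ
    κ₁ (u , r) (v , c) = blend (S.density u v) (η true r c) (η false r c)

    κ′ : Str n × Pairs → Fin n × Fin n → ℝ
    κ′ (x , r) (c′ , c) = η (lookup x c′) r c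

    κ𝕀 : ∀ r c → 𝕀 (κ r c)
    κ𝕀 (x , y) (c , _) = 𝕀-ind (lookup y c)

    κ₁𝕀 : ∀ r c → 𝕀 (κ₁ r c)
    κ₁𝕀 (u , r) (v , c) = 𝕀-mix (S.density-𝕀 u v) (η𝕀 true r c) (η𝕀 false r c)

    κ′𝕀 : ∀ r c → 𝕀 (κ′ r c)
    κ′𝕀 (x , r) (c′ , c) = η𝕀 (lookup x c′) r c

    private
      M = meas (T ⊗ Cols)
      M′ = meas (Rows′ ⊗ Cols′)

      W : Pairs → Fin n × ⊤ → ℝ
      W r c = ind (lookup (proj₁ r) (proj₁ c))
      ρ : Pairs → Fin n × ⊤ → ℝ
      ρ r c = S.density (S.rowType (proj₁ r)) (S.colType (proj₁ c))
      W′ : Str n × Pairs → Fin n × Fin n → ℝ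
      W′ r c = ind (lookup (proj₁ r) (proj₁ c))
      ρ′ : Str n × Pairs → Fin n × Fin n → ℝ
      ρ′ r c = S.density (S′.rowType (proj₁ r)) (S′.colType (proj₁ c))
      e : Bool → Pairs → Fin n × ⊤ → ℝ
      e s r c = η s r (proj₁ c)
      e′ : Bool → Str n × Pairs → Fin n × Fin n → ℝ
      e′ s r c = η s (proj₂ r) (proj₂ c)

      0≤ζθ : 0# ≤ ζ * θ
      0≤ζθ = *-nonNeg 0≤ζ 0≤θ

      difference : ∀ {x y} → x ⊴ 4^ K * z → y ⊴ 4^ K * z → x - y ⊴ ζ * θ
      difference p q = ⊴-≤ (⊴-+ p (⊴-neg q)) small

    -- By simplicity W - ρ stays small even when multiplied by a function of `η`. A difference of
    -- two such functions is tested because it is the factor by which a blend of them changes when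
    -- the bit is replaced by its block density.
    split : ∀ {f g : ℝ → ℝ → ℝ} → (∀ {x y} → 𝕀 x → 𝕀 y → 𝕀 (f x y)) → (∀ {x y} → 𝕀 x → 𝕀 y → 𝕀 (g x y)) → ∀ w → Rank1 w →
      ∫ M (λ (r , c) → w r c * ((W r c - ρ r c) * (f (e true r c) (e false r c) - g (e true r c) (e false r c)))) ⊴ ζ * θ
    split {f} {g} fi gi w rw = ⊴-cong
      (≈-sym (≈-trans (∫-cong M λ (r , c) → solve 4 (λ w d f g → w :* (d :* (f :- g)) := w :* d :* f :- w :* d :* g) ≈-refl
        (w r c) (W r c - ρ r c) (f (e true r c) (e false r c)) (g (e true r c) (e false r c))) (∫-- M _ _)))
      (difference (simple T Cols id proj₁ (λ r c → W r c - ρ r c) z (gap params) f fi w rw)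
                  (simple T Cols id proj₁ (λ r c → W r c - ρ r c) z (gap params) g gi w rw))

    split′ : ∀ {f g : ℝ → ℝ → ℝ} → (∀ {x y} → 𝕀 x → 𝕀 y → 𝕀 (f x y)) → (∀ {x y} → 𝕀 x → 𝕀 y → 𝕀 (g x y)) → ∀ w → Rank1 w →
      ∫ M′ (λ (r , c) → w r c * ((W′ r c - ρ′ r c) * (f (e′ true r c) (e′ false r c) - g (e′ true r c) (e′ false r c)))) ⊴ ζ * θ
    split′ {f} {g} fi gi w rw = ⊴-cong
      (≈-sym (≈-trans (∫-cong M′ λ (r , c) → solve 4 (λ w d f g → w :* (d :* (f :- g)) := w :* d :* f :- w :* d :* g) ≈-refl
        (w r c) (W′ r c - ρ′ r c) (f (e′ true r c) (e′ false r c)) (g (e′ true r c) (e′ false r c))) (∫-- M′ _ _)))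
      (difference (simple Rows′ Cols′ proj₂ proj₂ (λ r c → W′ r c - ρ′ r c) z (gap′ params) f fi w rw)
                  (simple Rows′ Cols′ proj₂ proj₂ (λ r c → W′ r c - ρ′ r c) z (gap′ params) g gi w rw))

    approximates-⊴ : ∀ (w : Pairs → Fin n × ⊤ → ℝ) → Rank1 w →
      ∫ M (λ (r , c) → w r c * (κ r c - η (lookup (proj₁ r) (proj₁ c)) r (proj₁ c))) ⊴ ζ * (θ + ∫ M (λ (r , c) → w r c))
    approximates-⊴ w (F , G , iF , iG , eq) = ≤-respˡ-≈ (∫-cong M λ (r , c) → *-congˡ (*-identityˡ _)) (approximates (λ _ → true) w₀ rw₀)
      , ≤-respˡ-≈ (≈-trans (∫-cong M λ (r , c) → solve 2 (λ w x → w :* (:- con (+ 1) :* x) := :- (w :* x)) ≈-refl (w r c) (κ r c - η (lookup (proj₁ r) (proj₁ c)) r (proj₁ c))) (∫-neg M _))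
          (approximates (λ _ → false) w₀ rw₀)
      where
      w₀ : Pairs → Fin n → ℝ
      w₀ r c = w r (c , tt)
      rw₀ : Rank1 w₀
      rw₀ = F , (λ c → G (c , tt)) , iF , (λ c → iG (c , tt)) , λ r c → eq r (c , tt)

    -- There are two errors. `approximates` replaces the second string's bit by `η` at the first
    -- string's bit. As `η` at a bit is an affine function of the bit, replacing that bit by its
    -- density costs (W - ρ)(η true - η false), which `split` controls.
    close : ∀ (w : Pairs → Fin n × ⊤ → ℝ) → Rank1 w → ∫ M (λ (r , c) → w r c * (κ r c - κ₁ (rowLabel params r) (colLabel params c))) ⊴ (ζ + ζ) * (θ + ∫ M (λ (r , c) → w r c))
    close w rw = ⊴-cong (≈-sym (≈-trans (∫-cong M λ (r , c) → ≈-trans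
          (solve 6 (λ w v h p q x → w :* (v :- (x :* p :+ (con (+ 1) :- x) :* q)) := w :* (v :- h) :+ w :* (h :- (x :* p :+ (con (+ 1) :- x) :* q))) ≈-refl
            (w r c) (κ r c) (η (lookup (proj₁ r) (proj₁ c)) r (proj₁ c)) (e true r c) (e false r c) (ρ r c))
          (+-congˡ (*-congˡ (≈-trans (+-congʳ (blend-ind (λ s → e s r c) (lookup (proj₁ r) (proj₁ c))))
            (solve 4 (λ y p q x → (y :* p :+ (con (+ 1) :- y) :* q) :- (x :* p :+ (con (+ 1) :- x) :* q) := (y :- x) :* (p :- q)) ≈-refl (W r c) (e true r c) (e false r c) (ρ r c))))))
        (∫-+ M _ _)))
      (⊴-≤ (⊴-+ (approximates-⊴ w rw) (split {λ x _ → x} {λ _ y → y} (λ p _ → p) (λ _ q → q) w rw))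
        (lin (*-nonNeg 0≤ζ (∫-pos M λ (r , c) → proj₁ (rank1-𝕀 rw r c))) (solve 3 (λ z θ m → z :* m :- con (+ 0) := (z :+ z) :* (θ :+ m) :- (z :* (θ :+ m) :+ z :* θ)) ≈-refl ζ θ _)))

    close′ : ∀ (w : Str n × Pairs → Fin n × Fin n → ℝ) → Rank1 w → ∫ M′ (λ (r , c) → w r c * (κ′ r c - κ₁ (rowLabel′ params r) (colLabel′ params c))) ⊴ (ζ + ζ) * (θ + ∫ M′ (λ (r , c) → w r c))
    close′ w rw = ⊴-cong (≈-sym (∫-cong M′ λ (r , c) → *-congˡ (≈-trans (+-congʳ (blend-ind (λ s → e′ s r c) (lookup (proj₁ r) (proj₁ c))))
            (solve 4 (λ y p q x → (y :* p :+ (con (+ 1) :- y) :* q) :- (x :* p :+ (con (+ 1) :- x) :* q) := (y :- x) :* (p :- q)) ≈-refl (W′ r c) (e′ true r c) (e′ false r c) (ρ′ r c)))))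
      (⊴-≤ (split′ {λ x _ → x} {λ _ y → y} (λ p _ → p) (λ _ q → q) w rw)
        (lin (0≤-+ 0≤ζθ (*-nonNeg (0≤-+ 0≤ζ 0≤ζ) (∫-pos M′ λ (r , c) → proj₁ (rank1-𝕀 rw r c)))) (solve 3 (λ z θ m → z :* θ :+ (z :+ z) :* m :- con (+ 0) := (z :+ z) :* (θ :+ m) :- z :* θ) ≈-refl ζ θ _)))

    -- Both kernels are compared with `κ₁`, which sees the labels only: by `counting` on either side
    -- and, between the two, by a change of the laws of the labels.
    values-close : ∀ {O : Set} (acc : O → Bool) (t : Algorithm n O 0) s q → samples t ℕ.≤ s → queries t ℕ.≤ q →
      value acc T Cols κ t - value acc Rows′ Cols′ κ′ t ⊴
      (fromℕ q * ((ζ + ζ) * (2^ q * θ + (1# + 1#))) + (fromℕ s * γ + fromℕ q * γ)) + fromℕ q * ((ζ + ζ) * (2^ q * θ + (1# + 1#)))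
    values-close {O} acc t s q ls lq = ⊴-cong
      (≈-trans (+-congʳ (+-congˡ (+-cong (≈-sym natural) (-‿cong (≈-sym natural′)))))
        (solve 4 (λ a b c d → (a :- b) :+ (b :- c) :+ :- (d :- c) := a :- d) ≈-refl v v₁ v₁′ v′))
      (⊴-+ (⊴-+ counted changed) (⊴-neg counted′))
      where
      v v₁ v₁′ v′ w₁ w₁′ : ℝ
      v   = value acc T Cols κ t
      v₁  = value acc T Cols (λ r c → κ₁ (rowLabel params r) (colLabel params c)) t
      v₁′ = value acc Rows′ Cols′ (λ r c → κ₁ (rowLabel′ params r) (colLabel′ params c)) t
      v′  = value acc Rows′ Cols′ κ′ t
      w₁  = value acc (mapP (rowLabel params) T) (mapP (colLabel params) Cols) κ₁ t
      w₁′ = value acc (mapP (rowLabel′ params) Rows′) (mapP (colLabel′ params) Cols′) κ₁ t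
      c : ℝ
      c = fromℕ q * ((ζ + ζ) * (2^ q * θ + (1# + 1#)))
      natural : v₁ ≈ w₁
      natural = value-natural acc T Cols (rowLabel params) (colLabel params) κ₁ t
      natural′ : v₁′ ≈ w₁′
      natural′ = value-natural acc Rows′ Cols′ (rowLabel′ params) (colLabel′ params) κ₁ t
      counted : v - v₁ ⊴ c
      counted = Counting.counting acc T Cols κ (λ r c → κ₁ (rowLabel params r) (colLabel params c)) κ𝕀 (λ r c → κ₁𝕀 (rowLabel params r) (colLabel params c)) (ζ + ζ) θ (0≤-+ 0≤ζ 0≤ζ) 0≤θ close q t lq
      counted′ : v′ - v₁′ ⊴ c
      counted′ = Counting.counting acc Rows′ Cols′ κ′ (λ r c → κ₁ (rowLabel′ params r) (colLabel′ params c)) κ′𝕀 (λ r c → κ₁𝕀 (rowLabel′ params r) (colLabel′ params c)) (ζ + ζ) θ (0≤-+ 0≤ζ 0≤ζ) 0≤θ close′ q t lq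
      changed : w₁ - w₁′ ⊴ fromℕ s * γ + fromℕ q * γ
      changed = value-change acc (mapP (rowLabel params) T) (mapP (rowLabel′ params) Rows′) (mapP (colLabel params) Cols) (mapP (colLabel′ params) Cols′)
        κ₁ κ₁𝕀 γ 0≤γ (rows-close params) (cols-close params) s q t ls lq

    transferCost : ℝ
    transferCost = ∫ M λ (r , c) → disagree (lookup (proj₁ r) (proj₁ c)) (κ r c)

    liftedCost : ℝ
    liftedCost = ∫ M′ λ (r , c) → disagree (lookup (proj₁ r) (proj₁ c)) (κ′ r c)

    -- The cost is an average over one entry, so it runs through the same chain as the values, with
    -- `κd` in place of `κ₁` and no tree. Where the first string has a 1, the disagreement falls as
    -- `η` grows, elsewhere it rises; hence `M = id` in the last step.
    liftedCost-≤ : liftedCost - transferCost ≤ ζ * θ + ((γ + γ) + (ζ * θ + ζ * (θ + 1#)))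
    liftedCost-≤ = ≤-trans (≤-reflexive (solve 5 (λ a b c d e → a :- e := (a :- b) :+ (:- (c :- b) :+ (:- (d :- c) :+ (d :- e)))) ≈-refl
        liftedCost (∫ M′ λ (r , c) → κd (rowLabel′ params r) (colLabel′ params c)) (∫ M λ (r , c) → κd (rowLabel params r) (colLabel params c)) (∫ M λ (r , c) → disη r c) transferCost))
      (proj₁ step₁ ⊕ (proj₁ (⊴-neg step₂) ⊕ (proj₁ (⊴-neg step₃) ⊕ step₄)))
      where
      κd : Type × Pairs → Type × Fin n → ℝ
      κd (u , r) (v , c) = blend (S.density u v) (1# - η true r c) (η false r c)
      κd𝕀 : ∀ r c → 𝕀 (κd r c)
      κd𝕀 (u , r) (v , c) = 𝕀-mix (S.density-𝕀 u v) (𝕀-not (η𝕀 true r c)) (η𝕀 false r c)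
      disη : Pairs → Fin n × ⊤ → ℝ
      disη r c = disagree (lookup (proj₁ r) (proj₁ c)) (η (lookup (proj₁ r) (proj₁ c)) r (proj₁ c))
      ones : ∀ {X Y : Set} → Rank1 {X} {Y} (λ _ _ → 1#)
      ones = (λ _ → 1#) , (λ _ → 1#) , (λ _ → 𝕀-1) , (λ _ → 𝕀-1) , λ _ _ → ≈-sym (*-identityˡ 1#)
      blended : ∀ (h : Bool → ℝ) b → disagree b (h b) ≈ blend (ind b) (1# - h true) (h false)
      blended h true  = solve 2 (λ x y → con (+ 1) :- x := con (+ 1) :* (con (+ 1) :- x) :+ (con (+ 1) :- con (+ 1)) :* y) ≈-refl (h true) (h false)
      blended h false = solve 2 (λ x y → y := con (+ 0) :* (con (+ 1) :- x) :+ (con (+ 1) :- con (+ 0)) :* y) ≈-refl (h true) (h false)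
      factor : ∀ y x p q → blend y p q - blend x p q ≈ 1# * ((y - x) * (p - q))
      factor = solve 4 (λ y x p q → (y :* p :+ (con (+ 1) :- y) :* q) :- (x :* p :+ (con (+ 1) :- x) :* q) := con (+ 1) :* ((y :- x) :* (p :- q))) ≈-refl
      step₁ : liftedCost - ∫ M′ (λ (r , c) → κd (rowLabel′ params r) (colLabel′ params c)) ⊴ ζ * θ
      step₁ = ⊴-cong (≈-sym (≈-trans (≈-sym (∫-- M′ _ _)) (∫-cong M′ λ (r , c) → ≈-trans (+-congʳ (blended (λ s → e′ s r c) (lookup (proj₁ r) (proj₁ c))))
          (factor (W′ r c) (ρ′ r c) (1# - e′ true r c) (e′ false r c)))))
        (split′ {λ x _ → 1# - x} {λ _ y → y} (λ p _ → 𝕀-not p) (λ _ q → q) (λ _ _ → 1#) ones)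
      step₂ : ∫ M (λ (r , c) → κd (rowLabel params r) (colLabel params c)) - ∫ M′ (λ (r , c) → κd (rowLabel′ params r) (colLabel′ params c)) ⊴ γ + γ
      step₂ = close-step {P = mapP (rowLabel params) T} {mapP (rowLabel′ params) Rows′} (rows-close params)
        (λ r → 𝔼 (mapP (colLabel params) Cols) (κd r)) (λ r → 𝔼 (mapP (colLabel′ params) Cols′) (κd r))
        (λ r → cols-close params (κd r) (κd𝕀 r)) (λ r → 𝔼-𝕀 (mapP (colLabel′ params) Cols′) (κd𝕀 r))
      step₃ : ∫ M (λ (r , c) → disη r c) - ∫ M (λ (r , c) → κd (rowLabel params r) (colLabel params c)) ⊴ ζ * θ
      step₃ = ⊴-cong (≈-sym (≈-trans (≈-sym (∫-- M _ _)) (∫-cong M λ (r , c) → ≈-trans (+-congʳ (blended (λ s → e s r c) (lookup (proj₁ r) (proj₁ c))))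
          (factor (W r c) (ρ r c) (1# - e true r c) (e false r c)))))
        (split {λ x _ → 1# - x} {λ _ y → y} (λ p _ → 𝕀-not p) (λ _ q → q) (λ _ _ → 1#) ones)
      step₄ : ∫ M (λ (r , c) → disη r c) - transferCost ≤ ζ * (θ + 1#)
      step₄ = ≤-respˡ-≈ (≈-trans (∫-cong M λ (r , c) → ≈-trans (*-identityˡ _) (signed (lookup (proj₁ r) (proj₁ c)) _ _)) (∫-- M _ _))
        (≤-trans (approximates id (λ _ _ → 1#) ones) (≤-reflexive (*-congˡ (+-congˡ (𝔼-const (T ⊗ 𝒰) 1#)))))
        where
        signed : ∀ b h v → sgn b * (v - h) ≈ disagree b h - disagree b v
        signed true  = solve 2 (λ h v → con (+ 1) :* (v :- h) := (con (+ 1) :- h) :- (con (+ 1) :- v)) ≈-refl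
        signed false = solve 2 (λ h v → :- con (+ 1) :* (v :- h) := h :- v) ≈-refl

  -- Earth Mover distance

  ==ᵛ-sym : ∀ {n} (x y : Str n) → (x ==ᵛ y) ≡ (y ==ᵛ x)
  ==ᵛ-sym [] []                 = refl
  ==ᵛ-sym (true ∷ x) (true ∷ y)   = ==ᵛ-sym x y
  ==ᵛ-sym (false ∷ x) (false ∷ y) = ==ᵛ-sym x y
  ==ᵛ-sym (true ∷ x) (false ∷ y)  = refl
  ==ᵛ-sym (false ∷ x) (true ∷ y)  = refl

  strings-complete : ∀ {n} (x : Str n) → x ∈ˡ strings n
  strings-complete []          = here refl
  strings-complete (false ∷ x) = ∈-++⁺ˡ (∈-map⁺ (false ∷_) (strings-complete x))
  strings-complete (true ∷ x)  = ∈-++⁺ʳ _ (∈-map⁺ (true ∷_) (strings-complete x))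

  mass-at : ∀ {n} (μ : Dist n) x → 𝔼 ⟦ μ ⟧ (λ a → ind (a ==ᵛ x)) ≈ mass μ x
  mass-at {n} μ x = ≈-trans (∫-cong (∑M (strings n)) λ a → ≈-trans (*-comm _ _) (*-congʳ (≈-reflexive (≡.cong ind (==ᵛ-sym a x)))))
    (Enum.pick (enumVec n) x (mass μ))

  -- A transfer as an abstract law with an upper bound on its cost. Couplings can be composed and
  -- permuted without building mass functions or tracking minimality.
  record Coupling {n} (μ τ : Dist n) (e : ℝ) : Set₁ where
    field
      joint-law : Prob (Str n × Str n)
      first     : mapP proj₁ joint-law ∼ ⟦ μ ⟧
      second    : mapP proj₂ joint-law ∼ ⟦ τ ⟧
      cost-≤    : 𝔼 joint-law (λ (x , y) → hamming x y) ≤ e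

  fromTransfer : ∀ {n} {μ τ : Dist n} {e} (T : Transfer μ τ) → cost T ≤ e → Coupling μ τ e
  fromTransfer {n} T le = record
    { joint-law = ⟦ joint T ⟧
    ; first = λ f → ≈-trans (∑-× (strings n) (strings n) _) (∫-cong (∑M (strings n)) λ x →
        ≈-trans (∫-*ʳ (∑M (strings n)) (f x) _) (*-congʳ (marginal₁ T x)))
    ; second = λ f → ≈-trans (∑-× (strings n) (strings n) _) (≈-trans (∫-swap (∑M (strings n)) (∑M (strings n)) _) (∫-cong (∑M (strings n)) λ y →
        ≈-trans (∫-*ʳ (∑M (strings n)) (f y) _) (*-congʳ (marginal₂ T y))))
    ; cost-≤ = le }

  toTransfer : ∀ {n} {μ τ : Dist n} (J : Prob (Str n × Str n)) → mapP proj₁ J ∼ ⟦ μ ⟧ → mapP proj₂ J ∼ ⟦ τ ⟧ → Transfer μ τ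
  toTransfer {n} {μ} {τ} J p q = record
    { joint = L
    ; marginal₁ = λ x → ≈-trans (≈-sym (∫-swap (meas J) (∑M (strings n)) _)) (≈-trans
        (∫-cong (meas J) λ (a , b) → ≈-trans (∫-cong (∑M (strings n)) λ y → ≈-trans (ind-∧ (a ==ᵛ x) (b ==ᵛ y)) (*-comm _ _)) (Enum.pick (enumVec n) b (λ _ → ind (a ==ᵛ x))))
        (≈-trans (p (λ a → ind (a ==ᵛ x))) (mass-at μ x)))
    ; marginal₂ = λ y → ≈-trans (≈-sym (∫-swap (meas J) (∑M (strings n)) _)) (≈-trans
        (∫-cong (meas J) λ (a , b) → ≈-trans (∫-cong (∑M (strings n)) λ x → ind-∧ (a ==ᵛ x) (b ==ᵛ y)) (Enum.pick (enumVec n) a (λ _ → ind (b ==ᵛ y))))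
        (≈-trans (q (λ b → ind (b ==ᵛ y))) (mass-at τ y))) }
    where L = lawOn (enum× (enumVec n) (enumVec n)) J

  toTransfer-cost : ∀ {n} {μ τ : Dist n} J p q → cost (toTransfer {n} {μ} {τ} J p q) ≈ 𝔼 J (λ (x , y) → hamming x y)
  toTransfer-cost {n} J p q = lawOn-∼ (enum× (enumVec n) (enumVec n)) J _

  independent : ∀ {n} (μ τ : Dist n) → Transfer μ τ
  independent {n} μ τ = toTransfer {n} {μ} {τ} (⟦ μ ⟧ ⊗ ⟦ τ ⟧) p q
    where
    p : mapP proj₁ (⟦ μ ⟧ ⊗ ⟦ τ ⟧) ∼ ⟦ μ ⟧
    p f = ∫-cong (meas ⟦ μ ⟧) λ x → 𝔼-const ⟦ τ ⟧ (f x)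
    q : mapP proj₂ (⟦ μ ⟧ ⊗ ⟦ τ ⟧) ∼ ⟦ τ ⟧
    q f = 𝔼-const ⟦ μ ⟧ (𝔼 ⟦ τ ⟧ f)

  0≤hamming : ∀ {n} .{{_ : NonZero n}} (x y : Str n) → 0# ≤ hamming x y
  0≤hamming {n} x y = *-nonNeg (0≤fromℕ (mismatches x y)) (<⇒≤ (0<⁻¹ (0<fromℕ n)))

  ≤-limit : ∀ {a b} N → (∀ δ → 0# < δ → a ≤ b + fromℕ N * δ) → a ≤ b
  ≤-limit {a} {b} N h with ≤-or-< a b
  ... | inj₁ p = p
  ... | inj₂ p = ⊥-elim (<⇒≰ 0<η (lin (h η 0<η ⊕ ≤-reflexive bound)
      (solve 4 (λ a b x h → (b :+ x :+ (a :- b :- h)) :- (a :+ x) := con (+ 0) :- h) ≈-refl a b (fromℕ N * η) η)))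
    where
    η = fromℕ (suc N) ⁻¹ * (a - b)
    0<η : 0# < η
    0<η = 0<-* (0<⁻¹ (0<fromℕ (suc N))) (≰⇒< λ q → <⇒≰ p (lin q (solve 2 (λ a b → con (+ 0) :- (a :- b) := b :- a) ≈-refl a b)))
    bound : fromℕ N * η ≈ a - b - η
    bound = ≈-trans (solve 3 (λ n i g → n :* (i :* g) := ((con (+ 1) :+ n) :* i) :* g :- i :* g) ≈-refl (fromℕ N) (fromℕ (suc N) ⁻¹) (a - b))
      (+-congʳ (≈-trans (*-congʳ (*-inv (0<fromℕ (suc N)))) (*-identityˡ (a - b))))

  ≈-limit : ∀ {a b} N → (∀ δ → 0# < δ → a - b ⊴ fromℕ N * δ) → a ≈ b
  ≈-limit {a} {b} N h = ≤-antisym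
    (≤-limit N λ δ p → lin (proj₁ (h δ p)) (solve 3 (λ a b x → x :- (a :- b) := (b :+ x) :- a) ≈-refl a b (fromℕ N * δ)))
    (≤-limit N λ δ p → lin (proj₂ (h δ p)) (solve 3 (λ a b x → x :- :- (a :- b) := (a :+ x) :- b) ≈-refl a b (fromℕ N * δ)))

  module _ {X : Set} where

    -- A filter base indexed by δ. Cluster points along it take the place of convergent
    -- subsequences.
    Shrinking : (ℝ → X → Set) → Set
    Shrinking Φ = (∀ {δ δ′ x} → δ ≤ δ′ → Φ δ x → Φ δ′ x) × (∀ δ → 0# < δ → ∃ (Φ δ))

    -- The limit superior of f along the filter.
    cluster-coordinate : ∀ Φ → Shrinking Φ → (f : X → ℝ) → (∀ x → 𝕀 (f x)) → ∃ λ p → Shrinking (λ δ x → Φ δ x × f x - p ⊴ δ)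
    cluster-coordinate Φ (mono , inhab) f f𝕀 = p , (λ le (a , b) → mono le a , ⊴-≤ b le) , close
      where
      S : Pred ℝ 0ℓ
      S a = ∀ δ → 0# < δ → ∃ λ x → Φ δ x × a ≤ f x
      0∈S : S 0#
      0∈S δ pos = let (x , φ) = inhab δ pos in x , φ , proj₁ (f𝕀 x)
      sup = leastUpperBound S (0# , 0∈S) (1# , λ a s → let (x , _ , q) = s 1# 0<1 in ≤-trans q (proj₂ (f𝕀 x)))
      p = proj₁ sup
      upper = proj₁ (proj₂ sup)
      least = proj₂ (proj₂ sup)
      close : ∀ δ → 0# < δ → ∃ λ x → Φ δ x × f x - p ⊴ δ
      close δ pos with em {∃ λ a → S a × p - δ ≤ a} | em {∃ λ δ₀ → 0# < δ₀ × (∀ x → Φ δ₀ x → f x ≤ p + δ)}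
      ... | no n | _ = ⊥-elim (<⇒≰ pos (lin (least (p - δ) (λ a s → <⇒≤ (≰⇒< λ q → n (a , s , q)))) (solve 2 (λ p d → (p :- d) :- p := con (+ 0) :- d) ≈-refl p δ)))
      ... | yes _ | no n = ⊥-elim (<⇒≰ pos (lin (upper (p + δ) above) (solve 2 (λ p d → p :- (p :+ d) := con (+ 0) :- d) ≈-refl p δ)))
        where
        above : S (p + δ)
        above δ₀ pos₀ with em {∃ λ x → Φ δ₀ x × p + δ ≤ f x}
        ... | yes w = w
        ... | no  m = ⊥-elim (n (δ₀ , pos₀ , λ x φ → <⇒≤ (≰⇒< λ q → m (x , φ , q))))
      ... | yes (a , s , q) | yes (δ₀ , pos₀ , below) with ≤-total δ δ₀
      ...   | inj₁ le = let (x , φ , r) = s δ pos in x , φ ,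
                lin (below x (mono le φ)) (solve 3 (λ f p d → (p :+ d) :- f := d :- (f :- p)) ≈-refl (f x) p δ) ,
                lin (≤-trans q r) (solve 3 (λ f p d → f :- (p :- d) := d :- :- (f :- p)) ≈-refl (f x) p δ)
      ...   | inj₂ le = let (x , φ , r) = s δ₀ pos₀ in x , mono le φ ,
                lin (below x φ) (solve 3 (λ f p d → (p :+ d) :- f := d :- (f :- p)) ≈-refl (f x) p δ) ,
                lin (≤-trans q r) (solve 3 (λ f p d → f :- (p :- d) := d :- :- (f :- p)) ≈-refl (f x) p δ)

    -- Compactness of a cube, one coordinate at a time: the limit superior of a coordinate refines
    -- the filter for the remaining ones.
    cluster-point : {I : Set} (f : I → X → ℝ) → (∀ i x → 𝕀 (f i x)) → ∀ (cs : List I) Φ → Shrinking Φ →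
                    ∃ λ (p : I → ℝ) → ∀ δ → 0# < δ → ∃ λ x → Φ δ x × All (λ i → f i x - p i ⊴ δ) cs
    cluster-point f f𝕀 [] Φ (_ , inhab) = (λ _ → 0#) , λ δ pos → let (x , φ) = inhab δ pos in x , φ , All.[]
    cluster-point {I} f f𝕀 (c ∷ cs) Φ sh = p , λ δ pos → let (x , (φ , d) , ds) = near δ pos in x , φ , at c d All.∷ All.map (λ {i} e → other i d e) ds
      where
      step = cluster-coordinate Φ sh (f c) (f𝕀 c)
      rest = cluster-point f f𝕀 cs _ (proj₂ step)
      near = proj₂ rest
      p : I → ℝ
      p i with em {i ≡ c}
      ... | yes _ = proj₁ step
      ... | no  _ = proj₁ rest i
      at : ∀ i {δ x} → f c x - proj₁ step ⊴ δ → f c x - p c ⊴ δ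
      at i d with em {c ≡ c}
      ... | yes _ = d
      ... | no  n = ⊥-elim (n refl)
      other : ∀ i {δ x} → f c x - proj₁ step ⊴ δ → f i x - proj₁ rest i ⊴ δ → f i x - p i ⊴ δ
      other i d e with em {i ≡ c}
      ... | yes refl = d
      ... | no  _    = e

  ∑-⊴ : ∀ {A : Set} (xs : List A) (f g : A → ℝ) δ → (∀ a → f a - g a ⊴ δ) → ∑ xs f - ∑ xs g ⊴ fromℕ (List.length xs) * δ
  ∑-⊴ {A} xs f g δ h = ⊴-cong (∫-- (∑M xs) f g) (⊴-≤ (∫-⊴ (∑M xs) h) (≤-reflexive (const xs)))
    where
    const : ∀ (xs : List A) → ∑ xs (λ _ → δ) ≈ fromℕ (List.length xs) * δ
    const []       = ≈-sym (zeroˡ δ)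
    const (x ∷ xs) = ≈-trans (+-congˡ (const xs)) (solve 2 (λ d l → d :+ l :* d := (con (+ 1) :+ l) :* d) ≈-refl δ (fromℕ (List.length xs)))

  module _ {n : ℕ} .{{_ : NonZero n}} where

    Closed : Pred (Dist n) 0ℓ → Set
    Closed K = ∀ τ → (∀ δ → 0# < δ → ∃ λ σ → K σ × (∀ x → mass σ x - mass τ x ⊴ δ)) → K τ

    -- If τ were outside `K`, the sets of distributions that differ from τ by more than δ in some
    -- mass would form an open cover of `K`. A finite subcover has a least δ, and a member of `K`
    -- within that δ of τ lies in none of its sets.
    compact⇒closed : ∀ K → IsCompact K → (∀ σ τ → (∀ x → mass σ x ≈ mass τ x) → K σ → K τ) → Closed K
    compact⇒closed K compact resp τ near with em {K τ}
    ... | yes k = k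
    ... | no nk = ⊥-elim (missed (proj₁ cover) (proj₂ cover))
      where
      I = ∃ λ δ → 0# < δ
      Far : I → Pred (Dist n) 0ℓ
      Far (δ , _) σ = ∃ λ x → ¬ (mass σ x - mass τ x ⊴ δ)
      open-Far : ∀ i → IsOpen (Far i)
      open-Far (δ , _) σ (x , far) with em {∃ λ η → 0# < η × ¬ (mass σ x - mass τ x ⊴ δ + η)}
      ... | yes (η , pos , far′) = η , pos , λ ν close → x , λ le → far′ (⊴-cong (solve 3 (λ s v t → (v :- t) :- (v :- s) := s :- t) ≈-refl (mass σ x) (mass ν x) (mass τ x))
              (⊴-+ le (⊴-neg (abs⇒⊴ (<⇒≤ (close x))))))
      ... | no n = ⊥-elim (far (≤-limit 1 (λ η pos → ≤-trans (proj₁ (all η pos)) (one η)) , ≤-limit 1 (λ η pos → ≤-trans (proj₂ (all η pos)) (one η))))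
        where
        one : ∀ η → δ + η ≤ δ + fromℕ 1 * η
        one η = ≤-reflexive (+-congˡ (≈-sym (≈-trans (*-congʳ fromℕ-1) (*-identityˡ η))))
        all : ∀ η → 0# < η → mass σ x - mass τ x ⊴ δ + η
        all η pos with em {mass σ x - mass τ x ⊴ δ + η}
        ... | yes p = p
        ... | no  q = ⊥-elim (n (η , pos , q))
      covers : ∀ σ → K σ → ∃ λ i → Far i σ
      covers σ k with em {∃ λ i → Far i σ}
      ... | yes p = p
      ... | no  q = ⊥-elim (nk (resp σ τ (λ x → ≈-limit 1 λ δ pos → ⊴-≤ (within x δ pos) (≤-reflexive (≈-sym (≈-trans (*-congʳ fromℕ-1) (*-identityˡ δ))))) k))
        where
        within : ∀ x δ → 0# < δ → mass σ x - mass τ x ⊴ δ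
        within x δ pos with em {mass σ x - mass τ x ⊴ δ}
        ... | yes p = p
        ... | no  r = ⊥-elim (q ((δ , pos) , x , r))
      cover = compact I Far open-Far covers
      minimum : ∀ (is : List I) → ∃ λ δ → 0# < δ × All (λ i → δ ≤ proj₁ i) is
      minimum [] = 1# , 0<1 , All.[]
      minimum ((δ , pos) ∷ is) with minimum is
      ... | δ′ , pos′ , all with ≤-total δ δ′
      ...   | inj₁ le = δ , pos , ≤-refl All.∷ All.map (≤-trans le) all
      ...   | inj₂ le = δ′ , pos′ , le All.∷ all
      missed : ∀ is → (∀ σ → K σ → Any (λ i → Far i σ) is) → ⊥
      missed is hit with minimum is
      ... | δ , pos , all with near δ pos
      ...   | σ , k , close = contra is all (hit σ k)
        where
        contra : ∀ is → All (λ i → δ ≤ proj₁ i) is → Any (λ i → Far i σ) is → ⊥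
        contra _ (le All.∷ _) (here (x , far)) = far (⊴-≤ (close x) le)
        contra _ (_ All.∷ all) (there a)       = contra _ all a

    -- The target and the transfer are minimised together: along transfers whose cost tends to the
    -- infimum the joint masses cluster. The limit keeps the first marginal, costs no more than the
    -- infimum, and its second marginal lies in `K` because `K` is closed.
    attained : ∀ K → Closed K → (μ : Dist n) → (∃ λ τ → K τ × Transfer μ τ) → ∃ λ τ → K τ × Σ (Transfer μ τ) λ T → ∀ σ → K σ → (T′ : Transfer μ σ) → cost T ≤ cost T′
    attained K closed μ x₀ = τ , kτ , T , λ σ kσ T′ → ≤-trans cost-T (lower (σ , kσ , T′))
      where
      X = ∃ λ τ → K τ × Transfer μ τ
      XX = cartesianProduct (strings n) (strings n)
      cst : X → ℝ
      cst (_ , _ , T) = cost T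
      0≤cst : ∀ x → 0# ≤ cst x
      0≤cst (_ , _ , T) = ∫-pos (∑M XX) λ (x , y) → *-nonNeg (nonNeg (joint T) (x , y)) (0≤hamming x y)
      sup = leastUpperBound (λ y → ∀ x → y ≤ cst x) (0# , 0≤cst) (cst x₀ , λ _ h → h x₀)
      v = proj₁ sup
      lower : ∀ x → v ≤ cst x
      lower x = proj₂ (proj₂ sup) (cst x) λ y h → h x
      Φ : ℝ → X → Set
      Φ δ x = cst x ≤ v + δ
      shrinking : Shrinking Φ
      shrinking = (λ le p → ≤-trans p (≤-refl ⊕ le)) , inhab
        where
        inhab : ∀ δ → 0# < δ → ∃ (Φ δ)
        inhab δ pos with em {∃ (Φ δ)}
        ... | yes p = p
        ... | no  q = ⊥-elim (<⇒≰ pos (lin (proj₁ (proj₂ sup) (v + δ) (λ x → <⇒≤ (≰⇒< λ r → q (x , r)))) (solve 2 (λ v d → v :- (v :+ d) := con (+ 0) :- d) ≈-refl v δ)))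
      EXX = enum× (enumVec n) (enumVec n)
      coord : Str n × Str n → X → ℝ
      coord i (_ , _ , T) = mass (joint T) i
      coord𝕀 : ∀ i x → 𝕀 (coord i x)
      coord𝕀 i (_ , _ , T) = nonNeg (joint T) i , ≤-trans (≤-reflexive (≈-sym (Enum.pick EXX i (mass (joint T))))) (≤-trans (∫-mono (∑M XX) λ j →
        ≤-respʳ-≈ (*-identityˡ _) (mul-mono (proj₁ (𝕀-ind _)) (proj₂ (𝕀-ind (Enum._==_ EXX i j))) (nonNeg (joint T) j) ≤-refl)) (≤-reflexive (total (joint T))))
      limit = cluster-point coord coord𝕀 XX Φ shrinking
      p = proj₁ limit
      near : ∀ δ → 0# < δ → ∃ λ x → Φ δ x × (∀ i → coord i x - p i ⊴ δ)
      near δ pos = let (x , φ , all) = proj₂ limit δ pos in x , φ , λ (a , b) → All.lookup all (∈-cartesianProduct⁺ (strings-complete a) (strings-complete b))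
      N = List.length (strings n)
      J : Distribution XX
      J = record
        { mass = p
        ; nonNeg = λ i → ≤-limit 1 λ δ pos → let (x , _ , d) = near δ pos in
            lin (proj₁ (d i) ⊕ proj₁ (coord𝕀 i x)) (solve 3 (λ m p d → (d :+ m) :- ((m :- p) :+ con (+ 0)) := (p :+ (con (+ 1) :+ con (+ 0)) :* d) :- con (+ 0)) ≈-refl (coord i x) (p i) δ)
        ; total = ≈-sym (≈-limit (List.length XX) λ δ pos → let (x@(_ , _ , T) , _ , d) = near δ pos in
            ⊴-cong (+-congʳ (total (joint T))) (∑-⊴ XX (coord-of x) p δ d)) }
        where
        coord-of : X → Str n × Str n → ℝ
        coord-of x i = coord i x
      first : mapP proj₁ ⟦ J ⟧ ∼ ⟦ μ ⟧
      first f = ≈-trans (∑-× (strings n) (strings n) _) (∫-cong (∑M (strings n)) λ x → ≈-trans (∫-*ʳ (∑M (strings n)) (f x) _) (*-congʳ (≈-sym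
        (≈-limit N λ δ pos → let (z@(_ , _ , T) , _ , d) = near δ pos in
          ⊴-cong (+-congʳ (marginal₁ T x)) (∑-⊴ (strings n) (λ y → mass (joint T) (x , y)) (λ y → p (x , y)) δ λ y → d (x , y))))))
      τ : Dist n
      τ = law (mapP proj₂ ⟦ J ⟧)
      T : Transfer μ τ
      T = toTransfer ⟦ J ⟧ first λ f → ≈-sym (law-∼ (mapP proj₂ ⟦ J ⟧) f)
      mass-τ : ∀ y → mass τ y ≈ ∑ (strings n) λ x → p (x , y)
      mass-τ y = ≈-trans (∑-× (strings n) (strings n) _) (∫-cong (∑M (strings n)) λ x →
        ≈-trans (∫-cong (∑M (strings n)) λ b → ≈-trans (*-comm _ _) (*-congʳ (≈-reflexive (≡.cong ind (==ᵛ-sym b y))))) (Enum.pick (enumVec n) y λ b → p (x , b)))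
      kτ : K τ
      kτ = closed τ λ δ pos → let (η , pos′ , le) = scaled δ pos ; ((σ , kσ , T) , _ , d) = near η pos′ in σ , kσ , λ y →
        ⊴-cong (+-cong (marginal₂ T y) (-‿cong (≈-sym (mass-τ y)))) (⊴-≤ (∑-⊴ (strings n) (λ x → mass (joint T) (x , y)) (λ x → p (x , y)) η λ x → d (x , y)) le)
        where
        scaled : ∀ δ → 0# < δ → ∃ λ η → 0# < η × fromℕ N * η ≤ δ
        scaled δ pos = fromℕ (suc N) ⁻¹ * δ , 0<-* (0<⁻¹ (0<fromℕ (suc N))) pos , ≤-trans (mul-mono (0≤fromℕ N) (fromℕ-mono (ℕₚ.n≤1+n N)) (<⇒≤ (0<-* (0<⁻¹ (0<fromℕ (suc N))) pos)) ≤-refl)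
          (≤-reflexive (≈-trans (≈-sym (*-assoc _ _ _)) (≈-trans (*-congʳ (*-inv (0<fromℕ (suc N)))) (*-identityˡ δ))))
      cost-T : cost T ≤ v
      cost-T = ≤-trans (≤-reflexive (toTransfer-cost {n} {μ} {τ} ⟦ J ⟧ first λ f → ≈-sym (law-∼ (mapP proj₂ ⟦ J ⟧) f))) (≤-limit (suc (List.length XX)) bound)
        where
        bound : ∀ δ → 0# < δ → ∑ XX (λ (x , y) → p (x , y) * hamming x y) ≤ v + fromℕ (suc (List.length XX)) * δ
        bound δ pos = let (z@(_ , _ , T) , φ , d) = near δ pos in
          arith (proj₂ (∑-⊴ XX (λ (x , y) → mass (joint T) (x , y) * hamming x y) (λ (x , y) → p (x , y) * hamming x y) δ λ (x , y) →
            ⊴-cong (solve 3 (λ h a b → h :* (a :- b) := a :* h :- b :* h) ≈-refl (hamming x y) (mass (joint T) (x , y)) (p (x , y)))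
              (⊴-≤ (⊴-scale (0≤hamming x y) (d (x , y))) (≤-respʳ-≈ (*-identityˡ δ) (mul-mono (0≤hamming x y) (hamming≤1 x y) (<⇒≤ pos) ≤-refl))))) φ
          where
          arith : ∀ {a b l} → - (a - b) ≤ l * δ → a ≤ v + δ → b ≤ v + (1# + l) * δ
          arith {a} {b} {l} q r = lin (q ⊕ r) (solve 5 (λ a b l d v → (l :* d :+ (v :+ d)) :- (:- (a :- b) :+ a) := (v :+ (con (+ 1) :+ l) :* d) :- b) ≈-refl a b l δ v)
          mismatches≤ : ∀ {m} (x y : Str m) → mismatches x y ℕ.≤ m
          mismatches≤ [] [] = z≤n
          mismatches≤ (a ∷ x) (b ∷ y) = ℕₚ.+-mono-≤ (bit≤ (does (a ≟ᵇ b))) (mismatches≤ x y)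
            where bit≤ : ∀ c → (if c then 0 else 1) ℕ.≤ 1
                  bit≤ true = z≤n
                  bit≤ false = s≤s z≤n
          hamming≤1 : ∀ (x y : Str n) → hamming x y ≤ 1#
          hamming≤1 x y = ≤-respʳ-≈ (*-inv (0<fromℕ n)) (mul-mono (0≤fromℕ (mismatches x y)) (fromℕ-mono (mismatches≤ x y)) (<⇒≤ (0<⁻¹ (0<fromℕ n))) ≤-refl)

  module EMDistance {n : ℕ} .{{_ : NonZero n}} (K : Pred (Dist n) 0ℓ) (compact-K : IsCompact K)
    (respects-K : ∀ σ τ → (∀ x → mass σ x ≈ mass τ x) → K σ → K τ) where

    couplingTransfer : ∀ {μ τ : Dist n} {e} → Coupling μ τ e → Σ (Transfer μ τ) λ T → cost T ≤ e
    couplingTransfer {μ} {τ} c = toTransfer {n} {μ} {τ} joint-law first second , ≤-respˡ-≈ (≈-sym (toTransfer-cost {n} {μ} {τ} joint-law first second)) cost-≤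
      where open Coupling c

    exists : ∃ K → ∀ μ → ∃ (IsEMDistanceTo K μ)
    exists (τ₀ , k₀) μ = go (attained K (compact⇒closed K compact-K respects-K) μ (τ₀ , k₀ , independent μ τ₀))
      where
      go : (∃ λ τ → K τ × Σ (Transfer μ τ) λ T → ∀ σ → K σ → (T′ : Transfer μ σ) → cost T ≤ cost T′) → ∃ (IsEMDistanceTo K μ)
      go (τ , kτ , T , least) = cost T , (τ , kτ , (T , ≈-refl) , λ { e (T′ , eq) → ≤-respʳ-≈ eq (least τ kτ T′) })
          , λ { e (σ , kσ , (T′ , eq) , _) → ≤-respʳ-≈ eq (least σ kσ T′) }

    optimal : ∀ {μ d} → IsEMDistanceTo K μ d → Σ (∃ K) λ (τ , _) → Coupling μ τ d
    optimal {μ} ((τ , kτ , (T , eq) , _) , _) = (τ , kτ) , fromTransfer T (≤-reflexive eq)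

    -- `IsEMDistanceTo` only ranks members by their exact distances, so the distance to `τ` must
    -- first be shown to be attained. This is `attained` again, for the class of distributions with
    -- the masses of `τ`.
    distance-≤ : ∀ {μ d} → IsEMDistanceTo K μ d → ∀ τ e → K τ → Coupling μ τ e → d ≤ e
    distance-≤ {μ} {d} (_ , least) τ e kτ c = go (attained Kτ closed-Kτ μ (τ , (λ _ → ≈-refl) , T₀))
      where
      T₀ = proj₁ (couplingTransfer c)
      Kτ : Pred (Dist n) 0ℓ
      Kτ σ = ∀ x → mass σ x ≈ mass τ x
      closed-Kτ : Closed Kτ
      closed-Kτ σ near x = ≈-sym (≈-limit 1 λ δ pos → let (ρ , kρ , close) = near δ pos in
        ⊴-cong (+-congʳ (kρ x)) (⊴-≤ (close x) (≤-reflexive (≈-sym (≈-trans (*-congʳ fromℕ-1) (*-identityˡ δ))))))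
      go : (∃ λ σ → Kτ σ × Σ (Transfer μ σ) λ T → ∀ ρ → Kτ ρ → (T′ : Transfer μ ρ) → cost T ≤ cost T′) → d ≤ e
      go (σ , kσ , T , min) = ≤-trans
        (least (cost T) (σ , respects-K τ σ (λ x → ≈-sym (kσ x)) kτ , (T , ≈-refl) , λ { e′ (T′ , eq) → ≤-respʳ-≈ eq (min σ kσ T′) }))
        (≤-trans (min τ (λ _ → ≈-refl) T₀) (proj₂ (couplingTransfer c)))

  mismatches-triangle : ∀ {n} (x y z : Str n) → mismatches x z ℕ.≤ mismatches x y ℕ.+ mismatches y z
  mismatches-triangle [] [] [] = z≤n
  mismatches-triangle (a ∷ x) (b ∷ y) (c ∷ z) = ℕₚ.≤-trans (ℕₚ.+-mono-≤ (bit a b c) (mismatches-triangle x y z))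
    (ℕₚ.≤-reflexive (shuffle (m a b) (m b c) (mismatches x y) (mismatches y z)))
    where
    m : Bool → Bool → ℕ
    m a b = if does (a ≟ᵇ b) then 0 else 1
    bit : ∀ a b c → m a c ℕ.≤ m a b ℕ.+ m b c
    bit true true true = z≤n
    bit true true false = s≤s z≤n
    bit true false true = z≤n
    bit true false false = s≤s z≤n
    bit false true true = s≤s z≤n
    bit false true false = z≤n
    bit false false true = s≤s z≤n
    bit false false false = z≤n
    shuffle : ∀ p q r s → (p ℕ.+ q) ℕ.+ (r ℕ.+ s) ≡ (p ℕ.+ r) ℕ.+ (q ℕ.+ s)
    shuffle p q r s = ≡.trans (ℕₚ.+-assoc p q _) (≡.trans (≡.cong (p ℕ.+_) (≡.trans (≡.sym (ℕₚ.+-assoc q r s))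
      (≡.trans (≡.cong (ℕ._+ s) (ℕₚ.+-comm q r)) (ℕₚ.+-assoc r q s)))) (≡.sym (ℕₚ.+-assoc p r _)))

  module _ {n : ℕ} .{{_ : NonZero n}} where

    hamming-triangle : ∀ (x y z : Str n) → hamming x z ≤ hamming x y + hamming y z
    hamming-triangle x y z = ≤-respʳ-≈ (≈-trans (*-congʳ (fromℕ-+ (mismatches x y) (mismatches y z))) (distribʳ _ _ _))
      (mul-mono (0≤fromℕ (mismatches x z)) (fromℕ-mono (mismatches-triangle x y z)) (<⇒≤ (0<⁻¹ (0<fromℕ n))) ≤-refl)

    -- The gluing behind the triangle inequality: the last string is drawn from the second coupling
    -- conditionally on the middle one.
    glue : ∀ {μ ν τ : Dist n} {d e} → Coupling μ ν d → Coupling ν τ e → Coupling μ τ (d + e)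
    glue {μ} {ν} {τ} {d} {e} c c′ = record
      { joint-law = bind J λ (x , z) → mapP (λ (_ , y) → x , y) (next z)
      ; first = λ f → ≈-trans (∫-cong (meas J) λ (x , z) → 𝔼-const (next z) (f x)) (Coupling.first c f)
      ; second = λ f → ≈-trans (chain (λ _ (_ , y) → f y)) (Coupling.second c′ f)
      ; cost-≤ = ≤-trans (∫-mono (meas J) λ (x , z) → ∫-mono (meas (next z)) λ (_ , y) → hamming-triangle x z y)
          (≤-trans (≤-reflexive (≈-trans (∫-cong (meas J) λ (x , z) → ≈-trans (∫-+ (meas (next z)) _ _) (+-congʳ (𝔼-const (next z) (hamming x z)))) (∫-+ (meas J) _ _)))
            (Coupling.cost-≤ c ⊕ ≤-respˡ-≈ (≈-sym (chain λ z (_ , y) → hamming z y)) (Coupling.cost-≤ c′))) }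
      where
      J = Coupling.joint-law c
      J′ = Coupling.joint-law c′
      next : Str n → Prob (Str n × Str n)
      next = cond (enumVec n) J′ proj₁
      chain : (g : Str n → Str n × Str n → ℝ) → 𝔼 J (λ (x , z) → 𝔼 (next z) (g z)) ≈ 𝔼 J′ (λ (z , y) → g z (z , y))
      chain g = ≈-trans (Coupling.second c λ z → 𝔼 (next z) (g z)) (≈-trans (≈-sym (Coupling.first c′ λ z → 𝔼 (next z) (g z)))
        (disintegrate (enumVec n) J′ proj₁ g))

    hamming-average : ∀ (x y : Str n) → hamming x y ≈ 𝔼 (uniform n) (λ j → disagree (lookup x j) (ind (lookup y j)))
    hamming-average x y = ≈-trans (*-congʳ (count x y)) (≈-trans (*-comm _ _) (≈-sym (∫-* (sumM n) _ _)))
      where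
      count : ∀ {m} (x y : Str m) → fromℕ (mismatches x y) ≈ sum (λ j → disagree (lookup x j) (ind (lookup y j)))
      count [] [] = ≈-refl
      count (a ∷ x) (b ∷ y) = ≈-trans (fromℕ-+ (if does (a ≟ᵇ b) then 0 else 1) (mismatches x y)) (+-cong (bit a b) (count x y))
        where
        bit : ∀ a b → fromℕ (if does (a ≟ᵇ b) then 0 else 1) ≈ disagree a (ind b)
        bit true true   = solve 0 (con (+ 0) := con (+ 1) :- con (+ 1)) ≈-refl
        bit true false  = solve 0 (con (+ 1) :+ con (+ 0) := con (+ 1) :- con (+ 0)) ≈-refl
        bit false true  = fromℕ-1
        bit false false = ≈-refl

    hamming-permute : ∀ (π : Permutation′ n) (x y : Str n) → hamming (permute π x) (permute π y) ≈ hamming x y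
    hamming-permute π x y = ≈-trans (hamming-average (permute π x) (permute π y)) (≈-trans
      (∫-cong (meas (uniform n)) λ j → ≈-reflexive (≡.cong₂ (λ a b → disagree a (ind b)) (lookup∘tabulate (λ i → lookup x (π ⟨$⟩ʳ i)) j) (lookup∘tabulate (λ i → lookup y (π ⟨$⟩ʳ i)) j)))
      (≈-trans (uniform-permute π λ j → disagree (lookup x j) (ind (lookup y j))) (≈-sym (hamming-average x y))))

    permute-inverse : ∀ (π : Permutation′ n) (x : Str n) → permute (flip π) (permute π x) ≡ x
    permute-inverse π x = ≡.trans (tabulate-cong λ i → ≡.trans (lookup∘tabulate (λ i → lookup x (π ⟨$⟩ʳ i)) (π ⟨$⟩ˡ i)) (≡.cong (lookup x) (Perm.inverseʳ π))) (tabulate∘lookup x)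

    permuteDist : Permutation′ n → Dist n → Dist n
    permuteDist π μ = law (mapP (permute π) ⟦ μ ⟧)

    permuteDist-∼ : ∀ π μ → ⟦ permuteDist π μ ⟧ ∼ mapP (permute π) ⟦ μ ⟧
    permuteDist-∼ π μ = law-∼ (mapP (permute π) ⟦ μ ⟧)

    permuted-∼ : ∀ (π : Permutation′ n) μ ν → ⟦ ν ⟧ ∼ mapP (permute π) ⟦ μ ⟧ → IsPermuted π μ ν
    permuted-∼ π μ ν e x = ≈-trans (≈-sym (mass-at ν (permute π x))) (≈-trans (e (λ a → ind (a ==ᵛ permute π x)))
      (≈-trans (∫-cong (meas ⟦ μ ⟧) λ a → ≈-reflexive (≡.cong ind (same a))) (mass-at μ x)))
      where
      same : ∀ a → (permute π a ==ᵛ permute π x) ≡ (a ==ᵛ x)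
      same a with permute π a ==ᵛ permute π x in p | a ==ᵛ x in q
      ... | true  | true  = refl
      ... | false | false = refl
      ... | true  | false = ≡.trans (≡.sym (==ᵛ-refl x)) (≡.trans (≡.cong (_==ᵛ x) (≡.sym (≡.trans (≡.sym (permute-inverse π a))
                              (≡.trans (≡.cong (permute (flip π)) (==ᵛ-sound (permute π a) (permute π x) p)) (permute-inverse π x))))) q)
      ... | false | true  = ≡.trans (≡.sym p) (≡.trans (≡.cong (λ z → permute π z ==ᵛ permute π x) (==ᵛ-sound a x q)) (==ᵛ-refl (permute π x)))

    unpermute : ∀ (π : Permutation′ n) {μ τ : Dist n} {e} → Coupling (permuteDist π μ) τ e → Coupling μ (permuteDist (flip π) τ) e
    unpermute π {μ} {τ} c = record
      { joint-law = mapP (λ (x , y) → permute (flip π) x , permute (flip π) y) J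
      ; first = λ f → ≈-trans (Coupling.first c (f ∘ permute (flip π))) (≈-trans (permuteDist-∼ π μ (f ∘ permute (flip π)))
          (∫-cong (meas ⟦ μ ⟧) λ x → ≈-reflexive (≡.cong f (permute-inverse π x))))
      ; second = λ f → ≈-trans (Coupling.second c (f ∘ permute (flip π))) (≈-sym (permuteDist-∼ (flip π) τ f))
      ; cost-≤ = ≤-respˡ-≈ (∫-cong (meas J) λ (x , y) → ≈-sym (hamming-permute (flip π) x y)) (Coupling.cost-≤ c) }
      where J = Coupling.joint-law c

  -- Pigeonhole: punching out a missed value would inject `Fin (suc n)` into `Fin n`.
  surjective : ∀ {n} (f : Fin n → Fin n) → (∀ i j → f i ≡ f j → i ≡ j) → ∀ y → ∃ λ x → f x ≡ y
  surjective {suc n} f inj y with em {∃ λ x → f x ≡ y}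
  ... | yes p = p
  ... | no  q = ⊥-elim (ℕₚ.1+n≰n (injective⇒≤ {f = λ x → punchOut (miss x)} λ {i} {j} e → inj i j (punchOut-injective (miss i) (miss j) e)))
    where
    miss : ∀ x → ¬ y ≡ f x
    miss x e = q (x , ≡.sym e)

  toPermutation : ∀ {n} (v : Vec (Fin n) n) → Distinct v → ∃ λ (π : Permutation′ n) → ∀ i → π ⟨$⟩ʳ i ≡ lookup v i
  toPermutation v d = permutation (lookup v) (λ y → proj₁ (onto y)) (λ y → proj₂ (onto y)) (λ x → d _ _ (proj₂ (onto (lookup v x)))) , λ i → refl
    where onto = surjective (lookup v) d

  indep-dirac : ∀ {n} (P : Fin n → Prob A) (v : Fin n → A) → (∀ j → P j ∼ dirac (v j)) → indep P ∼ dirac (tabulate v)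
  indep-dirac {n = zero} P v e f  = ≈-refl
  indep-dirac {n = suc n} P v e f = ≈-trans (e zero _) (indep-dirac (P ∘ suc) (v ∘ suc) (e ∘ suc) (f ∘ (v zero ∷_)))

  bernoulli-ind : ∀ b i → bernoulli (ind b) i ∼ dirac b
  bernoulli-ind true i f  = solve 2 (λ a b → con (+ 1) :* a :+ (con (+ 1) :- con (+ 1)) :* b := a) ≈-refl (f true) (f false)
  bernoulli-ind false i f = solve 2 (λ a b → con (+ 0) :* a :+ (con (+ 1) :- con (+ 0)) :* b := b) ≈-refl (f true) (f false)

  complementary : ∀ r {a b c d} → a + c ≈ 1# → b + d ≈ 1# → r * a + (1# - r) * b + (r * c + (1# - r) * d) ≈ 1#
  complementary r {a} {b} {c} {d} e f = ≈-trans (solve 5 (λ r a b c d → r :* a :+ (con (+ 1) :- r) :* b :+ (r :* c :+ (con (+ 1) :- r) :* d)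
      := r :* (a :+ c) :+ (con (+ 1) :- r) :* (b :+ d)) ≈-refl r a b c d)
    (≈-trans (+-cong (*-congˡ e) (*-congˡ f)) (solve 1 (λ r → r :* con (+ 1) :+ (con (+ 1) :- r) :* con (+ 1) := con (+ 1)) ≈-refl r))

  module _ {n : ℕ} {X Y : Set} (Rows : Prob X) (κ : X → Y → ℝ) (κ𝕀 : ∀ x y → 𝕀 (κ x y)) where

    private
      module I⁺ = Interpretation {n} id Rows κ
      module I⁻ = Interpretation {n} not Rows κ

    val-complement : ∀ φ {k} (ρ : Vec X k) kn (t : Algorithm n Bool k) → I⁺.val φ ρ kn t + I⁻.val φ ρ kn t ≈ 1#
    val-complement φ ρ kn (output true)  = +-identityʳ 1#
    val-complement φ ρ kn (output false) = +-identityˡ 1#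
    val-complement φ ρ kn (coin r p q t u) = complementary r (val-complement φ ρ kn t) (val-complement φ ρ kn u)
    val-complement φ ρ kn (sample t) = ≈-trans (≈-sym (∫-+ (meas Rows) _ _)) (≈-trans
      (∫-cong (meas Rows) λ x → val-complement φ (x ∷ ρ) (blank ∷ kn) t) (𝔼-const Rows 1#))
    val-complement φ ρ kn (query i j t) with known kn i j
    ... | just b  = val-complement φ ρ kn (t b)
    ... | nothing = complementary (κ (lookup ρ i) (lookup φ j)) (val-complement φ ρ _ (t true)) (val-complement φ ρ _ (t false))

    row-bit : ∀ {O : Set} (acc : O → Bool) φ x j → let open Interpretation {n} acc Rows κ in
              ∀ f → 𝔼 (bit κ𝕀 (lookup blank j) x (lookup φ j)) f ≈ 𝔼 (bernoulli (κ x (lookup φ j)) (κ𝕀 x (lookup φ j))) f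
    row-bit acc φ x j f rewrite lookup-replicate {n = n} j (nothing {A = Bool}) = ≈-refl

  -- The tester on the lifted distribution

  module Reduction (𝒫 : Property) (invariant : IndexInvariant 𝒫) {n : ℕ} .{{_ : NonZero n}} (μ μ′ : Dist n) (d d′ : ℝ)
    (dist : IsEMDistanceTo (member 𝒫 n) μ d) (dist′ : IsEMDistanceTo (member 𝒫 n) μ′ d′) where

    open EMDistance (member 𝒫 n) (compact 𝒫 n) (respects 𝒫 n)

    τ : Dist n
    τ = proj₁ (proj₁ (optimal dist))
    τ∈ : member 𝒫 n τ
    τ∈ = proj₂ (proj₁ (optimal dist))
    opt : Coupling μ τ d
    opt = proj₂ (optimal dist)
    T : Prob (Str n × Str n)
    T = Coupling.joint-law opt
    T∼ : mapP proj₁ T ∼ ⟦ μ ⟧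
    T∼ = Coupling.first opt

    0≤2/3 : 0# ≤ 2/3
    0≤2/3 = *-nonNeg (0≤fromℕ 2) (<⇒≤ (0<⁻¹ (0<fromℕ 3)))

    module _ {k : ℕ} (bs bs′ : Vec (Fin n) k) (as as′ : Vec (Str n) k) (params : Lifting.Parameters μ μ′ T T∼ bs bs′ as as′)
      (ε₁ : ℝ) (t : Algorithm n Bool 0) (tester : IsTester 𝒫 ε₁ n t) (s q : ℕ) (ls : samples t ℕ.≤ s) (lq : queries t ℕ.≤ q) (q≤n : fromℕ q ≤ fromℕ n) where

      open LiftedValues μ μ′ T T∼ bs bs′ as as′ params

      collision : ℝ
      collision = fromℕ q * (fromℕ q * fromℕ n ⁻¹)

      -- The kernel `κ` is deterministic: with distinct columns π it reads τ in permuted order. By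
      -- index invariance the result lies in the property, so completeness applies for every such π.
      accepted : (1# - collision) * 2/3 ≤ value id T Cols κ t
      accepted = value-lower id T κ κ𝕀 (λ _ → dirac tt) q t lq q≤n 2/3 0≤2/3 low
        where
        module I = Interpretation {n} id T κ
        low : ∀ π → Distinct π → 2/3 ≤ 𝔼 (indep {n = n} (λ _ → dirac tt)) (λ l → I.val (Vec.zip π l) [] [] t)
        low π dπ = 𝔼-≥ (indep {n = n} (λ _ → dirac tt)) λ l → ≤-respʳ-≈ (≈-sym (I.val≈prob κ𝕀 (Vec.zip π l) [] [] t))
          (IsTester.completeness tester (I.rowDist κ𝕀 (Vec.zip π l)) (in-property l))
          where
          π̂ = proj₁ (toPermutation π dπ)
          permuted : ∀ l → ⟦ I.rowDist κ𝕀 (Vec.zip π l) ⟧ ∼ mapP (permute π̂) ⟦ τ ⟧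
          permuted l f = ≈-trans (law-∼ (bind T λ r → I.rowLaw κ𝕀 (Vec.zip π l) r blank) f) (≈-trans
            (∫-cong (meas T) λ (x , y) → indep-dirac _ (λ j → lookup y (π̂ ⟨$⟩ʳ j)) (λ j g →
              ≈-trans (row-bit T κ κ𝕀 id (Vec.zip π l) (x , y) j g) (≈-trans (bernoulli-ind (lookup y (proj₁ (lookup (Vec.zip π l) j))) (κ𝕀 (x , y) (lookup (Vec.zip π l) j)) g)
                (≈-reflexive (≡.cong (λ z → g (lookup y (proj₁ z))) (lookup-zip j π l))))) f)
            (Coupling.second opt (f ∘ permute π̂)))
          in-property : ∀ l → member 𝒫 n (I.rowDist κ𝕀 (Vec.zip π l))
          in-property l = Equivalence.to (invariant n π̂ (I.rowDist κ𝕀 (Vec.zip π l))) (τ , τ∈ , permuted-∼ π̂ τ (I.rowDist κ𝕀 (Vec.zip π l)) (permuted l))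

      -- The rest is by contradiction: `far` makes every lifted distribution whose cost exceeds the
      -- mean by at most δ more than ε₁ away from the property.
      module _ (δ : ℝ) (0<δ : 0# < δ) (far : ¬ d′ ≤ liftedCost + δ + ε₁) where

        private
          module I = Interpretation {n} not Rows′ κ′

          module _ (π : Vec (Fin n) n) (dπ : Distinct π) where

            π̂ : Permutation′ n
            π̂ = proj₁ (toPermutation π dπ)

            labels : Prob (Vec (Fin n) n)
            labels = indep (colPartner ∘ lookup π)

            h : Fin n → Fin n → ℝ
            h j c = 𝔼 Rows′ λ (x , r) → disagree (lookup x (lookup π j)) (κ′ (x , r) (lookup π j , c))

            h𝕀 : ∀ j c → 𝕀 (h j c)
            h𝕀 j c = 𝔼-𝕀 Rows′ λ (x , r) → disagree-𝕀 (lookup x (lookup π j)) (κ′𝕀 (x , r) (lookup π j , c))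

            costAt : Vec (Fin n) n → ℝ
            costAt l = 𝔼 𝒰 λ j → h j (lookup l j)

            mean-cost : 𝔼 𝒰 (λ j → 𝔼 (colPartner (lookup π j)) (h j)) ≈ liftedCost
            mean-cost = ≈-trans (uniform-permute π̂ λ c → 𝔼 (colPartner c) λ c′ → 𝔼 Rows′ λ (x , r) → disagree (lookup x c) (κ′ (x , r) (c , c′)))
              (≈-sym (∫-swap (meas Rows′) (meas Cols′) _))

            -- A row of μ′, permuted by π, is paired with the noisy row that `κ′` generates from it.
            -- The Hamming distance is an average over positions, so the cost is the mean of the
            -- disagreement probabilities.
            coupled : ∀ l → Coupling (permuteDist π̂ μ′) (I.rowDist κ′𝕀 (Vec.zip π l)) (costAt l)
            coupled l = record
              { joint-law = J
              ; first = λ f → ≈-trans (∫-cong (meas Rows′) λ (x , r) → 𝔼-const (rows (x , r)) _) (≈-trans (Rows′∼ (f ∘ permute π̂)) (≈-sym (permuteDist-∼ π̂ μ′ f)))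
              ; second = λ f → ≈-sym (law-∼ (bind Rows′ rows) f)
              ; cost-≤ = ≤-reflexive (≈-trans (∫-cong (meas Rows′) λ r → ≈-trans (∫-cong (meas (rows r)) λ y → hamming-average (permute π̂ (proj₁ r)) y)
                  (≈-trans (∫-swap (meas (rows r)) (meas 𝒰) _) (∫-cong (meas 𝒰) λ j → entry r j))) (∫-swap (meas Rows′) (meas 𝒰) _)) }
              where
              rows : Str n × Pairs → Prob (Str n)
              rows r = I.rowLaw κ′𝕀 (Vec.zip π l) r blank
              J : Prob (Str n × Str n)
              J = bind Rows′ λ (x , r) → mapP (permute π̂ x ,_) (rows (x , r))
              flipped : ∀ b e i → 𝔼 (bernoulli e i) (λ y → disagree b (ind y)) ≈ disagree b e
              flipped true e i  = solve 1 (λ e → e :* (con (+ 1) :- con (+ 1)) :+ (con (+ 1) :- e) :* (con (+ 1) :- con (+ 0)) := con (+ 1) :- e) ≈-refl e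
              flipped false e i = solve 1 (λ e → e :* con (+ 1) :+ (con (+ 1) :- e) :* con (+ 0) := e) ≈-refl e
              entry : ∀ r j → 𝔼 (rows r) (λ y → disagree (lookup (permute π̂ (proj₁ r)) j) (ind (lookup y j))) ≈
                      disagree (lookup (proj₁ r) (lookup π j)) (κ′ r (lookup π j , lookup l j))
              entry r j = ≈-trans (indep-marginal (λ j → I.bit κ′𝕀 (lookup blank j) r (lookup (Vec.zip π l) j)) j (λ b → disagree (lookup (permute π̂ (proj₁ r)) j) (ind b)))
                (≈-trans (row-bit Rows′ κ′ κ′𝕀 not (Vec.zip π l) r j _) (≈-trans (flipped (lookup (permute π̂ (proj₁ r)) j) (κ′ r (lookup (Vec.zip π l) j)) (κ′𝕀 r (lookup (Vec.zip π l) j)))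
                  (≈-reflexive (≡.cong₂ (λ a b → disagree a (κ′ r b)) (lookup∘tabulate (λ i → lookup (proj₁ r) (π̂ ⟨$⟩ʳ i)) j) (lookup-zip j π l)))))

            -- If the lifted distribution were within ε₁ of a member, gluing this to `coupled` and
            -- undoing the permutation, which keeps the property, would bring μ′ within `costAt l` +
            -- ε₁ of the property, against `far`.
            rejects : ∀ l → costAt l ≤ liftedCost + δ → 2/3 ≤ I.val (Vec.zip π l) [] [] t
            rejects l le = ≤-respʳ-≈ (≈-sym (I.val≈prob κ′𝕀 (Vec.zip π l) [] [] t)) (by-distance (exists (τ , τ∈) law-l))
              where
              law-l = I.rowDist κ′𝕀 (Vec.zip π l)
              by-distance : ∃ (IsEMDistanceTo (member 𝒫 n) law-l) → 2/3 ≤ prob law-l not t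
              by-distance (d″ , D″) = cases (≤-or-< d″ ε₁)
                where
                near : (Σ (∃ (member 𝒫 n)) λ (σ , _) → Coupling law-l σ d″) → d′ ≤ costAt l + d″
                near ((σ , σ∈) , c) = distance-≤ dist′ (permuteDist (Perm.flip π̂) σ) (costAt l + d″)
                  (Equivalence.to (invariant n (Perm.flip π̂) (permuteDist (Perm.flip π̂) σ)) (σ , σ∈ , permuted-∼ (Perm.flip π̂) σ (permuteDist (Perm.flip π̂) σ) (permuteDist-∼ (Perm.flip π̂) σ)))
                  (unpermute π̂ (glue (coupled l) c))
                cases : d″ ≤ ε₁ ⊎ ε₁ < d″ → 2/3 ≤ prob law-l not t
                cases (inj₂ lt)       = IsTester.soundness tester law-l d″ D″ lt
                cases (inj₁ close-to) = ⊥-elim (far (≤-trans (near (optimal D″)) (le ⊕ close-to)))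

            bad : Vec (Fin n) n → ℝ
            bad l = ind (does (em {¬ costAt l ≤ liftedCost + δ}))

            -- Chebyshev's inequality for the average cost of independent labels.
            bad-≤ : 𝔼 labels bad * (fromℕ n * (δ * δ)) ≤ 1#
            bad-≤ = *-cancelˡ-≤ (0<fromℕ n) (≤-trans (≤-reflexive (solve 3 (λ n e x → n :* (e :* (n :* x)) := e :* ((n :* n) :* x)) ≈-refl (fromℕ n) (𝔼 labels bad) (δ * δ)))
              (≤-trans (≤-reflexive (≈-sym (∫-*ʳ (meas labels) _ _))) (≤-trans (∫-mono (meas labels) pointwise)
                (≤-trans (variance-≤ (colPartner ∘ lookup π) h) (≤-trans (∫-mono (sumM n) λ j → 𝔼-≤ (colPartner (lookup π j)) λ c → proj₂ (𝕀-* (h𝕀 j c) (h𝕀 j c))) (≤-reflexive (sum-const n 1#)))))))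
              where
              total-dev : Vec (Fin n) n → ℝ
              total-dev l = sum (λ j → h j (lookup l j) - 𝔼 (colPartner (lookup π j)) (h j))
              dev≈ : ∀ l → total-dev l ≈ fromℕ n * (costAt l - liftedCost)
              dev≈ l = ≈-trans (≈-sym (≈-trans (≈-sym (*-assoc _ _ _)) (≈-trans (*-congʳ (*-inv (0<fromℕ n))) (*-identityˡ _))))
                (*-congˡ (≈-trans (≈-sym (∫-* (sumM n) _ _)) (≈-trans (∫-- (meas 𝒰) _ _) (+-congˡ (-‿cong mean-cost)))))
              pointwise : ∀ l → bad l * ((fromℕ n * fromℕ n) * (δ * δ)) ≤ total-dev l * total-dev l
              pointwise l = cases (≤-or-< (costAt l) (liftedCost + δ))
                where
                0≤nδ = *-nonNeg (0≤fromℕ n) (<⇒≤ 0<δ)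
                cases : costAt l ≤ liftedCost + δ ⊎ liftedCost + δ < costAt l → bad l * ((fromℕ n * fromℕ n) * (δ * δ)) ≤ total-dev l * total-dev l
                cases (inj₁ g) = ≤-respˡ-≈ (≈-sym (≈-trans (*-congʳ (ind-no λ b → b g)) (zeroˡ _))) (0≤x² (total-dev l))
                cases (inj₂ g) = ≤-trans (≤-reflexive (≈-trans (*-congʳ (ind-yes (<⇒≰ g))) (solve 2 (λ n d → con (+ 1) :* ((n :* n) :* (d :* d)) := (n :* d) :* (n :* d)) ≈-refl (fromℕ n) δ)))
                    (≤-trans (mul-mono 0≤nδ big (≤-trans 0≤nδ big) big) (≤-reflexive (≈-sym (*-cong (dev≈ l) (dev≈ l)))))
                  where
                  big : fromℕ n * δ ≤ fromℕ n * (costAt l - liftedCost)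
                  big = 0≤fromℕ n ⊛ lin (<⇒≤ g) (solve 3 (λ c l d → c :- (l :+ d) := (c :- l) :- d) ≈-refl (costAt l) liftedCost δ)

        -- The labels are part of the lifted distribution and fixed before the tester runs, so
        -- soundness applies to each choice of labels separately and not to their average. By
        -- `bad-≤` all but a fraction `w` of them have a cost near the mean.
        rejected : ∀ w → 𝕀 w → 1# ≤ w * (fromℕ n * (δ * δ)) → (1# - collision) * ((1# - w) * 2/3) ≤ value not Rows′ Cols′ κ′ t
        rejected w iw enough = value-lower not Rows′ κ′ κ′𝕀 colPartner q t lq q≤n ((1# - w) * 2/3)
          (*-nonNeg (proj₁ (𝕀-not iw)) 0≤2/3) low
          where
          low : ∀ π → Distinct π → (1# - w) * 2/3 ≤ 𝔼 (indep (colPartner ∘ lookup π)) (λ l → I.val (Vec.zip π l) [] [] t)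
          low π dπ = ≤-trans (lin (0≤2/3 ⊛ few) (solve 3 (λ p w b → p :* w :- p :* b := (con (+ 1) :- b) :* p :- (con (+ 1) :- w) :* p) ≈-refl 2/3 w (𝔼 (labels π dπ) (bad π dπ))))
            (≤-trans (≤-reflexive (≈-sym (≈-trans (∫-*ʳ (meas (labels π dπ)) 2/3 _) (*-congʳ (≈-trans (∫-- (meas (labels π dπ)) _ _) (+-congʳ (𝔼-const (labels π dπ) 1#)))))))
              (∫-mono (meas (labels π dπ)) pointwise))
            where
            0<nδ² = 0<-* (0<fromℕ n) (0<-* 0<δ 0<δ)
            few : 𝔼 (labels π dπ) (bad π dπ) ≤ w
            few = *-cancelˡ-≤ 0<nδ² (≤-respˡ-≈ (*-comm _ _) (≤-respʳ-≈ (*-comm _ _) (≤-trans (bad-≤ π dπ) enough)))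
            pointwise : ∀ l → (1# - bad π dπ l) * 2/3 ≤ I.val (Vec.zip π l) [] [] t
            pointwise l = cases (≤-or-< (costAt π dπ l) (liftedCost + δ))
              where
              cases : costAt π dπ l ≤ liftedCost + δ ⊎ liftedCost + δ < costAt π dπ l → (1# - bad π dπ l) * 2/3 ≤ I.val (Vec.zip π l) [] [] t
              cases (inj₂ g) = ≤-trans (≤-reflexive (≈-trans (*-congʳ (≈-trans (+-congˡ (-‿cong (ind-yes (<⇒≰ g)))) (-‿inverseʳ 1#))) (zeroˡ 2/3)))
                (proj₁ (I.val-𝕀 κ′𝕀 (Vec.zip π l) [] [] t))
              cases (inj₁ g) = ≤-trans (≤-reflexive (≈-trans (*-congʳ (≈-trans (+-congˡ (≈-trans (-‿cong (ind-no λ b → b g)) -0#≈0#)) (+-identityʳ 1#))) (*-identityˡ 2/3)))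
                (rejects π dπ l g)

      transferCost-≤ : transferCost ≤ d
      transferCost-≤ = ≤-trans (≤-reflexive (∫-cong (meas T) λ (x , y) → ≈-sym (hamming-average x y))) (Coupling.cost-≤ opt)

  -- The estimator

  module Programs {n : ℕ} {O : Set} where

    private
      Alg : ℕ → Set
      Alg = Algorithm n O

    -- A uniform element of Fin (suc r), by coins of bias 1 / (suc r), 1 / r, ….
    choose : ∀ {k} r → (Fin (suc r) → Alg k) → Alg k
    choose zero g    = g zero
    choose (suc r) g = coin (fromℕ (suc (suc r)) ⁻¹) (<⇒≤ (0<⁻¹ (0<fromℕ (suc (suc r)))))
      (≤-respʳ-≈ (*-inv (0<fromℕ (suc (suc r)))) (≤-respˡ-≈ (*-identityˡ _) (mul-mono 0≤1 (1≤fromℕ (suc (suc r))) (<⇒≤ (0<⁻¹ (0<fromℕ (suc (suc r))))) ≤-refl)))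
      (g zero) (choose r (g ∘ suc))

    drawFrom : ∀ {k} m → .{{NonZero m}} → (Fin m → Alg k) → Alg k
    drawFrom (suc r) = choose r

    drawColumns : ∀ {k} m → .{{NonZero m}} → ∀ r → (Vec (Fin m) r → Alg k) → Alg k
    drawColumns m zero g    = g []
    drawColumns m (suc r) g = drawFrom m λ c → drawColumns m r (g ∘ (c ∷_))

    -- The continuation receives the new indices of the old samples and the indices of the r new ones.
    drawRows : ∀ r {k} → (∀ {k′} → (Fin k → Fin k′) → Vec (Fin k′) r → Alg k′) → Alg k
    drawRows zero g    = g id []
    drawRows (suc r) g = sample (drawRows r λ e is → g (e ∘ suc) (e zero ∷ is))

    askRow : ∀ {k r} → Fin k → Vec (Fin n) r → (Vec Bool r → Alg k) → Alg k
    askRow i [] g       = g []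
    askRow i (j ∷ js) g = query i j λ b → askRow i js (g ∘ (b ∷_))

    askColumn : ∀ {k r} → Vec (Fin k) r → Fin n → (Vec Bool r → Alg k) → Alg k
    askColumn [] j g       = g []
    askColumn (i ∷ is) j g = query i j λ b → askColumn is j (g ∘ (b ∷_))

    choose-queries : ∀ {k} r (g : Fin (suc r) → Alg k) B → (∀ c → queries (g c) ℕ.≤ B) → queries (choose r g) ℕ.≤ B
    choose-queries zero g B le    = le zero
    choose-queries (suc r) g B le = ℕₚ.⊔-lub (le zero) (choose-queries r (g ∘ suc) B (le ∘ suc))

    drawFrom-queries : ∀ {k} m .{{_ : NonZero m}} (g : Fin m → Alg k) B → (∀ c → queries (g c) ℕ.≤ B) → queries (drawFrom m g) ℕ.≤ B
    drawFrom-queries (suc r) = choose-queries r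

    drawColumns-queries : ∀ {k} m .{{_ : NonZero m}} r (g : Vec (Fin m) r → Alg k) B → (∀ bs → queries (g bs) ℕ.≤ B) → queries (drawColumns m r g) ℕ.≤ B
    drawColumns-queries m zero g B le    = le []
    drawColumns-queries m (suc r) g B le = drawFrom-queries m _ B λ c → drawColumns-queries m r (g ∘ (c ∷_)) B (le ∘ (c ∷_))

    drawRows-queries : ∀ r {k} (g : ∀ {k′} → (Fin k → Fin k′) → Vec (Fin k′) r → Alg k′) B →
      (∀ {k′} (e : Fin k → Fin k′) is → queries (g e is) ℕ.≤ B) → queries (drawRows r g) ℕ.≤ B
    drawRows-queries zero g B le    = le id []
    drawRows-queries (suc r) g B le = drawRows-queries r (λ e is → g (e ∘ suc) (e zero ∷ is)) B λ e is → le (e ∘ suc) (e zero ∷ is)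

    askRow-queries : ∀ {k r} (i : Fin k) (js : Vec (Fin n) r) (g : Vec Bool r → Alg k) B → (∀ u → queries (g u) ℕ.≤ B) → queries (askRow i js g) ℕ.≤ r ℕ.+ B
    askRow-queries i [] g B le       = le []
    askRow-queries i (j ∷ js) g B le = s≤s (ℕₚ.⊔-lub (askRow-queries i js _ B (le ∘ (false ∷_))) (askRow-queries i js _ B (le ∘ (true ∷_))))

    askColumn-queries : ∀ {k r} (is : Vec (Fin k) r) j (g : Vec Bool r → Alg k) B → (∀ u → queries (g u) ℕ.≤ B) → queries (askColumn is j g) ℕ.≤ r ℕ.+ B
    askColumn-queries [] j g B le       = le []
    askColumn-queries (i ∷ is) j g B le = s≤s (ℕₚ.⊔-lub (askColumn-queries is j _ B (le ∘ (false ∷_))) (askColumn-queries is j _ B (le ∘ (true ∷_))))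

    module Semantics (acc : O → Bool) (μ : Dist n) where

      ⟪_⟫ : ∀ {k} → Alg k → Vec (Str n) k → ℝ
      ⟪ t ⟫ ρ = probFrom μ acc ρ t

      choose-sum : ∀ {k} r (g : Fin (suc r) → Alg k) ρ → fromℕ (suc r) * ⟪ choose r g ⟫ ρ ≈ sum (λ c → ⟪ g c ⟫ ρ)
      choose-sum zero g ρ    = ≈-trans (*-congʳ fromℕ-1) (≈-trans (*-identityˡ _) (≈-sym (+-identityʳ _)))
      choose-sum (suc r) g ρ = ≈-trans (arith (fromℕ (suc r)) (fromℕ (suc (suc r)) ⁻¹) (⟪ g zero ⟫ ρ) (⟪ choose r (g ∘ suc) ⟫ ρ) (*-inv (0<fromℕ (suc (suc r))))) (+-congˡ (choose-sum r (g ∘ suc) ρ))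
        where
        arith : ∀ l i a b → (1# + l) * i ≈ 1# → (1# + l) * (i * a + (1# - i) * b) ≈ a + l * b
        arith l i a b e = ≈-trans (solve 4 (λ l i a b → (con (+ 1) :+ l) :* (i :* a :+ (con (+ 1) :- i) :* b) := ((con (+ 1) :+ l) :* i) :* a :+ (con (+ 1) :+ l :- (con (+ 1) :+ l) :* i) :* b) ≈-refl l i a b)
          (≈-trans (+-cong (*-congʳ e) (*-congʳ (+-congˡ (-‿cong e)))) (solve 3 (λ l a b → con (+ 1) :* a :+ (con (+ 1) :+ l :- con (+ 1)) :* b := a :+ l :* b) ≈-refl l a b))

      drawFrom-≈ : ∀ {k} m .{{_ : NonZero m}} (g : Fin m → Alg k) ρ → ⟪ drawFrom m g ⟫ ρ ≈ 𝔼 (uniform m) (λ c → ⟪ g c ⟫ ρ)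
      drawFrom-≈ (suc r) g ρ = ≈-sym (≈-trans (∫-* (sumM (suc r)) (fromℕ (suc r) ⁻¹) (λ c → ⟪ g c ⟫ ρ)) (≈-trans (*-congˡ (≈-sym (choose-sum r g ρ)))
        (≈-trans (≈-sym (*-assoc _ _ _)) (≈-trans (*-congʳ (≈-trans (*-comm _ _) (*-inv (0<fromℕ (suc r))))) (*-identityˡ _)))))

      drawColumns-≈ : ∀ {k} m .{{_ : NonZero m}} r (g : Vec (Fin m) r → Alg k) ρ → ⟪ drawColumns m r g ⟫ ρ ≈ 𝔼 (indep {n = r} (λ _ → uniform m)) (λ bs → ⟪ g bs ⟫ ρ)
      drawColumns-≈ m zero g ρ    = ≈-refl
      drawColumns-≈ m (suc r) g ρ = ≈-trans (drawFrom-≈ m _ ρ) (∫-cong (meas (uniform m)) λ c → drawColumns-≈ m r (g ∘ (c ∷_)) ρ)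

      -- Later samples shift the indices of earlier ones, so the continuation is compared with `H`
      -- through the embedding `e`, for every store that extends the old one.
      drawRows-≈ : ∀ r {k} (g : ∀ {k′} → (Fin k → Fin k′) → Vec (Fin k′) r → Alg k′) (ρ : Vec (Str n) k) (H : Vec (Str n) r → ℝ) →
        (∀ {k′} (e : Fin k → Fin k′) is (ρ′ : Vec (Str n) k′) → (∀ i → lookup ρ′ (e i) ≡ lookup ρ i) → ⟪ g e is ⟫ ρ′ ≈ H (Vec.map (lookup ρ′) is)) →
        ⟪ drawRows r g ⟫ ρ ≈ 𝔼 (indep {n = r} (λ _ → ⟦ μ ⟧)) H
      drawRows-≈ zero g ρ H h    = h id [] ρ (λ _ → refl)
      drawRows-≈ (suc r) g ρ H h = ∫-cong (meas ⟦ μ ⟧) λ x → drawRows-≈ r (λ e is → g (e ∘ suc) (e zero ∷ is)) (x ∷ ρ) (H ∘ (x ∷_)) λ e is ρ′ old →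
        ≈-trans (h (e ∘ suc) (e zero ∷ is) ρ′ (old ∘ suc)) (≈-reflexive (≡.cong (λ a → H (a ∷ Vec.map (lookup ρ′) is)) (old zero)))

      askRow-≈ : ∀ {k r} (i : Fin k) (js : Vec (Fin n) r) (g : Vec Bool r → Alg k) ρ → ⟪ askRow i js g ⟫ ρ ≡ ⟪ g (Vec.map (lookup (lookup ρ i)) js) ⟫ ρ
      askRow-≈ i [] g ρ       = refl
      askRow-≈ i (j ∷ js) g ρ = askRow-≈ i js (g ∘ (lookup (lookup ρ i) j ∷_)) ρ

      askColumn-≈ : ∀ {k r} (is : Vec (Fin k) r) j (g : Vec Bool r → Alg k) ρ → ⟪ askColumn is j g ⟫ ρ ≡ ⟪ g (Vec.map (λ i → lookup (lookup ρ i) j) is) ⟫ ρ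
      askColumn-≈ [] j g ρ       = refl
      askColumn-≈ (i ∷ is) j g ρ = askColumn-≈ is j (g ∘ (lookup (lookup ρ i) j ∷_)) ρ

  Observation : ℕ → Set
  Observation r = Vec Bool r × (Vec Bool r × Bool)

  observe : ∀ {n r} → Vec (Fin n) r → Vec (Str n) r → Str n → Fin n → Observation r
  observe bs as x c = Vec.map (lookup x) bs , Vec.map (λ a → lookup a c) as , lookup x c

  observationLaw : ∀ {n} .{{_ : NonZero n}} {r} → Dist n → Vec (Fin n) r → Vec (Str n) r → Prob (Observation r)
  observationLaw {n} μ bs as = bind ⟦ μ ⟧ λ x → mapP (observe bs as x) (uniform n)

  module Sampling {n : ℕ} .{{_ : NonZero n}} {O : Set} (r : ℕ) where

    open Programs {n} {O}

    round : ∀ {k} → Vec (Fin n) r → Vec (Fin k) r → (Observation r → Algorithm n O (suc k)) → Fin n → Algorithm n O (suc k)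
    round bs is g c = askRow zero bs λ u → askColumn (Vec.map suc is) c λ v → query zero c λ b → g (u , v , b)

    rounds : ∀ m {k} → Vec (Fin n) r → Vec (Fin k) r → (Vec (Observation r) m → O) → Algorithm n O k
    rounds zero bs is f    = output (f [])
    rounds (suc m) bs is f = sample (drawFrom n (round bs is λ o → rounds m bs (Vec.map suc is) (f ∘ (o ∷_))))

    estimator : ∀ m → (Vec (Observation r) m → O) → Algorithm n O 0
    estimator m f = drawColumns n r λ bs → drawRows r λ _ is → rounds m bs is f

    -- A round asks for r entries of the fresh row, r entries of the fresh column, and their common
    -- entry.
    rounds-queries : ∀ m {k} bs (is : Vec (Fin k) r) f → queries (rounds m bs is f) ℕ.≤ m ℕ.* (r ℕ.+ (r ℕ.+ 1))
    rounds-queries zero bs is f    = z≤n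
    rounds-queries (suc m) bs is f = drawFrom-queries n _ _ λ c → ℕₚ.≤-trans
      (askRow-queries zero bs _ (r ℕ.+ suc (m ℕ.* (r ℕ.+ (r ℕ.+ 1)))) λ u → askColumn-queries (Vec.map suc is) c _ (suc (m ℕ.* (r ℕ.+ (r ℕ.+ 1)))) λ v →
        s≤s (ℕₚ.⊔-lub (rounds-queries m bs (Vec.map suc is) _) (rounds-queries m bs (Vec.map suc is) _)))
      (ℕₚ.≤-reflexive (arith r (m ℕ.* (r ℕ.+ (r ℕ.+ 1)))))
      where
      arith : ∀ r x → r ℕ.+ (r ℕ.+ suc x) ≡ r ℕ.+ (r ℕ.+ 1) ℕ.+ x
      arith r x = ≡.trans (≡.cong (r ℕ.+_) (≡.sym (ℕₚ.+-assoc r 1 x))) (≡.sym (ℕₚ.+-assoc r (r ℕ.+ 1) x))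

    estimator-queries : ∀ m f → queries (estimator m f) ℕ.≤ m ℕ.* (r ℕ.+ (r ℕ.+ 1))
    estimator-queries m f = drawColumns-queries n r _ _ λ bs → drawRows-queries r (λ _ is → rounds m bs is f) _ λ _ is → rounds-queries m bs is f

    module _ (acc : O → Bool) (μ : Dist n) where
      open Semantics acc μ

      round-≈ : ∀ {k} bs (is : Vec (Fin k) r) (g : Observation r → Algorithm n O (suc k)) c x ρ →
        ⟪ round bs is g c ⟫ (x ∷ ρ) ≡ ⟪ g (observe bs (Vec.map (lookup ρ) is) x c) ⟫ (x ∷ ρ)
      round-≈ bs is g c x ρ = ≡.trans (askRow-≈ zero bs (λ u → askColumn (Vec.map suc is) c λ v → query zero c λ b → g (u , v , b)) (x ∷ ρ))
        (≡.trans (askColumn-≈ (Vec.map suc is) c (λ v → query zero c λ b → g (Vec.map (lookup x) bs , v , b)) (x ∷ ρ))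
          (≡.cong (λ v → ⟪ g (Vec.map (lookup x) bs , v , lookup x c) ⟫ (x ∷ ρ))
            (≡.trans (≡.sym (map-∘ (λ i → lookup (lookup (x ∷ ρ) i) c) suc is)) (map-∘ (λ a → lookup a c) (lookup ρ) is))))

      rounds-≈ : ∀ m {k} bs (is : Vec (Fin k) r) f (ρ : Vec (Str n) k) as → Vec.map (lookup ρ) is ≡ as →
        ⟪ rounds m bs is f ⟫ ρ ≈ 𝔼 (indep {n = m} (λ _ → observationLaw μ bs as)) (λ D → ind (acc (f D)))
      rounds-≈ zero bs is f ρ as e = ≈-refl
      rounds-≈ (suc m) bs is f ρ as refl = ∫-cong (meas ⟦ μ ⟧) λ x → ≈-trans (drawFrom-≈ n (round bs is next) (x ∷ ρ)) (∫-cong (meas (uniform n)) λ c →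
        ≈-trans (≈-reflexive (round-≈ bs is next c x ρ))
          (rounds-≈ m bs (Vec.map suc is) (f ∘ (observe bs as x c ∷_)) (x ∷ ρ) as (≡.sym (map-∘ (lookup (x ∷ ρ)) suc is))))
        where
        next = λ o → rounds m bs (Vec.map suc is) (f ∘ (o ∷_))

      estimator-≈ : ∀ m f → prob μ acc (estimator m f) ≈
        𝔼 (indep {n = r} (λ _ → uniform n)) λ bs → 𝔼 (indep {n = r} (λ _ → ⟦ μ ⟧)) λ as →
        𝔼 (indep {n = m} (λ _ → observationLaw μ bs as)) λ D → ind (acc (f D))
      estimator-≈ m f = ≈-trans (drawColumns-≈ n r anchored []) (∫-cong (meas (indep {n = r} (λ _ → uniform n))) given)
        where
        anchored : Vec (Fin n) r → Algorithm n O 0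
        anchored bs = drawRows r λ _ is → rounds m bs is f
        H : Vec (Fin n) r → Vec (Str n) r → ℝ
        H bs as = 𝔼 (indep {n = m} (λ _ → observationLaw μ bs as)) λ D → ind (acc (f D))
        inner : ∀ bs {k′} (e : Fin 0 → Fin k′) is (ρ′ : Vec (Str n) k′) → (∀ i → lookup ρ′ (e i) ≡ lookup [] i) → ⟪ rounds m bs is f ⟫ ρ′ ≈ H bs (Vec.map (lookup ρ′) is)
        inner bs e is ρ′ _ = rounds-≈ m bs is f ρ′ (Vec.map (lookup ρ′) is) refl
        given : ∀ bs → ⟪ anchored bs ⟫ [] ≈ 𝔼 (indep {n = r} (λ _ → ⟦ μ ⟧)) (H bs)
        given bs = drawRows-≈ r (λ _ is → rounds m bs is f) [] (H bs) (inner bs)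

  ∑-strings-1 : ∀ k → ∑ (strings k) (λ _ → 1#) ≈ 2^ k
  ∑-strings-1 zero    = +-identityʳ 1#
  ∑-strings-1 (suc k) = ≈-trans (∑-++ (List.map (false ∷_) (strings k)) _ _) (≈-trans
    (+-cong (≈-trans (∑-map (false ∷_) (strings k) _) (∑-strings-1 k)) (≈-trans (∑-map (true ∷_) (strings k) _) (∑-strings-1 k)))
    (solve 1 (λ p → p :+ p := con (+ 2) :* p) ≈-refl (2^ k)))

  -- Typical data

  module Data {n : ℕ} .{{_ : NonZero n}} (k m : ℕ) .{{_ : NonZero m}} where

    Obs : Set
    Obs = Observation k

    enumObs : Enum Obs
    enumObs = enum× (enumVec k) (enum× (enumVec k) enumBool)

    open Enum enumObs

    module _ (μ : Dist n) where

      frequency : Vec (Fin n) k → Vec (Str n) k → Obs → ℝ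
      frequency bs as o = 𝔼 (observationLaw μ bs as) λ o′ → ind (o′ == o)

      excess : Vec (Fin n) k → Vec (Str n) k → Vec Obs m → Obs → ℝ
      excess bs as D o = sum λ i → ind (lookup D i == o) - frequency bs as o

      -- The squared distance between the counts of the observations and their expectations, without
      -- division by m. Its mean is at most m, as each draw contributes at most 1 to the sum of the
      -- variances.
      spread : Vec (Fin n) k → Vec (Str n) k → Vec Obs m → ℝ
      spread bs as D = ∑ elems λ o → excess bs as D o * excess bs as D o

      rowTotal : Vec (Fin n) k → ℝ
      rowTotal = Anchors.tot ⟦ μ ⟧ (uniform n) lookup

      colTotal : Vec (Str n) k → ℝ
      colTotal = Anchors.tot (uniform n) ⟦ μ ⟧ (λ c x → lookup x c)

      -- `rowTotal` and `colTotal` have mean at most 1 and `spread` at most m, so `total-loss` has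
      -- mean at most 3m. Markov's inequality at 9m leaves the failure probability 1/3 that an
      -- estimator may have.
      nine : ℝ
      nine = fromℕ 9

      -- The anchors are quantified existentially since the data record values at the anchors and
      -- not the anchors themselves. Two distributions may therefore share data by way of different
      -- anchors.
      Typical : Vec Obs m → Set
      Typical D = ∃ λ bs → ∃ λ as → rowTotal bs ≤ nine × colTotal as ≤ nine × spread bs as D ≤ nine * fromℕ m

      𝔼-spread : ∀ bs as → 𝔼 (indep {n = m} λ _ → observationLaw μ bs as) (spread bs as) ≤ fromℕ m
      𝔼-spread bs as = ≤-trans (≤-reflexive (∫-swap (meas (indep {n = m} λ _ → L)) (∑M elems) _))
        (≤-trans (∫-mono (∑M elems) λ o → variance-≤ {n = m} (λ _ → L) (λ _ o′ → ind (o′ == o)))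
          (≤-trans (≤-reflexive (∫-swap (∑M elems) (sumM m) _)) (≤-trans (∫-mono (sumM m) λ _ →
            ≤-trans (≤-reflexive (≈-sym (∫-swap (meas L) (∑M elems) λ o′ o → ind (o′ == o) * ind (o′ == o)))) (𝔼-≤ L λ o′ →
              ≤-trans (≤-reflexive (pick o′ (λ o → ind (o′ == o)))) (proj₂ (𝕀-ind (o′ == o′)))))
            (≤-reflexive (≈-trans (sum-const m 1#) (*-identityʳ _))))))
        where L = observationLaw μ bs as

      experiment : Prob (Vec (Fin n) k × Vec (Str n) k × Vec Obs m)
      experiment = bind (indep {n = k} λ _ → uniform n) λ bs → bind (indep {n = k} λ _ → ⟦ μ ⟧) λ as → mapP (λ D → bs , as , D) (indep {n = m} λ _ → observationLaw μ bs as)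

      total-loss : Vec (Fin n) k × Vec (Str n) k × Vec Obs m → ℝ
      total-loss (bs , as , D) = fromℕ m * (rowTotal bs + colTotal as) + spread bs as D

      𝔼-loss : 𝔼 experiment total-loss ≤ fromℕ 3 * fromℕ m
      𝔼-loss = ≤-trans (∫-mono (meas Bs) λ bs → ≤-trans (∫-mono (meas As) λ as → inner bs as) (≤-reflexive (middle bs)))
        (≤-trans (∫-mono (meas Bs) λ bs → (≤-refl ⊕ 0≤fromℕ m ⊛ Anchors.𝔼-tot (uniform n) ⟦ μ ⟧ (λ c x → lookup x c) k) ⊕ ≤-refl)
        (≤-trans (≤-reflexive outer) (≤-trans ((0≤fromℕ m ⊛ Anchors.𝔼-tot ⟦ μ ⟧ (uniform n) lookup k ⊕ ≤-refl) ⊕ ≤-refl)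
          (≤-reflexive (solve 1 (λ m → m :* con (+ 1) :+ m :* con (+ 1) :+ m := con (+ 3) :* m) ≈-refl (fromℕ m))))))
        where
        Bs = indep {n = k} λ _ → uniform n
        As = indep {n = k} λ _ → ⟦ μ ⟧
        inner : ∀ bs as → 𝔼 (indep {n = m} λ _ → observationLaw μ bs as) (λ D → total-loss (bs , as , D)) ≤ fromℕ m * (rowTotal bs + colTotal as) + fromℕ m
        inner bs as = ≤-trans (≤-reflexive (≈-trans (∫-+ (meas Ds) (λ _ → anchorLoss) (spread bs as)) (+-congʳ (𝔼-const Ds anchorLoss))))
          (≤-refl ⊕ 𝔼-spread bs as)
          where
          Ds = indep {n = m} λ _ → observationLaw μ bs as
          anchorLoss = fromℕ m * (rowTotal bs + colTotal as)
        middle : ∀ bs → 𝔼 As (λ as → fromℕ m * (rowTotal bs + colTotal as) + fromℕ m) ≈ fromℕ m * rowTotal bs + fromℕ m * 𝔼 As colTotal + fromℕ m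
        middle bs = ≈-trans (∫-+ (meas As) _ _) (+-cong (≈-trans (∫-* (meas As) _ _) (≈-trans (*-congˡ (≈-trans (∫-+ (meas As) _ _) (+-congʳ (𝔼-const As _)))) (distribˡ _ _ _))) (𝔼-const As _))
        outer : 𝔼 Bs (λ bs → fromℕ m * rowTotal bs + fromℕ m * 1# + fromℕ m) ≈ fromℕ m * 𝔼 Bs rowTotal + fromℕ m * 1# + fromℕ m
        outer = ≈-trans (∫-+ (meas Bs) _ _) (+-cong (≈-trans (∫-+ (meas Bs) _ _) (+-cong (∫-* (meas Bs) _ _) (𝔼-const Bs _))) (𝔼-const Bs _))

      typical-likely : (f : Vec Obs m → ℝ) → (∀ D → 0# ≤ f D) → (∀ D → Typical D → 1# ≤ f D) → 2/3 ≤ 𝔼 experiment (λ (_ , _ , D) → f D)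
      typical-likely f 0≤f hit = ≤-trans (two-thirds few) (≤-trans (≤-reflexive (≈-sym (≈-trans (∫-- (meas experiment) _ _) (+-congʳ (𝔼-const experiment 1#)))))
        (∫-mono (meas experiment) pointwise))
        where
        9m = nine * fromℕ m
        atypical : Vec (Fin n) k × Vec (Str n) k × Vec Obs m → ℝ
        atypical z = ind (does (9m ≤? total-loss z))
        0≤row : ∀ bs → 0# ≤ rowTotal bs
        0≤row = Anchors.0≤tot ⟦ μ ⟧ (uniform n) lookup
        0≤col : ∀ as → 0# ≤ colTotal as
        0≤col = Anchors.0≤tot (uniform n) ⟦ μ ⟧ (λ c x → lookup x c)
        0≤spread : ∀ bs as D → 0# ≤ spread bs as D
        0≤spread bs as D = ∫-pos (∑M elems) λ o → 0≤x² (excess bs as D o)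
        0≤m = 0≤fromℕ m
        few : 𝔼 experiment atypical * 9m ≤ fromℕ 3 * fromℕ m
        few = ≤-trans (markov experiment total-loss (λ (bs , as , D) → 0≤-+ (*-nonNeg 0≤m (0≤-+ (0≤row bs) (0≤col as))) (0≤spread bs as D)) 9m) 𝔼-loss
        two-thirds : ∀ {e} → e * 9m ≤ fromℕ 3 * fromℕ m → 2/3 ≤ 1# - e
        two-thirds {e} le = *-cancelˡ-≤ (0<fromℕ 3) (≤-respˡ-≈ (≈-sym (≈-trans (solve 3 (λ a b c → a :* (b :* c) := b :* (a :* c)) ≈-refl (fromℕ 3) (fromℕ 2) (fromℕ 3 ⁻¹)) (≈-trans (*-congˡ (*-inv (0<fromℕ 3))) (*-identityʳ _))))
          (lin (*-cancelˡ-≤ {fromℕ 3 * fromℕ m} {fromℕ 3 * e} {1#} (0<-* (0<fromℕ 3) (0<fromℕ m)) (lin le (solve 2 (λ e m → con (+ 3) :* m :- e :* (con (+ 9) :* m) := con (+ 3) :* m :* con (+ 1) :- con (+ 3) :* m :* (con (+ 3) :* e)) ≈-refl e (fromℕ m))))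
            (solve 1 (λ e → con (+ 1) :- con (+ 3) :* e := con (+ 3) :* (con (+ 1) :- e) :- con (+ 2)) ≈-refl e)))
        typical : ∀ bs as D → total-loss (bs , as , D) ≤ 9m → Typical D
        typical bs as D le = bs , as , bound (lin (le ⊕ 0≤-+ (*-nonNeg 0≤m (0≤col as)) (0≤spread bs as D))
              (solve 5 (λ m r c s t → (t :+ (m :* c :+ s)) :- (m :* (r :+ c) :+ s :+ con (+ 0)) := t :- m :* r) ≈-refl (fromℕ m) (rowTotal bs) (colTotal as) (spread bs as D) 9m))
          , bound (lin (le ⊕ 0≤-+ (*-nonNeg 0≤m (0≤row bs)) (0≤spread bs as D))
              (solve 5 (λ m r c s t → (t :+ (m :* r :+ s)) :- (m :* (r :+ c) :+ s :+ con (+ 0)) := t :- m :* c) ≈-refl (fromℕ m) (rowTotal bs) (colTotal as) (spread bs as D) 9m))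
          , lin (le ⊕ *-nonNeg 0≤m (0≤-+ (0≤row bs) (0≤col as)))
              (solve 4 (λ m r s t → (t :+ m :* r) :- (m :* r :+ s :+ con (+ 0)) := t :- s) ≈-refl (fromℕ m) (rowTotal bs + colTotal as) (spread bs as D) 9m)
          where
          bound : ∀ {x} → fromℕ m * x ≤ 9m → x ≤ nine
          bound le′ = *-cancelˡ-≤ (0<fromℕ m) (≤-respʳ-≈ (*-comm _ _) le′)
        pointwise : ∀ z → 1# - atypical z ≤ f (proj₂ (proj₂ z))
        pointwise z@(bs , as , D) with 9m ≤? total-loss z
        ... | yes _ = ≤-trans (≤-reflexive (-‿inverseʳ 1#)) (0≤f D)
        ... | no lt = ≤-trans (≤-reflexive (solve 0 (con (+ 1) :- con (+ 0) := con (+ 1)) ≈-refl)) (hit D (typical bs as D (<⇒≤ (≰⇒< lt))))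

    module _ (μ μ′ : Dist n) (bs bs′ : Vec (Fin n) k) (as as′ : Vec (Str n) k) (D : Vec Obs m)
      (sp : spread μ bs as D ≤ nine μ * fromℕ m) (sp′ : spread μ′ bs′ as′ D ≤ nine μ′ * fromℕ m)
      (γ₀ : ℝ) (0≤γ₀ : 0# ≤ γ₀) (enough : 2^ k * (2^ k * fromℕ 2) * fromℕ 9 ≤ fromℕ m * (γ₀ * γ₀)) where

      -- Both laws are compared with the empirical counts of the shared data. Cauchy-Schwarz over
      -- the 2·4^k possible observations turns `spread` into a bound for bounded tests, γ₀ on either
      -- side.
      observations-close : (F : Obs → ℝ) → (∀ o → F o ⊴ 1#) → 𝔼 (observationLaw μ bs as) F - 𝔼 (observationLaw μ′ bs′ as′) F ⊴ γ₀ + γ₀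
      observations-close F F⊴ = cancel-m (⊴-cong difference (⊴-+ (small (excess μ′ bs′ as′ D) sp′) (⊴-neg (small (excess μ bs as D) sp))))
        where
        M = fromℕ m
        types : ∑ elems (λ _ → 1#) ≈ 2^ k * (2^ k * fromℕ 2)
        types = ≈-trans (∑-× (strings k) _ _) (≈-trans (∫-cong (∑M (strings k)) λ _ → ≈-trans (∑-× (strings k) (false ∷ true ∷ []) _)
            (≈-trans (∫-cong (∑M (strings k)) λ _ → ≈-sym (*-identityˡ (fromℕ 2))) (≈-trans (∫-*ʳ (∑M (strings k)) (fromℕ 2) (λ _ → 1#)) (*-congʳ (∑-strings-1 k)))))
          (≈-trans (∫-cong (∑M (strings k)) λ _ → ≈-sym (*-identityˡ _)) (≈-trans (∫-*ʳ (∑M (strings k)) _ (λ _ → 1#)) (*-congʳ (∑-strings-1 k)))))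
        F² : ∀ o → F o * F o ≤ 1#
        F² o = lin (*-nonNeg (≤⇒0≤ (proj₁ (F⊴ o))) (≤⇒0≤ (proj₂ (F⊴ o)))) (solve 1 (λ f → (con (+ 1) :- f) :* (con (+ 1) :- :- f) :- con (+ 0) := con (+ 1) :- f :* f) ≈-refl (F o))
        small : (x : Obs → ℝ) → ∑ elems (λ o → x o * x o) ≤ fromℕ 9 * M → ∑ elems (λ o → F o * x o) ⊴ M * γ₀
        small x le = ²≤⇒⊴ (*-nonNeg (0≤fromℕ m) 0≤γ₀) (≤-trans (∫-cauchySchwarz (∑M elems) F x)
          (≤-trans (mul-mono (∫-pos (∑M elems) λ o → 0≤x² (F o)) (∫-mono (∑M elems) F²) (*-nonNeg (0≤fromℕ 9) (0≤fromℕ m)) le)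
            (≤-trans (≤-reflexive (≈-trans (*-congʳ types) (solve 3 (λ t n m → t :* (n :* m) := m :* (t :* n)) ≈-refl (2^ k * (2^ k * fromℕ 2)) (fromℕ 9) M)))
              (≤-trans (0≤fromℕ m ⊛ enough) (≤-reflexive (solve 2 (λ m g → m :* (m :* (g :* g)) := m :* g :* (m :* g)) ≈-refl M γ₀))))))
        counts : ℝ
        counts = ∑ elems λ o → F o * sum λ i → ind (lookup D i == o)
        expand : ∀ ν bs as → ∑ elems (λ o → F o * excess ν bs as D o) ≈ counts - M * 𝔼 (observationLaw ν bs as) F
        expand ν bs as = ≈-trans (∫-cong (∑M elems) λ o → ≈-trans (*-congˡ (≈-trans (∫-- (sumM m) _ _) (+-congˡ (-‿cong (sum-const m _)))))
            (solve 4 (λ f s m p → f :* (s :- m :* p) := f :* s :- m :* (p :* f)) ≈-refl (F o) (sum λ i → ind (lookup D i == o)) M (frequency ν bs as o)))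
          (≈-trans (∫-- (∑M elems) _ _) (+-congˡ (-‿cong (≈-trans (∫-* (∑M elems) M _) (*-congˡ (≈-sym (∑-fibres enumObs (observationLaw ν bs as) id F)))))))
        difference : ∑ elems (λ o → F o * excess μ′ bs′ as′ D o) + - ∑ elems (λ o → F o * excess μ bs as D o) ≈ M * (𝔼 (observationLaw μ bs as) F - 𝔼 (observationLaw μ′ bs′ as′) F)
        difference = ≈-trans (+-cong (expand μ′ bs′ as′) (-‿cong (expand μ bs as)))
          (solve 4 (λ c m a b → (c :- m :* b) :+ :- (c :- m :* a) := m :* (a :- b)) ≈-refl counts M (𝔼 (observationLaw μ bs as) F) (𝔼 (observationLaw μ′ bs′ as′) F))
        cancel-m : ∀ {x} → M * x ⊴ M * γ₀ + M * γ₀ → x ⊴ γ₀ + γ₀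
        cancel-m {x} (p , q) = *-cancelˡ-≤ (0<fromℕ m) (≤-respʳ-≈ (≈-sym (distribˡ M γ₀ γ₀)) p)
                             , *-cancelˡ-≤ (0<fromℕ m) (≤-respʳ-≈ (≈-sym (distribˡ M γ₀ γ₀)) (≤-respˡ-≈ (-‿distribʳ-* M x) q))

  -- The analysis uses the parameters only through these inequalities; their values are chosen at
  -- the end. `steps`, `anchors` and `repeats` say how many greedy steps, anchors and observations
  -- are enough, and the last fields balance the probabilities and the cost.
  record Numbers (n s q : ℕ) (ε ε₁ : ℝ) : Set where
    field
      K k m : ℕ
      ζ θ ν γ₀ δ w : ℝ
      0≤ζ  : 0# ≤ ζ
      0≤θ  : 0# ≤ θ
      0≤ν  : 0# ≤ ν
      0≤γ₀ : 0# ≤ γ₀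
      0<δ  : 0# < δ
      0<k  : 0# < fromℕ k
      m≢0  : NonZero m
      steps    : 1# < fromℕ K * (fromℕ 2 * (ζ * ζ * θ))
      anchors  : fromℕ 9 ≤ fromℕ k * ((ν * ν) * (ν * ν))
      repeats  : 2^ k * (2^ k * fromℕ 2) * fromℕ 9 ≤ fromℕ m * (γ₀ * γ₀)
    γ : ℝ
    γ = γ₀ + γ₀
    z : ℝ
    z = (ν + ν) + (γ + γ)
    count : ℝ
    count = fromℕ q * ((ζ + ζ) * (2^ q * θ + (1# + 1#)))
    field
      small     : 4^ K * z + 4^ K * z ≤ ζ * θ
      values    : (count + (fromℕ s * γ + fromℕ q * γ)) + count ≤ w
      collision : fromℕ q * (fromℕ q * fromℕ n ⁻¹) ≤ w
      q≤n       : fromℕ q ≤ fromℕ n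
      deviation : 1# ≤ w * (fromℕ n * (δ * δ))
      w≈        : fromℕ 20 * w ≈ 1#
      slack     : (ζ * θ + ((γ + γ) + (ζ * θ + ζ * (θ + 1#)))) + δ + ε₁ ≤ ε

  module Estimation (𝒫 : Property) (invariant : IndexInvariant 𝒫) {n : ℕ} .{{_ : NonZero n}} {s q : ℕ} {ε ε₁ : ℝ} (numbers : Numbers n s q ε ε₁)
    (t : Algorithm n Bool 0) (tester : IsTester 𝒫 ε₁ n t) (ls : samples t ℕ.≤ s) (lq : queries t ℕ.≤ q) where

    open Numbers numbers
    private instance _ = m≢0

    open Data {n} k m

    0≤w : 0# ≤ w
    0≤w = *-cancelˡ-≤ (0<fromℕ 20) (≤-trans (≤-reflexive (zeroʳ _)) (≤-trans 0≤1 (≤-reflexive (≈-sym w≈))))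

    -- With w = 1/20 the acceptance of the target and the rejection of the lifted distribution force
    -- a′ + b to be at least (1 - w) 2/3 - w + (1 - 2w) 2/3 = 71/60. Multiplied by 60, this exceeds
    -- 60 by the 11 of the final absurdity.
    contradiction′ : ∀ {a b a′ c} → (1# - c) * 2/3 ≤ a → (1# - c) * ((1# - w) * 2/3) ≤ b → 0# ≤ c → c ≤ w → a - a′ ≤ w → a′ + b ≈ 1# → ⊥
    contradiction′ {a} {b} {a′} {c} h₁ h₂ 0≤c cw h₃ e = <⇒≰ (0<fromℕ 11) (lin (0≤fromℕ 60 ⊛ (h₁′ ⊕ (h₂′ ⊕ h₃)))
      arith)
      where
      p = 2/3
      0≤p : 0# ≤ p
      0≤p = *-nonNeg (0≤fromℕ 2) (<⇒≤ (0<⁻¹ (0<fromℕ 3)))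
      3p : fromℕ 3 * p ≈ fromℕ 2
      3p = ≈-trans (solve 3 (λ a b c → a :* (b :* c) := b :* (a :* c)) ≈-refl (fromℕ 3) (fromℕ 2) (fromℕ 3 ⁻¹)) (≈-trans (*-congˡ (*-inv (0<fromℕ 3))) (*-identityʳ _))
      w≤1 : w ≤ 1#
      w≤1 = *-cancelˡ-≤ (0<fromℕ 20) (≤-trans (≤-reflexive w≈) (≤-trans (1≤fromℕ 20) (≤-reflexive (≈-sym (*-identityʳ _)))))
      h₁′ : (1# - w) * p ≤ a
      h₁′ = ≤-trans (lin (0≤p ⊛ cw) (solve 3 (λ p w c → p :* w :- p :* c := (con (+ 1) :- c) :* p :- (con (+ 1) :- w) :* p) ≈-refl p w c)) h₁
      h₂′ : (1# - w - w) * p ≤ b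
      h₂′ = ≤-trans (lin (*-nonNeg 0≤p (≤⇒0≤ cw) ⊕ *-nonNeg 0≤p (*-nonNeg 0≤c 0≤w))
        (solve 3 (λ p w c → (p :* (w :- c) :+ p :* (c :* w)) :- (con (+ 0) :+ con (+ 0)) := (con (+ 1) :- c) :* ((con (+ 1) :- w) :* p) :- (con (+ 1) :- w :- w) :* p) ≈-refl p w c)) h₂
      arith : fromℕ 60 * (a + (b + w)) - fromℕ 60 * ((1# - w) * p + ((1# - w - w) * p + (a - a′))) ≈ 0# - fromℕ 11
      arith = begin
        fromℕ 60 * (a + (b + w)) - fromℕ 60 * ((1# - w) * p + ((1# - w - w) * p + (a - a′)))
          ≈⟨ solve 5 (λ a b a′ p w → con (+ 60) :* (a :+ (b :+ w)) :- con (+ 60) :* ((con (+ 1) :- w) :* p :+ ((con (+ 1) :- w :- w) :* p :+ (a :- a′)))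
               := con (+ 60) :* (a′ :+ b) :+ con (+ 3) :* (con (+ 20) :* w) :- con (+ 40) :* (con (+ 3) :* p) :+ con (+ 3) :* (con (+ 20) :* w) :* (con (+ 3) :* p)) ≈-refl a b a′ p w ⟩
        fromℕ 60 * (a′ + b) + fromℕ 3 * (fromℕ 20 * w) - fromℕ 40 * (fromℕ 3 * p) + fromℕ 3 * (fromℕ 20 * w) * (fromℕ 3 * p)
          ≈⟨ +-cong (+-cong (+-cong (*-congˡ e) (*-congˡ w≈)) (-‿cong (*-congˡ 3p))) (*-cong (*-congˡ w≈) 3p) ⟩
        fromℕ 60 * 1# + fromℕ 3 * 1# - fromℕ 40 * fromℕ 2 + fromℕ 3 * 1# * fromℕ 2
          ≈⟨ solve 0 (con (+ 60) :* con (+ 1) :+ con (+ 3) :* con (+ 1) :- con (+ 40) :* con (+ 2) :+ con (+ 3) :* con (+ 1) :* con (+ 2) := con (+ 0) :- con (+ 11)) ≈-refl ⟩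
        0# - fromℕ 11 ∎
        where open ≈R

    -- The hypotheses are symmetric in μ and μ′, so one inequality is enough. If d′ exceeded d + ε,
    -- `slack` would make μ′ far in the sense of `rejected`, and the tester would have to accept and
    -- to reject with nearly equal values.
    distances-close : ∀ μ μ′ d d′ → IsEMDistanceTo (member 𝒫 n) μ d → IsEMDistanceTo (member 𝒫 n) μ′ d′ → ∀ D → Typical μ D → Typical μ′ D → d′ ≤ d + ε
    distances-close μ μ′ d d′ dist dist′ D (bs , as , row , col , sp) (bs′ , as′ , row′ , col′ , sp′) = from-greedy (L.G.greedy ζ θ 0≤ζ 0≤θ K steps)
      where
      module Red = Reduction 𝒫 invariant μ μ′ d d′ dist dist′
      module L = Lifting μ μ′ Red.T Red.T∼ bs bs′ as as′
      typeClose : L.TypeClose γ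
      typeClose f f⊴ = observations-close μ μ′ bs bs′ as as′ D sp sp′ γ₀ 0≤γ₀ repeats (λ (u , v , b) → f u v b) (λ (u , v , b) → f⊴ u v b)
      from-greedy : (∃ λ (η : Bool → L.Pairs → Fin n → ℝ) → (∀ s r c → 𝕀 (η s r c)) × Σ (Simple K η) λ _ → L.G.Approximates ζ θ 0≤ζ 0≤θ η) → d′ ≤ d + ε
      from-greedy (η , η𝕀 , simple , approximates) = by-cases (≤-or-< d′ (d + ε))
        where
        params : L.Parameters
        params = record
          { ν = ν ; γ = γ ; ζ = ζ ; θ = θ ; K = K ; 0≤ν = 0≤ν ; 0≤γ = 0≤-+ 0≤γ₀ 0≤γ₀ ; 0≤ζ = 0≤ζ ; 0≤θ = 0≤θ ; 0<k = 0<k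
          ; rowTot = ≤-trans row anchors ; colTot = ≤-trans col anchors ; rowTot′ = ≤-trans row′ anchors ; colTot′ = ≤-trans col′ anchors
          ; typeClose = typeClose ; small = small ; η = η ; η𝕀 = η𝕀 ; simple = simple ; approximates = approximates }
        module V = LiftedValues μ μ′ Red.T Red.T∼ bs bs′ as as′ params
        far : d + ε < d′ → ¬ d′ ≤ V.liftedCost + δ + ε₁
        far lt le = <⇒≰ lt (≤-trans le (lin (V.liftedCost-≤ ⊕ Red.transferCost-≤ bs bs′ as as′ params ε₁ t tester s q ls lq q≤n ⊕ slack)
          (solve 7 (λ l tc d δ ε₁ ε B → (B :+ d :+ ε) :- (l :- tc :+ tc :+ (B :+ δ :+ ε₁)) := (d :+ ε) :- (l :+ δ :+ ε₁)) ≈-refl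
            V.liftedCost V.transferCost d δ ε₁ ε (ζ * θ + ((γ + γ) + (ζ * θ + ζ * (θ + 1#)))))))
        by-cases : d′ ≤ d + ε ⊎ d + ε < d′ → d′ ≤ d + ε
        by-cases (inj₁ p) = p
        by-cases (inj₂ p) = ⊥-elim (contradiction′
          (Red.accepted bs bs′ as as′ params ε₁ t tester s q ls lq q≤n)
          (Red.rejected bs bs′ as as′ params ε₁ t tester s q ls lq q≤n δ 0<δ (far p) w (0≤w , w≤1) deviation)
          (*-nonNeg (0≤fromℕ q) (*-nonNeg (0≤fromℕ q) (<⇒≤ (0<⁻¹ (0<fromℕ n))))) collision (≤-trans (proj₁ (V.values-close id t s q ls lq)) values)
          (≈-trans (≈-sym (∫-+ (meas (indep {n = n} λ _ → V.Cols′)) _ _)) (≈-trans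
            (∫-cong (meas (indep {n = n} λ _ → V.Cols′)) λ φ → val-complement V.Rows′ V.κ′ V.κ′𝕀 φ [] [] t) (𝔼-const (indep {n = n} λ _ → V.Cols′) 1#))))
          where
          w≤1 : w ≤ 1#
          w≤1 = *-cancelˡ-≤ (0<fromℕ 20) (≤-trans (≤-reflexive w≈) (≤-trans (1≤fromℕ 20) (≤-reflexive (≈-sym (*-identityʳ _)))))

    Candidate : Vec Obs m → ℝ → Set
    Candidate D d = ∃ λ μ → Typical μ D × IsEMDistanceTo (member 𝒫 n) μ d

    -- Any distance consistent with the data; 0# if there is none.
    guess : Vec Obs m → ℝ
    guess D with em {∃ (Candidate D)}
    ... | yes (d , _) = d
    ... | no  _       = 0#

    guess-close : ∀ μ d → IsEMDistanceTo (member 𝒫 n) μ d → ∀ D → Typical μ D → ∣ guess D - d ∣ ≤ ε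
    guess-close μ d dist D ty with em {∃ (Candidate D)}
    ... | no none = ⊥-elim (none (d , μ , ty , dist))
    ... | yes (d′ , μ′ , ty′ , dist′) = ⊴⇒abs
          ( lin (distances-close μ μ′ d d′ dist dist′ D ty ty′) (solve 3 (λ d d′ e → (d :+ e) :- d′ := e :- (d′ :- d)) ≈-refl d d′ ε)
          , lin (distances-close μ′ μ d′ d dist′ dist D ty′ ty) (solve 3 (λ d d′ e → (d′ :+ e) :- d := e :- :- (d′ :- d)) ≈-refl d d′ ε))

    isEstimator : IsEstimator 𝒫 ε n (Sampling.estimator k m guess)
    isEstimator μ d dist = ≤-trans (typical-likely μ hit (λ D → proj₁ (𝕀-ind _)) likely)
      (≤-reflexive (≈-sym (Sampling.estimator-≈ k (λ d̃ → does (∣ d̃ - d ∣ ≤? ε)) μ m guess)))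
      where
      hit : Vec Obs m → ℝ
      hit D = ind (does (∣ guess D - d ∣ ≤? ε))
      likely : ∀ D → Typical μ D → 1# ≤ hit D
      likely D ty with ∣ guess D - d ∣ ≤? ε
      ... | yes _ = ≤-refl
      ... | no n  = ⊥-elim (n (guess-close μ d dist D ty))

  -- The exponential function

  prefix : (ℕ → ℝ) → ℕ → ℝ
  prefix a zero    = 0#
  prefix a (suc m) = a 0 + prefix (a ∘ suc) m

  ∑-upTo : ∀ m (a : ℕ → ℝ) → ∑ (upTo m) a ≈ prefix a m
  ∑-upTo m a = go m id
    where
    go : ∀ m (f : ℕ → ℕ) → ∑ (List.applyUpTo f m) a ≈ prefix (a ∘ f) m
    go zero f    = ≈-refl
    go (suc m) f = +-congˡ (go m (f ∘ suc))

  prefix-suc : ∀ a m → prefix a (suc m) ≈ prefix a m + a m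
  prefix-suc a zero    = ≈-trans (+-identityʳ _) (≈-sym (+-identityˡ _))
  prefix-suc a (suc m) = ≈-trans (+-congˡ (prefix-suc (a ∘ suc) m)) (≈-sym (+-assoc _ _ _))

  prefix-mono : ∀ a → (∀ i → 0# ≤ a i) → ∀ {m m′} → m ℕ.≤ m′ → prefix a m ≤ prefix a m′
  prefix-mono a pos {zero} {m′} z≤n = 0≤prefix a pos m′
    where
    0≤prefix : ∀ a → (∀ i → 0# ≤ a i) → ∀ m → 0# ≤ prefix a m
    0≤prefix a pos zero    = ≤-refl
    0≤prefix a pos (suc m) = 0≤-+ (pos 0) (0≤prefix (a ∘ suc) (pos ∘ suc) m)
  prefix-mono a pos (s≤s le) = ≤-refl ⊕ prefix-mono (a ∘ suc) (pos ∘ suc) le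

  term-≤-prefix : ∀ a → (∀ i → 0# ≤ a i) → ∀ j → a j ≤ prefix a (suc j)
  term-≤-prefix a pos j = ≤-respʳ-≈ (≈-sym (prefix-suc a j)) (≤-respˡ-≈ (+-identityˡ _) (prefix-mono a pos {0} {j} z≤n ⊕ ≤-refl))

  e : ℝ → ℕ → ℝ
  e x k = x ^ k * fromℕ (k !) ⁻¹

  0<! : ∀ k → 0# < fromℕ (k !)
  0<! zero    = 0<fromℕ 1
  0<! (suc k) = <-≤-trans (0<-* (0<fromℕ (suc k)) (0<! k)) (≤-reflexive (≈-sym (fromℕ-* (suc k) (k !))))

  e-zero : ∀ x → e x 0 ≈ 1#
  e-zero x = ≈-trans (*-congʳ (≈-sym fromℕ-1)) (*-inv (0<fromℕ 1))

  e-suc : ∀ x k → fromℕ (suc k) * e x (suc k) ≈ x * e x k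
  e-suc x k = *-cancel (begin
    f * (l * (x * X * j))   ≈⟨ solve 5 (λ f l x X j → f :* (l :* (x :* X :* j)) := (x :* X) :* ((l :* f) :* j)) ≈-refl f l x X j ⟩
    x * X * ((l * f) * j)   ≈⟨ *-congˡ (≈-trans (*-congʳ (≈-sym (fromℕ-* (suc k) (k !)))) (*-inv (0<! (suc k)))) ⟩
    x * X * 1#              ≈⟨ *-congˡ (≈-sym (*-inv (0<! k))) ⟩
    x * X * (f * i)         ≈⟨ solve 4 (λ f x X i → x :* X :* (f :* i) := f :* (x :* (X :* i))) ≈-refl f x X i ⟩
    f * (x * (X * i))       ∎)
    where
    open ≈R
    X = x ^ k
    f = fromℕ (k !)
    l = fromℕ (suc k)
    i = f ⁻¹
    j = fromℕ (suc k !) ⁻¹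
    *-cancel : ∀ {a b} → f * a ≈ f * b → a ≈ b
    *-cancel p = ≤-antisym (*-cancelˡ-≤ (0<! k) (≤-reflexive p)) (*-cancelˡ-≤ (0<! k) (≤-reflexive (≈-sym p)))

  e-nonNeg : ∀ {x} → 0# ≤ x → ∀ k → 0# ≤ e x k
  e-nonNeg p k = *-nonNeg (power k) (<⇒≤ (0<⁻¹ (0<! k)))
    where
    power : ∀ k → 0# ≤ _ ^ k
    power zero    = 0≤1
    power (suc k) = *-nonNeg p (power k)

  limit-≥ : ∀ {a l c} M → IsLimit a l → (∀ m → M ℕ.≤ m → c ≤ a m) → c ≤ l
  limit-≥ {a} {l} {c} M lim h = ≤-limit 1 λ δ pos → let (N , near) = lim δ pos ; m = M ℕ.⊔ N in
    lin (h m (ℕₚ.m≤m⊔n M N) ⊕ proj₁ (abs⇒⊴ (<⇒≤ (near m (ℕₚ.m≤n⊔m M N)))))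
      (solve 4 (λ a l c d → (a :+ d) :- (c :+ (a :- l)) := (l :+ (con (+ 1) :+ con (+ 0)) :* d) :- c) ≈-refl (a m) l c δ)

  limit-≤ : ∀ {a l c} M → IsLimit a l → (∀ m → M ℕ.≤ m → a m ≤ c) → l ≤ c
  limit-≤ {a} {l} {c} M lim h = ≤-limit 1 λ δ pos → let (N , near) = lim δ pos ; m = M ℕ.⊔ N in
    lin (h m (ℕₚ.m≤m⊔n M N) ⊕ proj₂ (abs⇒⊴ (<⇒≤ (near m (ℕₚ.m≤n⊔m M N)))))
      (solve 4 (λ a l c d → (c :+ d) :- (a :+ :- (a :- l)) := (c :+ (con (+ 1) :+ con (+ 0)) :* d) :- l) ≈-refl (a m) l c δ)

  limit-cong : ∀ {a b l} → (∀ m → a m ≈ b m) → IsLimit a l → IsLimit b l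
  limit-cong {l = l} eq lim δ pos = let (N , near) = lim δ pos in N , λ m le →
    ≤-<-trans (⊴⇒abs (⊴-cong (+-congʳ (eq m)) (abs⇒⊴ ≤-refl))) (near m le)

  exp-prefix : ∀ {x y} → IsExp x y → IsLimit (prefix (e x)) y
  exp-prefix {x} = limit-cong λ m → ∑-upTo m (e x)

  -- From the index l on the terms at least halve, so prefix + 2 · next term decreases.
  halving : ∀ {x} → 0# ≤ x → ∀ l → x + x ≤ fromℕ l → ∀ r → prefix (e x) (r ℕ.+ l) + (e x (r ℕ.+ l) + e x (r ℕ.+ l)) ≤ prefix (e x) l + (e x l + e x l)
  halving p l le zero    = ≤-refl
  halving {x} p l le (suc r) = ≤-trans (≤-trans (≤-reflexive (+-congʳ (prefix-suc (e x) m)))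
      (lin half (solve 3 (λ P a b → a :- (b :+ b) := (P :+ (a :+ a)) :- ((P :+ a) :+ (b :+ b))) ≈-refl (prefix (e x) m) (e x m) (e x (suc m))))) (halving p l le r)
    where
    m = r ℕ.+ l
    half : e x (suc m) + e x (suc m) ≤ e x m
    half = *-cancelˡ-≤ (0<fromℕ (suc m)) (≤-trans (≤-reflexive (≈-trans (distribˡ _ _ _) (≈-trans (+-cong (e-suc x m) (e-suc x m)) (≈-sym (distribʳ _ _ _)))))
      (mul-mono (0≤-+ p p) (≤-trans le (fromℕ-mono (ℕₚ.≤-trans (ℕₚ.m≤n+m l r) (ℕₚ.n≤1+n m)))) (e-nonNeg p m) ≤-refl))

  monotone-limit : ∀ (a : ℕ → ℝ) b → (∀ {m m′} → m ℕ.≤ m′ → a m ≤ a m′) → (∀ m → a m ≤ b) → ∃ λ y → IsLimit a y × a 0 ≤ y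
  monotone-limit a b mono bounded = go (leastUpperBound S (a 0 , 0 , ≈-refl) (b , λ z (m , eq) → ≤-respˡ-≈ (≈-sym eq) (bounded m)))
    where
    S : Pred ℝ 0ℓ
    S z = ∃ λ m → z ≈ a m
    go : (∃ λ u → (∀ x → S x → x ≤ u) × (∀ b → (∀ x → S x → x ≤ b) → u ≤ b)) → ∃ λ y → IsLimit a y × a 0 ≤ y
    go (y , upper , least) = y , converges , upper (a 0) (0 , ≈-refl)
      where
      strict : ∀ {δ z} → z ≤ y → y - δ < z → ∣ z - y ∣ < δ
      strict {δ} {z} q r = ≤-<-trans (⊴⇒abs {b = y - z} (lin (q ⊕ q) (solve 2 (λ z y → (y :+ y) :- (z :+ z) := (y :- z) :- (z :- y)) ≈-refl z y) , ≤-reflexive (solve 2 (λ z y → :- (z :- y) := y :- z) ≈-refl z y)))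
        (≰⇒< λ s → <⇒≰ r (lin s (solve 3 (λ z y d → (y :- z) :- d := (y :- d) :- z) ≈-refl z y δ)))
      converges : IsLimit a y
      converges δ pos = cases em
        where
        cases : Dec (∃ λ N → y - δ < a N) → ∃ λ N → ∀ m → N ℕ.≤ m → ∣ a m - y ∣ < δ
        cases (yes (N , lt)) = N , λ m le → strict (upper (a m) (m , ≈-refl)) (<-≤-trans lt (mono le))
        cases (no none) = ⊥-elim (<⇒≰ pos (lin (least (y - δ) (λ z (m , eq) → ≤-respˡ-≈ (≈-sym eq) (not< m (≤-or-< (a m) (y - δ))))) (solve 2 (λ y d → (y :- d) :- y := con (+ 0) :- d) ≈-refl y δ)))
          where
          not< : ∀ m → a m ≤ y - δ ⊎ y - δ < a m → a m ≤ y - δ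
          not< m (inj₁ q) = q
          not< m (inj₂ q) = ⊥-elim (none (m , q))

  exp-exists : ∀ {x} → 0# ≤ x → ∃ λ y → IsExp x y × 0# ≤ y
  exp-exists {x} p = finish (monotone-limit (prefix (e x)) bnd (prefix-mono (e x) pos) bounded)
    where
    l = proj₁ (archimedean (x + x))
    bnd = prefix (e x) l + (e x l + e x l)
    pos = e-nonNeg p
    bounded : ∀ m → prefix (e x) m ≤ bnd
    bounded m = ≤-trans (prefix-mono (e x) pos (ℕₚ.m≤m+n m l)) (≤-trans (≤-respˡ-≈ (+-identityʳ _) (≤-refl ⊕ 0≤-+ (pos (m ℕ.+ l)) (pos (m ℕ.+ l)))) (halving p l (proj₂ (archimedean (x + x))) m))
    finish : (∃ λ y → IsLimit (prefix (e x)) y × 0# ≤ y) → ∃ λ y → IsExp x y × 0# ≤ y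
    finish (y , lim , 0≤y) = y , limit-cong (λ m → ≈-sym (∑-upTo m (e x))) lim , 0≤y

  exp-≥-prefix : ∀ {x y} → 0# ≤ x → IsExp x y → ∀ m → prefix (e x) m ≤ y
  exp-≥-prefix {x} p ex m = limit-≥ m (exp-prefix ex) λ m′ le → prefix-mono (e x) (e-nonNeg p) le

  -- While i < j, the ratio x/(i + 1) of consecutive terms is at least 2; so the single term of
  -- index j already reaches 2^j.
  e-≥-2^ : ∀ {x} j → fromℕ 2 * fromℕ j ≤ x → ∀ i → i ℕ.≤ j → 2^ i ≤ e x i
  e-≥-2^ {x} j le zero _ = ≤-reflexive (≈-sym (e-zero x))
  e-≥-2^ {x} j le (suc i) i<j = *-cancelˡ-≤ (0<fromℕ (suc i)) (≤-trans (≤-trans (≤-reflexive (solve 3 (λ l t p → l :* (t :* p) := (t :* l) :* p) ≈-refl (fromℕ (suc i)) (fromℕ 2) (2^ i)))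
    (mul-mono (*-nonNeg (0≤fromℕ 2) (0≤fromℕ (suc i))) (≤-trans (0≤fromℕ 2 ⊛ fromℕ-mono i<j) le) (≤-trans (0≤2^ i) ih) ih)) (≤-reflexive (≈-sym (e-suc x i))))
    where ih = e-≥-2^ j le i (ℕₚ.≤-trans (ℕₚ.n≤1+n i) i<j)

  exp-≥-2^ : ∀ {x y} j → fromℕ 2 * fromℕ j ≤ x → IsExp x y → 2^ j ≤ y
  exp-≥-2^ {x} j le ex = ≤-trans (e-≥-2^ j le j ℕₚ.≤-refl) (≤-trans (term-≤-prefix (e x) (e-nonNeg 0≤x) j) (exp-≥-prefix 0≤x ex (suc j)))
    where 0≤x = ≤-trans (*-nonNeg (0≤fromℕ 2) (0≤fromℕ j)) le

  exp-≥-x : ∀ {x y} → 0# ≤ x → IsExp x y → x ≤ y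
  exp-≥-x {x} p ex = ≤-trans (≤-reflexive (≈-sym e₁)) (≤-trans (term-≤-prefix (e x) (e-nonNeg p) 1) (exp-≥-prefix p ex 2))
    where
    e₁ : e x 1 ≈ x
    e₁ = ≈-trans (≈-sym (≈-trans (*-congʳ fromℕ-1) (*-identityˡ _))) (≈-trans (e-suc x 0) (≈-trans (*-congˡ (e-zero x)) (*-identityʳ x)))

  conv : (ℕ → ℝ) → (ℕ → ℝ) → ℕ → ℝ
  conv a b zero    = a 0 * b 0
  conv a b (suc m) = a 0 * b (suc m) + conv (a ∘ suc) b m

  -- The sum of a i * b j over i + j < m, a partial sum of the Cauchy product, arranged by rows so
  -- that `prefix b` appears.
  triangle : (ℕ → ℝ) → (ℕ → ℝ) → ℕ → ℝ
  triangle a b zero    = 0#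
  triangle a b (suc m) = a 0 * prefix b (suc m) + triangle (a ∘ suc) b m

  triangle-suc : ∀ a b m → triangle a b (suc m) ≈ triangle a b m + conv a b m
  triangle-suc a b zero = solve 2 (λ a b → a :* (b :+ con (+ 0)) :+ con (+ 0) := con (+ 0) :+ a :* b) ≈-refl (a 0) (b 0)
  triangle-suc a b (suc m) = ≈-trans (+-cong (*-congˡ (prefix-suc b (suc m))) (triangle-suc (a ∘ suc) b m))
    (solve 5 (λ a p b t c → a :* (p :+ b) :+ (t :+ c) := (a :* p :+ t) :+ (a :* b :+ c)) ≈-refl (a 0) (prefix b (suc m)) (b (suc m)) (triangle (a ∘ suc) b m) (conv (a ∘ suc) b m))

  conv-cong : ∀ {a a′ b b′} → (∀ i → a i ≈ a′ i) → (∀ i → b i ≈ b′ i) → ∀ m → conv a b m ≈ conv a′ b′ m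
  conv-cong p q zero    = *-cong (p 0) (q 0)
  conv-cong p q (suc m) = +-cong (*-cong (p 0) (q (suc m))) (conv-cong (p ∘ suc) q m)

  conv-+ : ∀ a a′ b m → conv (λ i → a i + a′ i) b m ≈ conv a b m + conv a′ b m
  conv-+ a a′ b zero    = distribʳ _ _ _
  conv-+ a a′ b (suc m) = ≈-trans (+-cong (distribʳ _ _ _) (conv-+ (a ∘ suc) (a′ ∘ suc) b m))
    (solve 4 (λ a b c d → (a :+ b) :+ (c :+ d) := (a :+ c) :+ (b :+ d)) ≈-refl (a 0 * b (suc m)) (a′ 0 * b (suc m)) (conv (a ∘ suc) b m) (conv (a′ ∘ suc) b m))

  conv-*ˡ : ∀ t a b m → conv (λ i → t * a i) b m ≈ t * conv a b m
  conv-*ˡ t a b zero    = *-assoc _ _ _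
  conv-*ˡ t a b (suc m) = ≈-trans (+-cong (*-assoc _ _ _) (conv-*ˡ t (a ∘ suc) b m)) (≈-sym (distribˡ _ _ _))

  conv-*ʳ : ∀ t a b m → conv a (λ i → t * b i) m ≈ t * conv a b m
  conv-*ʳ t a b zero    = solve 3 (λ a t b → a :* (t :* b) := t :* (a :* b)) ≈-refl (a 0) t (b 0)
  conv-*ʳ t a b (suc m) = ≈-trans (+-cong (solve 3 (λ a t b → a :* (t :* b) := t :* (a :* b)) ≈-refl (a 0) t (b (suc m))) (conv-*ʳ t (a ∘ suc) b m)) (≈-sym (distribˡ _ _ _))

  derivative : (ℕ → ℝ) → ℕ → ℝ
  derivative a i = fromℕ (suc i) * a (suc i)

  leibniz : ∀ m a b → fromℕ (suc m) * conv a b (suc m) ≈ conv (derivative a) b m + conv a (derivative b) m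
  leibniz zero a b = solve 4 (λ a₀ a₁ b₀ b₁ → (con (+ 1) :+ con (+ 0)) :* (a₀ :* b₁ :+ a₁ :* b₀) := ((con (+ 1) :+ con (+ 0)) :* a₁) :* b₀ :+ a₀ :* ((con (+ 1) :+ con (+ 0)) :* b₁)) ≈-refl (a 0) (a 1) (b 0) (b 1)
  leibniz (suc m) a b = begin
    (1# + l) * (a 0 * b₂ + (a 1 * b₁ + R₂))
      ≈⟨ solve 6 (λ l a b₂ a₁ b₁ R₂ → (con (+ 1) :+ l) :* (a :* b₂ :+ (a₁ :* b₁ :+ R₂)) := (con (+ 1) :+ l) :* (a :* b₂) :+ (l :* (a₁ :* b₁ :+ R₂) :+ (a₁ :* b₁ :+ R₂))) ≈-refl l (a 0) b₂ (a 1) b₁ R₂ ⟩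
    (1# + l) * (a 0 * b₂) + (l * (a 1 * b₁ + R₂) + (a 1 * b₁ + R₂))
      ≈⟨ +-congˡ (+-congʳ (leibniz m (a ∘ suc) b)) ⟩
    (1# + l) * (a 0 * b₂) + ((conv (derivative (a ∘ suc)) b m + conv (a ∘ suc) (derivative b) m) + (a 1 * b₁ + R₂))
      ≈⟨ solve 8 (λ l a b₂ a₁ b₁ R₂ D E → (con (+ 1) :+ l) :* (a :* b₂) :+ ((D :+ E) :+ (a₁ :* b₁ :+ R₂)) := ((con (+ 1) :+ con (+ 0)) :* a₁ :* b₁ :+ (D :+ R₂)) :+ (a :* ((con (+ 1) :+ l) :* b₂) :+ E)) ≈-refl l (a 0) b₂ (a 1) b₁ R₂ (conv (derivative (a ∘ suc)) b m) (conv (a ∘ suc) (derivative b) m) ⟩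
    (fromℕ 1 * a 1 * b₁ + (conv (derivative (a ∘ suc)) b m + R₂)) + (a 0 * ((1# + l) * b₂) + conv (a ∘ suc) (derivative b) m)
      ≈⟨ +-congʳ (+-congˡ (≈-sym (≈-trans (conv-cong (λ i → solve 2 (λ l x → (con (+ 1) :+ l) :* x := l :* x :+ x) ≈-refl (fromℕ (suc i)) (a (suc (suc i)))) (λ _ → ≈-refl) m) (conv-+ (derivative (a ∘ suc)) (λ i → a (suc (suc i))) b m)))) ⟩
    conv (derivative a) b (suc m) + conv a (derivative b) (suc m) ∎
    where
    open ≈R
    l = fromℕ (suc m)
    b₁ = b (suc m)
    b₂ = b (suc (suc m))
    R₂ = conv (λ i → a (suc (suc i))) b m

  -- The formal identity exp t · exp (-t) = 1: by `leibniz` the derivative of the product series is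
  -- t - t = 0 times the series, so all coefficients of positive index vanish.
  triangle-exp : ∀ t m → triangle (e t) (e (- t)) (suc m) ≈ 1#
  triangle-exp t zero    = ≈-trans (triangle-suc (e t) (e (- t)) 0) (≈-trans (+-identityˡ _) (≈-trans (*-cong (e-zero t) (e-zero (- t))) (*-identityˡ 1#)))
  triangle-exp t (suc m) = ≈-trans (triangle-suc (e t) (e (- t)) (suc m)) (≈-trans (+-cong (triangle-exp t m) vanish) (+-identityʳ 1#))
    where
    c = conv (e t) (e (- t))
    vanish : c (suc m) ≈ 0#
    vanish = ≤-antisym (*-cancelˡ-≤ (0<fromℕ (suc m)) (≤-reflexive z)) (*-cancelˡ-≤ (0<fromℕ (suc m)) (≤-reflexive (≈-sym z)))
      where
      z : fromℕ (suc m) * c (suc m) ≈ fromℕ (suc m) * 0#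
      z = ≈-trans (leibniz m (e t) (e (- t))) (≈-trans
        (+-cong (≈-trans (conv-cong (e-suc t) (λ _ → ≈-refl) m) (conv-*ˡ t (e t) (e (- t)) m)) (≈-trans (conv-cong (λ _ → ≈-refl) (e-suc (- t)) m) (conv-*ʳ (- t) (e t) (e (- t)) m)))
        (solve 3 (λ t c l → t :* c :+ :- t :* c := l :* con (+ 0)) ≈-refl t (c m) (fromℕ (suc m))))

  -- The first `r` rows of the triangle have at least `N` terms of `b`, so their inner sums are at
  -- least `c`. The last `N` rows only have the lower bound -L, but their coefficients lie in the
  -- tail of `a`.
  triangle-lower : ∀ N c L b → (∀ i → - L ≤ prefix b i) → (∀ i → N ℕ.≤ i → c ≤ prefix b i) → ∀ r a → (∀ i → 0# ≤ a i) →
    c * prefix a r - L * (prefix a (r ℕ.+ N) - prefix a r) ≤ triangle a b (r ℕ.+ N)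
  triangle-lower N c L b low high zero a pos = ≤-trans (≤-reflexive (solve 3 (λ c L p → c :* con (+ 0) :- L :* (p :- con (+ 0)) := :- L :* p) ≈-refl c L (prefix a N))) (all N a pos)
    where
    all : ∀ m a → (∀ i → 0# ≤ a i) → - L * prefix a m ≤ triangle a b m
    all zero a pos    = ≤-reflexive (zeroʳ _)
    all (suc m) a pos = ≤-respˡ-≈ (≈-sym (distribˡ _ _ _)) (≤-respˡ-≈ (*-comm _ _) (pos 0 ⊛ low (suc m)) ⊕ all m (a ∘ suc) (pos ∘ suc))
  triangle-lower N c L b low high (suc r) a pos = ≤-trans
    (≤-reflexive (solve 5 (λ c L a p q → c :* (a :+ p) :- L :* ((a :+ q) :- (a :+ p)) := a :* c :+ (c :* p :- L :* (q :- p))) ≈-refl c L (a 0) (prefix (a ∘ suc) r) (prefix (a ∘ suc) (r ℕ.+ N))))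
    (pos 0 ⊛ high (suc (r ℕ.+ N)) (ℕₚ.≤-trans (ℕₚ.m≤n+m N r) (ℕₚ.n≤1+n _)) ⊕ triangle-lower N c L b low high r (a ∘ suc) (pos ∘ suc))

  -- `IsExp₂` asks for some logarithm of 2, whose sign has to be determined. If exp (-t) were 2, the
  -- Cauchy product of the two series would be close to 2 exp t, at least 2, but it is 1. With two
  -- errors of 1/4 the contradiction reads 1 ≤ 1/2.
  exp-neg≢2 : ∀ t → 0# ≤ t → ¬ IsExp (- t) (fromℕ 2)
  exp-neg≢2 t p ex = <⇒≰ (0<fromℕ 2) (lin (0≤fromℕ 4 ⊛ ≤-trans key (≤-refl ⊕ yη≤h)) (≈-trans
    (solve 1 (λ h → con (+ 4) :* (h :+ h) :- con (+ 4) :* con (+ 1) := con (+ 2) :* (con (+ 4) :* h) :- con (+ 4)) ≈-refl h)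
    (≈-trans (+-congʳ (*-congˡ (*-inv (0<fromℕ 4)))) (solve 0 (con (+ 2) :* con (+ 1) :- con (+ 4) := con (+ 0) :- con (+ 2)) ≈-refl))))
    where
    h = fromℕ 4 ⁻¹
    0<h : 0# < h
    0<h = 0<⁻¹ (0<fromℕ 4)
    pos = e-nonNeg p
    ey = exp-exists p
    y = proj₁ ey
    0≤y = proj₂ (proj₂ ey)
    c = fromℕ 2 - h
    0≤c : 0# ≤ c
    0≤c = ≤⇒0≤ (*-cancelˡ-≤ (0<fromℕ 4) (≤-trans (≤-reflexive (*-inv (0<fromℕ 4))) (≤-trans (1≤fromℕ 8) (≤-reflexive (fromℕ-* 4 2)))))
    near = exp-prefix ex h 0<h
    N = suc (proj₁ near)
    high : ∀ i → N ℕ.≤ i → c ≤ prefix (e (- t)) i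
    high i le = lin (proj₂ (abs⇒⊴ (<⇒≤ (proj₂ near i (ℕₚ.≤-trans (ℕₚ.n≤1+n (proj₁ near)) le))))) (solve 3 (λ a h t → h :- :- (a :- t) := a :- (t :- h)) ≈-refl (prefix (e (- t)) i) h (fromℕ 2))
    bounds : ∀ a b → (∀ i → - a i ≤ b i) → ∀ m → - prefix a m ≤ prefix b m
    bounds a b q zero    = ≤-reflexive -0#≈0#
    bounds a b q (suc m) = ≤-respˡ-≈ (-‿+-comm _ _) (q 0 ⊕ bounds (a ∘ suc) (b ∘ suc) (q ∘ suc) m)
    powers : ∀ i → 0# ≤ t ^ i + (- t) ^ i × 0# ≤ t ^ i - (- t) ^ i
    powers zero    = 0≤-+ 0≤1 0≤1 , ≤-reflexive (≈-sym (-‿inverseʳ 1#))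
    powers (suc i) = ≤-respʳ-≈ (solve 3 (λ t a b → t :* (a :- b) := t :* a :+ :- t :* b) ≈-refl t (t ^ i) ((- t) ^ i)) (*-nonNeg p (proj₂ (powers i)))
                   , ≤-respʳ-≈ (solve 3 (λ t a b → t :* (a :+ b) := t :* a :- :- t :* b) ≈-refl t (t ^ i) ((- t) ^ i)) (*-nonNeg p (proj₁ (powers i)))
    low : ∀ i → - y ≤ prefix (e (- t)) i
    low i = ≤-trans (neg-mono (exp-≥-prefix p (proj₁ (proj₂ ey)) i)) (bounds (e t) (e (- t)) (λ k →
      lin (*-nonNeg (<⇒≤ (0<⁻¹ (0<! k))) (proj₁ (powers k))) (solve 3 (λ i a b → i :* (a :+ b) :- con (+ 0) := b :* i :- :- (a :* i)) ≈-refl (fromℕ (k !) ⁻¹) (t ^ k) ((- t) ^ k))) i)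
    -- y times the tail of the series for exp t is at most 1/4.
    η = h * (y + 1#) ⁻¹
    0<y+1 : 0# < y + 1#
    0<y+1 = <-≤-trans 0<1 (≤-respˡ-≈ (+-identityˡ 1#) (0≤y ⊕ ≤-refl))
    tail = exp-prefix (proj₁ (proj₂ ey)) η (0<-* 0<h (0<⁻¹ 0<y+1))
    r = suc (proj₁ tail)
    one : 1# ≤ prefix (e t) r
    one = ≤-trans (≤-reflexive (≈-sym (e-zero t))) (≤-trans (term-≤-prefix (e t) pos 0) (prefix-mono (e t) pos {1} {r} (s≤s z≤n)))
    small : prefix (e t) (r ℕ.+ N) - prefix (e t) r ≤ η
    small = lin (exp-≥-prefix p (proj₁ (proj₂ ey)) (r ℕ.+ N) ⊕ proj₂ (abs⇒⊴ (<⇒≤ (proj₂ tail r (ℕₚ.n≤1+n (proj₁ tail))))))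
      (solve 4 (λ y η a b → (y :+ η) :- (a :+ :- (b :- y)) := η :- (a :- b)) ≈-refl y η (prefix (e t) (r ℕ.+ N)) (prefix (e t) r))
    triangle-≈ : ∀ r → triangle (e t) (e (- t)) (r ℕ.+ N) ≈ 1#
    triangle-≈ r = ≡.subst (λ m → triangle (e t) (e (- t)) m ≈ 1#) (≡.sym (ℕₚ.+-suc r (proj₁ near))) (triangle-exp t (r ℕ.+ proj₁ near))
    key : 1# ≤ h + y * η
    key = lin (≤-trans (triangle-lower N c y (e (- t)) low high r (e t) pos) (≤-reflexive (triangle-≈ r)) ⊕ (0≤c ⊛ one ⊕ 0≤y ⊛ small))
      (solve 5 (λ h p y d z → (con (+ 1) :+ ((con (+ 2) :- h) :* p :+ y :* z)) :- ((con (+ 2) :- h) :* p :- y :* d :+ ((con (+ 2) :- h) :* con (+ 1) :+ y :* d)) := (h :+ y :* z) :- con (+ 1))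
        ≈-refl h (prefix (e t) r) y (prefix (e t) (r ℕ.+ N) - prefix (e t) r) η)
    yη≤h : y * η ≤ h
    yη≤h = ≤-trans (≤-reflexive (solve 3 (λ y h i → y :* (h :* i) := h :* (y :* i)) ≈-refl y h ((y + 1#) ⁻¹))) (≤-trans
      (<⇒≤ 0<h ⊛ mul-mono 0≤y (≤-respˡ-≈ (+-identityʳ y) (≤-refl ⊕ 0≤1)) (<⇒≤ (0<⁻¹ 0<y+1)) ≤-refl)
      (≤-reflexive (≈-trans (*-congˡ (*-inv 0<y+1)) (*-identityʳ h))))

  -- A negative logarithm is excluded by `exp-neg≢2`. For 0 ≤ x < 1/2 the terms at least halve from
  -- index 1 on, so the series is at most 1 + 2x, which has to reach 2.
  ln2-≥-half : ∀ {x} → IsExp x (fromℕ 2) → 1# ≤ x + x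
  ln2-≥-half {x} ex with ≤-or-< 1# (x + x)
  ... | inj₁ p = p
  ... | inj₂ small = ⊥-elim (<⇒≰ small (by-sign (≤-total 0# x)))
    where
    by-sign : 0# ≤ x ⊎ x ≤ 0# → 1# ≤ x + x
    by-sign (inj₂ n) = ⊥-elim (exp-neg≢2 (- x) (0≤-neg n) (λ δ pos → let (N , near) = ex δ pos in N , λ m le → ≤-<-trans (⊴⇒abs (⊴-cong (+-congʳ (∫-cong (∑M (upTo m)) λ k → *-congʳ (pow k))) (abs⇒⊴ ≤-refl))) (near m le)))
      where
      pow : ∀ k → x ^ k ≈ (- - x) ^ k
      pow zero    = ≈-refl
      pow (suc k) = *-cong (≈-sym (-‿involutive x)) (pow k)
    by-sign (inj₁ p) = lin upper (≈-trans (+-congʳ (+-cong (+-cong (e-zero x) ≈-refl) (+-cong e₁ e₁)))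
        (solve 1 (λ x → con (+ 1) :+ con (+ 0) :+ (x :+ x) :- con (+ 2) := (x :+ x) :- con (+ 1)) ≈-refl x))
      where
      e₁ : e x 1 ≈ x
      e₁ = ≈-trans (≈-sym (≈-trans (*-congʳ fromℕ-1) (*-identityˡ _))) (≈-trans (e-suc x 0) (≈-trans (*-congˡ (e-zero x)) (*-identityʳ x)))
      upper : fromℕ 2 ≤ prefix (e x) 1 + (e x 1 + e x 1)
      upper = limit-≤ 1 (exp-prefix ex) λ { (suc m) _ → ≤-trans (≤-respˡ-≈ (+-identityʳ _) (≤-refl ⊕ 0≤-+ (e-nonNeg p (suc m)) (e-nonNeg p (suc m))))
        (≡.subst (λ l → prefix (e x) l + (e x l + e x l) ≤ prefix (e x) 1 + (e x 1 + e x 1)) (ℕₚ.+-comm m 1) (halving p 1 (≤-trans (<⇒≤ small) (≤-reflexive (≈-sym fromℕ-1))) m)) }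

  -- Combines exp u ≥ u with ln 2 ≥ 1/2.
  exp₂-≥ : ∀ {x y} → 0# ≤ x → IsExp₂ x y → x ≤ y + y
  exp₂-≥ {x} {y} p (ln2 , e₂ , ex) = ≤-trans (≤-respˡ-≈ (*-identityʳ x) (p ⊛ half)) (≤-trans (≤-reflexive (distribˡ x ln2 ln2)) (up ⊕ up))
    where
    half = ln2-≥-half e₂
    0≤ln2 : 0# ≤ ln2
    0≤ln2 = *-cancelˡ-≤ (0<fromℕ 2) (lin (≤-trans 0≤1 half) (solve 1 (λ l → l :+ l :- con (+ 0) := con (+ 2) :* l :- con (+ 2) :* con (+ 0)) ≈-refl ln2))
    up = exp-≥-x (*-nonNeg p 0≤ln2) ex

  -- Choice of the parameters

  module ℕSolver = Data.Nat.Solver.+-*-Solver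

  n≤2^n : ∀ n → n ℕ.≤ 2 ℕ.^ n
  n≤2^n zero    = z≤n
  n≤2^n (suc n) = ℕₚ.≤-trans (ℕₚ.+-mono-≤ (1≤ n) (n≤2^n n)) (ℕₚ.≤-reflexive (≡.cong (2 ℕ.^ n ℕ.+_) (≡.sym (ℕₚ.+-identityʳ (2 ℕ.^ n)))))
    where
    1≤ : ∀ n → 1 ℕ.≤ 2 ℕ.^ n
    1≤ n = ℕₚ.^-monoʳ-≤ 2 {0} {n} z≤n

  2^-* : ∀ {a b} i j → a ℕ.≤ 2 ℕ.^ i → b ℕ.≤ 2 ℕ.^ j → a ℕ.* b ℕ.≤ 2 ℕ.^ (i ℕ.+ j)
  2^-* i j p q = ℕₚ.≤-trans (ℕₚ.*-mono-≤ p q) (ℕₚ.≤-reflexive (≡.sym (ℕₚ.^-distribˡ-+-* 2 i j)))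

  4^≤ : ∀ i → 4 ℕ.^ i ℕ.≤ 2 ℕ.^ (2 ℕ.* i)
  4^≤ i = ℕₚ.≤-reflexive (ℕₚ.^-*-assoc 2 2 i)

  -- `Y` and `k` are 2^O(K), and `m` is 2^O(k), so the product is doubly exponential in `K`. The
  -- hypothesis 7 ≤ K absorbs the additive constants into the multiple 22K.
  query-bound : ∀ {Z P K Y k m} → Z ℕ.≤ K → P ℕ.≤ K → 7 ℕ.≤ K → 1 ℕ.≤ Y → Y ≡ 12 ℕ.* 4 ℕ.^ K ℕ.* (Z ℕ.* P) → k ≡ 9 ℕ.* (Y ℕ.* Y ℕ.* (Y ℕ.* Y)) →
    m ≡ 18 ℕ.* 4 ℕ.^ k ℕ.* (Y ℕ.* Y) → m ℕ.* (k ℕ.+ (k ℕ.+ 1)) ℕ.≤ 2 ℕ.^ (2 ℕ.^ (22 ℕ.* K))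
  query-bound {Z} {P} {K} {Y} {k} {m} Z≤K P≤K 7≤K 1≤Y refl k≡ m≡ = ℕₚ.≤-trans product-≤ (ℕₚ.^-monoʳ-≤ 2 exponent)
    where
    open ℕSolver using () renaming (solve to solveℕ; con to lit; _:+_ to _⊞_; _:*_ to _⊠_; _:=_ to _≐_)
    Y≤ : Y ℕ.≤ 2 ℕ.^ (5 ℕ.* K)
    Y≤ = ℕₚ.≤-trans (2^-* (4 ℕ.+ 2 ℕ.* K) (K ℕ.+ K) (2^-* 4 (2 ℕ.* K) (ℕₚ.m≤m+n 12 4) (4^≤ K))
        (2^-* K K (ℕₚ.≤-trans Z≤K (n≤2^n K)) (ℕₚ.≤-trans P≤K (n≤2^n K))))
      (ℕₚ.^-monoʳ-≤ 2 (ℕₚ.≤-trans (ℕₚ.+-monoˡ-≤ (K ℕ.+ K) (ℕₚ.+-monoˡ-≤ (2 ℕ.* K) (ℕₚ.≤-trans (ℕₚ.m≤m+n 4 3) 7≤K)))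
        (ℕₚ.≤-reflexive (solveℕ 1 (λ K → K ⊞ lit 2 ⊠ K ⊞ (K ⊞ K) ≐ lit 5 ⊠ K) refl K))))
    Y⁴≤ : Y ℕ.* Y ℕ.* (Y ℕ.* Y) ℕ.≤ 2 ℕ.^ (20 ℕ.* K)
    Y⁴≤ = ℕₚ.≤-trans (2^-* (5 ℕ.* K ℕ.+ 5 ℕ.* K) (5 ℕ.* K ℕ.+ 5 ℕ.* K) (2^-* (5 ℕ.* K) (5 ℕ.* K) Y≤ Y≤) (2^-* (5 ℕ.* K) (5 ℕ.* K) Y≤ Y≤))
      (ℕₚ.≤-reflexive (≡.cong (2 ℕ.^_) (solveℕ 1 (λ K → lit 5 ⊠ K ⊞ lit 5 ⊠ K ⊞ (lit 5 ⊠ K ⊞ lit 5 ⊠ K) ≐ lit 20 ⊠ K) refl K)))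
    k≤ : k ℕ.≤ 2 ℕ.^ (4 ℕ.+ 20 ℕ.* K)
    k≤ = ℕₚ.≤-trans (ℕₚ.≤-reflexive k≡) (2^-* 4 (20 ℕ.* K) (ℕₚ.m≤m+n 9 7) Y⁴≤)
    9≤k : 9 ℕ.≤ k
    9≤k = ℕₚ.≤-trans (ℕₚ.*-monoʳ-≤ 9 (ℕₚ.*-mono-≤ (ℕₚ.*-mono-≤ 1≤Y 1≤Y) (ℕₚ.*-mono-≤ 1≤Y 1≤Y))) (ℕₚ.≤-reflexive (≡.sym k≡))
    YY≤k : Y ℕ.* Y ℕ.≤ 2 ℕ.^ k
    YY≤k = ℕₚ.≤-trans (ℕₚ.≤-trans (ℕₚ.≤-trans (ℕₚ.≤-reflexive (≡.sym (ℕₚ.*-identityʳ (Y ℕ.* Y)))) (ℕₚ.*-monoʳ-≤ (Y ℕ.* Y) (ℕₚ.*-mono-≤ 1≤Y 1≤Y)))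
      (ℕₚ.≤-trans (ℕₚ.m≤m+n (Y ℕ.* Y ℕ.* (Y ℕ.* Y)) (8 ℕ.* (Y ℕ.* Y ℕ.* (Y ℕ.* Y)))) (ℕₚ.≤-reflexive (≡.sym k≡)))) (n≤2^n k)
    m≤ : m ℕ.≤ 2 ℕ.^ (5 ℕ.+ 2 ℕ.* k ℕ.+ k)
    m≤ = ℕₚ.≤-trans (ℕₚ.≤-reflexive m≡) (2^-* (5 ℕ.+ 2 ℕ.* k) k (2^-* 5 (2 ℕ.* k) (ℕₚ.m≤m+n 18 14) (4^≤ k)) YY≤k)
    2k+1≤ : k ℕ.+ (k ℕ.+ 1) ℕ.≤ 2 ℕ.^ (2 ℕ.+ k)
    2k+1≤ = ℕₚ.≤-trans (ℕₚ.≤-trans (ℕₚ.+-monoʳ-≤ k (ℕₚ.+-monoʳ-≤ k (ℕₚ.≤-trans (ℕₚ.m≤m+n 1 8) 9≤k)))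
        (ℕₚ.≤-trans (ℕₚ.m≤m+n (k ℕ.+ (k ℕ.+ k)) k) (ℕₚ.≤-reflexive (solveℕ 1 (λ k → k ⊞ (k ⊞ k) ⊞ k ≐ lit 4 ⊠ k) refl k))))
      (2^-* {4} {k} 2 k (ℕₚ.≤-refl) (n≤2^n k))
    product-≤ : m ℕ.* (k ℕ.+ (k ℕ.+ 1)) ℕ.≤ 2 ℕ.^ (5 ℕ.+ 2 ℕ.* k ℕ.+ k ℕ.+ (2 ℕ.+ k))
    product-≤ = 2^-* (5 ℕ.+ 2 ℕ.* k ℕ.+ k) (2 ℕ.+ k) m≤ 2k+1≤
    exponent : 5 ℕ.+ 2 ℕ.* k ℕ.+ k ℕ.+ (2 ℕ.+ k) ℕ.≤ 2 ℕ.^ (22 ℕ.* K)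
    exponent = ℕₚ.≤-trans (ℕₚ.≤-reflexive (solveℕ 1 (λ k → lit 5 ⊞ lit 2 ⊠ k ⊞ k ⊞ (lit 2 ⊞ k) ≐ lit 7 ⊞ lit 4 ⊠ k) refl k))
      (ℕₚ.≤-trans (ℕₚ.+-monoˡ-≤ (4 ℕ.* k) (ℕₚ.≤-trans (ℕₚ.m≤m+n 7 2) (ℕₚ.≤-trans 9≤k (ℕₚ.m≤m+n k (3 ℕ.* k)))))
      (ℕₚ.≤-trans (ℕₚ.≤-reflexive (solveℕ 1 (λ k → lit 4 ⊠ k ⊞ lit 4 ⊠ k ≐ lit 8 ⊠ k) refl k))
      (ℕₚ.≤-trans (2^-* 3 (4 ℕ.+ 20 ℕ.* K) (ℕₚ.≤-refl) k≤) (ℕₚ.^-monoʳ-≤ 2 (ℕₚ.≤-trans (ℕₚ.+-monoˡ-≤ (20 ℕ.* K) 7≤K)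
        (ℕₚ.≤-trans (ℕₚ.m≤m+n (K ℕ.+ 20 ℕ.* K) K) (ℕₚ.≤-reflexive (solveℕ 1 (λ K → K ⊞ lit 20 ⊠ K ⊞ K ≐ lit 22 ⊠ K) refl K))))))))

  fromℕ-^ : ∀ a i → fromℕ (a ℕ.^ i) ≈ fromℕ a ^ i
  fromℕ-^ a zero    = fromℕ-1
  fromℕ-^ a (suc i) = ≈-trans (fromℕ-* a (a ℕ.^ i)) (*-congˡ (fromℕ-^ a i))

  ⁻¹-antitone : ∀ {a b} → 0# < a → a ≤ b → b ⁻¹ ≤ a ⁻¹
  ⁻¹-antitone {a} {b} 0<a le = *-cancelˡ-≤ 0<a (≤-trans (mul-mono (<⇒≤ 0<a) le (<⇒≤ (0<⁻¹ 0<b)) ≤-refl) (≤-reflexive (≈-trans (*-inv 0<b) (≈-sym (*-inv 0<a)))))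
    where 0<b = <-≤-trans 0<a le

  -- Here Z = 1/ζ, P = 1/θ, Y = 1/ν = 1/γ₀, and A bounds 1/ε. K = P Z² gives 2ζ²θK = 2. The 12 in Y
  -- is 2·6, as z = 6ν enters `small` twice; 9 and 18 = 2·9 come from `nine`. The factor 400 makes
  -- the error of the values, at most 16Bζ, less than 1/20, and 1280 = 20·8² comes from w = 1/20 and
  -- δ = 1/(8A).
  module _ {n s q A B Z P K Y k m : ℕ} .{{_ : NonZero n}} {ε : ℝ} (1≤A : 1 ℕ.≤ A) (s≤B : s ℕ.≤ B) (q≤B : q ℕ.≤ B) (A≤B : A ℕ.≤ B)
    (Z≡ : Z ≡ 400 ℕ.* B) (P≡ : P ≡ 2 ℕ.^ q) (K≡ : K ≡ P ℕ.* (Z ℕ.* Z)) (Y≡ : Y ≡ 12 ℕ.* 4 ℕ.^ K ℕ.* (Z ℕ.* P))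
    (k≡ : k ≡ 9 ℕ.* (Y ℕ.* Y ℕ.* (Y ℕ.* Y))) (m≡ : m ≡ 18 ℕ.* 4 ℕ.^ k ℕ.* (Y ℕ.* Y))
    (1≤εA : 1# ≤ ε * fromℕ A) (0≤ε : 0# ≤ ε) (n≥ : fromℕ 1280 * (fromℕ B * fromℕ B) ≤ fromℕ n) where

    private
      a = fromℕ A
      b = fromℕ B
      ẑ = fromℕ Z
      p = 2^ q
      y = fromℕ Y
      n̂ = fromℕ n
      F = 4^ K
      1≤a : 1# ≤ a
      1≤a = ≤-respˡ-≈ fromℕ-1 (fromℕ-mono 1≤A)
      a≤b : a ≤ b
      a≤b = fromℕ-mono A≤B
      1≤b = ≤-trans 1≤a a≤b
      0≤b = ≤-trans 0≤1 1≤b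
      Z≈ : ẑ ≈ fromℕ 400 * b
      Z≈ = ≈-trans (≈-reflexive (≡.cong fromℕ Z≡)) (fromℕ-* 400 B)
      P≈ : fromℕ P ≈ p
      P≈ = ≈-trans (≈-reflexive (≡.cong fromℕ P≡)) (fromℕ-^ 2 q)
      K≈ : fromℕ K ≈ p * (ẑ * ẑ)
      K≈ = ≈-trans (≈-reflexive (≡.cong fromℕ K≡)) (≈-trans (fromℕ-* P (Z ℕ.* Z)) (*-cong P≈ (fromℕ-* Z Z)))
      Y≈ : y ≈ fromℕ 12 * F * (ẑ * p)
      Y≈ = ≈-trans (≈-reflexive (≡.cong fromℕ Y≡)) (≈-trans (fromℕ-* (12 ℕ.* 4 ℕ.^ K) (Z ℕ.* P)) (*-cong (≈-trans (fromℕ-* 12 (4 ℕ.^ K)) (*-congˡ (fromℕ-^ 4 K))) (≈-trans (fromℕ-* Z P) (*-congˡ P≈))))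
      k≈ : fromℕ k ≈ fromℕ 9 * (y * y * (y * y))
      k≈ = ≈-trans (≈-reflexive (≡.cong fromℕ k≡)) (≈-trans (fromℕ-* 9 (Y ℕ.* Y ℕ.* (Y ℕ.* Y))) (*-congˡ (≈-trans (fromℕ-* (Y ℕ.* Y) (Y ℕ.* Y)) (*-cong (fromℕ-* Y Y) (fromℕ-* Y Y)))))
      m≈ : fromℕ m ≈ fromℕ 18 * (2^ k * 2^ k) * (y * y)
      m≈ = ≈-trans (≈-reflexive (≡.cong fromℕ m≡)) (≈-trans (fromℕ-* (18 ℕ.* 4 ℕ.^ k) (Y ℕ.* Y)) (*-cong (≈-trans (fromℕ-* 18 (4 ℕ.^ k)) (*-congˡ (≈-trans (fromℕ-^ 4 k) (four k)))) (fromℕ-* Y Y)))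
        where
        four : ∀ k → 4^ k ≈ 2^ k * 2^ k
        four zero    = ≈-sym (*-identityˡ 1#)
        four (suc k) = ≈-trans (*-congˡ (four k)) (solve 1 (λ t → con (+ 4) :* (t :* t) := (con (+ 2) :* t) :* (con (+ 2) :* t)) ≈-refl (2^ k))
      1≤4^ : ∀ j → 1# ≤ 4^ j
      1≤4^ zero    = ≤-refl
      1≤4^ (suc j) = ≤-respˡ-≈ (*-identityˡ 1#) (mul-mono 0≤1 (1≤fromℕ 4) (≤-trans 0≤1 (1≤4^ j)) (1≤4^ j))
      1≤-* : ∀ {x y} → 1# ≤ x → 1# ≤ y → 1# ≤ x * y
      1≤-* p q = ≤-respˡ-≈ (*-identityˡ 1#) (mul-mono 0≤1 p (≤-trans 0≤1 q) q)
      1≤ẑ : 1# ≤ ẑ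
      1≤ẑ = ≤-respʳ-≈ (≈-sym Z≈) (1≤-* (1≤fromℕ 400) 1≤b)
      ẑ≤y : ẑ ≤ y
      ẑ≤y = ≤-respʳ-≈ (≈-sym Y≈) (≤-respˡ-≈ (*-identityˡ ẑ) (mul-mono 0≤1 (1≤-* (1≤fromℕ 12) (1≤4^ K)) (*-nonNeg (≤-trans 0≤1 1≤ẑ) (0≤2^ q))
        (≤-respˡ-≈ (*-identityʳ ẑ) (≤-trans 0≤1 1≤ẑ ⊛ 1≤2^ q))))
      0<ẑ = <-≤-trans 0<1 1≤ẑ
      0<y = <-≤-trans 0<ẑ ẑ≤y
      0<p = <-≤-trans 0<1 (1≤2^ q)
      ζ = ẑ ⁻¹
      θ = p ⁻¹
      ν = y ⁻¹
      iζ : ẑ * ζ ≈ 1#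
      iζ = *-inv 0<ẑ
      iθ : p * θ ≈ 1#
      iθ = *-inv 0<p
      iν : y * ν ≈ 1#
      iν = *-inv 0<y
      0≤ζ = <⇒≤ (0<⁻¹ 0<ẑ)
      0≤θ = <⇒≤ (0<⁻¹ 0<p)
      0≤ν = <⇒≤ (0<⁻¹ 0<y)
      ν≤ζ : ν ≤ ζ
      ν≤ζ = ⁻¹-antitone 0<ẑ ẑ≤y
      w = fromℕ 20 ⁻¹
      iw : fromℕ 20 * w ≈ 1#
      iw = *-inv (0<fromℕ 20)
      0<8a = 0<-* (0<fromℕ 8) (<-≤-trans 0<1 1≤a)
      δ = (fromℕ 8 * a) ⁻¹
      iδ : fromℕ 8 * a * δ ≈ 1#
      iδ = *-inv 0<8a
      0<δ = 0<⁻¹ 0<8a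
      bb≤n : ∀ {c} → c ≤ fromℕ 1280 → 0# ≤ c → c * (b * b) ≤ n̂
      bb≤n h 0≤c = ≤-trans (mul-mono 0≤c h (*-nonNeg 0≤b 0≤b) ≤-refl) n≥
      q≤b : fromℕ q ≤ b
      q≤b = fromℕ-mono q≤B
      400bζ : fromℕ 400 * (b * ζ) ≈ 1#
      400bζ = ≈-trans (≈-sym (*-assoc _ _ _)) (≈-trans (*-congʳ (≈-sym Z≈)) iζ)

      steps : 1# < fromℕ K * (fromℕ 2 * (ζ * ζ * θ))
      steps = <-≤-trans {b = fromℕ 2} (≰⇒< λ le → <⇒≰ 0<1 (lin le (solve 0 (con (+ 1) :- con (+ 2) := con (+ 0) :- con (+ 1)) ≈-refl)))
        (≤-reflexive (≈-sym (≈-trans (*-congʳ K≈) (≈-trans (solve 4 (λ p z ζ θ → p :* (z :* z) :* (con (+ 2) :* (ζ :* ζ :* θ)) := con (+ 2) :* ((z :* ζ) :* (z :* ζ) :* (p :* θ))) ≈-refl p ẑ ζ θ)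
          (≈-trans (*-congˡ (*-cong (*-cong iζ iζ) iθ)) (solve 0 (con (+ 2) :* (con (+ 1) :* con (+ 1) :* con (+ 1)) := con (+ 2)) ≈-refl))))))

      anchors : fromℕ 9 ≤ fromℕ k * ((ν * ν) * (ν * ν))
      anchors = ≤-reflexive (≈-sym (≈-trans (*-congʳ k≈) (≈-trans (solve 3 (λ c y v → c :* (y :* y :* (y :* y)) :* ((v :* v) :* (v :* v)) := c :* ((y :* v) :* (y :* v) :* ((y :* v) :* (y :* v)))) ≈-refl (fromℕ 9) y ν)
        (≈-trans (*-congˡ (*-cong (*-cong iν iν) (*-cong iν iν))) (solve 1 (λ c → c :* (con (+ 1) :* con (+ 1) :* (con (+ 1) :* con (+ 1))) := c) ≈-refl (fromℕ 9))))))

      repeats : 2^ k * (2^ k * fromℕ 2) * fromℕ 9 ≤ fromℕ m * (ν * ν)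
      repeats = ≤-reflexive (≈-sym (≈-trans (*-congʳ m≈) (≈-trans (solve 3 (λ t y v → con (+ 18) :* (t :* t) :* (y :* y) :* (v :* v) := con (+ 18) :* (t :* t) :* ((y :* v) :* (y :* v))) ≈-refl (2^ k) y ν)
        (≈-trans (*-congˡ (*-cong iν iν)) (solve 1 (λ t → con (+ 18) :* (t :* t) :* (con (+ 1) :* con (+ 1)) := t :* (t :* con (+ 2)) :* con (+ 9)) ≈-refl (2^ k))))))

      small : F * ((ν + ν) + ((ν + ν) + (ν + ν))) + F * ((ν + ν) + ((ν + ν) + (ν + ν))) ≤ ζ * θ
      small = ≤-reflexive (begin
        F * ((ν + ν) + ((ν + ν) + (ν + ν))) + F * ((ν + ν) + ((ν + ν) + (ν + ν)))
          ≈⟨ solve 2 (λ F v → F :* ((v :+ v) :+ ((v :+ v) :+ (v :+ v))) :+ F :* ((v :+ v) :+ ((v :+ v) :+ (v :+ v))) := con (+ 12) :* F :* (con (+ 1) :* con (+ 1)) :* v) ≈-refl F ν ⟩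
        fromℕ 12 * F * (1# * 1#) * ν        ≈⟨ *-congʳ (*-congˡ (*-cong (≈-sym iζ) (≈-sym iθ))) ⟩
        fromℕ 12 * F * ((ẑ * ζ) * (p * θ)) * ν ≈⟨ solve 7 (λ c F z ζ p θ v → c :* F :* ((z :* ζ) :* (p :* θ)) :* v := (c :* F :* (z :* p) :* v) :* (ζ :* θ)) ≈-refl (fromℕ 12) F ẑ ζ p θ ν ⟩
        fromℕ 12 * F * (ẑ * p) * ν * (ζ * θ) ≈⟨ *-congʳ (≈-trans (*-congʳ (≈-sym Y≈)) iν) ⟩
        1# * (ζ * θ)                        ≈⟨ *-identityˡ _ ⟩
        ζ * θ                               ∎)
        where open ≈R

      count = fromℕ q * ((ζ + ζ) * (p * θ + (1# + 1#)))

      count≤ : count ≤ fromℕ 6 * (b * ζ)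
      count≤ = ≤-trans (≤-reflexive (≈-trans (*-congˡ (*-congˡ (+-congʳ iθ))) (solve 2 (λ q z → q :* ((z :+ z) :* (con (+ 1) :+ (con (+ 1) :+ con (+ 1)))) := con (+ 6) :* (q :* z)) ≈-refl (fromℕ q) ζ)))
        (0≤fromℕ 6 ⊛ mul-mono (0≤fromℕ q) q≤b 0≤ζ ≤-refl)

      νs≤ : ∀ {x} → 0# ≤ x → x ≤ b → x * (ν + ν) ≤ fromℕ 2 * (b * ζ)
      νs≤ {x} 0≤x h = ≤-trans (mul-mono 0≤x h (0≤-+ 0≤ζ 0≤ζ) (ν≤ζ ⊕ ν≤ζ)) (≤-reflexive (solve 2 (λ b z → b :* (z :+ z) := con (+ 2) :* (b :* z)) ≈-refl b ζ))

      values : (count + (fromℕ s * (ν + ν) + fromℕ q * (ν + ν))) + count ≤ w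
      values = *-cancelˡ-≤ (0<fromℕ 20) (≤-trans (0≤fromℕ 20 ⊛ ((count≤ ⊕ (νs≤ (0≤fromℕ s) (fromℕ-mono s≤B) ⊕ νs≤ (0≤fromℕ q) q≤b)) ⊕ count≤))
        (≤-trans (lin (*-nonNeg (0≤fromℕ 80) (*-nonNeg 0≤b 0≤ζ)) (solve 1 (λ x → con (+ 80) :* x :- con (+ 0) := con (+ 400) :* x :- con (+ 20) :* ((con (+ 6) :* x :+ (con (+ 2) :* x :+ con (+ 2) :* x)) :+ con (+ 6) :* x)) ≈-refl (b * ζ)))
          (≤-reflexive (≈-trans 400bζ (≈-sym iw)))))

      collision : fromℕ q * (fromℕ q * n̂ ⁻¹) ≤ w
      collision = *-cancelˡ-≤ (0<-* (0<fromℕ 20) (0<fromℕ n)) (≤-trans (≤-reflexive (≈-trans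
          (solve 4 (λ c n q i → c :* n :* (q :* (q :* i)) := (n :* i) :* (c :* (q :* q))) ≈-refl (fromℕ 20) n̂ (fromℕ q) (n̂ ⁻¹)) (≈-trans (*-congʳ (*-inv (0<fromℕ n))) (*-identityˡ _))))
        (≤-trans (0≤fromℕ 20 ⊛ mul-mono (0≤fromℕ q) q≤b 0≤b q≤b) (≤-trans (bb≤n (fromℕ-mono (ℕₚ.m≤m+n 20 1260)) (0≤fromℕ 20))
          (≤-reflexive (≈-sym (≈-trans (solve 3 (λ c n w → c :* n :* w := (c :* w) :* n) ≈-refl (fromℕ 20) n̂ w) (≈-trans (*-congʳ iw) (*-identityˡ n̂))))))))

      q≤n : fromℕ q ≤ n̂
      q≤n = ≤-trans q≤b (≤-trans (≤-respˡ-≈ (*-identityʳ b) (≤-respʳ-≈ (≈-sym (*-identityˡ _)) (0≤b ⊛ 1≤b))) (bb≤n (1≤fromℕ 1280) 0≤1))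

      deviation : 1# ≤ w * (n̂ * (δ * δ))
      deviation = ≤-trans (≤-reflexive (≈-sym (≈-trans (solve 4 (λ w c a d → w :* (c :* ((con (+ 8) :* a) :* (con (+ 8) :* a)) :* (d :* d)) := (c :* w) :* ((con (+ 8) :* a :* d) :* (con (+ 8) :* a :* d))) ≈-refl w (fromℕ 20) a δ)
          (≈-trans (*-cong iw (*-cong iδ iδ)) (solve 0 (con (+ 1) :* (con (+ 1) :* con (+ 1)) := con (+ 1)) ≈-refl)))))
        (<⇒≤ (0<⁻¹ (0<fromℕ 20)) ⊛ mul-mono (*-nonNeg (0≤fromℕ 20) (0≤x² (fromℕ 8 * a))) enough (0≤x² δ) ≤-refl)
        where
        enough : fromℕ 20 * (fromℕ 8 * a * (fromℕ 8 * a)) ≤ n̂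
        enough = ≤-trans (≤-reflexive (solve 1 (λ a → con (+ 20) :* ((con (+ 8) :* a) :* (con (+ 8) :* a)) := con (+ 1280) :* (a :* a)) ≈-refl a))
          (≤-trans (0≤fromℕ 1280 ⊛ mul-mono (≤-trans 0≤1 1≤a) a≤b 0≤b a≤b) n≥)

      8ζ≤δ : fromℕ 8 * ζ ≤ δ
      8ζ≤δ = *-cancelˡ-≤ 0<8a (≤-trans (≤-trans (≤-reflexive (solve 2 (λ a z → con (+ 8) :* a :* (con (+ 8) :* z) := con (+ 64) :* (a :* z)) ≈-refl a ζ))
        (≤-trans (mul-mono (0≤fromℕ 64) (fromℕ-mono (ℕₚ.m≤m+n 64 336)) (*-nonNeg 0≤b 0≤ζ) (mul-mono (≤-trans 0≤1 1≤a) a≤b 0≤ζ ≤-refl)) (≤-reflexive 400bζ))) (≤-reflexive (≈-sym iδ)))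

      θ≤1 : θ ≤ 1#
      θ≤1 = *-cancelˡ-≤ 0<p (≤-trans (≤-reflexive iθ) (≤-respʳ-≈ (≈-sym (*-identityʳ p)) (1≤2^ q)))

      slack : (ζ * θ + (((ν + ν) + (ν + ν)) + (ζ * θ + ζ * (θ + 1#)))) + δ + fromℕ 2 ⁻¹ * ε ≤ ε
      slack = ≤-trans (≤-trans ((terms ⊕ ≤-refl) ⊕ ≤-refl) (≤-trans ((≤-trans 8ζ≤δ ≤-refl ⊕ ≤-refl) ⊕ ≤-refl) (2δ ⊕ ≤-refl))) (≤-reflexive half)
        where
        h = fromℕ 2 ⁻¹
        half : h * ε + h * ε ≈ ε
        half = ≈-trans (solve 2 (λ h e → h :* e :+ h :* e := (con (+ 2) :* h) :* e) ≈-refl h ε) (≈-trans (*-congʳ (*-inv (0<fromℕ 2))) (*-identityˡ ε))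
        ζθ≤ζ : ζ * θ ≤ ζ
        ζθ≤ζ = ≤-respʳ-≈ (*-identityʳ ζ) (0≤ζ ⊛ θ≤1)
        terms : ζ * θ + (((ν + ν) + (ν + ν)) + (ζ * θ + ζ * (θ + 1#))) ≤ fromℕ 8 * ζ
        terms = ≤-trans (ζθ≤ζ ⊕ (((ν≤ζ ⊕ ν≤ζ) ⊕ (ν≤ζ ⊕ ν≤ζ)) ⊕ (ζθ≤ζ ⊕ 0≤ζ ⊛ (θ≤1 ⊕ ≤-refl))))
          (≤-reflexive (solve 1 (λ z → z :+ (((z :+ z) :+ (z :+ z)) :+ (z :+ z :* (con (+ 1) :+ con (+ 1)))) := con (+ 8) :* z) ≈-refl ζ))
        2δ : δ + δ ≤ h * ε
        2δ = *-cancelˡ-≤ (0<fromℕ 4) (≤-trans (≤-reflexive (solve 1 (λ d → con (+ 4) :* (d :+ d) := con (+ 8) :* d :* con (+ 1)) ≈-refl δ))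
          (≤-trans (*-nonNeg (0≤fromℕ 8) (<⇒≤ 0<δ) ⊛ 1≤εA) (≤-trans (≤-reflexive (≈-trans (solve 3 (λ d e a → con (+ 8) :* d :* (e :* a) := (con (+ 8) :* a :* d) :* e) ≈-refl δ ε a)
            (≈-trans (*-congʳ iδ) (≈-trans (*-identityˡ ε) (≈-sym half))))) (lin (0≤-+ 0≤hε 0≤hε) (solve 1 (λ x → x :+ x :- con (+ 0) := con (+ 4) :* x :- (x :+ x)) ≈-refl (h * ε))))))
          where 0≤hε = *-nonNeg (<⇒≤ (0<⁻¹ (0<fromℕ 2))) 0≤ε

    numbers : Numbers n s q ε (fromℕ 2 ⁻¹ * ε)
    numbers = record
      { K = K ; k = k ; m = m ; ζ = ζ ; θ = θ ; ν = ν ; γ₀ = ν ; δ = δ ; w = w ; 0≤ζ = 0≤ζ ; 0≤θ = 0≤θ ; 0≤ν = 0≤ν ; 0≤γ₀ = 0≤ν ; 0<δ = 0<δ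
      ; 0<k = <-≤-trans (0<-* (0<fromℕ 9) (0<-* (0<-* 0<y 0<y) (0<-* 0<y 0<y))) (≤-reflexive (≈-sym k≈))
      ; m≢0 = nonzero m (<-≤-trans (0<-* (0<-* (0<fromℕ 18) (0<-* (<-≤-trans 0<1 (1≤2^ k)) (<-≤-trans 0<1 (1≤2^ k)))) (0<-* 0<y 0<y)) (≤-reflexive (≈-sym m≈)))
      ; steps = steps ; anchors = anchors ; repeats = repeats ; small = small ; values = values ; collision = collision ; q≤n = q≤n
      ; deviation = deviation ; w≈ = iw ; slack = slack }
      where
      nonzero : ∀ m → 0# < fromℕ m → NonZero m
      nonzero zero p    = ⊥-elim (<⇒≰ p ≤-refl)
      nonzero (suc m) p = _

  ceiling : ∀ x → ∃ λ A → x ≤ fromℕ A × (fromℕ A ≤ x + 1# ⊎ A ≡ 0)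
  ceiling x = let (n , le) = archimedean x in descend n le
    where
    descend : ∀ n → x ≤ fromℕ n → ∃ λ A → x ≤ fromℕ A × (fromℕ A ≤ x + 1# ⊎ A ≡ 0)
    descend zero le    = 0 , le , inj₂ refl
    descend (suc n) le with ≤-or-< x (fromℕ n)
    ... | inj₁ p = descend n p
    ... | inj₂ p = suc n , le , inj₁ (≤-trans (≤-refl ⊕ <⇒≤ p) (≤-reflexive (+-comm 1# x)))

  q≤2^q : ∀ q → fromℕ q ≤ 2^ q
  q≤2^q q = ≤-trans (fromℕ-mono (n≤2^n q)) (≤-reflexive (fromℕ-^ 2 q))

  -- `exp-≥-2^` needs twice the exponent 22K + 1, which is at most 23K; hence 46. The square of 400
  -- enters through Z², and 184 = 4·46 pays for `four-squares`.
  constant : ℝ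
  constant = fromℕ 184 * (fromℕ 400 * fromℕ 400)

  polynomial : Polynomial 3
  polynomial = (constant , 2 ∷ 0 ∷ 0 ∷ []) ∷ (constant , 0 ∷ 2 ∷ 0 ∷ []) ∷ (constant , 0 ∷ 0 ∷ 2 ∷ []) ∷ (constant , 0 ∷ 0 ∷ 0 ∷ []) ∷ []

  eval-polynomial : ∀ u v w → eval polynomial (u ∷ v ∷ w ∷ []) ≈ constant * (u * u + v * v + w * w + 1#)
  eval-polynomial u v w = go constant
    where
    go : ∀ c → c * (u * (u * 1#) * (1# * (1# * 1#))) + (c * (1# * (v * (v * 1#) * (1# * 1#))) + (c * (1# * (1# * (w * (w * 1#) * 1#))) + (c * (1# * (1# * (1# * 1#))) + 0#)))
               ≈ c * (u * u + v * v + w * w + 1#)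
    go c = solve 4 (λ c u v w → c :* (u :* (u :* con (+ 1)) :* (con (+ 1) :* (con (+ 1) :* con (+ 1)))) :+ (c :* (con (+ 1) :* (v :* (v :* con (+ 1)) :* (con (+ 1) :* con (+ 1))))
         :+ (c :* (con (+ 1) :* (con (+ 1) :* (w :* (w :* con (+ 1)) :* con (+ 1)))) :+ (c :* (con (+ 1) :* (con (+ 1) :* (con (+ 1) :* con (+ 1)))) :+ con (+ 0))))
      := c :* (u :* u :+ v :* v :+ w :* w :+ con (+ 1))) ≈-refl c u v w

  four-squares : ∀ u v w → (u + v + w + 1#) * (u + v + w + 1#) ≤ fromℕ 4 * (u * u + v * v + w * w + 1#)
  four-squares u v w = lin (0≤x² (u - v) ⊕ (0≤x² (u - w) ⊕ (0≤x² (u - 1#) ⊕ (0≤x² (v - w) ⊕ (0≤x² (v - 1#) ⊕ 0≤x² (w - 1#))))))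
    (solve 3 (λ u v w → ((u :- v) :* (u :- v) :+ ((u :- w) :* (u :- w) :+ ((u :- con (+ 1)) :* (u :- con (+ 1)) :+ ((v :- w) :* (v :- w) :+ ((v :- con (+ 1)) :* (v :- con (+ 1)) :+ (w :- con (+ 1)) :* (w :- con (+ 1)))))))
        :- (con (+ 0) :+ (con (+ 0) :+ (con (+ 0) :+ (con (+ 0) :+ (con (+ 0) :+ con (+ 0))))))
      := con (+ 4) :* (u :* u :+ v :* v :+ w :* w :+ con (+ 1)) :- (u :+ v :+ w :+ con (+ 1)) :* (u :+ v :+ w :+ con (+ 1))) ≈-refl u v w)

  eval-lower : ∀ {b} u v w → 0# ≤ b → b ≤ u + v + w + 1# → fromℕ 46 * ((fromℕ 400 * b) * (fromℕ 400 * b)) ≤ eval polynomial (u ∷ v ∷ w ∷ [])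
  eval-lower {b} u v w 0≤b le = ≤-trans (≤-reflexive (solve 2 (λ b l → con (+ 46) :* ((l :* b) :* (l :* b)) := con (+ 46) :* (l :* l) :* (b :* b)) ≈-refl b (fromℕ 400)))
    (≤-trans (*-nonNeg (0≤fromℕ 46) (*-nonNeg (0≤fromℕ 400) (0≤fromℕ 400)) ⊛ ≤-trans (mul-mono 0≤b le (≤-trans 0≤b le) le) (four-squares u v w))
      (≤-reflexive (≈-trans (solve 2 (λ l x → con (+ 46) :* (l :* l) :* (con (+ 4) :* x) := con (+ 184) :* (l :* l) :* x) ≈-refl (fromℕ 400) (u * u + v * v + w * w + 1#)) (≈-sym (eval-polynomial u v w)))))

  module _ (𝒫 : Property) (invariant : IndexInvariant 𝒫) (ε : ℝ) (0<ε : 0# < ε) (ε<1 : ε < 1#) {n : ℕ} .{{_ : NonZero n}} (s q : ℕ)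
    (t : Algorithm n Bool 0) (tester : IsTester 𝒫 (fromℕ 2 ⁻¹ * ε) n t) (ls : samples t ℕ.≤ s) (lq : queries t ℕ.≤ q)
    (N : ℝ) (large : IsExp₂ (eval polynomial (2^ q ∷ fromℕ s ∷ ε ⁻¹ ∷ [])) N) (N≤n : N ≤ fromℕ n) where

    Goal : Set
    Goal = ∃ λ (t : Algorithm n ℝ 0) → IsEstimator 𝒫 ε n t × ∃ λ (y : ℝ) → ∃ λ (z : ℝ) →
      IsExp (2^ q * eval polynomial (fromℕ s ∷ fromℕ q ∷ ε ⁻¹ ∷ [])) y × IsExp y z × fromℕ (queries t) ≤ z

    -- The parameters are abstract here, so that they are never evaluated.
    withParameters : ∀ A B Z P K Y k m → ε ⁻¹ ≤ fromℕ A → fromℕ A ≤ ε ⁻¹ + 1# → 1 ℕ.≤ A → B ≡ s ℕ.+ q ℕ.+ A → Z ≡ 400 ℕ.* B → P ≡ 2 ℕ.^ q → K ≡ P ℕ.* (Z ℕ.* Z) →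
      Y ≡ 12 ℕ.* 4 ℕ.^ K ℕ.* (Z ℕ.* P) → k ≡ 9 ℕ.* (Y ℕ.* Y ℕ.* (Y ℕ.* Y)) → m ≡ 18 ℕ.* 4 ℕ.^ k ℕ.* (Y ℕ.* Y) → Goal
    withParameters A B Z P K Y k m A≥ A≤ 1≤A B≡ Z≡ P≡ K≡ Y≡ k≡ m≡ =
      Sampling.estimator k m (Estimation.guess 𝒫 invariant nums t tester ls lq) , Estimation.isEstimator 𝒫 invariant nums t tester ls lq ,
      y , z , proj₁ (proj₂ ey) , proj₁ (proj₂ ez) , bounded
      where
      b = fromℕ B
      0≤b = 0≤fromℕ B
      b≈ : b ≈ fromℕ s + fromℕ q + fromℕ A
      b≈ = ≈-trans (≈-reflexive (≡.cong fromℕ B≡)) (≈-trans (fromℕ-+ (s ℕ.+ q) A) (+-congʳ (fromℕ-+ s q)))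
      b≤₁ : b ≤ 2^ q + fromℕ s + ε ⁻¹ + 1#
      b≤₁ = ≤-trans (≤-reflexive b≈) (≤-trans ((≤-refl ⊕ q≤2^q q) ⊕ A≤) (≤-reflexive (solve 3 (λ s q e → s :+ q :+ (e :+ con (+ 1)) := q :+ s :+ e :+ con (+ 1)) ≈-refl (fromℕ s) (2^ q) (ε ⁻¹))))
      b≤₂ : b ≤ fromℕ s + fromℕ q + ε ⁻¹ + 1#
      b≤₂ = ≤-trans (≤-reflexive b≈) (≤-trans (≤-refl ⊕ A≤) (≤-reflexive (≈-sym (+-assoc _ _ _))))
      b² = (fromℕ 400 * b) * (fromℕ 400 * b)
      0≤b² = 0≤x² (fromℕ 400 * b)
      n≥ : fromℕ 1280 * (b * b) ≤ fromℕ n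
      n≥ = *-cancelˡ-≤ (0<fromℕ 2) (≤-trans enough (≤-trans (≤-trans (eval-lower (2^ q) (fromℕ s) (ε ⁻¹) 0≤b b≤₁) (exp₂-≥ (≤-trans (*-nonNeg (0≤fromℕ 46) 0≤b²) (eval-lower (2^ q) (fromℕ s) (ε ⁻¹) 0≤b b≤₁)) large))
        (≤-trans (N≤n ⊕ N≤n) (≤-reflexive (solve 1 (λ n → n :+ n := con (+ 2) :* n) ≈-refl (fromℕ n))))))
        where
        enough : fromℕ 2 * (fromℕ 1280 * (b * b)) ≤ fromℕ 46 * b²
        enough = ≤-trans (≤-reflexive (solve 1 (λ b → con (+ 2) :* (con (+ 1280) :* (b :* b)) := con (+ 16) :* (con (+ 160) :* (b :* b))) ≈-refl b))
          (mul-mono (0≤fromℕ 16) (fromℕ-mono (ℕₚ.m≤m+n 16 30)) 0≤b² (≤-trans (mul-mono (0≤fromℕ 160) (≤-trans (fromℕ-mono (ℕₚ.m≤m+n 160 240)) (≤-respˡ-≈ (*-identityʳ _) (0≤fromℕ 400 ⊛ 1≤fromℕ 400))) (*-nonNeg 0≤b 0≤b) ≤-refl)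
            (≤-reflexive (solve 2 (λ l b → (l :* l) :* (b :* b) := (l :* b) :* (l :* b)) ≈-refl (fromℕ 400) b))))
      le-B : ∀ {x} → x ℕ.≤ s ℕ.+ q ℕ.+ A → x ℕ.≤ B
      le-B h = ℕₚ.≤-trans h (ℕₚ.≤-reflexive (≡.sym B≡))
      nums : Numbers n s q ε (fromℕ 2 ⁻¹ * ε)
      nums = numbers {n = n} {s} {q} {A} {B} {Z} {P} {K} {Y} {k} {m} {ε} 1≤A
        (le-B (ℕₚ.≤-trans (ℕₚ.m≤m+n s q) (ℕₚ.m≤m+n (s ℕ.+ q) A))) (le-B (ℕₚ.≤-trans (ℕₚ.m≤n+m q s) (ℕₚ.m≤m+n (s ℕ.+ q) A))) (le-B (ℕₚ.m≤n+m A (s ℕ.+ q)))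
        Z≡ P≡ K≡ Y≡ k≡ m≡ (≤-trans (≤-reflexive (≈-sym (*-inv 0<ε))) (<⇒≤ 0<ε ⊛ A≥)) (<⇒≤ 0<ε) n≥
      1≤B = ℕₚ.≤-trans 1≤A (le-B (ℕₚ.m≤n+m A (s ℕ.+ q)))
      400≤Z : 400 ℕ.≤ Z
      400≤Z = ℕₚ.≤-trans (ℕₚ.≤-reflexive (≡.sym (ℕₚ.*-identityʳ 400))) (ℕₚ.≤-trans (ℕₚ.*-monoʳ-≤ 400 1≤B) (ℕₚ.≤-reflexive (≡.sym Z≡)))
      1≤Z = ℕₚ.≤-trans (ℕₚ.m≤m+n 1 399) 400≤Z
      1≤P : 1 ℕ.≤ P
      1≤P = ℕₚ.≤-trans (ℕₚ.^-monoʳ-≤ 2 {0} {q} z≤n) (ℕₚ.≤-reflexive (≡.sym P≡))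
      widen : ∀ {x y} → 1 ℕ.≤ y → x ℕ.≤ x ℕ.* y
      widen {x} {y} h = ℕₚ.≤-trans (ℕₚ.≤-reflexive (≡.sym (ℕₚ.*-identityʳ x))) (ℕₚ.*-monoʳ-≤ x h)
      P≤K : P ℕ.≤ K
      P≤K = ℕₚ.≤-trans (widen (ℕₚ.*-mono-≤ 1≤Z 1≤Z)) (ℕₚ.≤-reflexive (≡.sym K≡))
      Z≤K : Z ℕ.≤ K
      Z≤K = ℕₚ.≤-trans (ℕₚ.≤-trans (widen 1≤Z) (ℕₚ.≤-trans (widen 1≤P) (ℕₚ.≤-reflexive (ℕₚ.*-comm (Z ℕ.* Z) P)))) (ℕₚ.≤-reflexive (≡.sym K≡))
      7≤K = ℕₚ.≤-trans (ℕₚ.m≤m+n 7 393) (ℕₚ.≤-trans 400≤Z Z≤K)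
      1≤Y : 1 ℕ.≤ Y
      1≤Y = ℕₚ.≤-trans (ℕₚ.*-mono-≤ (ℕₚ.*-mono-≤ (ℕₚ.m≤m+n 1 11) (ℕₚ.^-monoʳ-≤ 4 {0} {K} z≤n)) (ℕₚ.*-mono-≤ 1≤Z 1≤P)) (ℕₚ.≤-reflexive (≡.sym Y≡))
      K≈ : fromℕ K ≈ 2^ q * b²
      K≈ = ≈-trans (≈-reflexive (≡.cong fromℕ K≡)) (≈-trans (fromℕ-* P (Z ℕ.* Z)) (*-cong (≈-trans (≈-reflexive (≡.cong fromℕ P≡)) (fromℕ-^ 2 q))
        (≈-trans (fromℕ-* Z Z) (*-cong Z≈ Z≈))))
        where Z≈ = ≈-trans (≈-reflexive (≡.cong fromℕ Z≡)) (fromℕ-* 400 B)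
      X = 2^ q * eval polynomial (fromℕ s ∷ fromℕ q ∷ ε ⁻¹ ∷ [])
      X≥ : fromℕ 46 * fromℕ K ≤ X
      X≥ = ≤-trans (≤-reflexive (≈-trans (*-congˡ K≈) (solve 3 (λ c p b → c :* (p :* b) := p :* (c :* b)) ≈-refl (fromℕ 46) (2^ q) b²)))
        (0≤2^ q ⊛ eval-lower (fromℕ s) (fromℕ q) (ε ⁻¹) 0≤b b≤₂)
      ey = exp-exists (≤-trans (*-nonNeg (0≤fromℕ 46) (0≤fromℕ K)) X≥)
      y = proj₁ ey
      ez = exp-exists (proj₂ (proj₂ ey))
      z = proj₁ ez
      L = 22 ℕ.* K
      y≥ : 2^ (suc L) ≤ y
      y≥ = exp-≥-2^ (suc L) (≤-trans (≤-trans (0≤fromℕ 2 ⊛ fromℕ-mono suc-L≤) (≤-reflexive (≈-trans (*-congˡ (fromℕ-* 23 K)) (solve 1 (λ k → con (+ 2) :* (con (+ 23) :* k) := con (+ 46) :* k) ≈-refl (fromℕ K))))) X≥) (proj₁ (proj₂ ey))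
        where
        suc-L≤ : suc L ℕ.≤ 23 ℕ.* K
        suc-L≤ = ℕₚ.+-monoˡ-≤ L (ℕₚ.≤-trans (ℕₚ.m≤m+n 1 6) 7≤K)
      z≥ : 2^ (2 ℕ.^ L) ≤ z
      z≥ = exp-≥-2^ (2 ℕ.^ L) (≤-trans (≤-reflexive (*-congˡ (fromℕ-^ 2 L))) y≥) (proj₁ (proj₂ ez))
      bounded : fromℕ (queries (Sampling.estimator {n} {O = ℝ} k m (Estimation.guess 𝒫 invariant nums t tester ls lq))) ≤ z
      bounded = ≤-trans (fromℕ-mono (ℕₚ.≤-trans (Sampling.estimator-queries k m (Estimation.guess 𝒫 invariant nums t tester ls lq)) (query-bound Z≤K P≤K 7≤K 1≤Y Y≡ k≡ m≡)))
        (≤-trans (≤-reflexive (fromℕ-^ 2 (2 ℕ.^ L))) z≥)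

    estimation : Goal
    estimation = go (ceiling (ε ⁻¹))
      where
      1≤ε⁻¹ : 1# ≤ ε ⁻¹
      1≤ε⁻¹ = *-cancelˡ-≤ 0<ε (≤-trans (≤-reflexive (*-identityʳ ε)) (≤-trans (<⇒≤ ε<1) (≤-reflexive (≈-sym (*-inv 0<ε)))))
      positive-A : ∀ A → 1# ≤ fromℕ A → 1 ℕ.≤ A
      positive-A zero le    = ⊥-elim (<⇒≰ 0<1 le)
      positive-A (suc A) le = s≤s z≤n
      go : (∃ λ A → ε ⁻¹ ≤ fromℕ A × (fromℕ A ≤ ε ⁻¹ + 1# ⊎ A ≡ 0)) → Goal
      go (A , A≥ , inj₂ refl) = ⊥-elim (<⇒≰ 0<1 (≤-trans 1≤ε⁻¹ A≥))
      go (A , A≥ , inj₁ A≤)   = withParameters A _ _ _ _ _ _ _ A≥ A≤ (positive-A A (≤-trans 1≤ε⁻¹ A≥)) refl refl refl refl refl refl refl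

  1/2 : ℝ
  1/2 = fromℕ 2 ⁻¹

  -- The choice c = 1/2 leaves half of ε to the tester's own tolerance and the other half to the
  -- excess cost of the lifted distribution and its deviation δ.
  main : ∃ λ (c : ℝ) → 0# < c × ∃ λ (p : Polynomial 3) →
    ∀ (𝒫 : Property) → IndexInvariant 𝒫 → ∀ (s q : ℝ → ℕ) → Testable 𝒫 s q → ∀ (ε : ℝ) → 0# < ε → ε < 1# →
    ∀ (n : ℕ) → .{{_ : NonZero n}} → ∀ (N : ℝ) → IsExp₂ (eval p (2^ (q (c * ε)) ∷ fromℕ (s (c * ε)) ∷ ε ⁻¹ ∷ [])) N → N ≤ fromℕ n →
    ∃ λ (t : Algorithm n ℝ 0) → IsEstimator 𝒫 ε n t × ∃ λ (y : ℝ) → ∃ λ (z : ℝ) →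
    IsExp (2^ (q (c * ε)) * eval p (fromℕ (s (c * ε)) ∷ fromℕ (q (c * ε)) ∷ ε ⁻¹ ∷ [])) y × IsExp y z × fromℕ (queries t) ≤ z
  main = 1/2 , 0<⁻¹ (0<fromℕ 2) , polynomial , λ 𝒫 invariant s q testable ε 0<ε ε<1 n N large N≤n →
    let (t , tester , ls , lq) = testable (1/2 * ε) (0<-* (0<⁻¹ (0<fromℕ 2)) 0<ε) (half<1 0<ε ε<1) n
    in estimation 𝒫 invariant ε 0<ε ε<1 (s (1/2 * ε)) (q (1/2 * ε)) t tester ls lq N large N≤n
    where
    half<1 : ∀ {ε} → 0# < ε → ε < 1# → 1/2 * ε < 1#
    half<1 {ε} 0<ε ε<1 = ≤-<-trans (*-cancelˡ-≤ (0<fromℕ 2) (≤-trans (≤-reflexive (≈-trans (≈-sym (*-assoc _ _ _)) (*-congʳ (*-inv (0<fromℕ 2)))))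
      (lin (<⇒≤ 0<ε) (solve 1 (λ e → e :- con (+ 0) := con (+ 2) :* e :- con (+ 1) :* e) ≈-refl ε)))) ε<1

theorem5p1 : ExcludedMiddle 0ℓ → (R : CompleteOrderedField) →
  let open HugeObject R in
  ∃ λ (c : ℝ) → 0# < c × ∃ λ (p : Polynomial 3) →
    ∀ (𝒫 : Property) → IndexInvariant 𝒫 →
    ∀ (s q : ℝ → ℕ) → Testable 𝒫 s q →
    ∀ (ε : ℝ) → 0# < ε → ε < 1# →
    let s′ = fromℕ (s (c * ε))
        q′ = fromℕ (q (c * ε))
        2^q = fromℕ 2 ^ q (c * ε)
    in
    ∀ (n : ℕ) → .{{_ : NonZero n}} →
    ∀ (N : ℝ) → IsExp₂ (eval p (2^q ∷ s′ ∷ ε ⁻¹ ∷ [])) N → N ≤ fromℕ n →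
    ∃ λ (t : Algorithm n ℝ 0) →
      IsEstimator 𝒫 ε n t ×
      ∃ λ (y : ℝ) → ∃ λ (z : ℝ) →
        IsExp (2^q * eval p (s′ ∷ q′ ∷ ε ⁻¹ ∷ [])) y × IsExp y z ×
        fromℕ (queries t) ≤ z
theorem5p1 em R = Proof.main em R
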